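{- There exists a Monte Carlo algorithm which solves Binary Linear Programming instances on $n$ variables with maximum absolute integer value $m$ and $d$ constraints in polynomial space and time $O^*\big(2^{0.86n}(\log(mn)\,n)^{O(d)}\big)$. The algorithm assumes random read-only access to exponentially many random bits.
   Context: Binary Linear Programming: given $v,a^1,\ldots,a^d\in\mathbb{Z}^n$ and $u_1,\ldots,u_d\in\mathbb{Z}$, minimize $\langle v,x\rangle$ over all $x\in\{0,1\}^n$ subject to $\langle a^j,x\rangle\le u_j$ for $j=1,\ldots,d$. The maximum absolute integer value $m$ of an instance is the maximum absolute value of the integers in the input. The notation $O^*(\cdot)$ suppresses factors polynomial in the input size; "polynomial space" means working memory polynomial in the input size. A Monte Carlo algorithm is a randomized algorithm with no false positives and with false negatives occurring only with (at most some) constant probability (smaller than 1); for an optimization problem this refers to its decision version, asking whether there is a feasible solution whose objective value is at most a given bound. Random read-only access to random bits means that there is a read-only string of independent uniform random bits (here of length exponential in the input size, not counted in the working memory), any position of which can be read in constant time. -}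

module Defs where

open import Data.Bool using (Bool; true; false; if_then_else_)
open import Data.Fin using (Fin)
open import Data.Integer as ℤ using (ℤ; +_; -[1+_]; ∣_∣; 0ℤ; 1ℤ)
open import Data.List as List using (List; []; _∷_; _++_; [_])
open import Data.Maybe using (Maybe; just; nothing)
open import Data.Nat
open import Data.Nat.DivMod using (_/_)
open import Data.Nat.ListAction using (sum)
open import Data.Nat.Logarithm using (⌈log₂_⌉)
open import Data.Nat.Properties using (m^n≢0)
open import Data.Product using (∃; _×_)
open import Data.Rational as ℚ using (ℚ)
open import Data.Vec as Vec using (Vec; []; _∷_; _[_]≔_)

record BLP (n d : ℕ) : Set where
  field
    v : Vec ℤ n
    a : Vec (Vec ℤ n) d
    u : Vec ℤ d

open BLP public

⟨_,_⟩ : ∀ {n} → Vec ℤ n → Vec ℤ n → ℤ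
⟨ []     , []     ⟩ = 0ℤ
⟨ y ∷ ys , z ∷ zs ⟩ = y ℤ.* z ℤ.+ ⟨ ys , zs ⟩

0/1 : ∀ {n} → Vec Bool n → Vec ℤ n
0/1 = Vec.map (if_then 1ℤ else 0ℤ)

Feasible : ∀ {n d} → BLP n d → Vec Bool n → Set
Feasible I x = ∀ j → ⟨ Vec.lookup (a I) j , 0/1 x ⟩ ℤ.≤ Vec.lookup (u I) j

-- The decision version of the minimisation problem.
HasSolution : ∀ {n d} → BLP n d → ℤ → Set
HasSolution I bound = ∃ λ x → Feasible I x × ⟨ v I , 0/1 x ⟩ ℤ.≤ bound

entries : ∀ {n d} → BLP n d → List ℤ
entries I = Vec.toList (v I) ++ Vec.toList (Vec.concat (a I)) ++ Vec.toList (u I)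

-- The bound of the decision version is not part of the optimisation
-- instance, so it does not contribute here.
maxAbs : ∀ {n d} → BLP n d → ℕ
maxAbs I = List.foldr _⊔_ 0 (List.map ∣_∣ (entries I))

encodeℤ : ℤ → List ℕ
encodeℤ (+ k)    = 0 ∷ k ∷ []
encodeℤ -[1+ k ] = 1 ∷ suc k ∷ []

encode : ∀ {n d} → BLP n d → ℤ → List ℕ
encode {n} {d} I bound = n ∷ d ∷ List.concatMap encodeℤ (entries I ++ [ bound ])

-- ⌈log₂ (1 + x)⌉ is the number of binary digits of x; the extra unit per
-- cell makes zeros and the number of cells count as well.
bits : List ℕ → ℕ
bits xs = sum (List.map (λ x → 1 + ⌈log₂ suc x ⌉) xs)

inputSize : ∀ {n d} → BLP n d → ℤ → ℕ
inputSize I bound = bits (encode I bound)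

-- Instructions of a random access machine with a read-only random string.
-- Every instruction takes one time step.  Cells hold arbitrary naturals, but
-- space is counted in bits, so within polynomial space every step acts on
-- numbers of polynomially many bits and unit cost agrees with bit cost up to
-- a polynomial factor.

data Op : Set where
  add monus mul div : Op

data Instr (k : ℕ) : Set where
  set    : (r : Fin k) (c : ℕ) → Instr k          -- r := c
  arith  : (o : Op) (r p q : Fin k) → Instr k     -- r := p o q
  load   : (r p : Fin k) → Instr k                -- r := mem[p]
  store  : (p q : Fin k) → Instr k                -- mem[p] := q
  random : (r p : Fin k) → Instr k                -- r := p-th random bit
  jz     : (r : Fin k) (target : ℕ) → Instr k     -- if r = 0 goto target
  accept : Instr k
  reject : Instr k

Program : ℕ → Set
Program k = List (Instr k)

record State (k : ℕ) : Set where
  constructor state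
  field
    pc   : ℕ
    regs : Vec ℕ k
    mem  : List ℕ

nth : ∀ {A : Set} → A → List A → ℕ → A
nth default []       _       = default
nth default (x ∷ _)  zero    = x
nth default (_ ∷ xs) (suc i) = nth default xs i

-- Writing past the end pads with zeros, so addresses count towards space.
write : List ℕ → ℕ → ℕ → List ℕ
write []       zero    y = y ∷ []
write []       (suc i) y = 0 ∷ write [] i y
write (_ ∷ xs) zero    y = y ∷ xs
write (x ∷ xs) (suc i) y = x ∷ write xs i y

⟦_⟧ : Op → ℕ → ℕ → ℕ
⟦ add   ⟧ x y       = x + y
⟦ monus ⟧ x y       = x ∸ y
⟦ mul   ⟧ x y       = x * y
⟦ div   ⟧ x zero    = 0
⟦ div   ⟧ x (suc y) = x / suc y

fetch : ∀ {k} → Program k → ℕ → Instr k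
fetch = nth reject

exec : ∀ {k L} → Vec Bool L → Instr k → State k → State k
exec ω (set r c)       (state i R M) = state (suc i) (R [ r ]≔ c) M
exec ω (arith o r p q) (state i R M) =
  state (suc i) (R [ r ]≔ ⟦ o ⟧ (Vec.lookup R p) (Vec.lookup R q)) M
exec ω (load r p)      (state i R M) =
  state (suc i) (R [ r ]≔ nth 0 M (Vec.lookup R p)) M
exec ω (store p q)     (state i R M) =
  state (suc i) R (write M (Vec.lookup R p) (Vec.lookup R q))
exec ω (random r p)    (state i R M) =
  state (suc i)
        (R [ r ]≔ (if nth false (Vec.toList ω) (Vec.lookup R p) then 1 else 0)) M
exec ω (jz r target)   (state i R M) with Vec.lookup R r
... | zero  = state target R M
... | suc _ = state (suc i) R M
exec ω accept          S = S
exec ω reject          S = S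

initial : ∀ {k} → List ℕ → State k
initial input = state 0 (Vec.replicate _ 0) input

run : ∀ {k L} → Program k → Vec Bool L → List ℕ → ℕ → State k
run P ω input zero    = initial input
run P ω input (suc t) = let S = run P ω input t in exec ω (fetch P (State.pc S)) S

verdict : ∀ {k} → Instr k → Maybe Bool
verdict accept = just true
verdict reject = just false
verdict _      = nothing

-- The verdict reached within t steps, if any; halted machines stay put.
output : ∀ {k L} → Program k → Vec Bool L → List ℕ → ℕ → Maybe Bool
output P ω input t = verdict (fetch P (State.pc (run P ω input t)))

space : ∀ {k} → State k → ℕ
space S = bits (Vec.toList (State.regs S)) + bits (State.mem S)

rejects : Maybe Bool → Bool
rejects (just false) = true
rejects _            = false

count : ∀ {L} → (Vec Bool L → Bool) → ℕ
count {zero}  E = if E [] then 1 else 0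
count {suc L} E = count (λ ω → E (false ∷ ω)) + count (λ ω → E (true ∷ ω))

Pr : ∀ {L} → (Vec Bool L → Bool) → ℚ
Pr {L} E = ℚ._/_ (+ count E) (2 ^ L) {{m^n≢0 2 L}}

-- Input sizes are at least 2, so every polynomial in the input size is
-- dominated by some poly c.
poly : ℕ → ℕ → ℕ
poly c s = c * s ^ c

-- log(mn)·n, kept positive in the degenerate cases (mn ≤ 1).
logBase : ∀ {n d} → BLP n d → ℕ
logBase {n} I = 1 ⊔ (⌈log₂ (maxAbs I * n) ⌉ * n)

-- T ≤ poly(input size) · 2^(0.86 n) · (log(mn) n)^(C d), with both sides
-- raised to the power 100 to clear the fractional exponent.
TimeBound : ∀ {n d} (c C : ℕ) → BLP n d → ℤ → ℕ → Set
TimeBound {n} {d} c C I bound T =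
  T ^ 100 ≤ 2 ^ (86 * n) * (poly c (inputSize I bound) * logBase I ^ (C * d)) ^ 100

-- Guessing the number of chosen variables and, for every constraint, how its
-- slack is to be rounded turns the constraints into a single equation
-- w · x = t whose solutions are all feasible. If the subset sums of w take at
-- most 2^(0.86 n) values, a random prime p of about as many bits separates t
-- from the other sums; modulo a second prime q the number of solutions modulo p
-- is a coefficient of ∏ (1 + X^(w_u)), obtained as a power sum over the field
-- with q elements, and a solution is found by self-reduction. If there are more
-- values, then few pairs of subsets have equal sums, so a random balanced
-- splitting of the variables leaves few collisions inside either half: a random
-- walk through the partial sums of both halves probably meets the one pair that
-- forms x, and Floyd's cycle search detects it in polynomial space. The walk is
-- driven by the random bits, read as a function of the partial sum. Both trials
-- are written in a small language of arithmetic expressions with loops over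
-- fixed ranges, whose compilation to the machine has generic bounds on time,
-- values and registers.

module Submission where

open import Data.Bool using (Bool; true; false; if_then_else_; not; T; _∧_; _∨_)
import Data.Bool.Properties as Boolₚ
open import Data.Empty using (⊥-elim)
open import Data.Fin as Fin using (Fin; zero; suc; #_; toℕ; fromℕ<)
import Data.Fin.Properties as Finₚ
open import Data.Fin.Properties using (toℕ-fromℕ<; toℕ<n)
open import Data.Integer as ℤ using (ℤ; -[1+_]; 0ℤ) renaming (+_ to ⁺_; ∣_∣ to abs)
import Data.Integer.Properties as ℤₚ
import Data.Integer.Tactic.RingSolver as ℤ-Solver
open import Data.List as List using (List; []; _∷_; _++_; length; replicate)
open import Data.List.Properties using (length-++; ++-assoc; ++-identityʳ; length-replicate)
open import Data.Maybe as Maybe using (Maybe; just; nothing)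
import Data.Maybe.Properties as Maybeₚ
open import Data.Nat
open import Data.Nat.Divisibility
open import Data.Nat.DivMod hiding (_div_; _mod_; DivMod; module DivMod; result; _divMod_)
open import Data.Nat.Induction using (<-rec; <-wellFounded)
open import Data.Nat.Logarithm using (⌈log₂_⌉; ⌈log₂⌉-mono-≤; ⌈log₂2^n⌉≡n)
open import Data.Nat.Logarithm.Core using (⌈log2⌉; ⌈log2⌉-acc-irrelevant)
open import Data.Nat.Primality hiding (composite)
open import Data.Nat.Properties renaming (+-identityʳ to n+0≡n; *-identityʳ to n*1≡n; ^-distribˡ-+-* to ^-+; m+[n∸m]≡n to m+[n∸m]; m<n⇒m<1+n to <-suc; *-monoʳ-≤ to *-monoʳ; *-monoˡ-≤ to *-monoˡ; *-mono-≤ to *-mono; +-monoʳ-≤ to +-monoʳ; +-monoˡ-≤ to +-monoˡ; +-mono-≤ to +-mono; ^-monoʳ-≤ to ^-monoʳ; ^-monoˡ-≤ to ^-monoˡ)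
open import Data.Nat.Tactic.RingSolver using () renaming (solve-∀ to ring)
open import Data.Product using (_×_; _,_; ∃; Σ) renaming (proj₁ to fst; proj₂ to snd)
open import Data.Rational as ℚ using (ℚ; 1ℚ; ½)
import Data.Rational.Properties as ℚₚ
open import Data.Rational.Unnormalised as ℚᵘ using (mkℚᵘ)
import Data.Rational.Unnormalised.Properties as ℚᵘₚ
open import Data.Sum using (_⊎_; inj₁; inj₂; [_,_]′)
open import Data.Unit using (⊤; tt)
open import Data.Vec as Vec using (Vec; []; _∷_; _∷ʳ_; lookup; _[_]≔_)
import Data.Vec.Properties as Vecₚ
open import Data.Vec.Properties using (lookup-replicate; lookup∘update; lookup∘update′; toList-++; length-toList)
open import Function using (_$_)
open import Induction.WellFounded using (Acc; acc)
open import Relation.Binary.Definitions using (tri<; tri≈; tri>)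
open import Relation.Binary.PropositionalEquality hiding ([_])
open import Relation.Nullary using (yes; no; ¬_; Dec; does)
open import Relation.Nullary.Decidable using (_×-dec_)
open import Defs hiding (v; a; u)
open ≤-Reasoning using (begin_; begin-equality_; begin-strict_; _∎; step-≡-⟩; step-≡-⟨; step-≤; step-<)

-- Let e = ⌊0.14 n⌋. Counting solutions modulo a prime costs about the number of distinct sums,
-- which is affordable up to 2^(n-e). A walk on about 2^(n/2) vertices that runs for about 2^e steps
-- meets a prescribed pair with probability about 2^(2e-n), so repeating it 2^(n-2e) times costs
-- 2^(n-e) again. It survives that long only if at most about 2^(n-2e) pairs of vertices collide.
-- The crux is that 2^(n-e) distinct sums leave so few collisions in an average balanced splitting.
-- This is shown by a weighted injection whose weights are products over the coordinates: a
-- coordinate contributes 5 or 2 to a splitting, hence 9 or 2 to a difference of two subsets, and 81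
-- or 4 once a representative is added, in total 170. What remains is 8^0.14 · 170 ≤ 36 · √40, true
-- by about one part in a thousand; this fixes 0.14. Probabilities appear only as counts of random
-- words, and all moduli of random words are powers of two, so that residues are exactly uniform.

infixr 5 _⟫_ _≡⟫_ _⟫≡_
infixr 6 _∙_

_⟫_ : ∀ {a b c} → a ≤ b → b ≤ c → a ≤ c
_⟫_ = ≤-trans

_≡⟫_ : ∀ {a b c : ℕ} → a ≡ b → b ≤ c → a ≤ c
refl ≡⟫ q = q

_⟫≡_ : ∀ {a b c : ℕ} → a ≤ b → b ≡ c → a ≤ c
p ⟫≡ refl = p

pad : ∀ {a b c} → a + c ≡ b → a ≤ b
pad eq = m+n≤o⇒m≤o _ (≤-reflexive eq)

_∙_ : ∀ {A : Set} {a b c : A} → a ≡ b → b ≡ c → a ≡ c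
_∙_ = trans

+-exchange : ∀ a b c → a + (b + c) ≡ b + a + c
+-exchange = ring

+-rotate : ∀ a b c → a + (b + c) ≡ b + (a + c)
+-rotate = ring

+-swap : ∀ a b c → a + b + c ≡ a + c + b
+-swap = ring

+-interchange : ∀ a b c d → a + b + (c + d) ≡ a + c + (b + d)
+-interchange = ring

*-exchange : ∀ a b c → a * (b * c) ≡ b * (a * c)
*-exchange = ring

*-interchange : ∀ a b c d → a * b * (c * d) ≡ a * c * (b * d)
*-interchange = ring

-- Finite sums and products over initial segments of ℕ.

∑ : ℕ → (ℕ → ℕ) → ℕ
∑ zero f = 0
∑ (suc n) f = ∑ n f + f n

∏ : ℕ → (ℕ → ℕ) → ℕ
∏ zero f = 1
∏ (suc n) f = ∏ n f * f n

-- The index runs downwards, as the counter of a compiled loop does.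
iterate↓ : ℕ → (ℕ → ℕ → ℕ) → ℕ → ℕ
iterate↓ zero f a = a
iterate↓ (suc n) f a = iterate↓ n f (f n a)

∑-cong : ∀ n {f g : ℕ → ℕ} → (∀ i → i < n → f i ≡ g i) → ∑ n f ≡ ∑ n g
∑-cong zero h = refl
∑-cong (suc n) h = cong₂ _+_ (∑-cong n λ i i<n → h i (<-suc i<n)) (h n ≤-refl)

∑-cong' : ∀ n {f g : ℕ → ℕ} → (∀ i → f i ≡ g i) → ∑ n f ≡ ∑ n g
∑-cong' n h = ∑-cong n λ i _ → h i

∑-mono : ∀ n {f g : ℕ → ℕ} → (∀ i → i < n → f i ≤ g i) → ∑ n f ≤ ∑ n g
∑-mono zero h = z≤n
∑-mono (suc n) h = +-mono (∑-mono n λ i i<n → h i (<-suc i<n)) (h n ≤-refl)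

∑-+ : ∀ n (f g : ℕ → ℕ) → ∑ n (λ i → f i + g i) ≡ ∑ n f + ∑ n g
∑-+ zero f g = refl
∑-+ (suc n) f g = cong (_+ (f n + g n)) (∑-+ n f g) ∙ +-interchange (∑ n f) (∑ n g) (f n) (g n)

∑-*ˡ : ∀ n c (f : ℕ → ℕ) → ∑ n (λ i → c * f i) ≡ c * ∑ n f
∑-*ˡ zero c f = sym (*-zeroʳ c)
∑-*ˡ (suc n) c f = cong (_+ c * f n) (∑-*ˡ n c f) ∙ sym (*-distribˡ-+ c (∑ n f) (f n))

∑-*ʳ : ∀ n c (f : ℕ → ℕ) → ∑ n (λ i → f i * c) ≡ ∑ n f * c
∑-*ʳ n c f = (∑-cong' n λ i → *-comm (f i) c) ∙ ∑-*ˡ n c f ∙ *-comm c _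

∑-const : ∀ n c → ∑ n (λ _ → c) ≡ n * c
∑-const zero c = refl
∑-const (suc n) c = cong (_+ c) (∑-const n c) ∙ +-comm (n * c) c

∑-zero : ∀ n → ∑ n (λ _ → 0) ≡ 0
∑-zero n = ∑-const n 0 ∙ *-zeroʳ n

∑-swap : ∀ m n (f : ℕ → ℕ → ℕ) → ∑ m (λ i → ∑ n (f i)) ≡ ∑ n (λ j → ∑ m (λ i → f i j))
∑-swap zero n f = sym (∑-zero n)
∑-swap (suc m) n f = cong (_+ ∑ n (f m)) (∑-swap m n f) ∙ sym (∑-+ n _ (f m))

∑-head : ∀ n f → ∑ (suc n) f ≡ f 0 + ∑ n (λ i → f (suc i))
∑-head zero f = +-comm 0 (f 0)
∑-head (suc n) f = cong (_+ f (suc n)) (∑-head n f) ∙ +-assoc (f 0) _ _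

∑-split : ∀ m n f → ∑ (m + n) f ≡ ∑ m f + ∑ n (λ i → f (m + i))
∑-split m zero f = cong (λ k → ∑ k f) (n+0≡n m) ∙ sym (n+0≡n _)
∑-split m (suc n) f = cong (λ k → ∑ k f) (+-suc m n) ∙
 cong (_+ f (m + n)) (∑-split m n f) ∙ +-assoc (∑ m f) _ _

∑-product : ∀ m n f → ∑ (m * n) f ≡ ∑ m (λ i → ∑ n (λ j → f (i * n + j)))
∑-product zero n f = refl
∑-product (suc m) n f = cong (λ k → ∑ k f) (+-comm n (m * n)) ∙
 ∑-split (m * n) n f ∙ cong (_+ ∑ n (λ j → f (m * n + j))) (∑-product m n f)

∑-term : ∀ {n} i f → i < n → f i ≤ ∑ n f
∑-term {suc n} i f (s≤s i≤n) with m≤n⇒m<n∨m≡n i≤n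
... | inj₁ i<n = ∑-term i f i<n ⟫ m≤m+n _ _
... | inj₂ refl = m≤n+m (f n) _

∑-≤-const : ∀ n {f} c → (∀ i → i < n → f i ≤ c) → ∑ n f ≤ n * c
∑-≤-const n c h = ∑-mono n h ⟫≡ ∑-const n c

∑≡0⇒≡0 : ∀ {n} f i → i < n → ∑ n f ≡ 0 → f i ≡ 0
∑≡0⇒≡0 f i i<n eq = n≤0⇒n≡0 (∑-term i f i<n ⟫≡ eq)

∏-cong : ∀ n {f g : ℕ → ℕ} → (∀ i → i < n → f i ≡ g i) → ∏ n f ≡ ∏ n g
∏-cong zero h = refl
∏-cong (suc n) h = cong₂ _*_ (∏-cong n λ i i<n → h i (<-suc i<n)) (h n ≤-refl)

∏-one : ∀ n {f} → (∀ i → i < n → f i ≡ 1) → ∏ n f ≡ 1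
∏-one zero h = refl
∏-one (suc n) h = cong₂ _*_ (∏-one n λ i i<n → h i (<-suc i<n)) (h n ≤-refl)

∏-split : ∀ m n f → ∏ (m + n) f ≡ ∏ m f * ∏ n (λ i → f (m + i))
∏-split m zero f = cong (λ k → ∏ k f) (n+0≡n m) ∙ sym (n*1≡n _)
∏-split m (suc n) f = cong (λ k → ∏ k f) (+-suc m n) ∙
 cong (_* f (m + n)) (∏-split m n f) ∙ *-assoc (∏ m f) _ _

∏-const : ∀ n c → ∏ n (λ _ → c) ≡ c ^ n
∏-const zero c = refl
∏-const (suc n) c = cong (_* c) (∏-const n c) ∙ *-comm (c ^ n) c

1≤2^ : ∀ n → 1 ≤ 2 ^ n
1≤2^ n = m^n>0 2 n

n<2^n : ∀ n → n < 2 ^ n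
n<2^n zero = z<s
n<2^n (suc n) = s≤s (n<2^n n) ⟫ +-monoˡ (2 ^ n) (1≤2^ n) ⟫≡ cong (2 ^ n +_) (sym (n+0≡n (2 ^ n)))

-- The expression language and its static cost measures.

-- At level `hi` an access to randomness yields a whole word, at level `lo` a single bit, and only
-- `lo` sees the number of the current repetition (`blk`). Trials are written in `hi` and translated
-- by `lower`.
data Level : Set where
 lo hi : Level

variable
 ℓ : Level
 P Γ Δ : ℕ

-- P counts parameters (fixed numbers, the only admissible loop counts and
-- caps), Γ counts local variables. The body of a loop sees its index, and in
-- iter also the accumulator, as new variables; every new value of the
-- accumulator of iter is cut off at the second parameter.
data Exp : Level → ℕ → ℕ → Set where
 par : Fin P → Exp ℓ P Γ
 var : Fin Γ → Exp ℓ P Γ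
 lit : ℕ → Exp ℓ P Γ
 op : Op → Exp ℓ P Γ → Exp ℓ P Γ → Exp ℓ P Γ
 mem : Exp ℓ P Γ → Exp ℓ P Γ
 rnd : Exp ℓ P Γ → Exp ℓ P Γ
 blk : Exp lo P Γ
 len : Fin P → Exp ℓ P Γ
 call : Exp ℓ P Δ → Vec (Exp ℓ P Γ) Δ → Exp ℓ P Γ
 sum : Fin P → Exp ℓ P (suc Γ) → Exp ℓ P Γ
 prod : Fin P → Exp ℓ P (suc Γ) → Exp ℓ P Γ
 iter : Fin P → Fin P → Exp ℓ P Γ → Exp ℓ P (2 + Γ) → Exp ℓ P Γ

digits : ℕ → ℕ
digits x = ⌈log₂ suc x ⌉

-- `κ` marks the parameters that are polynomial in the input size; the others only have polynomially
-- many bits (`Under`).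
Small : ℕ → Vec Bool P → Vec ℕ P → Set
Small σ κ π = ∀ i → lookup κ i ≡ true → lookup π i ≤ σ

Under : ℕ → Vec ℕ P → Set
Under σ π = ∀ i → lookup π i < 2 ^ σ

module Semantics (μ φ : ℕ → ℕ) (b : ℕ) where

 ⟦_⟧ᵉ : Exp ℓ P Γ → Vec ℕ P → Vec ℕ Γ → ℕ
 ⟦_⟧ᵉˢ : Vec (Exp ℓ P Γ) Δ → Vec ℕ P → Vec ℕ Γ → Vec ℕ Δ

 ⟦ par i ⟧ᵉ π ρ = lookup π i
 ⟦ var x ⟧ᵉ π ρ = lookup ρ x
 ⟦ lit c ⟧ᵉ π ρ = c
 ⟦ op o e f ⟧ᵉ π ρ = ⟦ o ⟧ (⟦ e ⟧ᵉ π ρ) (⟦ f ⟧ᵉ π ρ)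
 ⟦ mem e ⟧ᵉ π ρ = μ (⟦ e ⟧ᵉ π ρ)
 ⟦ rnd e ⟧ᵉ π ρ = φ (⟦ e ⟧ᵉ π ρ)
 ⟦ blk ⟧ᵉ π ρ = b
 ⟦ len i ⟧ᵉ π ρ = digits (lookup π i)
 ⟦ call f es ⟧ᵉ π ρ = ⟦ f ⟧ᵉ π (⟦ es ⟧ᵉˢ π ρ)
 ⟦ sum i e ⟧ᵉ π ρ = ∑ (lookup π i) λ j → ⟦ e ⟧ᵉ π (j ∷ ρ)
 ⟦ prod i e ⟧ᵉ π ρ = ∏ (lookup π i) λ j → ⟦ e ⟧ᵉ π (j ∷ ρ)
 ⟦ iter i cap e₀ e ⟧ᵉ π ρ =
  iterate↓ (lookup π i) (λ j a → ⟦ e ⟧ᵉ π (j ∷ a ∷ ρ) ⊓ lookup π cap) (⟦ e₀ ⟧ᵉ π ρ)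

 ⟦ [] ⟧ᵉˢ π ρ = []
 ⟦ e ∷ es ⟧ᵉˢ π ρ = ⟦ e ⟧ᵉ π ρ ∷ ⟦ es ⟧ᵉˢ π ρ

-- The length of the compiled code, wanted in advance because jump targets are absolute.
size : Exp ℓ P Γ → ℕ
sizes : Vec (Exp ℓ P Γ) Δ → ℕ
size (par i) = 2
size (var x) = 2
size (lit c) = 1
size (op o e f) = size e + (size f + 1)
size (mem e) = size e + 1
size (rnd e) = size e + 1
size blk = 2
size (len i) = 12
size (call f es) = sizes es + (size f + 2)
size (sum i e) = 3 + ((3 + (size e + 3)) + 2)
size (prod i e) = 3 + ((3 + (size e + 3)) + 2)
size (iter i c e₀ e) = 2 + (size e₀ + ((3 + (size e + 4)) + 2))
sizes [] = 0
sizes (e ∷ es) = size e + sizes es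

-- How many registers, counted from the stack position of the result, an evaluation may occupy.
need : Exp ℓ P Γ → ℕ
needs : Vec (Exp ℓ P Γ) Δ → ℕ
need (par i) = 2
need (var x) = 2
need (lit c) = 1
need (op o e f) = need e ⊔ suc (need f)
need (mem e) = need e
need (rnd e) = need e
need blk = 2
need (len i) = 3
need (call {Δ = Δ} f es) = needs es ⊔ ((Δ + need f) ⊔ (Δ + 2))
need (sum i e) = (2 + need e) ⊔ 4
need (prod i e) = (2 + need e) ⊔ 4
need (iter i c e₀ e) = (1 + need e₀) ⊔ ((2 + need e) ⊔ 4)
needs [] = 1
needs (e ∷ es) = need e ⊔ suc (needs es)

time : Exp ℓ P Γ → Vec ℕ P → ℕ
times : Vec (Exp ℓ P Γ) Δ → Vec ℕ P → ℕ
time (par i) π = 2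
time (var x) π = 2
time (lit c) π = 1
time (op o e f) π = time e π + (time f π + 1)
time (mem e) π = time e π + 1
time (rnd e) π = time e π + 1
time blk π = 2
time (len i) π = 3 + ((digits (lookup π i) * 7 + 1) + 2)
time (call f es) π = times es π + (time f π + 2)
time (sum i e) π = 3 + ((lookup π i * (3 + ((time e π + 1) + 2)) + 1) + 2)
time (prod i e) π = 3 + ((lookup π i * (3 + ((time e π + 1) + 2)) + 1) + 2)
time (iter i c e₀ e) π = 2 + (time e₀ π + ((lookup π i * (3 + ((time e π + 2) + 2)) + 1) + 2))
times [] π = 0
times (e ∷ es) π = time e π + times es π

-- Under the bounds of Bounded below, values stay below 2 ^ (σ ^ degree).
degree : Exp ℓ P Γ → Vec ℕ Γ → ℕ
degrees : Vec (Exp ℓ P Γ) Δ → Vec ℕ Γ → Vec ℕ Δ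
degree (par i) δ = 1
degree (var x) δ = lookup δ x
degree (lit c) δ = suc c
degree (op o e f) δ = suc (degree e δ ⊔ degree f δ)
degree (mem e) δ = suc (degree e δ)
degree (rnd e) δ = suc (degree e δ)
degree blk δ = 1
degree (len i) δ = 2
degree (call f es) δ = degree f (degrees es δ) + Vec.sum (degrees es δ)
degree (sum i e) δ = 2 + degree e (1 ∷ δ)
degree (prod i e) δ = 2 + degree e (1 ∷ δ)
degree (iter i c e₀ e) δ = let d = suc (degree e₀ δ) in degree e (1 ∷ d ∷ δ) + suc d
degrees [] δ = []
degrees (e ∷ es) δ = degree e δ ∷ degrees es δ

-- Products multiply numbers of polynomially many bits, so their number of
-- factors must itself be polynomial.
smallΠ : Vec Bool P → Exp ℓ P Γ → Bool
smallΠs : Vec Bool P → Vec (Exp ℓ P Γ) Δ → Bool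
smallΠ κ (op o e f) = smallΠ κ e ∧ smallΠ κ f
smallΠ κ (mem e) = smallΠ κ e
smallΠ κ (rnd e) = smallΠ κ e
smallΠ κ (call f es) = smallΠ κ f ∧ smallΠs κ es
smallΠ κ (sum i e) = smallΠ κ e
smallΠ κ (prod i e) = lookup κ i ∧ smallΠ κ e
smallΠ κ (iter i c e₀ e) = smallΠ κ e₀ ∧ smallΠ κ e
smallΠ κ _ = true
smallΠs κ [] = true
smallΠs κ (e ∷ es) = smallΠ κ e ∧ smallΠs κ es

T-fst : ∀ {x y} → T (x ∧ y) → T x
T-fst {true} {true} _ = tt

T-snd : ∀ {x y} → T (x ∧ y) → T y
T-snd {true} {true} _ = tt

T⇒≡ : ∀ {x} → T x → x ≡ true
T⇒≡ {true} _ = refl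

digits-≤ : ∀ {x n} → x < 2 ^ n → digits x ≤ n
digits-≤ {x} {n} x< = ⌈log₂⌉-mono-≤ x< ⟫≡ ⌈log₂2^n⌉≡n n

n/2≡⌊n/2⌋ : ∀ n → n / 2 ≡ ⌊ n /2⌋
n/2≡⌊n/2⌋ zero = refl
n/2≡⌊n/2⌋ (suc zero) = refl
n/2≡⌊n/2⌋ (suc (suc n)) = (m/n≡1+[m∸n]/n {suc (suc n)} {2} (s<s z<s)) ∙ cong suc (n/2≡⌊n/2⌋ n)

digits-suc : ∀ n → digits (suc n) ≡ suc (digits (suc n / 2))
digits-suc n = unfold n (<-wellFounded (suc (suc n))) ∙ cong (λ x → suc (digits x)) (sym (n/2≡⌊n/2⌋ (suc n)))
 where
 unfold : ∀ n (a : Acc _<_ (suc (suc n))) → ⌈log2⌉ (suc (suc n)) a ≡ suc (⌈log₂ suc ⌈ n /2⌉ ⌉)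
 unfold n (acc rs) = cong suc (⌈log2⌉-acc-irrelevant (suc ⌈ n /2⌉))

-- Values of expressions have polynomially many bits.

module Bounds (σ : ℕ) (2≤σ : 2 ≤ σ) where

 double≤ : ∀ d → σ ^ d + σ ^ d ≤ σ ^ suc d
 double≤ d = cong (σ ^ d +_) (sym (n+0≡n _)) ≡⟫ *-monoˡ (σ ^ d) 2≤σ

 abstract
  bnd : ℕ → ℕ
  bnd d = 2 ^ (σ ^ d)

  bnd-def : ∀ d → bnd d ≡ 2 ^ (σ ^ d)
  bnd-def d = refl

 private instance
  σ≢0 : NonZero σ
  σ≢0 = >-nonZero (z<s ⟫ 2≤σ)

 σ^-mono : ∀ {a c} → a ≤ c → σ ^ a ≤ σ ^ c
 σ^-mono = ^-monoʳ σ

 1≤σ^ : ∀ d → 1 ≤ σ ^ d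
 1≤σ^ d = m^n>0 σ d

 σ≤σ^ : ∀ {d} → 1 ≤ d → σ ≤ σ ^ d
 σ≤σ^ 1≤d = sym (^-identityʳ σ) ≡⟫ σ^-mono 1≤d

 bnd-mono : ∀ {a c} → a ≤ c → bnd a ≤ bnd c
 bnd-mono {a} {c} a≤c rewrite bnd-def a | bnd-def c = ^-monoʳ 2 (σ^-mono a≤c)

 bnd1 : bnd 1 ≡ 2 ^ σ
 bnd1 = bnd-def 1 ∙ cong (2 ^_) (n*1≡n σ)

 1≤bnd : ∀ d → 1 ≤ bnd d
 1≤bnd d = subst (1 ≤_) (sym (bnd-def d)) (1≤2^ (σ ^ d))

 bnd-square : ∀ {d} e → e ≤ σ ^ d + σ ^ d → 2 ^ e ≤ bnd (suc d)
 bnd-square {d} e e≤ rewrite bnd-def (suc d) = ^-monoʳ 2 (e≤ ⟫ double≤ d)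

 op-bound : ∀ o {x y d} → x < bnd d → y < bnd d → ⟦ o ⟧ x y < bnd (suc d)
 op-bound add {x} {y} {d} x< y< = +-mono-< x< y< ⟫ eq ≡⟫ bnd-square {d} (suc (σ ^ d)) (+-monoˡ (σ ^ d) (1≤σ^ d))
  where
  eq : bnd d + bnd d ≡ 2 ^ suc (σ ^ d)
  eq rewrite bnd-def d = cong (2 ^ (σ ^ d) +_) (sym (n+0≡n _))
 op-bound monus {x} {y} {d} x< y< = ≤-<-trans (m∸n≤m x y) x< ⟫ bnd-mono (n≤1+n d)
 op-bound mul {x} {y} {d} x< y< = *-mono-< x< y< ⟫ eq ≡⟫ bnd-square {d} (σ ^ d + σ ^ d) ≤-refl
  where
  eq : bnd d * bnd d ≡ 2 ^ (σ ^ d + σ ^ d)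
  eq rewrite bnd-def d = sym (^-+ 2 (σ ^ d) (σ ^ d))
 op-bound div {x} {zero} {d} x< y< = 1≤bnd (suc d)
 op-bound div {x} {suc y} {d} x< y< = ≤-<-trans (m/n≤m x (suc y)) x< ⟫ bnd-mono (n≤1+n d)

 sum-bound : ∀ {d} c f → c < 2 ^ σ → (∀ j → j < c → f j < bnd d) → ∑ c f < bnd (2 + d)
 sum-bound {d} zero f c< h = 1≤bnd (2 + d)
 sum-bound {d} (suc c) f c< h = begin-strict
  ∑ (suc c) f ≤⟨ ∑-≤-const (suc c) (bnd d) (λ i i<c → <⇒≤ (h i i<c)) ⟩
  suc c * bnd d <⟨ *-monoˡ-< (bnd d) c< ⟩
  2 ^ σ * bnd d ≡⟨ cong (2 ^ σ *_) (bnd-def d) ⟩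
  2 ^ σ * 2 ^ (σ ^ d) ≡⟨ ^-+ 2 σ (σ ^ d) ⟨
  2 ^ (σ + σ ^ d) ≤⟨ bnd-square {suc d} (σ + σ ^ d) (+-mono (σ≤σ^ {suc d} z<s) (σ^-mono (n≤1+n d))) ⟩
  bnd (2 + d) ∎
  where
  instance
   b≢0 : NonZero (bnd d)
   b≢0 = >-nonZero (1≤bnd d)

 -- At most σ factors multiply the number of bits by at most σ, which costs one power of σ; the
 -- second one makes the inequality strict.
 prod-bound : ∀ {d} c f → c ≤ σ → (∀ j → j < c → f j < bnd d) → ∏ c f < bnd (2 + d)
 prod-bound {d} c f c≤ h = ≤-<-trans (go c h) (subst (2 ^ (c * σ ^ d) <_) (sym (bnd-def (2 + d))) (^-monoʳ-< 2 (s<s z<s) strict))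
  where
  go : ∀ c → (∀ j → j < c → f j < bnd d) → ∏ c f ≤ 2 ^ (c * σ ^ d)
  go zero h = ≤-refl
  go (suc c) h = *-mono (go c λ j j<c → h j (<-suc j<c)) (subst (f c ≤_) (bnd-def d) (<⇒≤ (h c ≤-refl))) ⟫≡
   sym (^-+ 2 (c * σ ^ d) (σ ^ d)) ∙ cong (2 ^_) (+-comm (c * σ ^ d) (σ ^ d))
  strict : c * σ ^ d < σ ^ (2 + d)
  strict = ≤-<-trans (*-monoˡ (σ ^ d) c≤) (^-monoʳ-< σ 2≤σ (n<1+n (suc d)))

 iterate-bound : ∀ c {M} (f : ℕ → ℕ → ℕ) a → a < M → (∀ j a → j < c → a < M → f j a < M) → iterate↓ c f a < M
 iterate-bound zero f a a< h = a<
 iterate-bound (suc c) f a a< h =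
  iterate-bound c f (f c a) (h c a ≤-refl a<) λ j a j< → h j a (<-suc j<)

 record Local {Γ : ℕ} (ρ δ : Vec ℕ Γ) : Set where
  constructor local
  field at : ∀ x → lookup ρ x < bnd (lookup δ x)

 open Local public

 local-∷ : ∀ {Γ} {ρ δ : Vec ℕ Γ} {v d} → v < bnd d → Local ρ δ → Local (v ∷ ρ) (d ∷ δ)
 local-∷ v< h = local λ { zero → v< ; (suc x) → at h x }

 record Bounded : Set where
  constructor bounded
  field
   {N} : ℕ
   κ : Vec Bool N
   π : Vec ℕ N
   μ φ : ℕ → ℕ
   b : ℕ
   π< : Under σ π
   μ< : ∀ i → μ i < 2 ^ σ
   φ≤ : ∀ i → φ i ≤ 1
   b< : b < 2 ^ σ
   κ≤ : Small σ κ π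

  open Semantics μ φ b

  idx< : ∀ {i : Fin N} {j} → j < lookup π i → j < bnd 1
  idx< {i} j< = <-trans j< (subst (lookup π i <_) (sym bnd1) (π< i))

  value< : ∀ {Γ} (e : Exp lo N Γ) {ρ δ : Vec ℕ Γ} → T (smallΠ κ e) → Local ρ δ → ⟦ e ⟧ᵉ π ρ < bnd (degree e δ)
  values< : ∀ {Γ Δ} (es : Vec (Exp lo N Γ) Δ) {ρ δ : Vec ℕ Γ} → T (smallΠs κ es) → Local ρ δ → Local (⟦ es ⟧ᵉˢ π ρ) (degrees es δ)
  value< (par i) {ρ} {δ} ok h = subst (lookup π i <_) (sym bnd1) (π< i)
  value< (var x) {ρ} {δ} ok h = at h x
  value< (lit c) {ρ} {δ} ok h = subst (c <_) (sym (bnd-def (suc c)))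
   (n<2^n c ⟫ ^-monoʳ 2 (<⇒≤ (n<2^n c) ⟫ ^-monoˡ c 2≤σ ⟫ σ^-mono (n≤1+n c)))
  value< (op o e f) {ρ} {δ} ok h = op-bound o
   (value< e (T-fst ok) h ⟫ bnd-mono (m≤m⊔n (degree e δ) (degree f δ)))
   (value< f (T-snd {smallΠ κ e} ok) h ⟫ bnd-mono (m≤n⊔m (degree e δ) (degree f δ)))
  value< (mem e) {ρ} {δ} ok h = subst (μ (⟦ e ⟧ᵉ π ρ) <_) (sym bnd1) (μ< _) ⟫ bnd-mono z<s
  value< (rnd e) {ρ} {δ} ok h = ≤-<-trans (φ≤ _) (subst (1 <_) (sym bnd1) (2≤σ ⟫ <⇒≤ (n<2^n σ)) ⟫ bnd-mono z<s)
  value< blk {ρ} {δ} ok h = subst (b <_) (sym bnd1) b<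
  value< (len i) {ρ} {δ} ok h = ≤-<-trans (digits-≤ (π< i)) (n<2^n σ) ⟫ sym bnd1 ≡⟫ bnd-mono z<s
  value< (call f es) {ρ} {δ} ok h = value< f (T-fst ok) (values< es (T-snd {smallΠ κ f} ok) h) ⟫ bnd-mono (m≤m+n (degree f (degrees es δ)) _)
  value< (sum i e) {ρ} {δ} ok h = sum-bound (lookup π i) _ (π< i) λ j j< → value< e {δ = 1 ∷ δ} ok (local-∷ (idx< {i} j<) h)
  value< (prod i e) {ρ} {δ} ok h =
   prod-bound (lookup π i) _ (κ≤ i (T⇒≡ (T-fst ok)))
    (λ j j< → value< e {δ = 1 ∷ δ} (T-snd {lookup κ i} ok) (local-∷ (idx< {i} j<) h))
  -- Every value of the accumulator after the first is cut off at a parameter, hence below 2^σ, so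
  -- the bound does not grow with the number of rounds.
  value< (iter i c e₀ e) {ρ} {δ} ok h = iterate-bound (lookup π i) {bnd (suc (degree e₀ δ))} _ _
   (value< e₀ (T-fst ok) h ⟫ bnd-mono (n≤1+n (degree e₀ δ)))
   (λ j a j< a< → ≤-<-trans (m⊓n≤n (⟦ e ⟧ᵉ π (j ∷ a ∷ ρ)) _) (subst (lookup π c <_) (sym bnd1) (π< c)) ⟫ bnd-mono z<s) ⟫
   bnd-mono (n≤1+n _ ⟫ m≤n+m _ (degree e (1 ∷ suc (degree e₀ δ) ∷ δ)))
  values< [] ok h = local λ ()
  values< {Δ = suc Δ} (e ∷ es) {ρ} {δ} ok h = local-∷ (value< e (T-fst ok) h) (values< es (T-snd {smallΠ κ e} ok) h)

-- The compiler.

-- Numbers beyond K end at the last register. This lets register numbers be computed in ℕ; only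
-- numbers up to K are kept apart.
reg : ∀ {K} → ℕ → Fin (suc K)
reg {zero} _ = zero
reg {suc K} zero = zero
reg {suc K} (suc i) = suc (reg i)

reg-injective : ∀ {K i j} → i ≤ K → j ≤ K → reg {K} i ≡ reg j → i ≡ j
reg-injective {zero} z≤n z≤n eq = refl
reg-injective {suc K} {zero} {zero} p q eq = refl
reg-injective {suc K} {suc i} {suc j} (s≤s p) (s≤s q) eq = cong suc (reg-injective p q (suc-inj eq))
 where
 suc-inj : ∀ {n} {x y : Fin n} → Fin.suc x ≡ suc y → x ≡ y
 suc-inj refl = refl

get : ∀ {K} → Vec ℕ (suc K) → ℕ → ℕ
get R i = lookup R (reg i)

put : ∀ {K} → Vec ℕ (suc K) → ℕ → ℕ → Vec ℕ (suc K)
put R i x = R [ reg i ]≔ x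

get-put : ∀ {K} (R : Vec ℕ (suc K)) i x → get (put R i x) i ≡ x
get-put R i x = lookup∘update (reg i) R x

get-put' : ∀ {K} (R : Vec ℕ (suc K)) {i j} x → i ≤ K → j ≤ K → i ≢ j → get (put R i x) j ≡ get R j
get-put' R {i} {j} x i≤ j≤ i≢j = lookup∘update′ (λ eq → i≢j (reg-injective i≤ j≤ (sym eq))) R x

get-put≤ : ∀ {K} (R : Vec ℕ (suc K)) i x {X} → (∀ j → get R j ≤ X) → x ≤ X → ∀ j → get (put R i x) j ≤ X
get-put≤ {K} R i x {X} h x≤ j with reg {K} j Data.Fin.≟ reg i
 where import Data.Fin
... | yes eq = subst (λ r → lookup (put R i x) r ≤ X) (sym eq) (get-put R i x ≡⟫ x≤)
... | no neq = lookup∘update′ neq R x ≡⟫ h j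

range : ∀ n → ℕ → Vec ℕ n
range zero s = []
range (suc n) s = s ∷ range n (suc s)

module Compiler (K : ℕ) where

 I : Set
 I = Instr (suc K)

 mov : ℕ → ℕ → ℕ → List I
 mov s t z = set (reg z) 0 ∷ arith add (reg s) (reg t) (reg z) ∷ []

 -- Register s is the counter, s + 1 the accumulator, and s + 2 holds the constants 1 and 0 between
 -- two evaluations of the body. The jump back is a conditional jump on the register just set to 0.
 loop : ℕ → ℕ → ℕ → List I → List I
 loop s o m c = jz (reg s) (o + (3 + (m + 2)))
  ∷ set (reg (2 + s)) 1
  ∷ arith monus (reg s) (reg s) (reg (2 + s))
  ∷ (c ++ set (reg (2 + s)) 0 ∷ jz (reg (2 + s)) o ∷ [])

 accumulate : Op → ℕ → List I → List I
 accumulate p s c = c ++ arith p (reg (suc s)) (reg (suc s)) (reg (2 + s)) ∷ []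

 foldCode : Op → ℕ → ℕ → ℕ → ℕ → ℕ → List I → List I
 foldCode p v i s o m c = mov s i (suc s) ++ set (reg (suc s)) v ∷ (loop s (3 + o) (m + 1) (accumulate p s c) ++ mov s (suc s) (2 + s))

 -- The minimum of x and the cap c is computed as x - (x - c) with truncated subtraction.
 truncate : ℕ → ℕ → List I → List I
 truncate i s c = c ++ arith monus (reg (3 + s)) (reg (2 + s)) (reg i) ∷ arith monus (reg (suc s)) (reg (2 + s)) (reg (3 + s)) ∷ []

 -- The code starts at address o, leaves the value in register s and preserves all registers below
 -- s. Register 0 holds the number of the repetition; `ps` and `vs` say where parameters and
 -- variables are.
 comp : Exp lo P Γ → Vec ℕ P → Vec ℕ Γ → ℕ → ℕ → List I
 comps : Vec (Exp lo P Γ) Δ → Vec ℕ P → Vec ℕ Γ → ℕ → ℕ → List I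
 comp (par i) ps vs s o = mov s (lookup ps i) (suc s)
 comp (var x) ps vs s o = mov s (lookup vs x) (suc s)
 comp (lit c) ps vs s o = set (reg s) c ∷ []
 comp (op p e f) ps vs s o = comp e ps vs s o ++ comp f ps vs (suc s) (o + size e) ++ arith p (reg s) (reg s) (reg (suc s)) ∷ []
 comp (mem e) ps vs s o = comp e ps vs s o ++ load (reg s) (reg s) ∷ []
 comp (rnd e) ps vs s o = comp e ps vs s o ++ random (reg s) (reg s) ∷ []
 comp blk ps vs s o = mov s 0 (suc s)
 comp (len i) ps vs s o = mov s (lookup ps i) (suc s) ++ set (reg (suc s)) 0
  ∷ jz (reg s) (3 + o + 7) ∷ set (reg (2 + s)) 1 ∷ arith add (reg (suc s)) (reg (suc s)) (reg (2 + s))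
  ∷ set (reg (2 + s)) 2 ∷ arith div (reg s) (reg s) (reg (2 + s))
  ∷ set (reg (2 + s)) 0 ∷ jz (reg (2 + s)) (3 + o) ∷ mov s (suc s) (2 + s)
 comp (call {Δ = Δ} f es) ps vs s o = comps es ps vs s o ++ comp f ps (range Δ s) (Δ + s) (o + sizes es) ++ mov s (Δ + s) (suc (Δ + s))
 comp (sum i e) ps vs s o = foldCode add 0 (lookup ps i) s o (size e) (comp e ps (s ∷ vs) (2 + s) (6 + o))
 comp (prod i e) ps vs s o = foldCode mul 1 (lookup ps i) s o (size e) (comp e ps (s ∷ vs) (2 + s) (6 + o))
 comp (iter i c e₀ e) ps vs s o = mov s (lookup ps i) (suc s) ++ comp e₀ ps vs (suc s) (2 + o) ++
  (loop s (2 + o + size e₀) (size e + 2) (truncate (lookup ps c) s (comp e ps (s ∷ suc s ∷ vs) (2 + s) (5 + o + size e₀))) ++ mov s (suc s) (2 + s))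
 comps [] ps vs s o = []
 comps (e ∷ es) ps vs s o = comp e ps vs s o ++ comps es ps vs (suc s) (o + size e)

s<2+s : ∀ {s} → s < 2 + s
s<2+s = n<1+n _ ⟫ n≤1+n _

-- Correctness of compiled expressions.

record Machine : Set where
 constructor machine
 field
  {K L} : ℕ
  Pg : Program (suc K)
  ω : Vec Bool L
  input : List ℕ
  X : ℕ
  2≤X : 2 ≤ X

module Execution (E : Machine) where

 open Machine E
 open Compiler K

 Regs : Set
 Regs = Vec ℕ (suc K)

 OK : Regs → Set
 OK R = ∀ j → get R j ≤ X

 -- Compiled code contains no store instruction, so the memory is the input throughout.
 st : ℕ → Regs → State (suc K)
 st o R = state o R input

 next : State (suc K) → State (suc K)
 next S = exec ω (fetch Pg (State.pc S)) S

 -- The bound X on the registers is recorded at every step, because the space bound concerns every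
 -- moment of the run and not only its end.
 data Path : ℕ → State (suc K) → State (suc K) → Set where
  done : ∀ {S} → Path 0 S S
  step : ∀ {t o R S S'} → OK R → next (st o R) ≡ S → Path t S S' → Path (suc t) (st o R) S'

 infixr 5 _▹_
 _▹_ : ∀ {t u S S₁ S₂} → Path t S S₁ → Path u S₁ S₂ → Path (t + u) S S₂
 done ▹ q = q
 step b e p ▹ q = step b e (p ▹ q)

 At : ℕ → List I → Set
 At o [] = ⊤
 At o (i ∷ c) = fetch Pg o ≡ i × At (suc o) c

 at-++ : ∀ o c {c'} → At o (c ++ c') → At o c × At (o + length c) c'
 at-++ o [] {c'} h = tt , subst (λ k → At k c') (sym (n+0≡n o)) h
 at-++ o (i ∷ c) {c'} (e , h) with at-++ (suc o) c h
 ... | p , q = (e , p) , subst (λ k → At k c') (sym (+-suc o (length c))) q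

 at-++-size : ∀ o c {c' m} → length c ≡ m → At o (c ++ c') → At o c × At (o + m) c'
 at-++-size o c refl h = at-++ o c h

 record Upd (R : Regs) (s v : ℕ) (R' : Regs) : Set where
  field
   val : get R' s ≡ v
   same : ∀ {j} → j ≤ K → j ≢ s → get R' j ≡ get R j
   ok : OK R'

 Step : ℕ → Regs → ℕ → ℕ → Set
 Step o R s v = Σ Regs λ R' → Path 1 (st o R) (st (suc o) R') × Upd R s v R'

 upd : ∀ {R s v} → OK R → s ≤ K → v ≤ X → Upd R s v (put R s v)
 upd {R} {s} {v} okR s≤ v≤ = record
  { val = get-put R s v
  ; same = λ j≤ j≢ → get-put' R v s≤ j≤ (λ eq → j≢ (sym eq))
  ; ok = get-put≤ R s v okR v≤ }

 once : ∀ {o R i} → OK R → fetch Pg o ≡ i → Path 1 (st o R) (exec ω i (st o R))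
 once {o} {R} okR f = step okR (cong (λ i → exec ω i (st o R)) f) done

 do-set : ∀ {o R s c} → fetch Pg o ≡ set (reg s) c → OK R → s ≤ K → c ≤ X → Step o R s c
 do-set {o} {R} {s} {c} f okR s≤ c≤ =
  put R s c , once okR f , upd okR s≤ c≤

 do-arith : ∀ {o R s p} q r {v} → fetch Pg o ≡ arith p (reg s) (reg q) (reg r) → OK R → s ≤ K →
  ⟦ p ⟧ (get R q) (get R r) ≡ v → v ≤ X → Step o R s v
 do-arith {o} {R} {s} {p} q r f okR s≤ refl v≤ =
  _ , once okR f , upd okR s≤ v≤

 do-load : ∀ {o R s v} → fetch Pg o ≡ load (reg s) (reg s) → OK R → s ≤ K →
  nth 0 input (get R s) ≡ v → v ≤ X → Step o R s v
 do-load {o} {R} f okR s≤ refl v≤ = _ , once okR f , upd okR s≤ v≤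

 bit-of : ℕ → ℕ
 bit-of p = if nth false (Vec.toList ω) p then 1 else 0

 do-random : ∀ {o R s v} → fetch Pg o ≡ random (reg s) (reg s) → OK R → s ≤ K →
  bit-of (get R s) ≡ v → v ≤ X → Step o R s v
 do-random {o} {R} f okR s≤ refl v≤ = _ , once okR f , upd okR s≤ v≤

 do-jz0 : ∀ {o R} s {t} → fetch Pg o ≡ jz (reg s) t → OK R → get R s ≡ 0 → Path 1 (st o R) (st t R)
 do-jz0 {o} {R} s {t} f okR z = step okR (cong (λ i → exec ω i (st o R)) f ∙ lem z) done
  where
  lem : get R s ≡ 0 → exec ω (jz (reg s) t) (st o R) ≡ st t R
  lem z with lookup R (reg s) | z
  ... | zero | refl = refl

 do-jz1 : ∀ {o R} s {t j} → fetch Pg o ≡ jz (reg s) t → OK R → get R s ≡ suc j → Path 1 (st o R) (st (suc o) R)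
 do-jz1 {o} {R} s {t} {j} f okR z = step okR (cong (λ i → exec ω i (st o R)) f ∙ lem z) done
  where
  lem : get R s ≡ suc j → exec ω (jz (reg s) t) (st o R) ≡ st (suc o) R
  lem z with lookup R (reg s) | z
  ... | suc _ | refl = refl

 open Upd public

 keep : ∀ {R R' i v j} → Upd R i v R' → i ≤ K → j < i → get R' j ≡ get R j
 keep u i≤ j< = same u (<⇒≤ j< ⟫ i≤) (<⇒≢ j<)

 record Out (s v : ℕ) (R R' : Regs) : Set where
  constructor out
  field
   frame : ∀ {j} → j < s → get R' j ≡ get R j
   res : get R' s ≡ v
   fine : OK R'

 open Out public

 Reach : (t o o' s v : ℕ) → Regs → Set
 Reach t o o' s v R = Σ Regs λ R' → Path t (st o R) (st o' R') × Out s v R R'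

 do-mov : ∀ {o R} s t z → At o (mov s t z) → OK R → s ≤ K → t ≤ K → z ≤ K → t ≢ z → s ≤ z →
  Reach 2 o (2 + o) s (get R t) R
 do-mov {o} {R} s t z (f₁ , f₂ , _) okR s≤ t≤ z≤ t≢z s≤z
  with do-set f₁ okR z≤ z≤n
 ... | R₁ , p₁ , u₁
  with do-arith t z f₂ (ok u₁) s≤ (cong₂ _+_ (same u₁ t≤ t≢z) (val u₁) ∙ n+0≡n _) (okR t)
 ... | R₂ , p₂ , u₂ = R₂ , p₁ ▹ p₂ ,
  out (λ j< → keep u₂ s≤ j< ∙ keep u₁ z≤ (j< ⟫ s≤z)) (val u₂) (ok u₂)

 record LoopInv (s : ℕ) (R₀ : Regs) (j a : ℕ) (R : Regs) : Set where
  constructor inv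
  field
   below : ∀ {i} → i < s → get R i ≡ get R₀ i
   counter : get R s ≡ j
   accum : get R (suc s) ≡ a
   good : OK R

 open LoopInv public

 module Loop {s o m τ : ℕ} {c : List I} (code : At o (loop s o m c)) (|c| : length c ≡ m) (2+s≤ : 2 + s ≤ K)
  (R₀ : Regs) (n : ℕ) (f : ℕ → ℕ → ℕ) (A : ℕ → ℕ → Set)
  (A-step : ∀ {j a} → j < n → A (suc j) a → A j (f j a))
  (body : ∀ {j a R} → j < n → A (suc j) a → LoopInv s R₀ j a R →
   Σ Regs λ R' → Path τ (st (3 + o) R) (st (3 + o + m) R') × LoopInv s R₀ j (f j a) R') where

  private
   s≤ : s ≤ K
   s≤ = m≤n+m s 2 ⟫ 2+s≤

   s+1≤ : suc s ≤ K
   s+1≤ = n≤1+n _ ⟫ 2+s≤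

  scratch : ∀ {j a R R' v} → LoopInv s R₀ j a R → Upd R (2 + s) v R' → LoopInv s R₀ j a R'
  scratch (inv b ct ac g) u = inv
   (λ i< → keep u 2+s≤ (<-trans i< s<2+s) ∙ b i<) (keep u 2+s≤ s<2+s ∙ ct) (keep u 2+s≤ ≤-refl ∙ ac) (ok u)

  loop-run : ∀ j {a R} → j ≤ n → A j a → LoopInv s R₀ j a R →
   Σ Regs λ R' → Path (j * (3 + (τ + 2)) + 1) (st o R) (st (o + (3 + (m + 2))) R')
    × LoopInv s R₀ 0 (iterate↓ j f a) R'
  loop-run zero j≤ Aa I = _ , do-jz0 s (fst code) (good I) (counter I) , I
  loop-run (suc j) {R = R} j≤ Aa I
   with do-set (fst (snd code)) (good I) 2+s≤ (z<s ⟫ 2≤X)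
  ... | R₁ , p₁ , u₁
   with scratch I u₁
  ... | I₁
   with do-arith s (2 + s) {j} (fst (snd (snd code))) (ok u₁) s≤ (cong₂ _∸_ (counter I₁) (val u₁))
    (n≤1+n j ⟫ subst (_≤ X) (counter I₁) (good I₁ s))
  ... | R₂ , p₂ , u₂
   with body {j} {R = R₂} j≤ Aa
    (inv (λ i< → keep u₂ s≤ i< ∙ below I₁ i<) (val u₂)
     (same u₂ s+1≤ (λ eq → <⇒≢ ≤-refl (sym eq)) ∙ accum I₁) (ok u₂))
  ... | R₃ , p₃ , I₃
   with at-++-size (3 + o) c |c| (snd (snd (snd code)))
  ... | _ , (f₄ , f₅ , _)
   with do-set f₄ (good I₃) 2+s≤ z≤n
  ... | R₄ , p₄ , u₄
   with loop-run j {R = R₄} (<⇒≤ j≤) (A-step j≤ Aa) (scratch I₃ u₄)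
  ... | R₅ , p₅ , I₅ = R₅ , subst (λ t → Path t (st o R) (st (o + (3 + (m + 2))) R₅)) eq path , I₅
   where
   path = do-jz1 s (fst code) (good I) (counter I) ▹ (p₁ ▹ p₂ ▹ p₃ ▹ p₄ ▹ do-jz0 (2 + s) f₅ (ok u₄) (val u₄) ▹ p₅)
   eq : 3 + (τ + (2 + (j * (3 + (τ + 2)) + 1))) ≡ suc j * (3 + (τ + 2)) + 1
   eq = cong (3 +_) (sym (+-assoc τ 2 _) ∙ sym (+-assoc (τ + 2) _ 1))

iterate-+ : ∀ n g a → iterate↓ n (λ j a → a + g j) a ≡ a + ∑ n g
iterate-+ zero g a = sym (n+0≡n a)
iterate-+ (suc n) g a = iterate-+ n g (a + g n) ∙ +-assoc a (g n) _ ∙ cong (a +_) (+-comm (g n) _)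

iterate-* : ∀ n g a → iterate↓ n (λ j a → a * g j) a ≡ a * ∏ n g
iterate-* zero g a = sym (n*1≡n a)
iterate-* (suc n) g a = iterate-* n g (a * g n) ∙ *-assoc a (g n) _ ∙ cong (a *_) (*-comm (g n) _)

m∸[m∸n]≡m⊓n : ∀ m n → m ∸ (m ∸ n) ≡ m ⊓ n
m∸[m∸n]≡m⊓n m n with ≤-total m n
... | inj₁ m≤n = cong (m ∸_) (m≤n⇒m∸n≡0 m≤n) ∙ sym (m≤n⇒m⊓n≡m m≤n)
... | inj₂ n≤m = (m∸[m∸n]≡n n≤m) ∙ sym (m≥n⇒m⊓n≡n n≤m)

module _ (K : ℕ) where
 open Compiler K

 length-snoc : ∀ (c : List I) {c' m} → length c ≡ m → length (c ++ c') ≡ m + length c'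
 length-snoc c refl = length-++ c

 length-loop : ∀ s o k c {m} → length c ≡ m → length (loop s o k c) ≡ 3 + (m + 2)
 length-loop s o k c e = cong (3 +_) (length-snoc c e)

 length-fold : ∀ p v i s o {m} c → length c ≡ m → length (foldCode p v i s o m c) ≡ 3 + ((3 + (m + 3)) + 2)
 length-fold p v i s o {m} c e = cong (3 +_) (length-snoc (loop s (3 + o) (m + 1) (accumulate p s c))
  (length-loop s (3 + o) (m + 1) (accumulate p s c) (length-snoc c e) ∙ cong (3 +_) (+-assoc m 1 2)))

 length-comp : ∀ (e : Exp lo P Γ) {ps vs s o} → length (comp e ps vs s o) ≡ size e
 length-comps : ∀ (es : Vec (Exp lo P Γ) Δ) {ps vs s o} → length (comps es ps vs s o) ≡ sizes es
 length-comp (par i) = refl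
 length-comp (var x) = refl
 length-comp (lit c) = refl
 length-comp (op p e f) {ps} {vs} {s} {o} = length-snoc (comp e ps vs s o) (length-comp e) ∙
  cong (size e +_) (length-snoc (comp f ps vs (suc s) (o + size e)) (length-comp f))
 length-comp (mem e) {ps} {vs} {s} {o} = length-snoc (comp e ps vs s o) (length-comp e)
 length-comp (rnd e) {ps} {vs} {s} {o} = length-snoc (comp e ps vs s o) (length-comp e)
 length-comp blk = refl
 length-comp (len i) = refl
 length-comp (call {Δ = Δ} f es) {ps} {vs} {s} {o} = length-snoc (comps es ps vs s o) (length-comps es) ∙
  cong (sizes es +_) (length-snoc (comp f ps (range Δ s) (Δ + s) (o + sizes es)) (length-comp f))
 length-comp (sum i e) {ps} {vs} {s} {o} = length-fold add 0 (lookup ps i) s o (comp e ps (s ∷ vs) (2 + s) (6 + o)) (length-comp e)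
 length-comp (prod i e) {ps} {vs} {s} {o} = length-fold mul 1 (lookup ps i) s o (comp e ps (s ∷ vs) (2 + s) (6 + o)) (length-comp e)
 length-comp (iter i c e₀ e) {ps} {vs} {s} {o} = cong (2 +_) (length-snoc (comp e₀ ps vs (suc s) (2 + o)) (length-comp e₀) ∙
  cong (size e₀ +_) (length-snoc (loop s (2 + o + size e₀) (size e + 2) body)
   (length-loop s (2 + o + size e₀) (size e + 2) body (length-snoc (comp e ps (s ∷ suc s ∷ vs) (2 + s) (5 + o + size e₀)) (length-comp e)) ∙ cong (3 +_) (+-assoc (size e) 2 2))))
  where body = truncate (lookup ps c) s (comp e ps (s ∷ suc s ∷ vs) (2 + s) (5 + o + size e₀))
 length-comps [] = refl
 length-comps (e ∷ es) {ps} {vs} {s} {o} = length-snoc (comp e ps vs s o) (length-comp e) ∙ cong (size e +_) (length-comps es)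

need≥1 : ∀ (e : Exp lo P Γ) → 1 ≤ need e
needs≥1 : ∀ (es : Vec (Exp lo P Γ) Δ) → 1 ≤ needs es
need≥1 (par i) = z<s
need≥1 (var x) = z<s
need≥1 (lit c) = z<s
need≥1 (op o e f) = need≥1 e ⟫ m≤m⊔n _ _
need≥1 (mem e) = need≥1 e
need≥1 (rnd e) = need≥1 e
need≥1 blk = z<s
need≥1 (len i) = z<s
need≥1 (call f es) = needs≥1 es ⟫ m≤m⊔n _ _
need≥1 (sum i e) = z<s
need≥1 (prod i e) = z<s
need≥1 (iter i c e₀ e) = z<s
needs≥1 [] = z<s
needs≥1 (e ∷ es) = need≥1 e ⟫ m≤m⊔n _ _

record BoundedRun : Set where
 constructor boundedRun
 field E : Machine
 open Machine E public
 field
  σ : ℕ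
  2≤σ : 2 ≤ σ
  {N} : ℕ
  κ : Vec Bool N
  π : Vec ℕ N
  b D : ℕ
  bnd≤X : ∀ {d} → d ≤ D → Bounds.bnd σ 2≤σ d ≤ X
  π< : Under σ π
  μ< : ∀ i → nth 0 input i < 2 ^ σ
  b< : b < 2 ^ σ
  κ≤ : Small σ κ π

module Correct (C : BoundedRun) where

 open BoundedRun C
 open Compiler K
 open Execution E
 open Bounds σ 2≤σ

 bit≤1 : ∀ p → bit-of p ≤ 1
 bit≤1 p with nth false (Vec.toList ω) p
 ... | true = ≤-refl
 ... | false = z≤n

 open Semantics (nth 0 input) bit-of b

 Bd : Bounded
 Bd = bounded κ π (nth 0 input) bit-of b π< μ< bit≤1 b< κ≤

 open Bounded Bd using (value<; values<; idx<)

 value≤X : ∀ {Γ} (e : Exp lo N Γ) {ρ δ : Vec ℕ Γ} → T (smallΠ κ e) → Local ρ δ → degree e δ ≤ D → ⟦ e ⟧ᵉ π ρ ≤ X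
 value≤X e ok h d≤ = <⇒≤ (value< e ok h) ⟫ bnd≤X d≤

 record PC (ps : Vec ℕ N) (s : ℕ) (R : Regs) : Set where
  constructor pc
  field
   params : ∀ i → lookup ps i < s × get R (lookup ps i) ≡ lookup π i
   block : 0 < s × get R 0 ≡ b

 record VC {Γ} (vs ρ : Vec ℕ Γ) (s : ℕ) (R : Regs) : Set where
  constructor vc
  field vars : ∀ x → lookup vs x < s × get R (lookup vs x) ≡ lookup ρ x

 open PC
 open VC

 PC-weaken : ∀ {ps s s' R R'} → s ≤ s' → (∀ {j} → j < s → get R' j ≡ get R j) → PC ps s R → PC ps s' R'
 PC-weaken s≤ fr (pc p bl) = pc
  (λ i → fst (p i) ⟫ s≤ , fr (fst (p i)) ∙ snd (p i))
  (fst bl ⟫ s≤ , fr (fst bl) ∙ snd bl)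

 VC-weaken : ∀ {Γ s s' R R'} {vs ρ : Vec ℕ Γ} → s ≤ s' → (∀ {j} → j < s → get R' j ≡ get R j) → VC vs ρ s R → VC vs ρ s' R'
 VC-weaken s≤ fr (vc p) = vc λ x → fst (p x) ⟫ s≤ , fr (fst (p x)) ∙ snd (p x)

 VC-∷ : ∀ {Γ s R i v} {vs ρ : Vec ℕ Γ} → i < s → get R i ≡ v → VC vs ρ s R → VC (i ∷ vs) (v ∷ ρ) s R
 VC-∷ i< eq (vc p) = vc λ { zero → i< , eq ; (suc x) → p x }

 at-pc : ∀ {t o o₁ o₂ s v R} → o₁ ≡ o₂ → Reach t o o₁ s v R → Reach t o o₂ s v R
 at-pc refl r = r

 at-time : ∀ {t u o o₁ s v R} → t ≡ u → Reach t o o₁ s v R → Reach u o o₁ s v R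
 at-time refl r = r

 at-val : ∀ {t o o₁ s v w R} → v ≡ w → Reach t o o₁ s v R → Reach t o o₁ s w R
 at-val refl r = r

 after : ∀ {t u o o₁ o₂ s w R R₁} → Path t (st o R) (st o₁ R₁) → (∀ {j} → j < s → get R₁ j ≡ get R j) →
  Reach u o₁ o₂ s w R₁ → Reach (t + u) o o₂ s w R
 after p fr (R₂ , q , out f v g) = R₂ , p ▹ q , out (λ j< → f j< ∙ fr j<) v g

 finish : ∀ {t o o₁ s v w R R₁} → Path t (st o R) (st o₁ R₁) → (∀ {j} → j < s → get R₁ j ≡ get R j) → s ≤ K → v ≡ w →
  Step o₁ R₁ s v → Reach (t + 1) o (suc o₁) s w R
 finish p fr s≤ v≡w (R₂ , q , u) =
  R₂ , p ▹ q , out (λ j< → keep u s≤ j< ∙ fr j<) (val u ∙ v≡w) (ok u)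

 do-copy : ∀ {s o R t v} → suc s ≤ K → At o (mov s t (suc s)) → OK R → t < s × get R t ≡ v → Reach 2 o (2 + o) s v R
 do-copy {s} {t = t} s+1≤ h okR (t< , e) =
  at-val e (do-mov s t (suc s) h okR (<⇒≤ s+1≤) (<⇒≤ (<-trans t< s+1≤)) s+1≤ (<⇒≢ (<-suc t<)) (n≤1+n s))

 do-back : ∀ {s o R} → 2 + s ≤ K → At o (mov s (suc s) (2 + s)) → OK R → Reach 2 o (2 + o) s (get R (suc s)) R
 do-back {s} 2+s≤ h okR = do-mov s (suc s) (2 + s) h okR (<⇒≤ (<⇒≤ 2+s≤)) (<⇒≤ 2+s≤) 2+s≤ (<⇒≢ ≤-refl) (m≤n+m s 2)

 fits : ∀ s {n} → s + n ≤ suc K → ∀ {m} → m < n → m + s ≤ K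
 fits s {n} le {m} m<n = s≤s⁻¹ (+-monoˡ s m<n ⟫ +-comm n s ≡⟫ le)

 two : ∀ {m} → 2 < (2 + m) ⊔ 4
 two {m} = s≤s (s<s z<s) ⟫ m≤n⊔m (2 + m) 4

 three : ∀ {m} → 3 < (2 + m) ⊔ 4
 three {m} = m≤n⊔m (2 + m) 4

 sub : ∀ s {m n} → m ≤ n → s + n ≤ suc K → s + m ≤ suc K
 sub s m≤n le = +-monoʳ s m≤n ⟫ le

 module Digits {s o : ℕ} (s+2≤ : 2 + s ≤ K)
  (f₁ : fetch Pg o ≡ jz (reg s) (o + 7))
  (f₂ : fetch Pg (1 + o) ≡ set (reg (2 + s)) 1)
  (f₃ : fetch Pg (2 + o) ≡ arith add (reg (suc s)) (reg (suc s)) (reg (2 + s)))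
  (f₄ : fetch Pg (3 + o) ≡ set (reg (2 + s)) 2)
  (f₅ : fetch Pg (4 + o) ≡ arith div (reg s) (reg s) (reg (2 + s)))
  (f₆ : fetch Pg (5 + o) ≡ set (reg (2 + s)) 0)
  (f₇ : fetch Pg (6 + o) ≡ jz (reg (2 + s)) o) (R₀ : Regs) where

  private
   s≤ : s ≤ K
   s≤ = m≤n+m s 2 ⟫ s+2≤

   s+1≤ : suc s ≤ K
   s+1≤ = n≤1+n _ ⟫ s+2≤

  digits-run : ∀ fuel x a R → x ≤ fuel → a + digits x ≤ X → LoopInv s R₀ x a R →
   Σ Regs λ R' → Path (digits x * 7 + 1) (st o R) (st (o + 7) R') × LoopInv s R₀ 0 (a + digits x) R'
  digits-run fuel zero a R x≤ a≤ I = R , do-jz0 s f₁ (good I) (counter I) ,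
   inv (below I) (counter I) (accum I ∙ sym (n+0≡n a)) (good I)
  digits-run (suc fuel) (suc x) a R (s≤s x≤) a≤ (inv bel cnt accum okR)
   with do-set f₂ okR s+2≤ (z<s ⟫ 2≤X)
  ... | R₁ , p₁ , u₁
   with do-arith (suc s) (2 + s) {a + 1} f₃ (ok u₁) s+1≤
    (cong₂ _+_ (keep u₁ s+2≤ ≤-refl ∙ accum) (val u₁))
    (+-monoʳ a (subst (1 ≤_) (sym (digits-suc x)) z<s) ⟫ a≤)
  ... | R₂ , p₂ , u₂
   with do-set f₄ (ok u₂) s+2≤ 2≤X
  ... | R₃ , p₃ , u₃
   with do-arith s (2 + s) {suc x / 2} f₅ (ok u₃) s≤
    (cong₂ (λ y z → ⟦ div ⟧ y z)
     (keep u₃ s+2≤ s<2+s ∙ keep u₂ s+1≤ ≤-refl ∙ keep u₁ s+2≤ s<2+s ∙ cnt) (val u₃))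
    (m/n≤m (suc x) 2 ⟫ subst (_≤ X) cnt (okR s))
  ... | R₄ , p₄ , u₄
   with do-set f₆ (ok u₄) s+2≤ z≤n
  ... | R₅ , p₅ , u₅
   with digits-run fuel (suc x / 2) (a + 1) R₅ (s≤s⁻¹ (m/n<m (suc x) 2 (s<s z<s)) ⟫ x≤)
    (+-assoc a 1 _ ∙ cong (a +_) (sym (digits-suc x)) ≡⟫ a≤)
    (inv (λ i< → let i<2+s = <-trans i< s<2+s in keep u₅ s+2≤ i<2+s ∙ keep u₄ s≤ i< ∙ keep u₃ s+2≤ i<2+s ∙
     keep u₂ s+1≤ (<-suc i<) ∙ keep u₁ s+2≤ i<2+s ∙ bel i<)
     (keep u₅ s+2≤ s<2+s ∙ val u₄)
     (keep u₅ s+2≤ ≤-refl ∙ same u₄ s+1≤ (λ eq → <⇒≢ ≤-refl (sym eq)) ∙ keep u₃ s+2≤ ≤-refl ∙ val u₂) (ok u₅))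
  ... | R₆ , p₆ , inv bel₆ cnt₆ accum₆ ok₆ = R₆ ,
   subst (λ t → Path t (st o R) (st (o + 7) R₆)) (cong (λ d → d * 7 + 1) (sym (digits-suc x)))
    (do-jz1 s f₁ okR cnt ▹ p₁ ▹ p₂ ▹ p₃ ▹ p₄ ▹ p₅ ▹ do-jz0 (2 + s) f₇ (ok u₅) (val u₅) ▹ p₆) ,
   inv bel₆ cnt₆ (accum₆ ∙ +-assoc a 1 _ ∙ cong (a +_) (sym (digits-suc x))) ok₆

 code-split : ∀ {Γ} (e : Exp lo N Γ) ps vs s o {c'} → At o (comp e ps vs s o ++ c') → At o (comp e ps vs s o) × At (o + size e) c'
 code-split e ps vs s o = at-++-size o (comp e ps vs s o) (length-comp K e)

 bnd-pow : ∀ {d} c → c ≤ σ → bnd d ^ c ≤ bnd (2 + d)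
 bnd-pow {d} c c≤ = cong (_^ c) (bnd-def d) ∙ ^-*-assoc 2 (σ ^ d) c ≡⟫
  ^-monoʳ 2 (*-monoʳ (σ ^ d) c≤ ⟫ *-comm (σ ^ d) σ ≡⟫ σ^-mono (n≤1+n (suc d))) ⟫≡
   sym (bnd-def (2 + d))

 CompOK : ∀ {Γ} → Exp lo N Γ → Set
 CompOK {Γ} e = ∀ {ps vs ρ δ s o R} → T (smallΠ κ e) → Local ρ δ → degree e δ ≤ D → s + need e ≤ suc K →
  At o (comp e ps vs s o) → PC ps s R → VC {Γ} vs ρ s R → OK R → Reach (time e π) o (o + size e) s (⟦ e ⟧ᵉ π ρ) R

 -- The invariant `A j a` links the accumulator a to the j rounds still to come; it is what keeps
 -- partial results at most X.
 module Fold {Γ} (e : Exp lo N (suc Γ)) (IH : CompOK e) {ps vs} {ρ δ : Vec ℕ Γ} {s o R i} p (v₀ : ℕ) (A : ℕ → ℕ → Set) (v₀≤ : v₀ ≤ X)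
  (A-step : ∀ {j a} → j < lookup π i → A (suc j) a → A j (⟦ p ⟧ a (⟦ e ⟧ᵉ π (j ∷ ρ))) × ⟦ p ⟧ a (⟦ e ⟧ᵉ π (j ∷ ρ)) ≤ X) (A-init : A (lookup π i) v₀)
  (ok : T (smallΠ κ e)) (loc : Local ρ δ) (d≤ : degree e (1 ∷ δ) ≤ D) (le : s + ((2 + need e) ⊔ 4) ≤ suc K)
  (code : At o (foldCode p v₀ (lookup ps i) s o (size e) (comp e ps (s ∷ vs) (2 + s) (6 + o)))) (pcx : PC ps s R) (vcx : VC vs ρ s R) (okR : OK R) where

  private
   c₀ c : List I
   c₀ = comp e ps (s ∷ vs) (2 + s) (6 + o)
   c = accumulate p s c₀

   |c| : length c ≡ size e + 1
   |c| = length-snoc K c₀ (length-comp K e)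

   parts = at-++-size (3 + o) (loop s (3 + o) (size e + 1) c) (length-loop K s (3 + o) (size e + 1) c |c|) (snd (snd (snd code)))

   2+s≤ : 2 + s ≤ K
   2+s≤ = fits s le {2} (two {need e})

   s+1≤ : suc s ≤ K
   s+1≤ = <⇒≤ 2+s≤

   body : ∀ {j a R'} → j < lookup π i → A (suc j) a → LoopInv s R j a R' →
    Σ Regs λ R″ → Path (time e π + 1) (st (6 + o) R') (st (6 + o + (size e + 1)) R″) × LoopInv s R j (⟦ p ⟧ a (⟦ e ⟧ᵉ π (j ∷ ρ))) R″
   body {j} {a} {R'} j< Aa (inv bel cnt accum good)
    with at-++-size (6 + o) c |c| (snd (snd (snd (fst parts))))
   ... | hc , _
    with code-split e ps (s ∷ vs) (2 + s) (6 + o) hc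
   ... | he , (ha , _)
    with IH {δ = 1 ∷ δ} ok (local-∷ (idx< {i} j<) loc) d≤
     (sym (+-suc s (suc (need e)) ∙ cong suc (+-suc s (need e))) ≡⟫ sub s (m≤m⊔n (2 + need e) 4) le) he
     (PC-weaken (m≤n+m s 2) bel pcx) (VC-∷ s<2+s cnt (VC-weaken (m≤n+m s 2) bel vcx)) good
   ... | R₃ , p₃ , out fr₃ v₃ ok₃
    with do-arith (suc s) (2 + s) ha ok₃ s+1≤ (cong₂ ⟦ p ⟧ (fr₃ ≤-refl ∙ accum) v₃) (snd (A-step j< Aa))
   ... | R₄ , p₄ , u₄ = R₄ , subst (λ k → Path (time e π + 1) (st (6 + o) R') (st k R₄)) (sym (+-suc (6 + o) (size e)) ∙ cong (6 + o +_) (+-comm 1 (size e))) (p₃ ▹ p₄) ,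
    inv (λ j< → keep u₄ s+1≤ (<-suc j<) ∙ fr₃ (<-trans j< s<2+s) ∙ bel j<) (keep u₄ s+1≤ ≤-refl ∙ fr₃ s<2+s ∙ cnt) (val u₄) (Upd.ok u₄)

  fold-ok : Reach (3 + ((lookup π i * (3 + ((time e π + 1) + 2)) + 1) + 2)) o (o + (3 + ((3 + (size e + 3)) + 2))) s
   (iterate↓ (lookup π i) (λ j a → ⟦ p ⟧ a (⟦ e ⟧ᵉ π (j ∷ ρ))) v₀) R
  fold-ok
   with do-copy s+1≤ (fst code , fst (snd code) , tt) okR (params pcx i)
  ... | R₁ , p₁ , out fr₁ v₁ ok₁
   with do-set (fst (snd (snd code))) ok₁ s+1≤ v₀≤
  ... | R₂ , p₂ , u₂
   with Loop.loop-run {c = c} (fst parts) |c| 2+s≤ R (lookup π i) (λ j a → ⟦ p ⟧ a (⟦ e ⟧ᵉ π (j ∷ ρ))) A (λ j< Aa → fst (A-step j< Aa)) body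
    (lookup π i) ≤-refl A-init
    (inv (λ j< → keep u₂ s+1≤ (<-suc j<) ∙ fr₁ j<) (keep u₂ s+1≤ ≤-refl ∙ v₁) (val u₂) (Upd.ok u₂))
  ... | R₅ , p₅ , inv bel₅ cnt₅ accum₅ ok₅ =
   at-pc (eq-pc o (size e)) (at-time (+-assoc 3 (lookup π i * (3 + ((time e π + 1) + 2)) + 1) 2)
    (after (p₁ ▹ p₂ ▹ p₅) bel₅ (at-val accum₅ (do-back 2+s≤ (snd parts) ok₅))))
   where
   eq-pc : ∀ o m → 2 + (3 + o + (3 + (m + 1 + 2))) ≡ o + (3 + ((3 + (m + 3)) + 2))
   eq-pc = ring

 module Iter {Γ} (i cap : Fin N) (e₀ : Exp lo N Γ) (e : Exp lo N (2 + Γ)) (IH₀ : CompOK e₀) (IH : CompOK e) {ps vs} {ρ δ : Vec ℕ Γ} {s o R}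
  (ok : T (smallΠ κ e₀ ∧ smallΠ κ e)) (loc : Local ρ δ) (d≤ : degree (iter i cap e₀ e) δ ≤ D) (le : s + need (iter i cap e₀ e) ≤ suc K)
  (code : At o (comp (iter i cap e₀ e) ps vs s o)) (pcx : PC ps s R) (vcx : VC vs ρ s R) (okR : OK R) where

  private
   o' d₀ : ℕ
   o' = 2 + o + size e₀
   d₀ = suc (degree e₀ δ)

   c₀ c : List I
   c₀ = comp e ps (s ∷ suc s ∷ vs) (2 + s) (3 + o')
   c = truncate (lookup ps cap) s c₀

   |c| : length c ≡ size e + 2
   |c| = length-snoc K c₀ (length-comp K e)

   part₀ = code-split e₀ ps vs (suc s) (2 + o) (snd (snd code))
   parts = at-++-size o' (loop s o' (size e + 2) c) (length-loop K s o' (size e + 2) c |c|) (snd part₀)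

   le' : s + ((2 + need e) ⊔ 4) ≤ suc K
   le' = sub s (m≤n⊔m (1 + need e₀) _) le

   2+s≤ : 2 + s ≤ K
   2+s≤ = fits s le' (two {need e})

   s+1≤ : suc s ≤ K
   s+1≤ = <⇒≤ 2+s≤

   f : ℕ → ℕ → ℕ
   f j a = ⟦ e ⟧ᵉ π (j ∷ a ∷ ρ) ⊓ lookup π cap

   A-step : ∀ {j a} → j < lookup π i → a < bnd d₀ → f j a < bnd d₀
   A-step {j} {a} _ _ = ≤-<-trans (m⊓n≤n (⟦ e ⟧ᵉ π (j ∷ a ∷ ρ)) _) (subst (lookup π cap <_) (sym bnd1) (π< cap)) ⟫ bnd-mono z<s

   body : ∀ {j a R'} → j < lookup π i → a < bnd d₀ → LoopInv s R j a R' →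
    Σ Regs λ R″ → Path (time e π + 2) (st (3 + o') R') (st (3 + o' + (size e + 2)) R″) × LoopInv s R j (f j a) R″
   body {j} {a} {R'} j< Aa (inv bel cnt accum good)
    with at-++-size (3 + o') c |c| (snd (snd (snd (fst parts))))
   ... | hc , _
    with code-split e ps (s ∷ suc s ∷ vs) (2 + s) (3 + o') hc
   ... | he , (ha , hb , _)
    with IH {δ = 1 ∷ d₀ ∷ δ} (T-snd {smallΠ κ e₀} ok)
     (local-∷ (idx< {i} j<) (local-∷ Aa loc)) (m≤m+n _ (suc d₀) ⟫ d≤)
     (sym (+-suc s (suc (need e)) ∙ cong suc (+-suc s (need e))) ≡⟫ sub s (m≤m⊔n (2 + need e) 4) le') he
     (PC-weaken (m≤n+m s 2) bel pcx) (VC-∷ s<2+s cnt (VC-∷ ≤-refl accum (VC-weaken (m≤n+m s 2) bel vcx))) good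
   ... | R₃ , p₃ , out fr₃ v₃ ok₃
    with do-arith (2 + s) (lookup ps cap) ha ok₃ (fits s le' (three {need e}))
     (cong₂ _∸_ v₃ (fr₃ (<-trans (fst (params pcx cap)) s<2+s) ∙ bel (fst (params pcx cap)) ∙ snd (params pcx cap)))
     (m∸n≤m _ (lookup π cap) ⟫ subst (_≤ X) v₃ (ok₃ (2 + s)))
   ... | R₄ , p₄ , u₄
    with do-arith (2 + s) (3 + s) {f j a} hb (Upd.ok u₄) s+1≤
     (cong₂ _∸_ (same u₄ 2+s≤ (<⇒≢ ≤-refl) ∙ v₃) (val u₄) ∙ m∸[m∸n]≡m⊓n (⟦ e ⟧ᵉ π (j ∷ a ∷ ρ)) (lookup π cap))
     (m⊓n≤m _ (lookup π cap) ⟫ subst (_≤ X) v₃ (ok₃ (2 + s)))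
   ... | R₅ , p₅ , u₅ = R₅ , subst (λ k → Path (time e π + 2) (st (3 + o') R') (st k R₅)) (eq o' (size e)) (p₃ ▹ p₄ ▹ p₅) ,
    inv (λ j< → past (<-trans j< s<2+s) (<-suc j<) ∙ bel j<) (past s<2+s ≤-refl ∙ cnt) (val u₅) (Upd.ok u₅)
    where
    past : ∀ {k} → k < 2 + s → k < suc s → get R₅ k ≡ get R' k
    past k<2+s k<1+s = keep u₅ s+1≤ k<1+s ∙ keep u₄ (fits s le' (three {need e})) (<-suc k<2+s) ∙ fr₃ k<2+s
    eq : ∀ o m → 2 + (3 + o + m) ≡ 3 + o + (m + 2)
    eq = ring

  iter-ok : Reach (time (iter i cap e₀ e) π) o (o + size (iter i cap e₀ e)) s (⟦ iter i cap e₀ e ⟧ᵉ π ρ) R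
  iter-ok
   with do-copy s+1≤ (fst code , fst (snd code) , tt) okR (params pcx i)
  ... | R₁ , p₁ , out fr₁ v₁ ok₁
   with IH₀ {R = R₁} (T-fst ok) loc (n≤1+n _ ⟫ n≤1+n _ ⟫ m≤n+m (suc d₀) (degree e (1 ∷ d₀ ∷ δ)) ⟫ d≤)
    (sym (+-suc s (need e₀)) ≡⟫ sub s (m≤m⊔n (1 + need e₀) ((2 + need e) ⊔ 4)) le) (fst part₀)
    (PC-weaken (n≤1+n s) fr₁ pcx) (VC-weaken (n≤1+n s) fr₁ vcx) ok₁
  ... | R₂ , p₂ , out fr₂ v₂ ok₂
   with Loop.loop-run {c = c} (fst parts) |c| 2+s≤ R (lookup π i) f (λ j a → a < bnd d₀) A-step body
    (lookup π i) ≤-refl (value< e₀ (T-fst ok) loc ⟫ bnd-mono (n≤1+n (degree e₀ δ)))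
    (inv (λ j< → fr₂ (<-suc j<) ∙ fr₁ j<) (fr₂ ≤-refl ∙ v₁) v₂ ok₂)
  ... | R₅ , p₅ , inv bel₅ cnt₅ accum₅ ok₅ =
   at-pc (eq-pc o (size e₀) (size e)) (at-time (eq-time (time e₀ π) (lookup π i * (3 + ((time e π + 2) + 2))))
    (after (p₁ ▹ p₂ ▹ p₅) bel₅ (at-val accum₅ (do-back 2+s≤ (snd parts) ok₅))))
   where
   eq-pc : ∀ o k m → 2 + (2 + o + k + (3 + (m + 2 + 2))) ≡ o + (2 + (k + ((3 + (m + 4)) + 2)))
   eq-pc = ring
   eq-time : ∀ a b → 2 + (a + (b + 1)) + 2 ≡ 2 + (a + ((b + 1) + 2))
   eq-time = ring

 comp-ok : ∀ {Γ} (e : Exp lo N Γ) → CompOK e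

 comps-ok : ∀ {Γ Δ} (es : Vec (Exp lo N Γ) Δ) {ps vs ρ δ s o R} → T (smallΠs κ es) → Local ρ δ →
  Vec.sum (degrees es δ) ≤ D → s + needs es ≤ suc K → At o (comps es ps vs s o) → PC ps s R → VC vs ρ s R → OK R →
  Σ Regs λ R' → Path (times es π) (st o R) (st (o + sizes es) R') × (∀ {j} → j < s → get R' j ≡ get R j)
   × VC (range Δ s) (⟦ es ⟧ᵉˢ π ρ) (Δ + s) R' × OK R'

 comp-ok (par i) {s = s} {o} ok loc d≤ le h pcx vcx okR = at-pc (+-comm 2 o) (do-copy (fits s le (s<s z<s)) h okR (params pcx i))
 comp-ok (var x) {s = s} {o} ok loc d≤ le h pcx vcx okR = at-pc (+-comm 2 o) (do-copy (fits s le (s<s z<s)) h okR (vars vcx x))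
 comp-ok (lit c) {s = s} {o = o} ok loc d≤ le (h , _) pcx vcx okR =
  at-pc (+-comm 1 o) (finish done (λ _ → refl) (fits s le z<s) refl (do-set h okR (fits s le z<s) (value≤X (lit c) ok loc d≤)))
 comp-ok blk {s = s} {o} ok loc d≤ le h pcx vcx okR = at-pc (+-comm 2 o) (do-copy (fits s le (s<s z<s)) h okR (block pcx))
 comp-ok (op p e f) {ps} {vs} {ρ} {δ} {s} {o} ok loc d≤ le h pcx vcx okR
  with code-split e ps vs s o h
 ... | h₁ , h'
  with code-split f ps vs (suc s) (o + size e) h'
 ... | h₂ , (h₃ , _)
  with comp-ok e (T-fst ok) loc ((m≤m⊔n (degree e δ) (degree f δ) ⟫ n≤1+n _) ⟫ d≤) (sub s (m≤m⊔n (need e) _) le) h₁ pcx vcx okR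
 ... | R₁ , p₁ , out fr₁ v₁ ok₁
  with comp-ok f {R = R₁} (T-snd {smallΠ κ e} ok) loc ((m≤n⊔m (degree e δ) (degree f δ) ⟫ n≤1+n _) ⟫ d≤)
   (sym (+-suc s (need f)) ≡⟫ sub s (m≤n⊔m (need e) _) le) h₂ (PC-weaken (n≤1+n s) fr₁ pcx) (VC-weaken (n≤1+n s) fr₁ vcx) ok₁
 ... | R₂ , p₂ , out fr₂ v₂ ok₂ =
  at-pc (sym (+-suc (o + size e) (size f)) ∙ +-assoc o (size e) _ ∙ cong (λ m → o + (size e + m)) (+-comm 1 (size f)))
   (at-time (+-assoc (time e π) (time f π) 1)
   (finish (p₁ ▹ p₂) (λ j< → fr₂ (<-suc j<) ∙ fr₁ j<) s≤ refl
    (do-arith s (suc s) h₃ ok₂ s≤ (cong₂ ⟦ p ⟧ (fr₂ ≤-refl ∙ v₁) v₂) (value≤X (op p e f) ok loc d≤))))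
  where
  s≤ : s ≤ K
  s≤ = fits s le (need≥1 e ⟫ m≤m⊔n _ _)
 comp-ok (mem e) {ps} {vs} {ρ} {δ} {s} {o} ok loc d≤ le h pcx vcx okR
  with code-split e ps vs s o h
 ... | h₁ , (h₂ , _)
  with comp-ok e ok loc (n≤1+n _ ⟫ d≤) le h₁ pcx vcx okR
 ... | R₁ , p₁ , out fr₁ v₁ ok₁ =
  at-pc (sym (+-suc o (size e)) ∙ cong (o +_) (+-comm 1 (size e)))
   (finish p₁ fr₁ (fits s le (need≥1 e)) refl (do-load h₂ ok₁ (fits s le (need≥1 e)) (cong (nth 0 input) v₁) (value≤X (mem e) ok loc d≤)))
 comp-ok (rnd e) {ps} {vs} {ρ} {δ} {s} {o} ok loc d≤ le h pcx vcx okR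
  with code-split e ps vs s o h
 ... | h₁ , (h₂ , _)
  with comp-ok e ok loc (n≤1+n _ ⟫ d≤) le h₁ pcx vcx okR
 ... | R₁ , p₁ , out fr₁ v₁ ok₁ =
  at-pc (sym (+-suc o (size e)) ∙ cong (o +_) (+-comm 1 (size e)))
   (finish p₁ fr₁ (fits s le (need≥1 e)) refl (do-random h₂ ok₁ (fits s le (need≥1 e)) (cong bit-of v₁) (value≤X (rnd e) ok loc d≤)))
 comp-ok (len i) {ps} {vs} {ρ} {δ} {s} {o} {R} ok loc d≤ le (h₁ , h₂ , h₃ , f₁ , f₂ , f₃ , f₄ , f₅ , f₆ , f₇ , hm) pcx vcx okR
  with do-copy (fits s le (s<s z<s)) (h₁ , h₂ , tt) okR (params pcx i)
 ... | R₁ , p₁ , out fr₁ v₁ ok₁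
  with do-set h₃ ok₁ (fits s le {1} (s<s z<s)) z≤n
 ... | R₂ , p₂ , u₂
  with Digits.digits-run {s} {3 + o} (fits s le (s<s (s<s z<s))) f₁ f₂ f₃ f₄ f₅ f₆ f₇ R (lookup π i) (lookup π i) 0 R₂ ≤-refl
   (value≤X (len {Γ = 0} i) {[]} {[]} tt (local λ ()) d≤)
   (inv (λ j< → keep u₂ (fits s le {1} (s<s z<s)) (<-suc j<) ∙ fr₁ j<) (keep u₂ (fits s le {1} (s<s z<s)) ≤-refl ∙ v₁) (val u₂) (Upd.ok u₂))
 ... | R₃ , p₃ , inv bel₃ cnt₃ accum₃ ok₃ =
  at-pc (eq o) (at-time (+-assoc 3 (digits (lookup π i) * 7 + 1) 2) (after (p₁ ▹ p₂ ▹ p₃) bel₃ (at-val accum₃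
   (do-back (fits s le (s<s (s<s z<s))) (subst (λ k → At k (mov s (suc s) (2 + s))) (cong (3 +_) (+-comm 7 o)) hm) ok₃))))
  where
  eq : ∀ o → 2 + (3 + o + 7) ≡ o + 12
  eq = ring
 comp-ok (call {Δ = Δ} f es) {ps} {vs} {ρ} {δ} {s} {o} ok loc d≤ le h pcx vcx okR
  with at-++-size o (comps es ps vs s o) (length-comps K es) h
 ... | h₁ , h'
  with code-split f ps (range Δ s) (Δ + s) (o + sizes es) h'
 ... | h₂ , h₃
  with comps-ok es (T-snd {smallΠ κ f} ok) loc (m≤n+m _ (degree f (degrees es δ)) ⟫ d≤) (sub s (m≤m⊔n (needs es) _) le) h₁ pcx vcx okR
 ... | R₁ , p₁ , fr₁ , vc₁ , ok₁
  with comp-ok f {R = R₁} (T-fst ok) (values< es (T-snd {smallΠ κ f} ok) loc)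
   (m≤m+n (degree f (degrees es δ)) _ ⟫ d≤)
   (cong (_+ need f) (+-comm Δ s) ∙ +-assoc s Δ (need f) ≡⟫ sub s (m≤m⊔n (Δ + need f) _ ⟫ m≤n⊔m (needs es) _) le)
   h₂ (PC-weaken (m≤n+m s Δ) fr₁ pcx) vc₁ ok₁
 ... | R₂ , p₂ , out fr₂ v₂ ok₂ =
  at-pc (eq o (sizes es) (size f)) (at-time (+-assoc (times es π) (time f π) 2)
   (after (p₁ ▹ p₂) (λ j< → fr₂ (j< ⟫ m≤n+m s Δ) ∙ fr₁ j<) (at-val v₂
    (do-mov s (Δ + s) (suc (Δ + s)) h₃ ok₂ (m≤n+m s Δ ⟫ Δs≤) Δs≤ Δs+1≤ (<⇒≢ ≤-refl) (m≤n+m s Δ ⟫ n≤1+n _)))))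
  where
  le' : s + (Δ + 2) ≤ suc K
  le' = sub s (m≤n⊔m (Δ + need f) (Δ + 2) ⟫ m≤n⊔m (needs es) _) le
  Δs≤ : Δ + s ≤ K
  Δs≤ = fits s le' (m<m+n Δ z<s)
  Δs+1≤ : suc (Δ + s) ≤ K
  Δs+1≤ = fits s le' (≤-reflexive (+-comm 2 Δ))
  eq : ∀ o a m → 2 + (o + a + m) ≡ o + (a + (m + 2))
  eq = ring
 comp-ok (sum i e) {ps} {vs} {ρ} {δ} {s} {o} {R} ok loc d≤ le h pcx vcx okR =
  at-val (iterate-+ (lookup π i) _ 0)
   (Fold.fold-ok e (comp-ok e) {ps} {vs} {ρ} {δ} {s} {o} {R} {i} add 0 (λ j a → a + ∑ j (λ k → ⟦ e ⟧ᵉ π (k ∷ ρ)) ≡ ⟦ sum i e ⟧ᵉ π ρ) z≤n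
    (λ {j} {a} _ eq → (+-assoc a _ _ ∙ cong (a +_) (+-comm (⟦ e ⟧ᵉ π (j ∷ ρ)) _)) ∙ eq ,
     +-monoʳ a (m≤n+m (⟦ e ⟧ᵉ π (j ∷ ρ)) (∑ j (λ k → ⟦ e ⟧ᵉ π (k ∷ ρ)))) ⟫ eq ≡⟫ value≤X (sum i e) ok loc d≤)
    refl ok loc (m≤n+m (degree e (1 ∷ δ)) 2 ⟫ d≤) le h pcx vcx okR)
 comp-ok (prod i e) {ps} {vs} {ρ} {δ} {s} {o} {R} ok loc d≤ le h pcx vcx okR =
  at-val (iterate-* (lookup π i) _ 1 ∙ *-identityˡ _)
   (Fold.fold-ok e (comp-ok e) {ps} {vs} {ρ} {δ} {s} {o} {R} {i} mul 1 A (z<s ⟫ 2≤X) (λ {j} {a} → A-step {j} {a}) (≤-reflexive (*-identityˡ _))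
    (T-snd {lookup κ i} ok) loc (m≤n+m (degree e (1 ∷ δ)) 2 ⟫ d≤) le h pcx vcx okR)
  where
  c = lookup π i
  B = bnd (degree e (1 ∷ δ))
  A : ℕ → ℕ → Set
  -- A partial product may exceed the final one, since a later factor may be 0. Hence it is bounded
  -- together with the largest possible value of the factors to come.
  A j a = a * B ^ j ≤ B ^ c
  A-step : ∀ {j a} → j < c → A (suc j) a → A j (a * ⟦ e ⟧ᵉ π (j ∷ ρ)) × a * ⟦ e ⟧ᵉ π (j ∷ ρ) ≤ X
  A-step {j} {a} j< h = bound , (m≤m*n _ (B ^ j) {{m^n≢0 B j {{>-nonZero (1≤bnd (degree e (1 ∷ δ)))}}}} ⟫ bound) ⟫
   bnd-pow c (κ≤ i (T⇒≡ (T-fst ok))) ⟫ bnd≤X d≤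
   where
   bound : a * ⟦ e ⟧ᵉ π (j ∷ ρ) * B ^ j ≤ B ^ c
   bound = *-monoˡ (B ^ j) (*-monoʳ a (<⇒≤ (value< e {δ = 1 ∷ δ} (T-snd {lookup κ i} ok)
    (local-∷ (idx< {i} j<) loc)))) ⟫
    *-assoc a B (B ^ j) ≡⟫ h
 comp-ok (iter i cap e₀ e) ok loc d≤ le h pcx vcx okR = Iter.iter-ok i cap e₀ e (comp-ok e₀) (comp-ok e) ok loc d≤ le h pcx vcx okR

 comps-ok [] {s = s} {o = o} {R} ok loc d≤ le h pcx vcx okR =
  R , subst (λ k → Path 0 (st o R) (st k R)) (sym (n+0≡n o)) done , (λ _ → refl) , vc (λ ()) , okR
 comps-ok {Δ = suc Δ} (e ∷ es) {ps} {vs} {ρ} {δ} {s} {o} {R} ok loc d≤ le h pcx vcx okR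
  with code-split e ps vs s o h
 ... | h₁ , h₂
  with comp-ok e (T-fst ok) loc (m≤m+n (degree e δ) _ ⟫ d≤) (sub s (m≤m⊔n (need e) _) le) h₁ pcx vcx okR
 ... | R₁ , p₁ , out fr₁ v₁ ok₁
  with comps-ok es {R = R₁} (T-snd {smallΠ κ e} ok) loc (m≤n+m _ (degree e δ) ⟫ d≤)
   (sym (+-suc s (needs es)) ≡⟫ sub s (m≤n⊔m (need e) _) le) h₂
   (PC-weaken (n≤1+n s) fr₁ pcx) (VC-weaken (n≤1+n s) fr₁ vcx) ok₁
 ... | R₂ , p₂ , fr₂ , vc₂ , ok₂ = R₂ ,
  subst (λ k → Path (time e π + times es π) (st o R) (st k R₂)) (+-assoc o (size e) (sizes es)) (p₁ ▹ p₂) ,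
  (λ j< → fr₂ (<-suc j<) ∙ fr₁ j<) ,
  VC-∷ (m<n+m s {suc Δ} z<s) (fr₂ ≤-refl ∙ v₁) (subst (λ k → VC (range Δ (suc s)) (⟦ es ⟧ᵉˢ π ρ) k R₂) (+-suc Δ s) vc₂) , ok₂

-- Whole programs: definitions, sweeps and the run of the machine.

-- Parameters are computed one after the other; sweep evaluates its expression
-- for every block number below a parameter and accepts at the first nonzero value.
data Prog : ℕ → Set where
 def : Exp lo P 0 → Prog (suc P) → Prog P
 sweep : Fin P → Exp lo P 0 → Prog P → Prog P
 stop : Prog P

-- Cells 0 and 1 of the input hold n and d, which the input size dominates because the encoding has
-- at least that many cells. The number of digits of any admissible parameter is small too.
small : Vec Bool P → Exp lo P 0 → Bool
small κ (par i) = lookup κ i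
small κ (lit c) = true
small κ (op o e f) = small κ e ∧ small κ f
small κ (mem (lit 0)) = true
small κ (mem (lit 1)) = true
small κ (len i) = true
small κ _ = false

valueDegree : Exp lo P 0 → ℕ
valueDegree (lit c) = suc c
valueDegree (op o e f) = suc (valueDegree e + valueDegree f)
valueDegree _ = 1

any : ℕ → (ℕ → ℕ) → Bool
any zero f = false
any (suc n) f with f n
... | zero = any n f
... | suc _ = true

module _ (μ φ : ℕ → ℕ) where
 open Semantics μ φ

 accepts : Prog P → Vec ℕ P → Bool
 accepts (def e p) π = accepts p (⟦_⟧ᵉ 0 e π [] ∷ π)
 accepts (sweep i e p) π = any (lookup π i) (λ b → ⟦_⟧ᵉ b e π []) ∨ accepts p π
 accepts stop π = false

 timeᵖ : Prog P → Vec ℕ P → ℕ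
 timeᵖ (def e p) π = time e π + timeᵖ p (⟦_⟧ᵉ 0 e π [] ∷ π)
 timeᵖ (sweep i e p) π = (3 + lookup π i * (4 + time e π)) + timeᵖ p π
 timeᵖ stop π = 0

 Fine : ℕ → Prog P → Vec Bool P → Vec ℕ P → Set
 Fine σ (def e p) κ π =
  let v = ⟦_⟧ᵉ 0 e π [] in
  T (smallΠ κ e) × v < 2 ^ σ × (small κ e ≡ true → v ≤ σ) × Fine σ p (small κ e ∷ κ) (v ∷ π)
 Fine σ (sweep i e p) κ π = T (smallΠ κ e) × Fine σ p κ π
 Fine σ stop κ π = ⊤

needᵖ : Prog P → ℕ
needᵖ (def e p) = need e ⊔ suc (needᵖ p)
needᵖ (sweep i e p) = need e ⊔ needᵖ p
needᵖ stop = 1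

degreeᵖ : Prog P → ℕ
degreeᵖ (def e p) = degree e [] ⊔ degreeᵖ p
degreeᵖ (sweep i e p) = degree e [] ⊔ degreeᵖ p
degreeᵖ stop = 1

-- Each definition replaces the common bound σ by a power of σ, so the exponents multiply.
growth : Prog P → ℕ
growth (def e p) = suc (degree e [] + valueDegree e) * growth p
growth (sweep i e p) = growth p
growth stop = 1

okProducts : Vec Bool P → Prog P → Bool
okProducts κ (def e p) = smallΠ κ e ∧ okProducts (small κ e ∷ κ) p
okProducts κ (sweep i e p) = smallΠ κ e ∧ okProducts κ p
okProducts κ stop = true

countdown : ∀ P → Vec ℕ P
countdown zero = []
countdown (suc P) = suc P ∷ countdown P

countdown≤ : ∀ P i → lookup (countdown P) i < suc P
countdown≤ (suc P) zero = ≤-refl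
countdown≤ (suc P) (suc i) = <-suc (countdown≤ P i)

countdown≢0 : ∀ {P} i → lookup (countdown P) i ≢ 0
countdown≢0 {suc P} zero ()
countdown≢0 {suc P} (suc i) = countdown≢0 i

module _ (K : ℕ) where
 open Compiler K

 compᵖ : Prog P → ℕ → List I
 compᵖ {P} (def e p) o = comp e (countdown P) [] (suc P) o ++ compᵖ p (o + size e)
 -- Register 0 is the counter of the sweep and at the same time the block number that the body
 -- reads.
 compᵖ {P} (sweep i e p) o =
  set (reg (suc P)) 0 ∷ arith add (reg 0) (reg (lookup (countdown P) i)) (reg (suc P)) ∷
  jz (reg 0) (5 + o + (size e + 2)) ∷ set (reg (suc P)) 1 ∷ arith monus (reg 0) (reg 0) (reg (suc P)) ∷
  (comp e (countdown P) [] (suc P) (5 + o) ++ jz (reg (suc P)) (2 + o) ∷ accept ∷ compᵖ p (5 + o + (size e + 2)))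
 compᵖ stop o = reject ∷ []

small-value : ∀ {P σ} (2≤σ : 2 ≤ σ) μ φ (κ : Vec Bool P) π → Small σ κ π →
 Under σ π → μ 0 ≤ σ → μ 1 ≤ σ →
 ∀ e → small κ e ≡ true → Semantics.⟦_⟧ᵉ μ φ 0 e π [] ≤ σ ^ valueDegree e
small-value {P} {σ} 2≤σ μ φ κ π κ≤ π< μ₀ μ₁ = go
 where
 instance
  σ≢0 : NonZero σ
  σ≢0 = >-nonZero (z<s ⟫ 2≤σ)
 σ¹ : ∀ {x} → x ≤ σ → x ≤ σ ^ 1
 σ¹ h = h ⟫≡ sym (^-identityʳ σ)
 mono : ∀ {a c} → a ≤ c → σ ^ a ≤ σ ^ c
 mono = ^-monoʳ σ
 ∧₁ : ∀ {x y} → x ∧ y ≡ true → x ≡ true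
 ∧₁ {true} {true} _ = refl
 ∧₂ : ∀ {x y} → x ∧ y ≡ true → y ≡ true
 ∧₂ {true} {true} _ = refl
 ops : ∀ o {x y a c} → x ≤ σ ^ a → y ≤ σ ^ c → ⟦ o ⟧ x y ≤ σ ^ suc (a + c)
 ops add {x} {y} {a} {c} x≤ y≤ = +-mono (x≤ ⟫ mono (m≤m+n a c)) (y≤ ⟫ mono (m≤n+m c a)) ⟫
  cong (σ ^ (a + c) +_) (sym (n+0≡n _)) ≡⟫ *-monoˡ (σ ^ (a + c)) 2≤σ
 ops monus {x} {y} {a} {c} x≤ y≤ = m∸n≤m x y ⟫ x≤ ⟫ mono (m≤m+n a c ⟫ n≤1+n _)
 ops mul {x} {y} {a} {c} x≤ y≤ = *-mono x≤ y≤ ⟫ sym (^-+ σ a c) ≡⟫ mono (n≤1+n (a + c))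
 ops div {x} {zero} x≤ y≤ = z≤n
 ops div {x} {suc y} {a} {c} x≤ y≤ = m/n≤m x (suc y) ⟫ x≤ ⟫ mono (m≤m+n a c ⟫ n≤1+n _)
 go : ∀ e → small κ e ≡ true → Semantics.⟦_⟧ᵉ μ φ 0 e π [] ≤ σ ^ valueDegree e
 go (par i) h = σ¹ (κ≤ i h)
 go (lit c) h = <⇒≤ (n<2^n c) ⟫ ^-monoˡ c 2≤σ ⟫ mono (n≤1+n c)
 go (op o e f) h = ops o {a = valueDegree e} {valueDegree f} (go e (∧₁ h)) (go f (∧₂ {small κ e} h))
 go (mem (lit 0)) h = σ¹ μ₀
 go (mem (lit 1)) h = σ¹ μ₁
 go (len i) h = σ¹ (digits-≤ (π< i))

fine : ∀ {P} σ σ' (2≤σ : 2 ≤ σ) (p : Prog P) κ π μ φ → σ ^ growth p ≤ σ' → T (okProducts κ p) →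
 Small σ κ π → Under σ π →
 (∀ i → μ i < 2 ^ σ) → (∀ i → φ i ≤ 1) → μ 0 ≤ σ → μ 1 ≤ σ → Fine μ φ σ' p κ π
growth≥1 : ∀ (p : Prog P) → 1 ≤ growth p
growth≥1 (def e p) = growth≥1 p ⟫ m≤m+n _ _
growth≥1 (sweep i e p) = growth≥1 p
growth≥1 stop = z<s
fine σ σ' 2≤σ stop κ π μ φ σ≤ ok κ≤ π< μ< φ≤ μ₀ μ₁ = tt
fine σ σ' 2≤σ (sweep i e p) κ π μ φ σ≤ ok κ≤ π< μ< φ≤ μ₀ μ₁ =
 T-fst ok , fine σ σ' 2≤σ p κ π μ φ σ≤ (T-snd {smallΠ κ e} ok) κ≤ π< μ< φ≤ μ₀ μ₁
fine {P} σ σ' 2≤σ (def e p) κ π μ φ σ≤ ok κ≤ π< μ< φ≤ μ₀ μ₁ =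
 T-fst ok , v<₁ ⟫ ^-monoʳ 2 σ₁≤ , (λ sm → v≤₁ sm ⟫ σ₁≤) ,
 fine σ₁ σ' 2≤σ₁ p (small κ e ∷ κ) (v ∷ π) μ φ
  (^-*-assoc σ d (growth p) ≡⟫ σ≤) (T-snd {smallΠ κ e} ok)
  (λ { zero sm → v≤₁ sm ; (suc i) h → κ≤ i h ⟫ σ≤₁ })
  (λ { zero → v<₁ ; (suc i) → π< i ⟫ ^-monoʳ 2 σ≤₁ })
  (λ i → μ< i ⟫ ^-monoʳ 2 σ≤₁) φ≤ (μ₀ ⟫ σ≤₁) (μ₁ ⟫ σ≤₁)
 where
 open Bounds σ 2≤σ
 d = suc (degree e [] + valueDegree e)
 σ₁ = σ ^ d
 v = Semantics.⟦_⟧ᵉ μ φ 0 e π []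
 0<2^σ : 0 < 2 ^ σ
 0<2^σ = 1≤2^ σ
 σ≤₁ : σ ≤ σ₁
 σ≤₁ = σ≤σ^ {d} z<s
 2≤σ₁ : 2 ≤ σ₁
 2≤σ₁ = 2≤σ ⟫ σ≤₁
 v<₁ : v < 2 ^ σ₁
 v<₁ = subst (v <_) (bnd-def (degree e [])) (Bounded.value< (bounded κ π μ φ 0 π< μ< φ≤ 0<2^σ κ≤) e (T-fst ok) (local λ ())) ⟫
  ^-monoʳ 2 (σ^-mono (m≤m+n (degree e []) (valueDegree e) ⟫ n≤1+n _))
 v≤₁ : small κ e ≡ true → v ≤ σ₁
 v≤₁ sm = small-value 2≤σ μ φ κ π κ≤ π< μ₀ μ₁ e sm ⟫ σ^-mono (m≤n+m (valueDegree e) (degree e []) ⟫ n≤1+n _)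
 σ₁≤ : σ₁ ≤ σ'
 σ₁≤ = (cong (σ ^_) (sym (n*1≡n d)) ≡⟫ σ^-mono (*-monoʳ d (growth≥1 p))) ⟫ σ≤

record BoundedMachine : Set where
 constructor boundedMachine
 field
  {K L} : ℕ
  Pg : Program (suc K)
  ω : Vec Bool L
  input : List ℕ
  σ : ℕ
  2≤σ : 2 ≤ σ
  D : ℕ
  μ< : ∀ i → nth 0 input i < 2 ^ σ
  2≤X : 2 ≤ Bounds.bnd σ 2≤σ D

module RunProg (M : BoundedMachine) where

 open BoundedMachine M
 open Bounds σ 2≤σ

 X : ℕ
 X = bnd D

 E : Machine
 E = machine Pg ω input X 2≤X

 open Compiler K
 open Execution E

 record Parametrized : Set where
  constructor parametrized
  field
   {N} : ℕ
   κ : Vec Bool N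
   π : Vec ℕ N
   π< : Under σ π
   κ≤ : Small σ κ π

  context : ∀ b → b < 2 ^ σ → BoundedRun
  context b b< = boundedRun E σ 2≤σ κ π b D bnd-mono π< μ< b< κ≤

 μ : ℕ → ℕ
 μ = nth 0 input

 record Halts (S : State (suc K)) (r : Bool) : Set where
  field
   last : Regs
   at : ℕ
   here : S ≡ st at last
   fitting : OK last
   final : fetch Pg at ≡ (if r then accept else reject)

 record Params {P} (π : Vec ℕ P) (b : ℕ) (R : Regs) : Set where
  field
   params : ∀ i → get R (lookup (countdown P) i) ≡ lookup π i
   block : get R 0 ≡ b

 open Params

 Result : ∀ (p : Prog P) (π : Vec ℕ P) (o : ℕ) (R : Regs) → Set
 Result p π o R = ∃ λ t → ∃ λ S → t ≤ timeᵖ μ bit-of p π × Path t (st o R) S × Halts S (accepts μ bit-of p π)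

 record Code : Set where
  constructor code
  field
   Q : Parametrized
  open Parametrized Q public
  field
   e : Exp lo N 0
   i : Fin N
   okₑ : T (smallΠ κ e)
   d≤ : degree e [] ≤ D
   le : suc N + need e ≤ suc K
   {o} : ℕ
   f₁ : fetch Pg o ≡ jz (reg 0) (3 + o + (size e + 2))
   f₂ : fetch Pg (1 + o) ≡ set (reg (suc N)) 1
   f₃ : fetch Pg (2 + o) ≡ arith monus (reg 0) (reg 0) (reg (suc N))
   h : At (3 + o) (comp e (countdown N) [] (suc N) (3 + o))
   f₄ : fetch Pg (3 + o + size e) ≡ jz (reg (suc N)) o
   f₅ : fetch Pg (suc (3 + o + size e)) ≡ accept

 module Sweep (C : Code) where

  open Code C

  f : ℕ → ℕ
  f b = Semantics.⟦_⟧ᵉ μ bit-of b e π []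

  private
   P<K : suc N ≤ K
   P<K = s≤s⁻¹ (+-comm 1 (suc N) ≡⟫ +-monoʳ (suc N) (need≥1 e) ⟫ le)

   cd≢ : ∀ i → lookup (countdown N) i ≢ suc N
   cd≢ i = <⇒≢ (countdown≤ N i)

   cd≤ : ∀ i → lookup (countdown N) i ≤ K
   cd≤ i = <⇒≤ (countdown≤ N i) ⟫ P<K

   bound' : ∀ {j t} → t ≤ 1 + j * (4 + time e π) → 3 + (time e π + 1) + t ≤ 1 + suc j * (4 + time e π)
   bound' {j} t≤ = +-monoʳ (3 + (time e π + 1)) t≤ ⟫≡ arith-eq (time e π) (j * (4 + time e π))
    where
    arith-eq : ∀ a b → 3 + (a + 1) + (1 + b) ≡ 1 + (4 + a + b)
    arith-eq = ring

  sweep-run : ∀ j {R} → j ≤ lookup π i → Params π j R → OK R →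
   (any j f ≡ true × ∃ λ t → ∃ λ S → t ≤ 1 + j * (4 + time e π) × Path t (st o R) S × Halts S true)
   ⊎ (any j f ≡ false × ∃ λ t → Σ Regs λ R' → t ≤ 1 + j * (4 + time e π) × Path t (st o R) (st (3 + o + (size e + 2)) R') × Params π 0 R' × OK R')
  sweep-run zero {R} j≤ pa okR = inj₂ (refl , 1 , R , z<s , do-jz0 0 f₁ okR (block pa) , pa , okR)
  sweep-run (suc j) {R} j≤ pa okR
   with do-set f₂ okR P<K (z<s ⟫ 2≤X)
  ... | R₁ , p₁ , u₁
   with do-arith 0 (suc N) {j} f₃ (Upd.ok u₁) z≤n (cong₂ _∸_ ((same u₁ z≤n λ ()) ∙ block pa) (val u₁))
    (n≤1+n j ⟫ subst (_≤ X) (block pa) (okR 0))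
  ... | R₂ , p₂ , u₂
   with Correct.comp-ok (context j (j≤ ⟫ <⇒≤ (π< i))) e {vs = []} {R = R₂} okₑ (local λ ()) d≤ le h
    (Correct.pc (λ i → countdown≤ N i , same u₂ (cd≤ i) (countdown≢0 i) ∙ same u₁ (cd≤ i) (cd≢ i) ∙ params pa i)
     (z<s , val u₂)) (Correct.vc λ ()) (Upd.ok u₂)
  ... | R₃ , p₃ , out fr v g
   with f j in eq
  ... | suc m = inj₁ (refl , _ , _ , bound , path , record { last = R₃ ; at = suc (3 + o + size e) ; here = refl ; fitting = g ; final = f₅ })
   where
   path = do-jz1 0 f₁ okR (block pa) ▹ (p₁ ▹ p₂ ▹ p₃ ▹ do-jz1 (suc N) f₄ g (v ∙ eq))
   bound : 3 + (time e π + 1) ≤ 1 + suc j * (4 + time e π)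
   bound = cong (3 +_) (+-comm (time e π) 1) ≡⟫ m≤m+n _ (j * (4 + time e π)) ⟫ n≤1+n _
  ... | zero with sweep-run j {R₃} (n≤1+n j ⟫ j≤)
   (record { params = λ i → fr (countdown≤ N i) ∙ same u₂ (cd≤ i) (countdown≢0 i) ∙ same u₁ (cd≤ i) (cd≢ i) ∙ params pa i
    ; block = fr z<s ∙ val u₂ }) g
  ... | inj₁ (eq' , t , S , t≤ , q , H) = inj₁ (eq' , _ , S , bound' {j} t≤ , path ▹ q , H)
   where
   path = do-jz1 0 f₁ okR (block pa) ▹ (p₁ ▹ p₂ ▹ p₃ ▹ do-jz0 (suc N) f₄ g (v ∙ eq))
  ... | inj₂ (eq' , t , R₄ , t≤ , q , pa₄ , ok₄) = inj₂ (eq' , _ , R₄ , bound' {j} t≤ , path ▹ q , pa₄ , ok₄)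
   where
   path = do-jz1 0 f₁ okR (block pa) ▹ (p₁ ▹ p₂ ▹ p₃ ▹ do-jz0 (suc N) f₄ g (v ∙ eq))

 P<K : ∀ {P m} (e : Exp lo P 0) → suc P + (need e ⊔ m) ≤ suc K → suc P ≤ K
 P<K {P} e le = s≤s⁻¹ (+-comm 1 (suc P) ≡⟫ +-monoʳ (suc P) (need≥1 e ⟫ m≤m⊔n (need e) _) ⟫ le)

 run-prog : ∀ (p : Prog P) κ π {o R} → Under σ π → Small σ κ π →
  Fine μ bit-of σ p κ π → degreeᵖ p ≤ D → suc P + needᵖ p ≤ suc K → At o (compᵖ K p o) → Params π 0 R → OK R →
  Result p π o R
 run-prog {P} stop κ π {o} {R} π< κ≤ F d≤ le (h , _) pa okR =
  0 , _ , z≤n , done , record { last = R ; at = o ; here = refl ; fitting = okR ; final = h }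
 run-prog {P} (def e p) κ π {o} {R} π< κ≤ (ok , v< , v≤ , F) d≤ le h pa okR
  with at-++-size o (comp e (countdown P) [] (suc P) o) (length-comp K e) h
 ... | h₁ , h₂
  with Correct.comp-ok (Parametrized.context (parametrized κ π π< κ≤) 0 (1≤2^ σ)) e {vs = []} {R = R} ok (local λ ()) (m≤m⊔n (degree e []) _ ⟫ d≤)
   (+-monoʳ (suc P) (m≤m⊔n (need e) _) ⟫ le) h₁
   (Correct.pc (λ i → countdown≤ P i , params pa i) (z<s , block pa)) (Correct.vc λ ()) okR
 ... | R₁ , p₁ , out fr v g
  with run-prog p (small κ e ∷ κ) (Semantics.⟦_⟧ᵉ μ bit-of 0 e π [] ∷ π) {R = R₁}
   (λ { zero → v< ; (suc i) → π< i }) (λ { zero → v≤ ; (suc i) → κ≤ i }) F (m≤n⊔m (degree e []) _ ⟫ d≤)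
   (cong suc (sym (+-suc P (needᵖ p))) ≡⟫ +-monoʳ (suc P) (m≤n⊔m (need e) _) ⟫ le) h₂
   (record { params = λ { zero → v ; (suc i) → fr (countdown≤ P i) ∙ params pa i }
    ; block = fr z<s ∙ block pa }) g
 ... | t , S , t≤ , q , H = _ , S , +-monoʳ (time e π) t≤ , p₁ ▹ q , H
 run-prog {P} (sweep i e p) κ π {o} {R} π< κ≤ (ok , F) d≤ le (h₁ , h₂ , h₃ , h₄ , h₅ , h₆) pa okR
  with at-++-size (5 + o) (comp e (countdown P) [] (suc P) (5 + o)) (length-comp K e) h₆
 ... | h₇ , h₈ , h₉ , h₁₀
  with do-set h₁ okR (P<K e le) z≤n
 ... | R₁ , p₁ , u₁
  with do-arith (lookup (countdown P) i) (suc P) {lookup π i} h₂ (Upd.ok u₁) z≤n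
   (cong₂ _+_ (same u₁ (<⇒≤ (countdown≤ P i) ⟫ P<K e le) (<⇒≢ (countdown≤ P i)) ∙ params pa i) (val u₁) ∙ n+0≡n _)
   (subst (_≤ X) (params pa i) (okR _))
 ... | R₂ , p₂ , u₂
  with Sweep.sweep-run (code (parametrized κ π π< κ≤) e i ok (m≤m⊔n (degree e []) _ ⟫ d≤) (+-monoʳ (suc P) (m≤m⊔n (need e) _) ⟫ le)
   {2 + o} h₃ h₄ h₅ h₇ h₈ h₉) (lookup π i) {R₂} ≤-refl
   (record { params = λ i → same u₂ (<⇒≤ (countdown≤ P i) ⟫ P<K e le) (countdown≢0 i) ∙ same u₁ (<⇒≤ (countdown≤ P i) ⟫ P<K e le) (<⇒≢ (countdown≤ P i)) ∙ params pa i
    ; block = val u₂ }) (Upd.ok u₂)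
 ... | inj₁ (eq , t , S , t≤ , q , H) rewrite eq =
  _ , S , +-monoʳ 2 t≤ ⟫ m≤m+n _ _ , p₁ ▹ p₂ ▹ q , H
 ... | inj₂ (eq , t , R₃ , t≤ , q , pa₃ , ok₃) rewrite eq
  with run-prog p κ π {R = R₃} π< κ≤ F (m≤n⊔m (degree e []) _ ⟫ d≤) (+-monoʳ (suc P) (m≤n⊔m (need e) _) ⟫ le)
   (subst (λ k → At k (compᵖ K p (5 + o + (size e + 2)))) (sym (+-suc (5 + o) (suc (size e)) ∙ cong suc (+-suc (5 + o) (size e))) ∙ cong (5 + o +_) (+-comm 2 (size e))) h₁₀) pa₃ ok₃
 ... | u , S , u≤ , q' , H = _ , S , +-mono (+-monoʳ 2 t≤) u≤ , (p₁ ▹ p₂ ▹ q) ▹ q' , H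

nth-++ʳ : ∀ {A : Set} (d : A) xs {ys} i → nth d (xs ++ ys) (length xs + i) ≡ nth d ys i
nth-++ʳ d [] i = refl
nth-++ʳ d (x ∷ xs) i = nth-++ʳ d xs i

module Top (p : Prog 0) where

 K : ℕ
 K = needᵖ p

 Pg : Program (suc K)
 Pg = compᵖ K p 0

 record Given : Set where
  constructor given
  field
   {L} : ℕ
   ω : Vec Bool L
   input : List ℕ
   σ₀ : ℕ
   2≤σ₀ : 2 ≤ σ₀
   μ< : ∀ i → nth 0 input i < 2 ^ σ₀
   μ₀ : nth 0 input 0 ≤ σ₀
   μ₁ : nth 0 input 1 ≤ σ₀
   okp : T (okProducts [] p)

 module _ (G : Given) where

  open Given G

  private
   σ = σ₀ ^ growth p
   D = degreeᵖ p
   open Bounds σ₀ 2≤σ₀ using (σ≤σ^)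

   σ₀≤σ : σ₀ ≤ σ
   σ₀≤σ = σ≤σ^ (growth≥1 p)

   2≤σ : 2 ≤ σ
   2≤σ = 2≤σ₀ ⟫ σ₀≤σ

   μ<' : ∀ i → nth 0 input i < 2 ^ σ
   μ<' i = μ< i ⟫ ^-monoʳ 2 σ₀≤σ

  open Bounds σ 2≤σ using (bnd; bnd1; bnd-mono; bnd-def)

  private
   degreeᵖ≥1 : ∀ {P} (p : Prog P) → 1 ≤ degreeᵖ p
   degreeᵖ≥1 (def e p) = degreeᵖ≥1 p ⟫ m≤n⊔m (degree e []) _
   degreeᵖ≥1 (sweep i e p) = degreeᵖ≥1 p ⟫ m≤n⊔m (degree e []) _
   degreeᵖ≥1 stop = ≤-refl

   X = bnd D

   2≤X : 2 ≤ X
   2≤X = ((2≤σ ⟫ <⇒≤ (n<2^n σ)) ⟫≡ sym bnd1) ⟫ bnd-mono (degreeᵖ≥1 p)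

  private
   B : BoundedMachine
   B = boundedMachine Pg ω input σ 2≤σ D μ<' 2≤X

  open RunProg B hiding (X)
  open Execution (machine Pg ω input X 2≤X) using (st; Regs; OK; At; Path; step; done; next; bit-of)

  bit : ℕ → ℕ
  bit = bit-of

  private
   bit≤ : ∀ i → bit-of i ≤ 1
   bit≤ i with nth false (Vec.toList ω) i
   ... | true = ≤-refl
   ... | false = z≤n

   code-at : ∀ pre c post → Pg ≡ pre ++ (c ++ post) → At (length pre) c
   code-at pre [] post eq = tt
   code-at pre (i ∷ c) post eq =
    cong (λ P → nth reject P (length pre)) eq ∙
     cong (nth reject (pre ++ i ∷ c ++ post)) (sym (n+0≡n _)) ∙ nth-++ʳ reject pre 0 ,
    subst (λ k → At k c) (length-++ pre ∙ +-comm (length pre) 1)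
     (code-at (pre ++ i ∷ []) c post (eq ∙ sym (Data.List.Properties.++-assoc pre (i ∷ []) (c ++ post))))
    where import Data.List.Properties

   start : Vec ℕ (suc K)
   start = Vec.replicate _ 0

   result : Result p [] 0 start
   result = run-prog p [] [] (λ ()) (λ ())
    (fine σ₀ σ 2≤σ₀ p [] [] (nth 0 input) bit-of ≤-refl okp (λ ()) (λ ()) μ< bit≤ μ₀ μ₁)
    ≤-refl ≤-refl
    (code-at [] Pg [] (sym (++-identityʳ Pg)))
    (record { params = λ () ; block = lookup-replicate (reg {K} 0) 0 })
    (λ j → lookup-replicate (reg {K} j) 0 ≡⟫ z≤n)

   accepted = accepts (nth 0 input) bit-of p []

   Good : State (suc K) → Set
   Good S = Σ Regs λ R → ∃ λ o → S ≡ st o R × OK R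

   run-path : ∀ {t S S'} u → run Pg ω input u ≡ S → Path t S S' → run Pg ω input (u + t) ≡ S'
   run-path u eq done = cong (run Pg ω input) (n+0≡n u) ∙ eq
   run-path {suc t} u eq (step b e q) = cong (run Pg ω input) (+-suc u t) ∙
    run-path (suc u) (cong next eq ∙ e) q

   during : ∀ {t S S'} u → run Pg ω input u ≡ S → Path t S S' → ∀ w → w < t → Good (run Pg ω input (u + w))
   during u eq (step b e q) zero w< = _ , _ , cong (run Pg ω input) (n+0≡n u) ∙ eq , b
   during u eq (step b e q) (suc w) (s≤s w<) =
    subst (λ k → Good (run Pg ω input k)) (sym (+-suc u w)) (during (suc u) (cong next eq ∙ e) q w w<)

   t₀ = fst result
   S₀ = fst (snd result)
   halts = snd (snd (snd (snd result)))

   at-end : run Pg ω input t₀ ≡ S₀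
   at-end = run-path 0 refl (fst (snd (snd (snd result))))

   stay : ∀ w → run Pg ω input (t₀ + w) ≡ S₀
   stay zero = cong (run Pg ω input) (n+0≡n t₀) ∙ at-end
   stay (suc w) = cong (run Pg ω input) (+-suc t₀ w) ∙ cong next (stay w) ∙ fixed
    where
    open Halts halts renaming (at to pc₀)
    fix : ∀ r → exec ω (if r then accept else reject) S₀ ≡ S₀
    fix true = refl
    fix false = refl
    fixed : next S₀ ≡ S₀
    fixed = cong (λ S → exec ω (fetch Pg (State.pc S)) S₀) here ∙ cong (λ i → exec ω i S₀) final ∙ fix accepted

  prog-output : ∀ {T} → timeᵖ (nth 0 input) bit p [] ≤ T → output Pg ω input T ≡ just (accepts (nth 0 input) bit p [])
  prog-output {T} T≥ = cong (λ S → verdict (fetch Pg (State.pc S)))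
   (cong (run Pg ω input) (sym (m+[n∸m] (fst (snd (snd result)) ⟫ T≥))) ∙ stay (T ∸ t₀)) ∙
   cong (λ S → verdict (fetch Pg (State.pc S))) here ∙ cong verdict final ∙ lem accepted
   where
   open Halts halts renaming (at to pc₀)
   lem : ∀ r → verdict {suc K} (if r then accept else reject) ≡ just r
   lem true = refl
   lem false = refl

  private
   good : ∀ t → Good (run Pg ω input t)
   good t with t <? t₀
   ... | yes t< = during 0 refl (fst (snd (snd (snd result)))) t t<
   ... | no t≮ = _ , _ , (cong (run Pg ω input) (sym (m+[n∸m] (≮⇒≥ t≮))) ∙ stay (t ∸ t₀)) ∙ here , fitting
    where open Halts halts renaming (at to pc₀)

   all≤ : ∀ {k} (R : Vec ℕ k) Y → (∀ i → lookup R i ≤ Y) → bits (Vec.toList R) ≤ k * (1 + digits Y)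
   all≤ [] Y h = z≤n
   all≤ (x ∷ R) Y h = +-mono (s≤s (⌈log₂⌉-mono-≤ (s≤s (h zero)))) (all≤ R Y (λ i → h (suc i)))

   reg-onto : ∀ {K} (i : Fin (suc K)) → Σ ℕ λ j → reg {K} j ≡ i
   reg-onto {zero} zero = 0 , refl
   reg-onto {suc K} zero = 0 , refl
   reg-onto {suc K} (suc i) with reg-onto i
   ... | j , eq = suc j , cong suc eq

  -- Registers are bounded along the whole path, the memory never changes, and after the path the
  -- machine stays in its halting state.
  prog-space : ∀ t → space (run Pg ω input t) ≤ suc K * (2 + (σ₀ ^ growth p) ^ degreeᵖ p) + bits input
  prog-space t with good t
  ... | R , o , eq , okR = cong space eq ≡⟫ +-monoˡ (bits input)
   (all≤ R X (λ i → subst (λ r → lookup R r ≤ X) (snd (reg-onto i)) (okR (fst (reg-onto i)))) ⟫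
    *-monoʳ (suc K) (s≤s (digits-≤ X<)))
   where
   X< : X < 2 ^ suc (σ ^ D)
   X< = ≤-<-trans (≤-reflexive (bnd-def D)) (^-monoʳ-< 2 (s<s z<s) (n<1+n (σ ^ D)))

-- The two trials as expressions.

infixl 6 _⊕_ _⊖_
infixl 7 _⊗_ _⊘_

_⊕_ _⊖_ _⊗_ _⊘_ : Exp ℓ P Γ → Exp ℓ P Γ → Exp ℓ P Γ
_⊕_ = op add
_⊖_ = op monus
_⊗_ = op mul
_⊘_ = op div

x₀ : Exp ℓ P (1 + Γ)
x₀ = var zero

x₁ : Exp ℓ P (2 + Γ)
x₁ = var (suc zero)

x₂ : Exp ℓ P (3 + Γ)
x₂ = var (suc (suc zero))

x₃ : Exp ℓ P (4 + Γ)
x₃ = var (suc (suc (suc zero)))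

x₄ : Exp ℓ P (5 + Γ)
x₄ = var (suc (suc (suc (suc zero))))

modE ltE eqE minE : Exp ℓ P 2
modE = x₀ ⊖ (x₀ ⊘ x₁) ⊗ x₁
ltE = lit 1 ⊖ ((lit 1 ⊕ x₀) ⊖ x₁)
eqE = lit 1 ⊖ ((x₀ ⊖ x₁) ⊕ (x₁ ⊖ x₀))
minE = x₀ ⊖ (x₀ ⊖ x₁)

selE : Exp ℓ P 3
selE = x₀ ⊗ x₁ ⊕ (lit 1 ⊖ x₀) ⊗ x₂

-- Entry k has its sign in cell 2 + 2k and its absolute value in cell 3 + 2k, after the cells of n
-- and d. Positive and negative parts are kept apart since the machine has natural numbers only.
posE negE : Exp ℓ P 1
posE = mem (lit 3 ⊕ lit 2 ⊗ x₀) ⊗ (lit 1 ⊖ mem (lit 2 ⊕ lit 2 ⊗ x₀))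
negE = mem (lit 3 ⊕ lit 2 ⊗ x₀) ⊗ mem (lit 2 ⊕ lit 2 ⊗ x₀)

P# : ℕ
P# = 31

nᵖ Dᵖ Oᵖ mᵖ lam1ᵖ Gamᵖ Bᵖ BIGᵖ Nᵖ bbᵖ cpᵖ cqᵖ Ypᵖ Yqᵖ K2ᵖ Wᵖ SLᵖ Lwᵖ NNᵖ R1ᵖ R2ᵖ : Fin P#
nᵖ = # 30
Dᵖ = # 29
Oᵖ = # 27
mᵖ = # 26
lam1ᵖ = # 23
Gamᵖ = # 21
Bᵖ = # 20
BIGᵖ = # 19
Nᵖ = # 15
bbᵖ = # 14
cpᵖ = # 12
cqᵖ = # 11
Ypᵖ = # 10
Yqᵖ = # 9
K2ᵖ = # 7
Wᵖ = # 6
SLᵖ = # 5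
Lwᵖ = # 4
NNᵖ = # 3
R1ᵖ = # 1
R2ᵖ = # 0

-- Loop counts are fixed parameters, so 2^i is a product of W factors, i of which are 2 and the
-- others 1; beyond W it saturates.
pow2E : ∀ {ℓ} → Exp ℓ P# 1
pow2E = prod Wᵖ (lit 1 ⊕ call ltE (x₀ ∷ x₁ ∷ []))

bitE : ∀ {ℓ} → Exp ℓ P# 2
bitE = call modE (x₀ ⊘ call pow2E (x₁ ∷ []) ∷ lit 2 ∷ [])

-- Each repetition owns SL consecutive words of W bits. Reducing the word number modulo SL keeps a
-- trial inside its own words, which makes the repetitions of a sweep independent.
wordE : Exp lo P# 1
wordE = sum Wᵖ (rnd ((blk ⊗ par SLᵖ ⊕ call modE (x₁ ∷ par SLᵖ ∷ [])) ⊗ par Wᵖ ⊕ x₀) ⊗ call pow2E (x₀ ∷ []))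

lower : ∀ {Γ} → Exp hi P# Γ → Exp lo P# Γ
lowers : ∀ {Γ Δ} → Vec (Exp hi P# Γ) Δ → Vec (Exp lo P# Γ) Δ
lower (par i) = par i
lower (var x) = var x
lower (lit c) = lit c
lower (op o e f) = op o (lower e) (lower f)
lower (mem e) = mem (lower e)
lower (rnd e) = call wordE (lower e ∷ [])
lower (len i) = len i
lower (call f es) = call (lower f) (lowers es)
lower (sum i e) = sum i (lower e)
lower (prod i e) = prod i (lower e)
lower (iter i c e₀ e) = iter i c (lower e₀) (lower e)
lowers [] = []
lowers (e ∷ es) = lower e ∷ lowers es

-- The objective is row 0, but its bound is encoded last, after all entries of u; hence the cyclic
-- shift by D - 1.
rhsE : Exp hi P# 1
rhsE = par Dᵖ ⊗ par nᵖ ⊕ call modE (x₀ ⊕ (par Dᵖ ⊖ lit 1) ∷ par Dᵖ ∷ [])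

-- Candidates are checked against the original rows, the objective included. Thus wrong guesses
-- never lead to acceptance by mistake.
verifyE : Exp hi P# 1
verifyE = lit 1 ⊖ sum Dᵖ (
 (sum nᵖ (call bitE (x₂ ∷ x₀ ∷ []) ⊗ call posE (x₁ ⊗ par nᵖ ⊕ x₀ ∷ [])) ⊕ call negE (call rhsE (x₀ ∷ []) ∷ []))
 ⊖ (sum nᵖ (call bitE (x₂ ∷ x₀ ∷ []) ⊗ call negE (x₁ ⊗ par nᵖ ⊕ x₀ ∷ [])) ⊕ call posE (call rhsE (x₀ ∷ []) ∷ [])))

-- The guesses for one row: the exponent of the power of two to which it is rounded, and its rounded
-- slack.
giE geE : Exp hi P# 1
giE = call modE (rnd (lit 2 ⊗ x₀) ∷ par Gamᵖ ∷ [])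
geE = call modE (rnd (lit 2 ⊗ x₀ ⊕ lit 1) ∷ par Gamᵖ ∷ [])

kappaE pE qE kE : Exp hi P# 0
kappaE = call modE (rnd (lit 2 ⊗ par Dᵖ) ∷ par K2ᵖ ∷ [])
pE = call modE (rnd (lit 2 ⊗ par Dᵖ ⊕ lit 1) ∷ par Ypᵖ ∷ [])
qE = call modE (rnd (lit 2 ⊗ par Dᵖ ⊕ lit 2) ∷ par Yqᵖ ∷ [])
kE = call modE (rnd (lit 2 ⊗ par Dᵖ ⊕ lit 3) ∷ par K2ᵖ ∷ [])

powBE : Exp hi P# 1
powBE = prod Dᵖ (lit 1 ⊕ call ltE (x₀ ∷ x₁ ∷ []) ⊗ (par Bᵖ ⊖ lit 1))

-- Adding O makes all coefficients nonnegative. The rounded rows become the digits of one number in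
-- base B, and the leading digit 1 makes a sum of weights count its variables.
wtE : Exp hi P# 1
wtE = sum Dᵖ (((par Oᵖ ⊕ call posE (x₀ ⊗ par nᵖ ⊕ x₁ ∷ [])) ⊖ call negE (x₀ ⊗ par nᵖ ⊕ x₁ ∷ []))
 ⊘ call pow2E (call giE (x₀ ∷ []) ∷ []) ⊗ call powBE (x₀ ∷ []))
 ⊕ call powBE (par Dᵖ ∷ [])

tgE : Exp hi P# 0
tgE = sum Dᵖ ((((par Oᵖ ⊗ call kappaE [] ⊕ call minE (call posE (call rhsE (x₀ ∷ []) ∷ []) ∷ par nᵖ ⊗ par mᵖ ∷ []))
 ⊖ call negE (call rhsE (x₀ ∷ []) ∷ []))
 ⊘ call pow2E (call giE (x₀ ∷ []) ∷ []) ⊖ call geE (x₀ ∷ [])) ⊗ call powBE (x₀ ∷ []))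
 ⊕ call kappaE [] ⊗ call powBE (par Dᵖ ∷ [])

wpE : Exp hi P# 1
wpE = call modE (call wtE (x₀ ∷ []) ∷ call pE [] ∷ [])

-- A sum of at most n residues modulo p that is congruent to the target equals the residue of the
-- target plus k p for some k ≤ n; this k is guessed.
TE : Exp hi P# 0
TE = call modE (call tgE [] ∷ call pE [] ∷ []) ⊕ call kE [] ⊗ call pE []

pwE : Exp hi P# 3
pwE = iter Wᵖ Yqᵖ (lit 1)
 (call modE (x₁ ⊗ x₁ ⊗ (call bitE (x₃ ∷ x₀ ∷ []) ⊗ x₂ ⊕ (lit 1 ⊖ call bitE (x₃ ∷ x₀ ∷ []))) ∷ x₄ ∷ []))

-- Minus the coefficient of X^τ in the product of 1 + X^(w_u) over u < v, modulo q: the sum over the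
-- field of x^(q-1-τ) times the product. As loops have fixed ranges, x runs up to Yq with an
-- indicator for x < q.
extE : Exp hi P# 2
extE = call modE (sum Yqᵖ (call ltE (x₀ ∷ call qE [] ∷ [])
 ⊗ (call pwE (x₀ ∷ (call qE [] ⊖ lit 1) ⊖ x₂ ∷ call qE [] ∷ [])
  ⊗ prod nᵖ (lit 1 ⊕ call ltE (x₀ ∷ x₂ ∷ []) ⊗ call pwE (x₁ ∷ call wpE (x₀ ∷ []) ∷ call qE [] ∷ [])))) ∷ call qE [] ∷ [])

-- Variable v is chosen exactly when the variables below v seem unable to reach the remaining target
-- on their own.
solE : Exp hi P# 0
solE = iter nᵖ NNᵖ (lit 0)
 (x₁ ⊕ call pow2E (x₀ ∷ []) ⊗ (lit 1 ⊖ call extE (x₀ ∷ call TE [] ⊖ sum nᵖ (call bitE (x₂ ∷ x₀ ∷ []) ⊗ call wpE (x₀ ∷ [])) ∷ [])))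

-- The masks 0 and 1 take care of instances with n ≤ 1 or m = 0, which the probability estimates
-- exclude.
trialA : Exp hi P# 0
trialA = call verifyE (solE ∷ []) ⊕ (call verifyE (lit 0 ∷ []) ⊕ call verifyE (lit 1 ∷ []))

LE startE : Exp hi P# 0
LE = rnd (lit 2 ⊗ par Dᵖ ⊕ lit 1)
startE = call modE (rnd (lit 2 ⊗ par Dᵖ ⊕ lit 2) ∷ par Nᵖ ∷ [])

sideE : Exp hi P# 1
sideE = call modE (x₀ ∷ lit 2 ∷ [])

-- The place of a variable among those on its side of the splitting L, that is, the bit of a half
-- index that decides it.
rankE : Exp hi P# 2
rankE = sum nᵖ (call ltE (x₀ ∷ x₁ ∷ []) ⊗ call eqE (call bitE (LE' ∷ x₀ ∷ []) ∷ x₂ ∷ []))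
 where
 LE' : Exp hi P# 3
 LE' = call LE []

xbE : Exp hi P# 2
xbE = call eqE (call bitE (call LE [] ∷ x₁ ∷ []) ∷ call sideE (x₀ ∷ []) ∷ [])
 ⊗ call bitE (x₀ ⊘ lit 2 ∷ call rankE (x₁ ∷ call sideE (x₀ ∷ []) ∷ []) ∷ [])

swE mskE : Exp hi P# 1
swE = sum nᵖ (call xbE (x₁ ∷ x₀ ∷ []) ⊗ call wtE (x₀ ∷ []))
mskE = sum nᵖ (call xbE (x₁ ∷ x₀ ∷ []) ⊗ call pow2E (x₀ ∷ []))

-- On side 0 the key is BIG plus the partial sum, on side 1 it is BIG plus the target minus the
-- partial sum, so the two halves of a solution have equal keys. The summand BIG keeps the
-- subtraction exact.
keyE : Exp hi P# 1
keyE = (par BIGᵖ ⊕ call sideE (x₀ ∷ []) ⊗ call tgE [] ⊕ (lit 1 ⊖ call sideE (x₀ ∷ [])) ⊗ call swE (x₀ ∷ []))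
 ⊖ call sideE (x₀ ∷ []) ⊗ call swE (x₀ ∷ [])

stepE : Exp hi P# 1
stepE = call modE (rnd (lit 2 ⊗ par Dᵖ ⊕ lit 3 ⊕ call keyE (x₀ ∷ [])) ∷ par Nᵖ ∷ [])

packE : Exp hi P# 2
packE = x₀ ⊗ par Nᵖ ⊕ x₁

fstE sndE : Exp hi P# 1
fstE = x₀ ⊘ par Nᵖ
sndE = call modE (x₀ ∷ par Nᵖ ∷ [])

joinE : Exp hi P# 1
joinE = call verifyE (call mskE (call fstE (x₀ ∷ []) ∷ []) ⊕ call mskE (call sndE (x₀ ∷ []) ∷ []) ∷ [])

-- Both phases run for a fixed number of rounds and stand still once their test succeeds. The first
-- one starts one and two steps after the start, where the runners no longer agree trivially.
ph1E ph2E trialB : Exp hi P# 0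
ph1E = iter Lwᵖ NNᵖ (call packE (call stepE (startE ∷ []) ∷ call stepE (call stepE (startE ∷ []) ∷ []) ∷ []))
 (call selE (call eqE (call fstE (x₁ ∷ []) ∷ call sndE (x₁ ∷ []) ∷ []) ∷ x₁ ∷
  call packE (call stepE (call fstE (x₁ ∷ []) ∷ []) ∷ call stepE (call stepE (call sndE (x₁ ∷ []) ∷ []) ∷ []) ∷ []) ∷ []))
ph2E = iter Lwᵖ NNᵖ (call packE (startE ∷ call sndE (ph1E ∷ []) ∷ []))
 (call selE (call joinE (x₁ ∷ []) ∷ x₁ ∷
  call packE (call stepE (call fstE (x₁ ∷ []) ∷ []) ∷ call stepE (call sndE (x₁ ∷ []) ∷ []) ∷ []) ∷ []))
trialB = call joinE (ph2E ∷ [])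

-- # 0 is the latest parameter.
program : Prog 0
program =
 def (mem (lit 0)) $
 def (lit 1 ⊕ mem (lit 1)) $
 def (par (# 0) ⊗ par (# 1) ⊕ (par (# 0) ⊖ lit 1)) $
 def (lit 1 ⊕ (mem (lit 3 ⊕ lit 2 ⊗ par (# 0)) ⊕ sum (# 0) (mem (lit 3 ⊕ lit 2 ⊗ x₀)))) $
 def (iter (# 1) (# 0) (lit 0) (x₁ ⊕ (mem (lit 3 ⊕ lit 2 ⊗ x₀) ⊖ x₁))) $
 def (par (# 0) ⊗ par (# 4) ⊖ lit 1) $
 def (len (# 0)) $
 def (par (# 0) ⊗ par (# 6) ⊖ lit 1) $
 def (lit 5 ⊗ len (# 0)) $
 def (prod (# 0) (lit 2)) $
 def (lit 2 ⊗ (par (# 9) ⊕ lit 1) ⊗ (par (# 6) ⊕ lit 1)) $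
 def (par (# 0) ⊗ prod (# 9) (par (# 0))) $
 def (len (# 0)) $
 def (lit 14 ⊗ par (# 12) ⊘ lit 100) $
 def ((par (# 13) ⊕ lit 1) ⊘ lit 2) $
 def (lit 2 ⊗ prod (# 0) (lit 2)) $
 def (par (# 3) ⊕ par (# 15) ⊕ lit 32) $
 def (len (# 0)) $
 def (par (# 17) ⊖ par (# 4) ⊕ lit 3 ⊗ par (# 0)) $
 def (par (# 0) ⊕ lit 4 ⊗ par (# 1)) $
 def (prod (# 1) (lit 2)) $
 def (prod (# 1) (lit 2)) $
 def (len (# 21)) $
 def (prod (# 0) (lit 2)) $
 def (par (# 4) ⊕ par (# 15) ⊕ par (# 23) ⊕ par (# 9) ⊕ par (# 1) ⊕ par (# 11) ⊕ lit 1) $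
 def (lit 2 ⊗ par (# 23) ⊕ lit 4 ⊕ lit 3 ⊗ par (# 13)) $
 def (lit 1 ⊕ prod (# 12) (lit 2) ⊘ (lit 16 ⊗ (par (# 25) ⊕ lit 2))) $
 def (par (# 11) ⊗ par (# 11)) $
 def (par (# 13) ⊕ lit 1 ⊖ par (# 14)) $
 def (prod (# 27) (par (# 19) ⊗ par (# 19)) ⊗ (par (# 5) ⊗ par (# 5)) ⊗ (lit 4 ⊗ par (# 10) ⊗ par (# 9))) $
 def (prod (# 28) (par (# 20) ⊗ par (# 20)) ⊗ par (# 6) ⊗ (lit 16 ⊗ lit 16 ⊗ lit 16 ⊗ ((par (# 29) ⊕ lit 2) ⊗ (par (# 29) ⊕ lit 2) ⊗ (par (# 29) ⊕ lit 2)) ⊗ prod (# 1) (lit 4))) $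
 sweep R1ᵖ (lower trialA) $ sweep R2ᵖ (lower trialB) stop

okProgram : okProducts [] program ≡ true
okProgram = refl

-- Denotations of the trials.

infixl 7 _mod_ _quo_

_quo_ _mod_ : ℕ → ℕ → ℕ
x quo y = ⟦ div ⟧ x y
x mod y = x ∸ x quo y * y

mod-% : ∀ x y .{{_ : NonZero y}} → x mod y ≡ x % y
mod-% x (suc y) = sym (m%n≡m∸m/n*n x (suc y))

quo-/ : ∀ x y .{{_ : NonZero y}} → x quo y ≡ x / y
quo-/ x (suc y) = refl

lt eq : ℕ → ℕ → ℕ
lt i j = 1 ∸ (1 + i ∸ j)
eq x y = 1 ∸ ((x ∸ y) + (y ∸ x))

lt-yes : ∀ {i j} → i < j → lt i j ≡ 1
lt-yes {i} {j} i<j = cong (1 ∸_) (m≤n⇒m∸n≡0 i<j)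

lt-no : ∀ {i j} → j ≤ i → lt i j ≡ 0
lt-no {i} {j} j≤i = cong (1 ∸_) (+-∸-assoc 1 j≤i) ∙ 0∸n≡0 (i ∸ j)

eq-refl : ∀ x → eq x x ≡ 1
eq-refl x rewrite n∸n≡0 x = refl

1∸suc : ∀ {x} → 1 ≤ x → 1 ∸ x ≡ 0
1∸suc {suc x} _ = 0∸n≡0 x

eq-no : ∀ {x y} → x ≢ y → eq x y ≡ 0
eq-no {x} {y} x≢y = 1∸suc (pos (<-cmp x y))
 where
 pos : _ → 1 ≤ (x ∸ y) + (y ∸ x)
 pos (tri< x<y _ _) = m<n⇒0<n∸m x<y ⟫ m≤n+m _ _
 pos (tri≈ _ e _) with () ← x≢y e
 pos (tri> _ _ y<x) = m<n⇒0<n∸m y<x ⟫ m≤m+n _ _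

eq-yes : ∀ {x y} → x ≡ y → eq x y ≡ 1
eq-yes {x} refl = eq-refl x

eq-cases : ∀ x y → (x ≡ y × eq x y ≡ 1) ⊎ (x ≢ y × eq x y ≡ 0)
eq-cases x y with x ≟ y
... | yes e = inj₁ (e , eq-yes e)
... | no ¬e = inj₂ (¬e , eq-no ¬e)

power-product : ∀ c W i → ∏ W (λ j → 1 + lt j i * c) ≡ suc c ^ (i ⊓ W)
power-product c zero i = cong (suc c ^_) (sym (⊓-zeroʳ i))
power-product c (suc W) i with <-≤-connex W i
... | inj₁ W<i rewrite lt-yes W<i | m≥n⇒m⊓n≡n W<i | power-product c W i | m≥n⇒m⊓n≡n (<⇒≤ W<i) | n+0≡n c = *-comm (suc c ^ W) (suc c)
... | inj₂ i≤W rewrite lt-no i≤W | m≤n⇒m⊓n≡m (m≤n⇒m≤1+n i≤W) | power-product c W i | m≤n⇒m⊓n≡m i≤W = n*1≡n (suc c ^ i)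

iterate↓-cong : ∀ n {f g : ℕ → ℕ → ℕ} a → (∀ j a → j < n → f j a ≡ g j a) → iterate↓ n f a ≡ iterate↓ n g a
iterate↓-cong zero a h = refl
iterate↓-cong (suc n) {f} {g} a h = cong (iterate↓ n f) (h n a ≤-refl) ∙ (iterate↓-cong n (g n a) λ j a j< → h j a (<-suc j<))

bit : ℕ → ℕ → ℕ
bit x i = (x quo 2 ^ i) % 2

module Blocks (μ β : ℕ → ℕ) where

 word : Vec ℕ P# → ℕ → ℕ → ℕ
 word π b s = Semantics.⟦_⟧ᵉ μ β b wordE π (s ∷ [])

 word-sem : ∀ π b s → let W = lookup π Wᵖ ; S = lookup π SLᵖ in word π b s ≡ ∑ W (λ i → β ((b * S + s mod S) * W + i) * 2 ^ i)
 word-sem π b s = ∑-cong W λ j j< → cong (β ((b * lookup π SLᵖ + s mod lookup π SLᵖ) * W + j) *_)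
  ((∏-cong W λ i _ → cong suc (sym (n*1≡n (lt i j)))) ∙ power-product 1 W j ∙ cong (2 ^_) (m≤n⇒m⊓n≡m (<⇒≤ j<)))
  where W = lookup π Wᵖ

 module _ (π : Vec ℕ P#) (b : ℕ) (ψ : ℕ → ℕ) (h : ∀ s → word π b s ≡ ψ s) where

  lower-correct : ∀ {Γ} (e : Exp hi P# Γ) ρ → Semantics.⟦_⟧ᵉ μ β b (lower e) π ρ ≡ Semantics.⟦_⟧ᵉ μ ψ 0 e π ρ
  lowers-correct : ∀ {Γ Δ} (es : Vec (Exp hi P# Γ) Δ) ρ → Semantics.⟦_⟧ᵉˢ μ β b (lowers es) π ρ ≡ Semantics.⟦_⟧ᵉˢ μ ψ 0 es π ρ
  lower-correct (par i) ρ = refl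
  lower-correct (var x) ρ = refl
  lower-correct (lit c) ρ = refl
  lower-correct (op o e f) ρ = cong₂ ⟦ o ⟧ (lower-correct e ρ) (lower-correct f ρ)
  lower-correct (mem e) ρ = cong μ (lower-correct e ρ)
  lower-correct (rnd e) ρ = cong (word π b) (lower-correct e ρ) ∙ h _
  lower-correct (len i) ρ = refl
  lower-correct (call f es) ρ = lower-correct f _ ∙ cong (Semantics.⟦_⟧ᵉ μ ψ 0 f π) (lowers-correct es ρ)
  lower-correct (sum i e) ρ = ∑-cong' (lookup π i) λ j → lower-correct e (j ∷ ρ)
  lower-correct (prod i e) ρ = ∏-cong (lookup π i) λ j _ → lower-correct e (j ∷ ρ)
  lower-correct (iter i c e₀ e) ρ = cong (iterate↓ (lookup π i) _) (lower-correct e₀ ρ) ∙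
   (iterate↓-cong (lookup π i) _ λ j a _ → cong (_⊓ lookup π c) (lower-correct e (j ∷ a ∷ ρ)))
  lowers-correct [] ρ = refl
  lowers-correct (e ∷ es) ρ = cong₂ _∷_ (lower-correct e ρ) (lowers-correct es ρ)

sel : ℕ → ℕ → ℕ → ℕ
sel c x y = c * x + (1 ∸ c) * y

phase₁ᶠ : (N NN Lw : ℕ) (f : ℕ → ℕ) → ℕ → ℕ
phase₁ᶠ N NN Lw f z = iterate↓ Lw (λ _ s → sel (eq (s quo N) (s mod N)) s (f (s quo N) * N + f (f (s mod N))) ⊓ NN) (f z * N + f (f z))

phase₂ᶠ : (N NN Lw : ℕ) (f join : ℕ → ℕ) → ℕ → ℕ → ℕ
phase₂ᶠ N NN Lw f join z y = iterate↓ Lw (λ _ s → sel (join s) s (f (s quo N) * N + f (s mod N)) ⊓ NN) (z * N + y mod N)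

module _ (N NN Lw : ℕ) where

 phase₁-cong : ∀ {f g : ℕ → ℕ} {z z'} → (∀ i → f i ≡ g i) → z ≡ z' → phase₁ᶠ N NN Lw f z ≡ phase₁ᶠ N NN Lw g z'
 phase₁-cong {f} {g} {z} h refl = cong (iterate↓ Lw (λ _ s → sel (eq (s quo N) (s mod N)) s (f (s quo N) * N + f (f (s mod N))) ⊓ NN)) (cong₂ (λ x y → x * N + y) (h z) (ff z)) ∙
  (iterate↓-cong Lw (g z * N + g (g z)) λ _ s _ → cong (_⊓ NN) (cong (sel (eq (s quo N) (s mod N)) s)
   (cong₂ (λ x y → x * N + y) (h (s quo N)) (ff (s mod N)))))
  where
  ff : ∀ i → f (f i) ≡ g (g i)
  ff i = h (f i) ∙ cong g (h i)

 phase₂-cong : ∀ {f f' g g' : ℕ → ℕ} {z z' y y'} → (∀ i → f i ≡ f' i) → (∀ i → g i ≡ g' i) → z ≡ z' → y ≡ y' →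
  phase₂ᶠ N NN Lw f g z y ≡ phase₂ᶠ N NN Lw f' g' z' y'
 phase₂-cong {z = z} {y = y} h h' refl refl = iterate↓-cong Lw (z * N + y mod N) λ _ s _ → cong (_⊓ NN) (cong₂ (λ c y → sel c s y) (h' s)
  (cong₂ (λ x y → x * N + y) (h (s quo N)) (h (s mod N))))

abstract
 race : (N NN Lw : ℕ) (f join : ℕ → ℕ) → ℕ → ℕ
 race N NN Lw f join z = join (phase₂ᶠ N NN Lw f join z (phase₁ᶠ N NN Lw f z))

 race-def : ∀ N NN Lw (f join : ℕ → ℕ) z → race N NN Lw f join z ≡ join (phase₂ᶠ N NN Lw f join z (phase₁ᶠ N NN Lw f z))
 race-def N NN Lw f join z = refl

race-cong : ∀ {N N' NN NN' Lw} {f f' join join' : ℕ → ℕ} {z z'} → N ≡ N' → NN ≡ NN' → (∀ i → f i ≡ f' i) → (∀ s → join s ≡ join' s) → z ≡ z' →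
 race N NN Lw f join z ≡ race N' NN' Lw f' join' z'
race-cong {N} {NN = NN} {Lw = Lw} {join' = join'} refl refl h h' z≡ = race-def _ _ _ _ _ _ ∙ h' _ ∙
 cong join' (phase₂-cong N NN Lw h h' z≡ (phase₁-cong N NN Lw h z≡)) ∙ sym (race-def _ _ _ _ _ _)

module Verifier (n D : ℕ) (μ : ℕ → ℕ) where

 pos neg : ℕ → ℕ
 pos k = μ (3 + 2 * k) * (1 ∸ μ (2 + 2 * k))
 neg k = μ (3 + 2 * k) * μ (2 + 2 * k)

 rhs : ℕ → ℕ
 rhs j = D * n + (j + (D ∸ 1)) mod D

 violation : ℕ → ℕ
 violation x = ∑ D (λ j → (∑ n (λ v → bit x v * pos (j * n + v)) + neg (rhs j))
  ∸ (∑ n (λ v → bit x v * neg (j * n + v)) + pos (rhs j)))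

 abstract
  verify : ℕ → ℕ
  verify x = 1 ∸ violation x

  verify-def : ∀ x → verify x ≡ 1 ∸ violation x
  verify-def x = refl

-- Opaque, so that type checking never unfolds the denotation of a whole trial.
abstract
 evalʰ : (μ ψ : ℕ → ℕ) → Exp hi P# 0 → Vec ℕ P# → ℕ
 evalʰ μ ψ e π = Semantics.⟦_⟧ᵉ μ ψ 0 e π []

 evalʰ-def : ∀ μ ψ e π → evalʰ μ ψ e π ≡ Semantics.⟦_⟧ᵉ μ ψ 0 e π []
 evalʰ-def μ ψ e π = refl

 evalˡ : (μ β : ℕ → ℕ) → ℕ → Exp lo P# 0 → Vec ℕ P# → ℕ
 evalˡ μ β b e π = Semantics.⟦_⟧ᵉ μ β b e π []

 evalˡ-def : ∀ μ β b e π → evalˡ μ β b e π ≡ Semantics.⟦_⟧ᵉ μ β b e π []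
 evalˡ-def μ β b e π = refl

lower-eval : ∀ μ β π b ψ → (∀ s → Blocks.word μ β π b s ≡ ψ s) → ∀ e → evalˡ μ β b (lower e) π ≡ evalʰ μ ψ e π
lower-eval μ β π b ψ h e = evalˡ-def μ β b (lower e) π ∙ (Blocks.lower-correct μ β π b ψ h e []) ∙ sym (evalʰ-def μ ψ e π)

record Sizes : Set where
 constructor sizes-of
 field n D cnt O m x1 lg lam1 g5 Gam B BIG b e n' N bb lbb cp cq Yp Yq kk K2 W SL Lw NN ne R1 R2 : ℕ

module Trial (V : Sizes) (μ ψ : ℕ → ℕ) where

 open Sizes V

 π : Vec ℕ P#
 π = R2 ∷ R1 ∷ ne ∷ NN ∷ Lw ∷ SL ∷ W ∷ K2 ∷ kk ∷ Yq ∷ Yp ∷ cq ∷ cp ∷ lbb ∷ bb ∷ N ∷ n' ∷ e ∷ b ∷ BIG ∷ B ∷ Gam ∷ g5 ∷ lam1 ∷ lg ∷ x1 ∷ m ∷ O ∷ cnt ∷ D ∷ n ∷ []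

 open Semantics μ ψ 0

 open Verifier n D μ public

 gi ge : ℕ → ℕ
 gi j = ψ (2 * j) mod Gam
 ge j = ψ (2 * j + 1) mod Gam

 κ p q k : ℕ
 κ = ψ (2 * D) mod K2
 p = ψ (2 * D + 1) mod Yp
 q = ψ (2 * D + 2) mod Yq
 k = ψ (2 * D + 3) mod K2

 wt : ℕ → ℕ
 wt v = ∑ D (λ j → (O + pos (j * n + v) ∸ neg (j * n + v)) quo 2 ^ (gi j ⊓ W) * B ^ j) + B ^ D

 tg : ℕ
 tg = ∑ D (λ j → ((O * κ + (pos (rhs j) ∸ (pos (rhs j) ∸ n * m)) ∸ neg (rhs j)) quo 2 ^ (gi j ⊓ W) ∸ ge j) * B ^ j) + κ * B ^ D

 wp : ℕ → ℕ
 wp v = wt v mod p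

 τ₀ : ℕ
 τ₀ = tg mod p + k * p

 pw : ℕ → ℕ → ℕ → ℕ
 pw x e q = iterate↓ W (λ i a → (a * a * (bit e i * x + (1 ∸ bit e i))) mod q ⊓ Yq) 1

 ext : ℕ → ℕ → ℕ
 ext v τ = ∑ Yq (λ x → lt x q * (pw x (q ∸ 1 ∸ τ) q * ∏ n (λ u → 1 + lt u v * pw x (wp u) q))) mod q

 sol : ℕ
 sol = iterate↓ n (λ v mask → (mask + 2 ^ v * (1 ∸ ext v (τ₀ ∸ ∑ n (λ u → bit mask u * wp u)))) ⊓ NN) 0

 L start : ℕ
 L = ψ (2 * D + 1)
 start = ψ (2 * D + 2) mod N

 side : ℕ → ℕ
 side i = i mod 2

 rank : ℕ → ℕ → ℕ
 rank v s = ∑ n (λ u → lt u v * eq (bit L u) s)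

 xb : ℕ → ℕ → ℕ
 xb i v = eq (bit L v) (side i) * bit (i / 2) (rank v (side i))

 sw msk : ℕ → ℕ
 sw i = ∑ n (λ v → xb i v * wt v)
 msk i = ∑ n (λ v → xb i v * 2 ^ v)

 key : ℕ → ℕ
 key i = BIG + side i * tg + (1 ∸ side i) * sw i ∸ side i * sw i

 walk : ℕ → ℕ
 walk i = ψ (2 * D + 3 + key i) mod N

 ph1 : ℕ
 ph1 = phase₁ᶠ N NN Lw walk start

 join : ℕ → ℕ
 join s = verify (msk (s quo N) + msk (s mod N))

 ph2 : ℕ
 ph2 = phase₂ᶠ N NN Lw walk join start ph1

 outcome : ℕ
 outcome = race N NN Lw walk join start

 found-A : ∀ {v} → v ≡ verify sol + (verify 0 + verify 1) → v ≢ 0 → ∃ λ z → verify z ≢ 0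
 found-A refl h with verify sol in s | verify 0 in z | verify 1 in o
 ... | suc _ | _ | _ = sol , λ e → 1+n≢0 (sym s ∙ e)
 ... | zero | suc _ | _ = 0 , λ e → 1+n≢0 (sym z ∙ e)
 ... | zero | zero | suc _ = 1 , λ e → 1+n≢0 (sym o ∙ e)
 ... | zero | zero | zero = ⊥-elim (h refl)

 found-B : ∀ {v} → v ≡ outcome → v ≢ 0 → ∃ λ z → verify z ≢ 0
 found-B e h = msk (ph2 quo N) + msk (ph2 mod N) , λ z → h (e ∙ race-def N NN Lw walk join start ∙ z)

 module _ (n≤W : n ≤ W) (1≤B : 1 ≤ B) where

  pow2-sem : ∀ i → ⟦ pow2E {hi} ⟧ᵉ π (i ∷ []) ≡ 2 ^ (i ⊓ W)
  pow2-sem i = (∏-cong W λ j _ → cong suc (sym (n*1≡n (lt j i)))) ∙ power-product 1 W i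

  pow2-sem≤ : ∀ {i} → i ≤ W → ⟦ pow2E {hi} ⟧ᵉ π (i ∷ []) ≡ 2 ^ i
  pow2-sem≤ {i} i≤ = pow2-sem i ∙ cong (2 ^_) (m≤n⇒m⊓n≡m i≤)

  mod2 : ∀ x → x mod 2 ≡ x % 2
  mod2 x = mod-% x 2

  bit-sem : ∀ x {i} → i ≤ W → ⟦ bitE {hi} ⟧ᵉ π (x ∷ i ∷ []) ≡ bit x i
  bit-sem x {i} i≤ = cong (λ y → (x quo y) mod 2) (pow2-sem≤ i≤) ∙ mod2 (x quo 2 ^ i)

  verify-sem : ∀ x → ⟦ verifyE ⟧ᵉ π (x ∷ []) ≡ verify x
  verify-sem x = cong (1 ∸_) (∑-cong' D λ j → cong₂ _∸_
   (cong (_+ neg (rhs j)) (∑-cong n λ v v< → cong (_* pos (j * n + v)) (bit-sem x (<⇒≤ v< ⟫ n≤W))))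
   (cong (_+ pos (rhs j)) (∑-cong n λ v v< → cong (_* neg (j * n + v)) (bit-sem x (<⇒≤ v< ⟫ n≤W))))) ∙ sym (verify-def x)

  powB-sem : ∀ {j} → j ≤ D → ⟦ powBE ⟧ᵉ π (j ∷ []) ≡ B ^ j
  powB-sem {j} j≤ = power-product (B ∸ 1) D j ∙ cong₂ _^_ (m+[n∸m] 1≤B) (m≤n⇒m⊓n≡m j≤)

  wt-sem : ∀ v → ⟦ wtE ⟧ᵉ π (v ∷ []) ≡ wt v
  wt-sem v = cong₂ _+_ (∑-cong D λ j j< → cong₂ (λ x y → (O + pos (j * n + v) ∸ neg (j * n + v)) quo x * y)
   (pow2-sem (gi j)) (powB-sem (<⇒≤ j<))) (powB-sem ≤-refl)

  tg-sem : ⟦ tgE ⟧ᵉ π [] ≡ tg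
  tg-sem = cong₂ _+_ (∑-cong D λ j j< → cong₂ (λ x y → ((O * κ + (pos (rhs j) ∸ (pos (rhs j) ∸ n * m)) ∸ neg (rhs j)) quo x ∸ ge j) * y)
   (pow2-sem (gi j)) (powB-sem (<⇒≤ j<))) (cong (κ *_) (powB-sem ≤-refl))

  wp-sem : ∀ v → ⟦ wpE ⟧ᵉ π (v ∷ []) ≡ wp v
  wp-sem v = cong (_mod p) (wt-sem v)

  τ₀-sem : ⟦ TE ⟧ᵉ π [] ≡ τ₀
  τ₀-sem = cong (λ t → t mod p + k * p) tg-sem

  pw-sem : ∀ x e q → ⟦ pwE ⟧ᵉ π (x ∷ e ∷ q ∷ []) ≡ pw x e q
  pw-sem x e q = iterate↓-cong W 1 λ i a i< → cong (λ y → (a * a * (y * x + (1 ∸ y))) mod q ⊓ Yq) (bit-sem e (<⇒≤ i<))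

  ext-sem : ∀ v τ → ⟦ extE ⟧ᵉ π (v ∷ τ ∷ []) ≡ ext v τ
  ext-sem v τ = cong (_mod q) (∑-cong' Yq λ x → cong (lt x q *_) (cong₂ _*_ (pw-sem x (q ∸ 1 ∸ τ) q)
   (∏-cong n λ u _ → cong (λ y → 1 + lt u v * y) (pw-sem x (⟦ wpE ⟧ᵉ π (u ∷ [])) q ∙ cong (λ e → pw x e q) (wp-sem u)))))

  sol-sem : ⟦ solE ⟧ᵉ π [] ≡ sol
  sol-sem = iterate↓-cong n 0 λ v mask v< → cong (_⊓ NN) (cong₂ (λ x y → mask + x * (1 ∸ y)) (pow2-sem≤ (<⇒≤ v< ⟫ n≤W))
   (ext-sem v (⟦ TE ⟧ᵉ π [] ∸ ∑ n (λ u → ⟦ bitE {hi} ⟧ᵉ π (mask ∷ u ∷ []) * ⟦ wpE ⟧ᵉ π (u ∷ []))) ∙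
    cong (ext v) (cong₂ _∸_ τ₀-sem (∑-cong n λ u u< → cong₂ _*_ (bit-sem mask (<⇒≤ u< ⟫ n≤W)) (wp-sem u)))))

  trialA-value : evalʰ μ ψ trialA π ≡ verify sol + (verify 0 + verify 1)
  trialA-value = evalʰ-def μ ψ trialA π ∙ cong₂ _+_ (verify-sem _ ∙ cong verify sol-sem) (cong₂ _+_ (verify-sem 0) (verify-sem 1))

  rank-sem : ∀ v s → ⟦ rankE ⟧ᵉ π (v ∷ s ∷ []) ≡ rank v s
  rank-sem v s = ∑-cong n λ u u< → cong (λ y → lt u v * eq y s) (bit-sem L (<⇒≤ u< ⟫ n≤W))

  rank≤n : ∀ v s → rank v s ≤ n
  rank≤n v s = (∑-≤-const n 1 λ u _ → *-mono (m∸n≤m 1 (1 + u ∸ v)) (m∸n≤m 1 ((bit L u ∸ s) + (s ∸ bit L u)))) ⟫≡ n*1≡n n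

  xb-sem : ∀ i {v} → v < n → ⟦ xbE ⟧ᵉ π (i ∷ v ∷ []) ≡ xb i v
  xb-sem i {v} v< = cong₂ (λ x y → eq x (side i) * y) (bit-sem L (<⇒≤ v< ⟫ n≤W))
   (cong (λ r → ⟦ bitE {hi} ⟧ᵉ π (i / 2 ∷ r ∷ [])) (rank-sem v (side i)) ∙ bit-sem (i / 2) (rank≤n v (side i) ⟫ n≤W))

  sw-sem : ∀ i → ⟦ swE ⟧ᵉ π (i ∷ []) ≡ sw i
  sw-sem i = ∑-cong n λ v v< → cong₂ _*_ (xb-sem i v<) (wt-sem v)

  msk-sem : ∀ i → ⟦ mskE ⟧ᵉ π (i ∷ []) ≡ msk i
  msk-sem i = ∑-cong n λ v v< → cong₂ _*_ (xb-sem i v<) (pow2-sem≤ (<⇒≤ v< ⟫ n≤W))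

  key-sem : ∀ i → ⟦ keyE ⟧ᵉ π (i ∷ []) ≡ key i
  key-sem i = cong₂ (λ t s → BIG + side i * t + (1 ∸ side i) * s ∸ side i * s) tg-sem (sw-sem i)

  walk-sem : ∀ i → ⟦ stepE ⟧ᵉ π (i ∷ []) ≡ walk i
  walk-sem i = cong (λ y → ψ (2 * D + 3 + y) mod N) (key-sem i)

  join-sem : ∀ s → ⟦ joinE ⟧ᵉ π (s ∷ []) ≡ join s
  join-sem s = verify-sem (⟦ mskE ⟧ᵉ π (s quo N ∷ []) + ⟦ mskE ⟧ᵉ π (s mod N ∷ [])) ∙ cong₂ (λ x y → verify (x + y)) (msk-sem (s quo N)) (msk-sem (s mod N))

  -- Stated for arbitrary expressions, so that type checking does not unfold
  -- the denotation of stepE.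
  ph1-gen : ∀ (stp' : Exp hi P# 1) (s₀ : Exp hi P# 0) →
   ⟦ iter Lwᵖ NNᵖ (call packE (call stp' (s₀ ∷ []) ∷ call stp' (call stp' (s₀ ∷ []) ∷ []) ∷ []))
    (call selE (call eqE (call fstE (x₁ ∷ []) ∷ call sndE (x₁ ∷ []) ∷ []) ∷ x₁ ∷
     call packE (call stp' (call fstE (x₁ ∷ []) ∷ []) ∷ call stp' (call stp' (call sndE (x₁ ∷ []) ∷ []) ∷ []) ∷ []) ∷ [])) ⟧ᵉ π []
   ≡ phase₁ᶠ N NN Lw (λ i → ⟦ stp' ⟧ᵉ π (i ∷ [])) (⟦ s₀ ⟧ᵉ π [])
  ph1-gen stp' s₀ = refl

  ph2-gen : ∀ (stp' join' : Exp hi P# 1) (s₀ s₁ : Exp hi P# 0) →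
   ⟦ iter Lwᵖ NNᵖ (call packE (s₀ ∷ call sndE (s₁ ∷ []) ∷ []))
    (call selE (call join' (x₁ ∷ []) ∷ x₁ ∷
     call packE (call stp' (call fstE (x₁ ∷ []) ∷ []) ∷ call stp' (call sndE (x₁ ∷ []) ∷ []) ∷ []) ∷ [])) ⟧ᵉ π []
   ≡ phase₂ᶠ N NN Lw (λ i → ⟦ stp' ⟧ᵉ π (i ∷ [])) (λ i → ⟦ join' ⟧ᵉ π (i ∷ [])) (⟦ s₀ ⟧ᵉ π []) (⟦ s₁ ⟧ᵉ π [])
  ph2-gen stp' join' s₀ s₁ = refl

  start-sem : ⟦ startE ⟧ᵉ π [] ≡ start
  start-sem = refl

  ph1-sem : ⟦ ph1E ⟧ᵉ π [] ≡ ph1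
  ph1-sem = ph1-gen stepE startE ∙ phase₁-cong N NN Lw {λ i → ⟦ stepE ⟧ᵉ π (i ∷ [])} {walk} {⟦ startE ⟧ᵉ π []} {start} walk-sem start-sem

  ph2-sem : ⟦ ph2E ⟧ᵉ π [] ≡ ph2
  ph2-sem = ph2-gen stepE joinE startE ph1E ∙ phase₂-cong N NN Lw {λ i → ⟦ stepE ⟧ᵉ π (i ∷ [])} {walk} {λ i → ⟦ joinE ⟧ᵉ π (i ∷ [])} {join}
   {⟦ startE ⟧ᵉ π []} {start} {⟦ ph1E ⟧ᵉ π []} {ph1} walk-sem join-sem start-sem ph1-sem

  trialB-value : evalʰ μ ψ trialB π ≡ outcome
  trialB-value = evalʰ-def μ ψ trialB π ∙ join-sem (⟦ ph2E ⟧ᵉ π []) ∙ cong join ph2-sem ∙ sym (race-def N NN Lw walk join start)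

-- Random strings as words: uniformity, independence, amplification.

sumL : ℕ → (List Bool → ℕ) → ℕ
sumL zero F = F []
sumL (suc n) F = sumL n (λ l → F (false ∷ l)) + sumL n (λ l → F (true ∷ l))

-- M^n times the expectation over n independent uniform words below M.
𝕊 : ℕ → ℕ → (List ℕ → ℕ) → ℕ
𝕊 zero M F = F []
𝕊 (suc n) M F = ∑ M λ x → 𝕊 n M λ xs → F (x ∷ xs)

sumL-cong : ∀ n {F G : List Bool → ℕ} → (∀ l → length l ≡ n → F l ≡ G l) → sumL n F ≡ sumL n G
sumL-cong zero h = h [] refl
sumL-cong (suc n) h = cong₂ _+_ (sumL-cong n λ l e → h (false ∷ l) (cong suc e)) (sumL-cong n λ l e → h (true ∷ l) (cong suc e))

sumL-split : ∀ m n F → sumL (m + n) F ≡ sumL m (λ l → sumL n (λ l' → F (l ++ l')))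
sumL-split zero n F = refl
sumL-split (suc m) n F = cong₂ _+_ (sumL-split m n _) (sumL-split m n _)

sumL-const : ∀ n c → sumL n (λ _ → c) ≡ 2 ^ n * c
sumL-const zero c = sym (n+0≡n c)
sumL-const (suc n) c rewrite sumL-const n c = lem (2 ^ n) c
 where
 lem : ∀ x c → x * c + x * c ≡ (x + (x + 0)) * c
 lem = ring

𝕊-cong : ∀ n {M F G} → (∀ xs → length xs ≡ n → F xs ≡ G xs) → 𝕊 n M F ≡ 𝕊 n M G
𝕊-cong zero h = h [] refl
𝕊-cong (suc n) {M} h = ∑-cong' M λ x → 𝕊-cong n λ xs e → h (x ∷ xs) (cong suc e)

𝕊-mono : ∀ n {M F G} → (∀ xs → length xs ≡ n → F xs ≤ G xs) → 𝕊 n M F ≤ 𝕊 n M G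
𝕊-mono zero h = h [] refl
𝕊-mono (suc n) {M} h = ∑-mono M λ x _ → 𝕊-mono n λ xs e → h (x ∷ xs) (cong suc e)

𝕊-split : ∀ m n M F → 𝕊 (m + n) M F ≡ 𝕊 m M (λ xs → 𝕊 n M (λ ys → F (xs ++ ys)))
𝕊-split zero n M F = refl
𝕊-split (suc m) n M F = ∑-cong' M λ x → 𝕊-split m n M _

𝕊-*ˡ : ∀ n M c F → 𝕊 n M (λ xs → c * F xs) ≡ c * 𝕊 n M F
𝕊-*ˡ zero M c F = refl
𝕊-*ˡ (suc n) M c F = (∑-cong' M λ x → 𝕊-*ˡ n M c _) ∙ ∑-*ˡ M c _

𝕊-*ʳ : ∀ n M c F → 𝕊 n M (λ xs → F xs * c) ≡ 𝕊 n M F * c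
𝕊-*ʳ n M c F = (𝕊-cong n λ xs _ → *-comm (F xs) c) ∙ 𝕊-*ˡ n M c F ∙ *-comm c _

𝕊-const : ∀ n M c → 𝕊 n M (λ _ → c) ≡ M ^ n * c
𝕊-const zero M c = sym (n+0≡n c)
𝕊-const (suc n) M c = (∑-cong' M λ _ → 𝕊-const n M c) ∙ ∑-const M _ ∙ sym (*-assoc M (M ^ n) c)

𝕊-+ : ∀ n M F G → 𝕊 n M (λ xs → F xs + G xs) ≡ 𝕊 n M F + 𝕊 n M G
𝕊-+ zero M F G = refl
𝕊-+ (suc n) M F G = (∑-cong' M λ x → 𝕊-+ n M _ _) ∙ ∑-+ M _ _

𝕊-∑ : ∀ n M k (F : ℕ → List ℕ → ℕ) → 𝕊 n M (λ xs → ∑ k (λ i → F i xs)) ≡ ∑ k (λ i → 𝕊 n M (F i))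
𝕊-∑ n M zero F = 𝕊-const n M 0 ∙ *-zeroʳ (M ^ n)
𝕊-∑ n M (suc k) F = 𝕊-+ n M _ (F k) ∙ cong (_+ 𝕊 n M (F k)) (𝕊-∑ n M k F)


value : List Bool → ℕ
value [] = 0
value (b ∷ l) = (if b then 1 else 0) + 2 * value l

∑-pairs : ∀ n f → ∑ (2 * n) f ≡ ∑ n (λ i → f (2 * i)) + ∑ n (λ i → f (1 + 2 * i))
∑-pairs zero f = refl
∑-pairs (suc n) f = cong (λ k → ∑ k f) (lem n) ∙ cong (λ s → s + f (2 * n) + f (1 + 2 * n)) (∑-pairs n f) ∙
 lem' (∑ n (λ i → f (2 * i))) (∑ n (λ i → f (1 + 2 * i))) (f (2 * n)) (f (1 + 2 * n))
 where
 lem : ∀ n → 2 * suc n ≡ suc (suc (2 * n))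
 lem = ring
 lem' : ∀ a b c d → a + b + c + d ≡ a + c + (b + d)
 lem' = ring

sumL-value : ∀ n G → sumL n (λ l → G (value l)) ≡ ∑ (2 ^ n) G
sumL-value zero G = refl
sumL-value (suc n) G = cong₂ _+_ (sumL-value n (λ x → G (2 * x))) (sumL-value n (λ x → G (1 + 2 * x))) ∙ sym (∑-pairs (2 ^ n) G)

words : ℕ → ℕ → List Bool → List ℕ
words W zero l = []
words W (suc n) l = value (List.take W l) ∷ words W n (List.drop W l)

take-++ : ∀ {A : Set} (l l' : List A) → List.take (length l) (l ++ l') ≡ l
take-++ [] l' = refl
take-++ (x ∷ l) l' = cong (x ∷_) (take-++ l l')

drop-++ : ∀ {A : Set} (l l' : List A) → List.drop (length l) (l ++ l') ≡ l'
drop-++ [] l' = refl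
drop-++ (x ∷ l) l' = drop-++ l l'

-- Disjoint stretches of W bits are independent uniform words; the r bits at the end only contribute
-- a factor.
sumL-words : ∀ W n r F → sumL (n * W + r) (λ l → F (words W n l)) ≡ 2 ^ r * 𝕊 n (2 ^ W) F
sumL-words W zero r F = sumL-const r (F [])
sumL-words W (suc n) r F = cong (λ k → sumL k (λ l → F (words W (suc n) l))) (+-assoc W (n * W) r) ∙ sumL-split W (n * W + r) _ ∙
 (sumL-cong W λ l e → (sumL-cong (n * W + r) λ l' _ →
  cong₂ (λ x y → F (value x ∷ words W n y)) (cong (λ k → List.take k (l ++ l')) (sym e) ∙ take-++ l l')
   (cong (λ k → List.drop k (l ++ l')) (sym e) ∙ drop-++ l l')) ∙
  sumL-words W n r (λ xs → F (value l ∷ xs))) ∙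
 sumL-value W (λ x → 2 ^ r * 𝕊 n (2 ^ W) (λ xs → F (x ∷ xs))) ∙ ∑-*ˡ (2 ^ W) (2 ^ r) _

bitval : List Bool → ℕ → ℕ
bitval l i = if nth false l i then 1 else 0

nth-beyond : ∀ {A : Set} (d : A) l i → length l ≤ i → nth d l i ≡ d
nth-beyond d [] i h = refl
nth-beyond d (x ∷ l) (suc i) (s≤s h) = nth-beyond d l i h

nth-drop : ∀ {A : Set} (d : A) k l i → nth d (List.drop k l) i ≡ nth d l (k + i)
nth-drop d zero l i = refl
nth-drop d (suc k) [] i = refl
nth-drop d (suc k) (x ∷ l) i = nth-drop d k l i

value-take : ∀ W l → value (List.take W l) ≡ ∑ W (λ i → bitval l i * 2 ^ i)
value-take zero l = refl
value-take (suc W) [] = sym (∑-zero (suc W))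
value-take (suc W) (b ∷ l) = cong (λ x → (if b then 1 else 0) + 2 * x) (value-take W l) ∙
 sym (∑-head W (λ i → bitval (b ∷ l) i * 2 ^ i) ∙ cong₂ _+_ (n*1≡n (if b then 1 else 0)) ((∑-cong' W λ i → lem (bitval l i) (2 ^ i)) ∙ ∑-*ˡ W 2 (λ i → bitval l i * 2 ^ i)))
 where
 lem : ∀ b x → b * (x + (x + 0)) ≡ 2 * (b * x)
 lem = ring

nth-words : ∀ W n l s → s < n → nth 0 (words W n l) s ≡ ∑ W (λ i → bitval l (s * W + i) * 2 ^ i)
nth-words W (suc n) l zero s< = value-take W l
nth-words W (suc n) l (suc s) (s≤s s<) = nth-words W n (List.drop W l) s s< ∙
 (∑-cong' W λ i → cong (λ b → (if b then 1 else 0) * 2 ^ i) (nth-drop false W l (s * W + i) ∙ cong (nth false l) (sym (+-assoc W (s * W) i))))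

count-toList : ∀ L (E : List Bool → Bool) → count {L} (λ ω → E (Vec.toList ω)) ≡ sumL L (λ l → if E l then 1 else 0)
count-toList zero E = refl
count-toList (suc L) E = cong₂ _+_ (count-toList L _) (count-toList L _)


∏-head : ∀ n f → ∏ (suc n) f ≡ f 0 * ∏ n (λ i → f (suc i))
∏-head zero f = n+0≡n (f 0) ∙ sym (n*1≡n (f 0))
∏-head (suc n) f = cong (_* f (suc n)) (∏-head n f) ∙ *-assoc (f 0) _ _

block : ℕ → ℕ → List ℕ → List ℕ
block S b xs = List.take S (List.drop (b * S) xs)

drop-drop : ∀ {A : Set} m n (l : List A) → List.drop (m + n) l ≡ List.drop n (List.drop m l)
drop-drop zero n l = refl
drop-drop (suc m) zero [] = refl
drop-drop (suc m) (suc n) [] = refl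
drop-drop (suc m) n (x ∷ l) = drop-drop m n l

-- Disjoint blocks are independent, so the expectation of the product is the product of
-- expectations.
𝕊-blocks : ∀ R S M (F : List ℕ → ℕ) → 𝕊 (R * S) M (λ xs → ∏ R (λ b → F (block S b xs))) ≡ 𝕊 S M F ^ R
𝕊-blocks zero S M F = refl
𝕊-blocks (suc R) S M F = 𝕊-split S (R * S) M _ ∙
 (𝕊-cong S λ u e → (𝕊-cong (R * S) λ w _ → ∏-head R _ ∙
  cong₂ _*_ (cong F (cong (λ k → List.take k (u ++ w)) (sym e) ∙ take-++ u w))
   (∏-cong R λ b _ → cong (λ z → F (List.take S z)) (drop-drop S (b * S) (u ++ w) ∙
    cong (List.drop (b * S)) (cong (λ k → List.drop k (u ++ w)) (sym e) ∙ drop-++ u w)))) ∙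
  𝕊-*ˡ (R * S) M (F u) _ ∙ cong (F u *_) (𝕊-blocks R S M F)) ∙
 𝕊-*ʳ S M (𝕊 S M F ^ R) F

bernoulli : ∀ f g n → f ^ suc n + suc n * (f ^ n * g) ≤ (f + g) ^ suc n
bernoulli f g zero = ≤-reflexive (lem f g)
 where
 lem : ∀ f g → f * 1 + 1 * (1 * g) ≡ (f + g) * 1
 lem = ring
bernoulli f g (suc n) = pad (lem f g n (f ^ n)) ⟫ *-monoʳ (f + g) (bernoulli f g n)
 where
 lem : ∀ f g n p → f * (f * p) + suc (suc n) * (f * p * g) + suc n * (p * g) * g ≡ (f + g) * (f * p + suc n * (p * g))
 lem = ring

-- The failure probability f / T of one trial is at most 1 - g / T, and T / g trials are made.
amplify : ∀ f g T R → 1 ≤ T → f + g ≤ T → T ≤ R * g → 2 * f ^ R ≤ T ^ R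
amplify f g T zero 1≤T f+g≤ T≤ with () ← 1≤T ⟫ T≤
amplify f g T (suc R) 1≤T f+g≤ T≤ = begin
 2 * f ^ suc R ≡⟨ cong (f ^ suc R +_) (n+0≡n _) ⟩
 -- The second copy of the power is paid by the linear term of the binomial expansion, since f is at
 -- most T and T is at most the number of trials times g.
 f ^ suc R + f * f ^ R ≤⟨ +-monoʳ (f ^ suc R) (*-monoˡ (f ^ R) (m+n≤o⇒m≤o f f+g≤ ⟫ T≤)) ⟩
 f ^ suc R + suc R * g * f ^ R ≡⟨ cong (f ^ suc R +_) (*-assoc (suc R) g _ ∙ cong (suc R *_) (*-comm g _)) ⟩
 f ^ suc R + suc R * (f ^ R * g) ≤⟨ bernoulli f g R ⟩
 (f + g) ^ suc R ≤⟨ ^-monoˡ (suc R) f+g≤ ⟩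
 T ^ suc R ∎

-- Numbers below q * Γ are uniform modulo Γ.
residue : ∀ q Γ M f g → M ≡ q * Γ → (∀ x r → r < Γ → x mod Γ ≡ r → g r ≤ f x) → q * ∑ Γ g ≤ ∑ M f
residue q Γ .(q * Γ) f g refl h = sym (∑-const q (∑ Γ g)) ≡⟫
 ∑-mono q (λ i _ → ∑-mono Γ (λ j j< → h (i * Γ + j) j j< (lem i j j<))) ⟫≡ sym (∑-product q Γ f)
 where
 lem : ∀ i j → j < Γ → (i * Γ + j) mod Γ ≡ j
 lem i j j< = mod-% (i * Γ + j) Γ {{≢0}} ∙ cong (λ x → (x % Γ) {{≢0}}) (+-comm (i * Γ) j) ∙
  ([m+kn]%n≡m%n j i Γ {{≢0}}) ∙ m<n⇒m%n≡m {{≢0}} j<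
  where
  ≢0 : NonZero Γ
  ≢0 = >-nonZero (≤-<-trans z≤n j<)

residue-≡ : ∀ q Γ M g → M ≡ q * Γ → ∑ M (λ x → g (x mod Γ)) ≡ q * ∑ Γ g
residue-≡ q Γ .(q * Γ) g refl = ∑-product q Γ _ ∙ (∑-cong' q λ i → ∑-cong Γ λ j j< → cong g (lem i j j<)) ∙ ∑-const q _
 where
 lem : ∀ i j → j < Γ → (i * Γ + j) mod Γ ≡ j
 lem i j j< = mod-% (i * Γ + j) Γ {{≢0}} ∙ cong (λ x → (x % Γ) {{≢0}}) (+-comm (i * Γ) j) ∙
  ([m+kn]%n≡m%n j i Γ {{≢0}}) ∙ m<n⇒m%n≡m {{≢0}} j<
  where
  ≢0 : NonZero Γ
  ≢0 = >-nonZero (≤-<-trans z≤n j<)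

∑-single : ∀ n i c → i < n → ∑ n (λ x → eq x i * c) ≡ c
∑-single (suc n) i c (s≤s i≤n) with m≤n⇒m<n∨m≡n i≤n
... | inj₁ i<n rewrite ∑-single n i c i<n | eq-no {n} {i} (λ e → <⇒≢ i<n (sym e)) = n+0≡n c
... | inj₂ refl rewrite eq-refl n | ∑-cong n (λ x x< → cong (_* c) (eq-no {x} {n} (<⇒≢ x<))) ∙ ∑-zero n = n+0≡n c

residue-hit : ∀ q Γ M f i c → M ≡ q * Γ → i < Γ → (∀ x → x mod Γ ≡ i → c ≤ f x) → q * c ≤ ∑ M f
residue-hit q Γ M f i c M≡ i< h = cong (q *_) (sym (∑-single Γ i c i<)) ≡⟫
 (residue q Γ M f (λ r → eq r i * c) M≡ λ x r _ e → [ (λ { (r≡i , one) → cong (_* c) one ∙ n+0≡n c ≡⟫ h x (e ∙ r≡i) }) ,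
  (λ { (_ , nul) → cong (_* c) nul ≡⟫ z≤n }) ]′ (eq-cases r i))
 where open import Data.Sum using ([_,_]′)

-- As M = q Γ, each word has its prescribed residue with probability exactly 1/Γ, independently of
-- the others.
guess : ∀ g q Γ M (τ : ℕ → ℕ) F c → M ≡ q * Γ → (∀ i → i < g → τ i < Γ) →
 (∀ us → length us ≡ g → (∀ i → i < g → nth 0 us i mod Γ ≡ τ i) → c ≤ F us) → q ^ g * c ≤ 𝕊 g M F
guess zero q Γ M τ F c M≡ τ< h = n+0≡n c ≡⟫ (h [] refl λ i ())
guess (suc g) q Γ M τ F c M≡ τ< h = *-assoc q (q ^ g) c ≡⟫
 (residue-hit q Γ M _ (τ 0) (q ^ g * c) M≡ (τ< 0 z<s) λ x e →
  guess g q Γ M (λ i → τ (suc i)) (λ us → F (x ∷ us)) c M≡ (λ i i< → τ< (suc i) (s≤s i<))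
   λ us len h' → h (x ∷ us) (cong suc len) λ { zero _ → e ; (suc i) (s≤s i<) → h' i i< })

-- Random walks whose steps are read from a table of random words.

update : ℕ → ℕ → List ℕ → List ℕ
update i y [] = []
update zero y (x ∷ xs) = y ∷ xs
update (suc i) y (x ∷ xs) = x ∷ update i y xs

nth-update : ∀ i y xs → i < length xs → nth 0 (update i y xs) i ≡ y
nth-update zero y (x ∷ xs) i< = refl
nth-update (suc i) y (x ∷ xs) (s≤s i<) = nth-update i y xs i<

nth-update' : ∀ i j y xs → i ≢ j → nth 0 (update i y xs) j ≡ nth 0 xs j
nth-update' i j y [] i≢j = refl
nth-update' zero zero y (x ∷ xs) i≢j with () ← i≢j refl
nth-update' zero (suc j) y (x ∷ xs) i≢j = refl
nth-update' (suc i) zero y (x ∷ xs) i≢j = refl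
nth-update' (suc i) (suc j) y (x ∷ xs) i≢j = nth-update' i j y xs (λ e → i≢j (cong suc e))

-- Deferred decisions: overwriting one word by an independent uniform value leaves the expectation
-- unchanged.
resample : ∀ n i M F → i < n → M * 𝕊 n M F ≡ ∑ M (λ y → 𝕊 n M (λ xs → F (update i y xs)))
resample (suc n) zero M F i< = sym (∑-*ˡ M M _) ∙ (∑-cong' M λ y → sym (∑-const M _))
resample (suc n) (suc i) M F (s≤s i<) = sym (∑-*ˡ M M _) ∙
 (∑-cong' M λ x → resample n i M (λ xs → F (x ∷ xs)) i<) ∙ ∑-swap M M _

notin : ℕ → List ℕ → ℕ
notin x [] = 1
notin x (u ∷ U) = (1 ∸ eq x u) * notin x U

case-01 : ¬ 0 ≡ 1
case-01 ()

notin-cases : ∀ x U → notin x U ≡ 0 ⊎ notin x U ≡ 1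
notin-cases x [] = inj₂ refl
notin-cases x (u ∷ U) with eq-cases x u | notin-cases x U
... | inj₁ (_ , e) | _ = inj₁ (cong (λ d → (1 ∸ d) * notin x U) e)
... | inj₂ (_ , e) | inj₁ z = inj₁ (cong₂ (λ d y → (1 ∸ d) * y) e z ∙ refl)
... | inj₂ (_ , e) | inj₂ z = inj₂ (cong₂ (λ d y → (1 ∸ d) * y) e z ∙ refl)

notin-head : ∀ x U → notin x (x ∷ U) ≡ 0
notin-head x U = cong (λ d → (1 ∸ d) * notin x U) (eq-refl x)

notin-tail : ∀ x u U → notin x U ≡ 0 → notin x (u ∷ U) ≡ 0
notin-tail x u U h = cong ((1 ∸ eq x u) *_) h ∙ *-zeroʳ (1 ∸ eq x u)

-- A walk on {0,…,N-1}: the word in slot κ of ys names the next vertex, whose own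
-- slot is read next. Φ s κ U ys tests a stretch of length |s| that never reads a
-- slot twice nor one in U, so that it is driven by independent uniform words.
module Walks (N M q K : ℕ) (slot : ℕ → ℕ) (M≡ : M ≡ q * N) (1≤M : 1 ≤ M) (slot< : ∀ z → z < N → slot z < K) (1≤N : 1 ≤ N) where

 vertex : List ℕ → ℕ → ℕ
 vertex ys κ = nth 0 ys κ mod N

 vertex< : ∀ ys κ → vertex ys κ < N
 vertex< ys κ = subst (_< N) (sym (mod-% (nth 0 ys κ) N {{N≢0}})) (m%n<n _ N {{N≢0}})
  where
  N≢0 : NonZero N
  N≢0 = >-nonZero 1≤N

 Φ : List (ℕ → ℕ) → ℕ → List ℕ → List ℕ → ℕ
 Φ [] κ U ys = 1
 Φ (T ∷ s) κ U ys = notin κ U * (T (vertex ys κ) * Φ s (slot (vertex ys κ)) (κ ∷ U) ys)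

 -- The same test with every next vertex drawn afresh: N^|s| times the expectation of `Φ`.
 Ψ : List (ℕ → ℕ) → ℕ → List ℕ → ℕ
 Ψ [] κ U = 1
 Ψ (T ∷ s) κ U = notin κ U * ∑ N (λ z → T z * Ψ s (slot z) (κ ∷ U))

 Φ-update : ∀ s κ U c y ys → notin c U ≡ 0 → Φ s κ U (update c y ys) ≡ Φ s κ U ys
 Φ-update [] κ U c y ys h = refl
 Φ-update (T ∷ s) κ U c y ys h with notin-cases κ U
 ... | inj₁ z rewrite z = refl
 ... | inj₂ z rewrite nth-update' c κ y ys (λ { refl → case-01 (sym h ∙ z) }) =
  cong (λ φ → notin κ U * (T (vertex ys κ) * φ)) (Φ-update s _ (κ ∷ U) c y ys (notin-tail c κ U h))

 -- The word in slot κ is resampled. The rest of the stretch is worth 0 as soon as it reads κ again,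
 -- so the change does not affect it.
 expectation : ∀ s κ U → κ < K → N ^ length s * 𝕊 K M (Φ s κ U) ≡ Ψ s κ U * M ^ K
 expectation [] κ U κ< = n+0≡n _ ∙ 𝕊-const K M 1 ∙ *-comm (M ^ K) 1
 expectation (T ∷ s) κ U κ< = *-cancelˡ-≡ _ _ M {{>-nonZero 1≤M}} (begin-equality
  M * (N * N ^ length s * 𝕊 K M (Φ (T ∷ s) κ U)) ≡⟨ lem₁ M N (N ^ length s) _ ⟩
  N * (N ^ length s * (M * 𝕊 K M (Φ (T ∷ s) κ U))) ≡⟨ cong (λ x → N * (N ^ length s * x)) step ⟩
  N * (N ^ length s * (a * (q * ∑ N g))) ≡⟨ lem₂ N (N ^ length s) a q (∑ N g) ⟩
  q * N * a * (N ^ length s * ∑ N g) ≡⟨ cong₂ (λ m x → m * a * x) (sym M≡) (sym (∑-*ˡ N (N ^ length s) g)) ⟩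
  M * a * ∑ N (λ z → N ^ length s * g z) ≡⟨ cong (M * a *_) (∑-cong N λ z z< → *-exchange (N ^ length s) (T z) _ ∙
   cong (T z *_) (expectation s (slot z) (κ ∷ U) (slot< z z<)) ∙ sym (*-assoc (T z) _ _)) ⟩
  M * a * ∑ N (λ z → T z * Ψ s (slot z) (κ ∷ U) * M ^ K) ≡⟨ cong (M * a *_) (∑-*ʳ N (M ^ K) _) ⟩
  M * a * (∑ N (λ z → T z * Ψ s (slot z) (κ ∷ U)) * M ^ K) ≡⟨ lem₄ M a _ (M ^ K) ⟩
  M * (Ψ (T ∷ s) κ U * M ^ K) ∎)
  where
  a = notin κ U
  g : ℕ → ℕ
  g z = T z * 𝕊 K M (Φ s (slot z) (κ ∷ U))
  lem₁ : ∀ m n x y → m * (n * x * y) ≡ n * (x * (m * y))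
  lem₁ = ring
  lem₂ : ∀ n x a q y → n * (x * (a * (q * y))) ≡ q * n * a * (x * y)
  lem₂ = ring
  lem₄ : ∀ m a x y → m * a * (x * y) ≡ m * (a * x * y)
  lem₄ = ring
  inner : ∀ y → 𝕊 K M (λ xs → Φ (T ∷ s) κ U (update κ y xs)) ≡ a * g (y mod N)
  inner y = (𝕊-cong K λ xs len → cong (a *_) (cong (λ x → T (x mod N) * Φ s (slot (x mod N)) (κ ∷ U) (update κ y xs)) (nth-update κ y xs (subst (κ <_) (sym len) κ<)) ∙
   cong (T (y mod N) *_) (Φ-update s _ (κ ∷ U) κ y xs (notin-head κ U)))) ∙
   𝕊-*ˡ K M a _ ∙ cong (a *_) (𝕊-*ˡ K M (T (y mod N)) _)
  step : M * 𝕊 K M (Φ (T ∷ s) κ U) ≡ a * (q * ∑ N g)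
  step = resample K κ M _ κ< ∙ ∑-cong' M inner ∙ ∑-*ˡ M a _ ∙ cong (a *_) (residue-≡ q N M g M≡)


 at-slot : List ℕ → ℕ → ℕ → ℕ
 at-slot ys κ zero = κ
 at-slot ys κ (suc k) = at-slot ys (slot (vertex ys κ)) k

 private
  *≢0ˡ : ∀ x {y} → x * y ≢ 0 → x ≢ 0
  *≢0ˡ .0 h refl = h refl

  *≢0ʳ : ∀ x {y} → x * y ≢ 0 → y ≢ 0
  *≢0ʳ x h refl = h (*-zeroʳ x)

 Φ-drop : ∀ s {s'} κ U ys → Φ (s ++ s') κ U ys ≢ 0 → Σ (List ℕ) λ U' → Φ s' (at-slot ys κ (length s)) U' ys ≢ 0
 Φ-drop [] κ U ys h = U , h
 Φ-drop (T ∷ s) κ U ys h = Φ-drop s _ (κ ∷ U) ys (*≢0ʳ (T (vertex ys κ)) (*≢0ʳ (notin κ U) h))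

 Φ-test : ∀ T {s} κ U ys → Φ (T ∷ s) κ U ys ≢ 0 → T (vertex ys κ) ≢ 0
 Φ-test T κ U ys h = *≢0ˡ (T (vertex ys κ)) (*≢0ʳ (notin κ U) h)

 Φ-fresh : ∀ s κ U ys → Φ s κ U ys ≢ 0 → ∀ l → l < length s → notin (at-slot ys κ l) U ≢ 0
 Φ-fresh (T ∷ s) κ U ys h zero l< = *≢0ˡ (notin κ U) h
 Φ-fresh (T ∷ s) κ U ys h (suc l) (s≤s l<) e =
  Φ-fresh s _ (κ ∷ U) ys (*≢0ʳ (T (vertex ys κ)) (*≢0ʳ (notin κ U) h)) l l< (notin-tail _ κ U e)

 Φ-distinct : ∀ s κ U ys → Φ s κ U ys ≢ 0 → ∀ k l → k < l → l < length s → at-slot ys κ k ≢ at-slot ys κ l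
 Φ-distinct (T ∷ s) κ U ys h zero (suc l) k< (s≤s l<) e =
  Φ-fresh s _ (κ ∷ U) ys (*≢0ʳ (T (vertex ys κ)) (*≢0ʳ (notin κ U) h)) l l< (subst (λ x → notin x (κ ∷ U) ≡ 0) e (notin-head κ U))
 Φ-distinct (T ∷ s) κ U ys h (suc k) (suc l) (s≤s k<) (s≤s l<) =
  Φ-distinct s _ (κ ∷ U) ys (*≢0ʳ (T (vertex ys κ)) (*≢0ʳ (notin κ U) h)) k l k< l<

 Φ≤1 : ∀ s κ U ys → (∀ k T → nth (λ _ → 0) s k ≡ T → ∀ z → T z ≤ 1) → Φ s κ U ys ≤ 1
 Φ≤1 [] κ U ys h = ≤-refl
 Φ≤1 (T ∷ s) κ U ys h = *-mono (le1 (notin-cases κ U)) (*-mono (h 0 T refl _) (Φ≤1 s _ _ ys λ k → h (suc k)))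
  where
  le1 : ∀ {x} → x ≡ 0 ⊎ x ≡ 1 → x ≤ 1
  le1 (inj₁ refl) = z≤n
  le1 (inj₂ refl) = ≤-refl

 -- The walk that passes through i and later through j, whose slots coincide, and
 -- otherwise avoids their slot.

 module Pair (i j : ℕ) (i< : i < N) (j< : j < N) (κ* : ℕ) (slot-i : slot i ≡ κ*) where

  free : ℕ → ℕ
  free z = 1 ∸ eq (slot z) κ*

  exactly : ℕ → ℕ → ℕ
  exactly i z = eq z i

  second first : ℕ → List (ℕ → ℕ)
  second r = replicate r free ++ exactly j ∷ []
  first r = exactly i ∷ second r

  schedule : ℕ → ℕ → List (ℕ → ℕ)
  schedule r₁ r₂ = replicate r₁ free ++ first r₂

  cnt : ℕ → ℕ
  cnt κ = ∑ N λ z → eq (slot z) κ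

  total : List ℕ → ℕ
  total [] = 0
  total (κ ∷ U) = cnt κ + total U

  -- The number of ordered pairs of vertices with a common slot, the diagonal included.
  p : ℕ
  p = ∑ N λ z → cnt (slot z)

  bad : List ℕ → ℕ → ℕ
  bad V z = 1 ∸ notin (slot z) V

  bad-total : ∀ V → ∑ N (bad V) ≤ total V
  bad-total [] = ≤-reflexive (∑-zero N)
  bad-total (κ ∷ V) = (∑-mono N λ z _ → lem (eq (slot z) κ) (notin (slot z) V) (e≤ (eq-cases (slot z) κ)) (n≤ (notin-cases (slot z) V))) ⟫
   ∑-+ N _ _ ≡⟫ +-monoʳ (cnt κ) (bad-total V)
   where
   e≤ : ∀ {A B : Set} {e} → (A × e ≡ 1) ⊎ (B × e ≡ 0) → e ≤ 1
   e≤ (inj₁ (_ , refl)) = ≤-refl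
   e≤ (inj₂ (_ , refl)) = z≤n
   n≤ : ∀ {x} → x ≡ 0 ⊎ x ≡ 1 → x ≤ 1
   n≤ (inj₁ refl) = z≤n
   n≤ (inj₂ refl) = ≤-refl
   lem : ∀ e x → e ≤ 1 → x ≤ 1 → 1 ∸ (1 ∸ e) * x ≤ e + (1 ∸ x)
   lem zero x z≤n x≤ = ≤-reflexive (cong (1 ∸_) (n+0≡n x))
   lem (suc zero) x z<s x≤ = z<s

  -- Divided by N^(2+r): when r free steps remain and the forbidden slots cover w vertices, the
  -- stretch fails with probability at most r w / N + r² p / N². Each step hits a forbidden slot
  -- with probability at most w / N and increases w by p / N on average.
  Bound : ℕ → ℕ → ℕ → Set
  Bound r w ψ = N ^ (2 + r) ≤ N * N * ψ + N ^ r * (r * w * N + r * r * p)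

  bound-step : ∀ r w V (T g : ℕ → ℕ) → total V ≤ w →
   (∀ z → z < N → notin (slot z) V ≡ 1 → T z ≡ 1 × Bound r (w + cnt (slot z)) (g z)) →
   Bound (suc r) w (∑ N λ z → T z * g z)
  bound-step r w V T g V≤ h = begin
   N * N ^ (2 + r) ≡⟨ ∑-const N (N ^ (2 + r)) ⟨
   ∑ N (λ _ → N ^ (2 + r)) ≤⟨ ∑-mono N each ⟩
   ∑ N (λ z → N * N * (T z * g z) + (N ^ r * (r * (w + cnt (slot z)) * N + r * r * p) + bad V z * N ^ (2 + r)))
    ≡⟨ ∑-+ N _ _ ∙ cong₂ _+_ (∑-*ˡ N (N * N) _) (∑-+ N _ _ ∙ cong₂ _+_ sum₂ (∑-*ʳ N (N ^ (2 + r)) (bad V))) ⟩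
   N * N * G + (N ^ r * (r * (N * w + p) * N + N * (r * r * p)) + ∑ N (bad V) * N ^ (2 + r))
    ≤⟨ +-monoʳ (N * N * G) (+-monoʳ _ (*-monoˡ (N ^ (2 + r)) (bad-total V ⟫ V≤))) ⟩
   N * N * G + (N ^ r * (r * (N * w + p) * N + N * (r * r * p)) + w * N ^ (2 + r))
    ≤⟨ m≤m+n _ (N ^ suc r * (r * p + p)) ⟩
   N * N * G + (N ^ r * (r * (N * w + p) * N + N * (r * r * p)) + w * N ^ (2 + r)) + N ^ suc r * (r * p + p)
    ≡⟨ lem N G (N ^ r) r w p ⟩
   N * N * G + N ^ suc r * (suc r * w * N + suc r * suc r * p) ∎
   where
   G = ∑ N λ z → T z * g z
   sum₂ : ∑ N (λ z → N ^ r * (r * (w + cnt (slot z)) * N + r * r * p)) ≡ N ^ r * (r * (N * w + p) * N + N * (r * r * p))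
   sum₂ = ∑-*ˡ N (N ^ r) _ ∙ cong (N ^ r *_) (∑-+ N _ _ ∙ cong₂ _+_
    (∑-*ʳ N N _ ∙ cong (_* N) (∑-*ˡ N r _ ∙ cong (r *_) (∑-+ N _ _ ∙ cong (_+ p) (∑-const N w))))
    (∑-const N (r * r * p)))
   lem : ∀ N G x r w p → N * N * G + (x * (r * (N * w + p) * N + N * (r * r * p)) + w * (N * (N * x))) + N * x * (r * p + p)
    ≡ N * N * G + N * x * (suc r * w * N + suc r * suc r * p)
   lem = ring
   each : ∀ z → z < N → N ^ (2 + r) ≤ N * N * (T z * g z) + (N ^ r * (r * (w + cnt (slot z)) * N + r * r * p) + bad V z * N ^ (2 + r))
   each z z< with notin-cases (slot z) V
   ... | inj₁ e rewrite e = sym (n+0≡n _) ≡⟫ m≤n+m _ (N ^ r * (r * (w + cnt (slot z)) * N + r * r * p)) ⟫ m≤n+m _ (N * N * (T z * g z))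
   ... | inj₂ e with h z z< e
   ... | t , b rewrite t | n+0≡n (g z) = b ⟫ +-monoʳ (N * N * g z) (m≤m+n _ _)

  notin-∷ : ∀ x u U → notin x (u ∷ U) ≡ 1 → eq x u ≡ 0 × notin x U ≡ 1
  notin-∷ x u U h with eq-cases x u
  ... | inj₁ (_ , e) with () ← sym (cong (λ d → (1 ∸ d) * notin x U) e) ∙ h
  ... | inj₂ (_ , e) = e , sym (cong (λ d → (1 ∸ d) * notin x U) e ∙ n+0≡n _) ∙ h

  fresh-* : ∀ κ U (x : ℕ) → notin κ U ≡ 1 → notin κ U * x ≡ x
  fresh-* κ U x e = cong (_* x) e ∙ n+0≡n x

  member-eq : ∀ x V → notin x V ≡ 1 → notin κ* V ≡ 0 → eq x κ* ≡ 0
  member-eq x V h h* with eq-cases x κ*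
  ... | inj₂ (_ , e) = e
  ... | inj₁ (refl , _) with () ← sym h* ∙ h

  second-bound : ∀ r κ U → notin κ U ≡ 1 → notin κ* (κ ∷ U) ≡ 0 → Bound r (total (κ ∷ U)) (Ψ (second r) κ U)
  second-bound zero κ U fr out = lem N ∙ cong (N * N *_) (sym ψ≡) ≡⟫ m≤m+n _ _
   where
   lem : ∀ n → n * (n * 1) ≡ n * n * 1
   lem = ring
   ψ≡ : Ψ (second zero) κ U ≡ 1
   ψ≡ = fresh-* κ U _ fr ∙ ∑-single N j 1 j<
  second-bound (suc r) κ U fr out = subst (Bound (suc r) (total (κ ∷ U))) (sym (fresh-* κ U _ fr))
   (bound-step r (total (κ ∷ U)) (κ ∷ U) free (λ z → Ψ (second r) (slot z) (κ ∷ U)) ≤-refl λ z z< ok →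
    cong (1 ∸_) (member-eq (slot z) (κ ∷ U) ok out) ,
    subst (λ w → Bound r w (Ψ (second r) (slot z) (κ ∷ U))) (+-comm (cnt (slot z)) (total (κ ∷ U))) (second-bound r (slot z) (κ ∷ U) ok (notin-tail κ* (slot z) (κ ∷ U) out)))

  -- The slot `κ*` must still be unread when i is reached, so the free steps avoid it from the
  -- beginning and it is charged as forbidden throughout.
  first-bound : ∀ r₁ r₂ κ U → notin κ U ≡ 1 → notin κ* (κ ∷ U) ≡ 1 → Bound (r₁ + r₂) (total (κ* ∷ κ ∷ U)) (Ψ (schedule r₁ r₂) κ U)
  first-bound zero r₂ κ U fr fr* = subst (Bound r₂ (total (κ* ∷ κ ∷ U)))
   (sym (fresh-* κ U _ fr ∙ (∑-cong' N λ z → at z) ∙ ∑-single N i _ i<))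
   (second-bound r₂ κ* (κ ∷ U) fr* (notin-head κ* (κ ∷ U)))
   where
   at : ∀ z → eq z i * Ψ (second r₂) (slot z) (κ ∷ U) ≡ eq z i * Ψ (second r₂) κ* (κ ∷ U)
   at z with eq-cases z i
   ... | inj₁ (refl , _) = cong (λ x → eq z i * Ψ (second r₂) x (κ ∷ U)) slot-i
   ... | inj₂ (_ , e) rewrite e = refl
  first-bound (suc r₁) r₂ κ U fr fr* = subst (Bound (suc (r₁ + r₂)) (total (κ* ∷ κ ∷ U))) (sym (fresh-* κ U _ fr))
   (bound-step (r₁ + r₂) (total (κ* ∷ κ ∷ U)) (κ* ∷ κ ∷ U) free (λ z → Ψ (schedule r₁ r₂) (slot z) (κ ∷ U)) ≤-refl λ z z< ok →
    let e , ok' = notin-∷ (slot z) κ* (κ ∷ U) ok in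
    cong (1 ∸_) e ,
    subst (λ w → Bound (r₁ + r₂) w (Ψ (schedule r₁ r₂) (slot z) (κ ∷ U))) (reorder (cnt κ*) (cnt (slot z)) (total (κ ∷ U)))
     (first-bound r₁ r₂ (slot z) (κ ∷ U) ok' (cong (λ d → (1 ∸ d) * notin κ* (κ ∷ U)) (flip-eq e) ∙ n+0≡n _ ∙ fr*)))
   where
   reorder : ∀ a b c → a + (b + c) ≡ a + c + b
   reorder = ring
   flip-eq : ∀ {x} → eq x κ* ≡ 0 → eq κ* x ≡ 0
   flip-eq {x} e with eq-cases κ* x
   ... | inj₂ (_ , e') = e'
   ... | inj₁ (refl , _) with () ← sym (eq-refl κ*) ∙ e

-- Floyd's cycle search.

rep : ∀ {A : Set} → (A → A) → ℕ → A → A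
rep f zero x = x
rep f (suc k) x = rep f k (f x)

rep-suc : ∀ {A : Set} (f : A → A) k x → rep f (suc k) x ≡ f (rep f k x)
rep-suc f zero x = refl
rep-suc f (suc k) x = rep-suc f k (f x)

-- The loop stands still from the first success on, so spare rounds do no harm; the cap has no
-- effect while the states stay at most NN.
search : ∀ c NN (test adv : ℕ → ℕ) s k → k ≤ c → (∀ x → test x ≡ 0 ⊎ test x ≡ 1) → (∀ j → j ≤ k → rep adv j s ≤ NN) →
 test (rep adv k s) ≡ 1 →
 ∃ λ l → l ≤ k × test (rep adv l s) ≡ 1 × iterate↓ c (λ _ s → sel (test s) s (adv s) ⊓ NN) s ≡ rep adv l s
search c NN test adv s k k≤ t01 bnd h with t01 s
... | inj₂ one = 0 , z≤n , one , stay c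
 where
 fix : sel (test s) s (adv s) ⊓ NN ≡ s
 fix = cong (λ t → sel t s (adv s) ⊓ NN) one ∙ cong (_⊓ NN) (n+0≡n _ ∙ n+0≡n s) ∙ m≤n⇒m⊓n≡m (bnd 0 z≤n)
 stay : ∀ c → iterate↓ c (λ _ s → sel (test s) s (adv s) ⊓ NN) s ≡ s
 stay zero = refl
 stay (suc c) = cong (iterate↓ c (λ _ s → sel (test s) s (adv s) ⊓ NN)) fix ∙ stay c
search c NN test adv s zero k≤ t01 bnd h | inj₁ nul with () ← sym nul ∙ h
search (suc c) NN test adv s (suc k) (s≤s k≤) t01 bnd h | inj₁ nul
 with search c NN test adv (adv s) k k≤ t01 (λ j j≤ → bnd (suc j) (s≤s j≤)) h
... | l , l≤ , t , e = suc l , s≤s l≤ , t , cong (iterate↓ c (λ _ s → sel (test s) s (adv s) ⊓ NN)) move ∙ e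
 where
 move : sel (test s) s (adv s) ⊓ NN ≡ adv s
 move = cong (λ t → sel t s (adv s) ⊓ NN) nul ∙ cong (_⊓ NN) (n+0≡n (adv s)) ∙ m≤n⇒m⊓n≡m (bnd 1 z<s)

module _ (N : ℕ) .{{N≢0 : NonZero N}} where

 pairing-mod : ∀ x y → y < N → (x * N + y) mod N ≡ y
 pairing-mod x y y< = mod-% (x * N + y) N ∙ cong (_% N) (+-comm (x * N) y) ∙ ([m+kn]%n≡m%n y x N) ∙ m<n⇒m%n≡m y<

 pairing-quo : ∀ x y → y < N → (x * N + y) quo N ≡ x
 pairing-quo x y y< = quo-/ (x * N + y) N ∙ +-distrib-/ (x * N) y (subst (_< N) (sym lem) y<) ∙
  cong₂ _+_ (m*n/n≡m x N) (m<n⇒m/n≡0 y<) ∙ n+0≡n x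
  where
  lem : x * N % N + y % N ≡ y
  lem = cong₂ _+_ (m*n%n≡0 x N) (m<n⇒m%n≡m y<)

-- The step depends on the slot only, so two vertices with equal slots have the same successor. This
-- is how a collision of keys closes the walk to a cycle.
module Floyd (N NN Lw : ℕ) (1≤N : 1 ≤ N) (NN≥ : N * N ≤ NN) (f : ℕ → ℕ) (f< : ∀ z → f z < N) (slot : ℕ → ℕ)
 (f-slot : ∀ x y → slot x ≡ slot y → f x ≡ f y) (join : ℕ → ℕ) (join01 : ∀ s → join s ≡ 0 ⊎ join s ≡ 1)
 (start : ℕ) (start< : start < N) where

 pack : ℕ → ℕ → ℕ
 pack x y = x * N + y

 private instance
  N≢0 : NonZero N
  N≢0 = >-nonZero 1≤N

 pack-mod : ∀ x y → y < N → pack x y mod N ≡ y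
 pack-mod = pairing-mod N

 pack-quo : ∀ x y → y < N → pack x y quo N ≡ x
 pack-quo = pairing-quo N

 pack≤ : ∀ {x y} → x < N → y < N → pack x y ≤ NN
 pack≤ {x} {y} x< y< = (+-monoʳ (x * N) (<⇒≤ y<) ⟫ +-comm (x * N) N ≡⟫ *-monoˡ N x<) ⟫ NN≥

 v : ℕ → ℕ
 v k = rep f k start

 v-suc : ∀ k → v (suc k) ≡ f (v k)
 v-suc k = rep-suc f k start

 v< : ∀ k → v k < N
 v< zero = start<
 v< (suc k) = subst (_< N) (sym (v-suc k)) (f< (v k))

 ph1 ph2 : ℕ
 ph1 = phase₁ᶠ N NN Lw f start
 ph2 = phase₂ᶠ N NN Lw f join start ph1

 module _ (a b : ℕ) (a<b : a < b) (b≤ : b ≤ Lw) (v≢ : v a ≢ v b) (slot≡ : slot (v a) ≡ slot (v b))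
  (distinct : ∀ k l → k < l → l < b → slot (v k) ≢ slot (v l))
  (hit : join (pack (v a) (v b)) ≡ 1) (hit' : join (pack (v b) (v a)) ≡ 1) where

  inj : ∀ k l → k < l → l ≤ b → v k ≢ v l
  inj k l k<l l≤b e with m≤n⇒m<n∨m≡n l≤b
  ... | inj₁ l<b = distinct k l k<l l<b (cong slot e)
  ... | inj₂ refl with <-cmp k a
  ... | tri< k<a _ _ = distinct k a k<a a<b (cong slot e ∙ sym slot≡)
  ... | tri≈ _ refl _ = v≢ e
  ... | tri> _ _ a<k = distinct a k a<k k<l (slot≡ ∙ cong slot (sym e))

  back : v (suc b) ≡ v (suc a)
  back = v-suc b ∙ f-slot _ _ (sym slot≡) ∙ sym (v-suc a)

  orbit : ∀ u → ∃ λ w → w ≤ b × v u ≡ v w × (1 ≤ u → 1 ≤ w)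
  orbit zero = 0 , z≤n , refl , λ ()
  orbit (suc u) with orbit u
  ... | w , w≤ , e , _ with m≤n⇒m<n∨m≡n w≤
  ... | inj₁ w< = suc w , w< , v-suc u ∙ cong f e ∙ sym (v-suc w) , λ _ → z<s
  ... | inj₂ refl = suc a , a<b , v-suc u ∙ cong f e ∙ sym (v-suc w) ∙ back , λ _ → z<s

  period : ∀ k → suc a ≤ k → v (k + (b ∸ a)) ≡ v k
  period (suc k) (s≤s a≤k) with m≤n⇒m<n∨m≡n a≤k
  ... | inj₁ a<k = v-suc (k + (b ∸ a)) ∙ cong f (period k a<k) ∙ sym (v-suc k)
  ... | inj₂ refl = cong (λ x → v (suc x)) (m+[n∸m] (<⇒≤ a<b)) ∙ back

  periods : ∀ c k → suc a ≤ k → v (k + c * (b ∸ a)) ≡ v k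
  periods zero k a<k = cong v (n+0≡n k)
  periods (suc c) k a<k = cong v (sym (+-assoc k (b ∸ a) (c * (b ∸ a)))) ∙
   periods c (k + (b ∸ a)) (a<k ⟫ m≤m+n k _) ∙ period k a<k

  -- The smallest multiple of the period b - a above a lies on the cycle, and doubling it adds whole
  -- periods.
  meet : ∃ λ m → 1 ≤ m × m ≤ b × v m ≡ v (m + m)
  meet = m , z<s ⟫ a<m , m≤b , sym (periods (suc (a / d)) m a<m)
   where
   d = b ∸ a
   instance
    d≢0 : NonZero d
    d≢0 = >-nonZero (m<n⇒0<n∸m a<b)
   m = suc (a / d) * d
   a<m : a < m
   a<m = s≤s (≤-reflexive (m≡m%n+[m/n]*n a d)) ⟫ +-monoˡ (a / d * d) (m%n<n a d)
   m≤b : m ≤ b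
   m≤b = +-monoʳ d (m/n*n≤m a d) ⟫≡ m∸n+n≡m (<⇒≤ a<b)

  -- The walk has the shape of the letter ρ: the entrance of the cycle is its only vertex with two
  -- predecessors in the walk, and these are `v a` and `v b`.
  collide : ∀ x y → x ≢ y → f x ≡ f y → (∃ λ u → v u ≡ x) → (∃ λ w → v w ≡ y) → (x ≡ v a × y ≡ v b) ⊎ (x ≡ v b × y ≡ v a)
  collide x y x≢y fe (u , refl) (w , refl) with orbit u | orbit w
  ... | u' , u≤ , eu , _ | w' , w≤ , ew , _ with m≤n⇒m<n∨m≡n u≤ | m≤n⇒m<n∨m≡n w≤
  ... | inj₂ refl | inj₂ refl = ⊥-elim (x≢y (eu ∙ sym ew))
  ... | inj₁ u< | inj₁ w< with <-cmp u' w'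
  ... | tri< lt _ _ = ⊥-elim (inj (suc u') (suc w') (s≤s lt) w< (v-suc u' ∙ cong f (sym eu) ∙ fe ∙ cong f ew ∙ sym (v-suc w')))
  ... | tri≈ _ refl _ = ⊥-elim (x≢y (eu ∙ sym ew))
  ... | tri> _ _ gt = ⊥-elim (inj (suc w') (suc u') (s≤s gt) u< (sym (v-suc u' ∙ cong f (sym eu) ∙ fe ∙ cong f ew ∙ sym (v-suc w'))))
  collide x y x≢y fe (u , refl) (w , refl) | u' , u≤ , eu , _ | w' , w≤ , ew , _ | inj₁ u< | inj₂ refl with <-cmp u' a
  ... | tri< lt _ _ = ⊥-elim (inj (suc u') (suc a) (s≤s lt) a<b (v-suc u' ∙ cong f (sym eu) ∙ fe ∙ cong f ew ∙ sym (v-suc b) ∙ back))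
  ... | tri≈ _ refl _ = inj₁ (eu , ew)
  ... | tri> _ _ gt = ⊥-elim (inj (suc a) (suc u') (s≤s gt) u< (sym (v-suc u' ∙ cong f (sym eu) ∙ fe ∙ cong f ew ∙ sym (v-suc b) ∙ back)))
  collide x y x≢y fe (u , refl) (w , refl) | u' , u≤ , eu , _ | w' , w≤ , ew , _ | inj₂ refl | inj₁ w< with <-cmp w' a
  ... | tri< lt _ _ = ⊥-elim (inj (suc w') (suc a) (s≤s lt) a<b (v-suc w' ∙ cong f (sym ew) ∙ sym fe ∙ cong f eu ∙ sym (v-suc b) ∙ back))
  ... | tri≈ _ refl _ = inj₂ (eu , ew)
  ... | tri> _ _ gt = ⊥-elim (inj (suc a) (suc w') (s≤s gt) w< (sym (v-suc w' ∙ cong f (sym ew) ∙ sym fe ∙ cong f eu ∙ sym (v-suc b) ∙ back)))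

  -- Going back in parallel from a meeting point, the two runners part at different vertices with a
  -- common successor, unless they agree back to time 0.
  descend : ∀ m k → v k ≡ v (k + m) → (∃ λ l → l < k × v l ≢ v (l + m) × v (suc l) ≡ v (suc l + m)) ⊎ v 0 ≡ v m
  descend m zero e = inj₂ e
  descend m (suc k) e with v k ≟ v (k + m)
  ... | no ne = inj₁ (k , ≤-refl , ne , e)
  ... | yes e' with descend m k e'
  ... | inj₁ (l , l< , ne , e″) = inj₁ (l , <-suc l< , ne , e″)
  ... | inj₂ e″ = inj₂ e″

  adv₁ adv₂ : ℕ → ℕ
  adv₁ s = pack (f (s quo N)) (f (f (s mod N)))
  adv₂ s = pack (f (s quo N)) (f (s mod N))

  rep-adv₁ : ∀ k m → rep adv₁ k (pack (v m) (v (m + m))) ≡ pack (v (k + m)) (v ((k + m) + (k + m)))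
  rep-adv₁ zero m = refl
  rep-adv₁ (suc k) m = cong (rep adv₁ k) (cong₂ (λ x y → pack (f x) (f (f y))) (pack-quo (v m) _ (v< (m + m))) (pack-mod (v m) _ (v< (m + m))) ∙
   cong₂ pack (sym (v-suc m)) (cong f (sym (v-suc (m + m))) ∙ sym (v-suc (suc (m + m))) ∙ cong (λ x → v (suc x)) (sym (+-suc m m)))) ∙
   rep-adv₁ k (suc m) ∙ cong (λ x → pack (v x) (v (x + x))) (+-suc k m)

  rep-adv₂ : ∀ k l m → rep adv₂ k (pack (v l) (v m)) ≡ pack (v (k + l)) (v (k + m))
  rep-adv₂ zero l m = refl
  rep-adv₂ (suc k) l m = cong (rep adv₂ k) (cong₂ (λ x y → pack (f x) (f y)) (pack-quo (v l) _ (v< m)) (pack-mod (v l) _ (v< m)) ∙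
   cong₂ pack (sym (v-suc l)) (sym (v-suc m))) ∙
   rep-adv₂ k (suc l) (suc m) ∙ cong₂ (λ x y → pack (v x) (v y)) (+-suc k l) (+-suc k m)

  phase₁ : ∃ λ m → 1 ≤ m × m ≤ b × v m ≡ v (m + m) × ph1 mod N ≡ v m
  phase₁ with meet
  ... | suc m , _ , m≤ , e
   with search Lw NN (λ s → eq (s quo N) (s mod N)) adv₁ (pack (v 1) (v 2)) m (n≤1+n m ⟫ m≤ ⟫ b≤)
    (λ s → cases s)
    (λ j _ → subst (_≤ NN) (sym (rep-adv₁ j 1)) (pack≤ (v< (j + 1)) (v< ((j + 1) + (j + 1)))))
    (cong (λ s → eq (s quo N) (s mod N)) (rep-adv₁ m 1) ∙ cong₂ eq (pack-quo _ _ (v< ((m + 1) + (m + 1)))) (pack-mod (v (m + 1)) _ (v< ((m + 1) + (m + 1)))) ∙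
     eq-yes (subst (λ x → v x ≡ v (x + x)) (+-comm 1 m) e))
   where
   cases : ∀ s → eq (s quo N) (s mod N) ≡ 0 ⊎ eq (s quo N) (s mod N) ≡ 1
   cases s with eq-cases (s quo N) (s mod N)
   ... | inj₁ (_ , x) = inj₂ x
   ... | inj₂ (_ , x) = inj₁ x
  ... | l , l≤ , t , r = l + 1 , m≤n+m 1 l , +-comm l 1 ≡⟫ s≤s l≤ ⟫ m≤ , same ,
   cong (_mod N) (r ∙ rep-adv₁ l 1) ∙ pack-mod (v (l + 1)) _ (v< ((l + 1) + (l + 1))) ∙ sym same
   where
   same : v (l + 1) ≡ v ((l + 1) + (l + 1))
   same with eq-cases (v (l + 1)) (v ((l + 1) + (l + 1)))
   ... | inj₁ (x , _) = x
   ... | inj₂ (_ , z) with () ← sym z ∙ sym (cong (λ s → eq (s quo N) (s mod N)) (rep-adv₁ l 1) ∙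
    cong₂ eq (pack-quo _ _ (v< ((l + 1) + (l + 1)))) (pack-mod (v (l + 1)) _ (v< ((l + 1) + (l + 1))))) ∙ t

  -- The second phase may stop before the cycle is reached, at some other pair that passes `join`;
  -- this is a success as well.
  floyd : join ph2 ≡ 1
  floyd with phase₁
  ... | m , 1≤m , m≤ , e , r with descend m m e
  ... | inj₂ v0 with orbit m
  -- The runners cannot agree at time 0, because `v 0` never recurs in the walk.
  ... | w , w≤ , ew , 1≤ = ⊥-elim (inj 0 w (1≤ 1≤m) w≤ (v0 ∙ ew))
  floyd | m , 1≤m , m≤ , e , r | inj₁ (l , l< , ne , e')
   with collide (v l) (v (l + m)) ne (sym (v-suc l) ∙ e' ∙ v-suc (l + m)) (l , refl) (l + m , refl)
  ... | c with search Lw NN join adv₂ (pack (v 0) (v m)) l (<⇒≤ l< ⟫ m≤ ⟫ b≤) join01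
   (λ j _ → subst (_≤ NN) (sym (rep-adv₂ j 0 m)) (pack≤ (v< (j + 0)) (v< (j + m))))
   (cong join (rep-adv₂ l 0 m ∙ cong (λ x → pack (v x) (v (l + m))) (n+0≡n l)) ∙ found c)
   where
   found : (v l ≡ v a × v (l + m) ≡ v b) ⊎ (v l ≡ v b × v (l + m) ≡ v a) → join (pack (v l) (v (l + m))) ≡ 1
   found (inj₁ (x , y)) = cong join (cong₂ pack x y) ∙ hit
   found (inj₂ (x , y)) = cong join (cong₂ pack x y) ∙ hit'
  ... | l' , _ , t , r' = cong join (cong (λ y → iterate↓ Lw (λ _ s → sel (join s) s (adv₂ s) ⊓ NN) (pack start y)) r ∙ r') ∙ t

-- Subset sums, collisions inside a splitting, and signed relations.

module WordSum {A : Set} (x : A) (l : List A) where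

 letters : A → List A → (A → ℕ) → ℕ
 letters x [] F = F x
 letters x (y ∷ l) F = F x + letters y l F

 Ω : ∀ n → (Vec A n → ℕ) → ℕ
 Ω zero F = F []
 Ω (suc n) F = letters x l λ s → Ω n λ z → F (s ∷ z)

 letters-mono : ∀ x l {F G : A → ℕ} → (∀ s → F s ≤ G s) → letters x l F ≤ letters x l G
 letters-mono x [] h = h x
 letters-mono x (y ∷ l) h = +-mono (h x) (letters-mono y l h)

 letters-cong : ∀ x l {F G : A → ℕ} → (∀ s → F s ≡ G s) → letters x l F ≡ letters x l G
 letters-cong x [] h = h x
 letters-cong x (y ∷ l) h = cong₂ _+_ (h x) (letters-cong y l h)

 letters-+ : ∀ x l (F G : A → ℕ) → letters x l (λ s → F s + G s) ≡ letters x l F + letters x l G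
 letters-+ x [] F G = refl
 letters-+ x (y ∷ l) F G = cong (F x + G x +_) (letters-+ y l F G) ∙ +-interchange (F x) (G x) _ _

 letters-*ˡ : ∀ x l c (F : A → ℕ) → letters x l (λ s → c * F s) ≡ c * letters x l F
 letters-*ˡ x [] c F = refl
 letters-*ˡ x (y ∷ l) c F = cong (c * F x +_) (letters-*ˡ y l c F) ∙ sym (*-distribˡ-+ c (F x) _)

 mono : ∀ n {F G : Vec A n → ℕ} → (∀ z → F z ≤ G z) → Ω n F ≤ Ω n G
 mono zero h = h []
 mono (suc n) h = letters-mono x l λ s → mono n λ z → h (s ∷ z)

 congr : ∀ n {F G : Vec A n → ℕ} → (∀ z → F z ≡ G z) → Ω n F ≡ Ω n G
 congr zero h = h []
 congr (suc n) h = letters-cong x l λ s → congr n λ z → h (s ∷ z)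

 plus : ∀ n (F G : Vec A n → ℕ) → Ω n (λ z → F z + G z) ≡ Ω n F + Ω n G
 plus zero F G = refl
 plus (suc n) F G = letters-cong x l (λ s → plus n _ _) ∙ letters-+ x l _ _

 scale : ∀ n c (F : Vec A n → ℕ) → Ω n (λ z → c * F z) ≡ c * Ω n F
 scale zero c F = refl
 scale (suc n) c F = letters-cong x l (λ s → scale n c _) ∙ letters-*ˡ x l c _

open WordSum false (true ∷ []) public using () renaming (Ω to 𝔹; mono to 𝔹-mono; congr to 𝔹-cong; plus to 𝔹-+; scale to 𝔹-*ˡ)

𝔹-*ʳ : ∀ n c (F : Vec Bool n → ℕ) → 𝔹 n (λ x → F x * c) ≡ 𝔹 n F * c
𝔹-*ʳ n c F = (𝔹-cong n λ x → *-comm (F x) c) ∙ 𝔹-*ˡ n c F ∙ *-comm c _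

𝔹-const : ∀ n c → 𝔹 n (λ _ → c) ≡ 2 ^ n * c
𝔹-const zero c = sym (n+0≡n c)
𝔹-const (suc n) c rewrite 𝔹-const n c = lem (2 ^ n) c
 where
 lem : ∀ x c → x * c + x * c ≡ (x + (x + 0)) * c
 lem = ring

𝔹-swap : ∀ m n (F : Vec Bool m → Vec Bool n → ℕ) → 𝔹 m (λ x → 𝔹 n (F x)) ≡ 𝔹 n (λ y → 𝔹 m (λ x → F x y))
𝔹-swap zero n F = refl
𝔹-swap (suc m) n F = cong₂ _+_ (𝔹-swap m n _) (𝔹-swap m n _) ∙ sym (𝔹-+ n _ _)

𝔹-term : ∀ n (F : Vec Bool n → ℕ) x → F x ≤ 𝔹 n F
𝔹-term zero F [] = ≤-refl
𝔹-term (suc n) F (false ∷ x) = 𝔹-term n _ x ⟫ m≤m+n _ _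
𝔹-term (suc n) F (true ∷ x) = 𝔹-term n _ x ⟫ m≤n+m _ _

𝔹-not : ∀ n (F : Vec Bool n → ℕ) → 𝔹 n (λ x → F (Vec.map not x)) ≡ 𝔹 n F
𝔹-not zero F = refl
𝔹-not (suc n) F = cong₂ _+_ (𝔹-not n (λ x → F (true ∷ x))) (𝔹-not n (λ x → F (false ∷ x))) ∙ +-comm (𝔹 n λ x → F (true ∷ x)) _

shift : (ℕ → ℕ) → ℕ → ℕ
shift w i = w (suc i)

dot : ∀ {n} → (ℕ → ℕ) → Vec Bool n → ℕ
dot w [] = 0
dot w (false ∷ x) = dot (shift w) x
dot w (true ∷ x) = w 0 + dot (shift w) x

card : ∀ {n} → Vec Bool n → ℕ
card [] = 0
card (false ∷ x) = card x
card (true ∷ x) = suc (card x)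

sub : ∀ {n} → Vec Bool n → Vec Bool n → ℕ
sub [] [] = 1
sub (false ∷ x) (_ ∷ l) = sub x l
sub (true ∷ x) (false ∷ l) = 0
sub (true ∷ x) (true ∷ l) = sub x l

card≤ : ∀ {n} (l : Vec Bool n) → card l ≤ n
card≤ [] = z≤n
card≤ (false ∷ l) = m≤n⇒m≤1+n (card≤ l)
card≤ (true ∷ l) = s≤s (card≤ l)

card-not : ∀ {n} (l : Vec Bool n) → card (Vec.map not l) + card l ≡ n
card-not [] = refl
card-not (false ∷ l) = cong suc (card-not l)
card-not (true ∷ l) = +-suc _ _ ∙ cong suc (card-not l)

collisions : ∀ {n} → (ℕ → ℕ) → Vec Bool n → ℕ
collisions {n} w l = 𝔹 n λ x → sub x l * 𝔹 n λ y → sub y l * eq (dot w x) (dot w y)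

eq-shift : ∀ c x y → eq (c + x) (c + y) ≡ eq x y
eq-shift c x y = cong₂ (λ a b → 1 ∸ (a + b)) ([m+n]∸[m+o]≡n∸o c x y) ([m+n]∸[m+o]≡n∸o c y x)

data Sign : Set where
 𝟘 ⊞ ⊟ : Sign

open WordSum 𝟘 (⊞ ∷ ⊟ ∷ []) public using () renaming (Ω to 𝕋; mono to 𝕋-mono; congr to 𝕋-cong; plus to 𝕋-+; scale to 𝕋-*ˡ)

dot⁺ dot⁻ : ∀ {n} → (ℕ → ℕ) → Vec Sign n → ℕ
dot⁺ w [] = 0
dot⁺ w (⊞ ∷ z) = w 0 + dot⁺ (shift w) z
dot⁺ w (𝟘 ∷ z) = dot⁺ (shift w) z
dot⁺ w (⊟ ∷ z) = dot⁺ (shift w) z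
dot⁻ w [] = 0
dot⁻ w (⊟ ∷ z) = w 0 + dot⁻ (shift w) z
dot⁻ w (𝟘 ∷ z) = dot⁻ (shift w) z
dot⁻ w (⊞ ∷ z) = dot⁻ (shift w) z

neg : ∀ {n} → Vec Sign n → Vec Sign n
neg [] = []
neg (𝟘 ∷ z) = 𝟘 ∷ neg z
neg (⊞ ∷ z) = ⊟ ∷ neg z
neg (⊟ ∷ z) = ⊞ ∷ neg z

𝕋-neg : ∀ n (F : Vec Sign n → ℕ) → 𝕋 n (λ z → F (neg z)) ≡ 𝕋 n F
𝕋-neg zero F = refl
𝕋-neg (suc n) F = cong₂ _+_ (𝕋-neg n λ z → F (𝟘 ∷ z)) (cong₂ _+_ (𝕋-neg n λ z → F (⊟ ∷ z)) (𝕋-neg n λ z → F (⊞ ∷ z)) ∙ +-comm (𝕋 n λ z → F (⊟ ∷ z)) _)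

dot⁺-neg : ∀ {n} w (z : Vec Sign n) → dot⁺ w (neg z) ≡ dot⁻ w z
dot⁺-neg w [] = refl
dot⁺-neg w (𝟘 ∷ z) = dot⁺-neg (shift w) z
dot⁺-neg w (⊞ ∷ z) = dot⁺-neg (shift w) z
dot⁺-neg w (⊟ ∷ z) = cong (w 0 +_) (dot⁺-neg (shift w) z)

dot⁻-neg : ∀ {n} w (z : Vec Sign n) → dot⁻ w (neg z) ≡ dot⁺ w z
dot⁻-neg w [] = refl
dot⁻-neg w (𝟘 ∷ z) = dot⁻-neg (shift w) z
dot⁻-neg w (⊟ ∷ z) = dot⁻-neg (shift w) z
dot⁻-neg w (⊞ ∷ z) = cong (w 0 +_) (dot⁻-neg (shift w) z)

relation : ∀ {n} → (ℕ → ℕ) → Vec Sign n → ℕ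
relation w z = eq (dot⁺ w z) (dot⁻ w z)

eq-sym : ∀ x y → eq x y ≡ eq y x
eq-sym x y = cong (1 ∸_) (+-comm (x ∸ y) (y ∸ x))

relation-neg : ∀ {n} w (z : Vec Sign n) → relation w (neg z) ≡ relation w z
relation-neg w z = cong₂ eq (dot⁺-neg w z) (dot⁻-neg w z) ∙ eq-sym (dot⁻ w z) (dot⁺ w z)

weight : ∀ {n} → Vec Sign n → ℕ
weight [] = 1
weight (𝟘 ∷ z) = 9 * weight z
weight (⊞ ∷ z) = 2 * weight z
weight (⊟ ∷ z) = 2 * weight z

-- A product weight instead of the uniform measure on balanced masks, on which it is about 10^(n/2).
-- Being multiplicative, it can be summed one coordinate at a time.
split-weight : ∀ {n} → Vec Bool n → ℕ
split-weight [] = 1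
split-weight (false ∷ l) = 5 * split-weight l
split-weight (true ∷ l) = 2 * split-weight l

split-weight-≡ : ∀ {n} (l : Vec Bool n) → split-weight l ≡ 5 ^ (n ∸ card l) * 2 ^ card l
split-weight-≡ [] = refl
split-weight-≡ {suc n} (false ∷ l) rewrite +-∸-assoc 1 (card≤ l) = cong (5 *_) (split-weight-≡ l) ∙ sym (*-assoc 5 (5 ^ (n ∸ card l)) _)
split-weight-≡ {suc n} (true ∷ l) = cong (2 *_) (split-weight-≡ l) ∙ lem (5 ^ (n ∸ card l)) (2 ^ card l)
 where
 lem : ∀ a b → 2 * (a * b) ≡ a * (2 * b)
 lem = ring

module _ where
 private
  -- The offsets α and β carry the contributions of the coordinates already removed, which makes the
  -- induction possible.
  C : ∀ n → (ℕ → ℕ) → ℕ → ℕ → Vec Bool n → ℕ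
  C n w α β l = 𝔹 n λ x → sub x l * 𝔹 n λ y → sub y l * eq (α + dot w x) (β + dot w y)

  U : ∀ n → (ℕ → ℕ) → ℕ → ℕ → ℕ
  U n w α β = 𝔹 n λ l → split-weight l * C n w α β l

  R : ∀ n → (ℕ → ℕ) → ℕ → ℕ → ℕ
  R n w α β = 𝕋 n λ z → weight z * eq (α + dot⁺ w z) (β + dot⁻ w z)


  zero-sum : ∀ n → 𝔹 n (λ _ → 0) ≡ 0
  zero-sum n = 𝔹-const n 0 ∙ *-zeroʳ (2 ^ n)

  C-false : ∀ n w α β l → C (suc n) w α β (false ∷ l) ≡ C n (shift w) α β l
  C-false n w α β l = cong₂ _+_ (𝔹-cong n λ x → cong (sub x l *_) (cong (𝔹 n (λ y → sub y l * eq (α + dot (shift w) x) (β + dot (shift w) y)) +_) (zero-sum n) ∙ n+0≡n _)) (zero-sum n) ∙ n+0≡n _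

  C-true : ∀ n w α β l → C (suc n) w α β (true ∷ l) ≡
   2 * C n (shift w) α β l + (C n (shift w) (w 0 + α) β l + C n (shift w) α (w 0 + β) l)
  C-true n w α β l = cong₂ _+_
   ((𝔹-cong n λ x → cong (sub x l *_) (cong (𝔹 n (λ y → sub y l * eq (α + dot w' x) (β + dot w' y)) +_)
    (𝔹-cong n λ y → cong (λ s → sub y l * eq (α + dot w' x) s) (+-exchange β (w 0) (dot w' y)))) ∙ *-distribˡ-+ (sub x l) _ _) ∙
    𝔹-+ n _ _)
   ((𝔹-cong n λ x → cong (sub x l *_) (cong₂ _+_
    (𝔹-cong n λ y → cong (λ s → sub y l * eq s (β + dot w' y)) (+-exchange α (w 0) (dot w' x)))
    (𝔹-cong n λ y → cong (sub y l *_) (cong₂ eq (+-exchange α (w 0) (dot w' x) ∙ +-assoc (w 0) α _) (+-exchange β (w 0) (dot w' y) ∙ +-assoc (w 0) β _) ∙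
     eq-shift (w 0) (α + dot w' x) (β + dot w' y)))) ∙ *-distribˡ-+ (sub x l) _ _) ∙
    𝔹-+ n _ _) ∙
   lem (C n w' α β l) (C n w' α (w 0 + β) l) (C n w' (w 0 + α) β l)
   where
   w' = shift w
   lem : ∀ a b c → a + b + (c + a) ≡ 2 * a + (c + b)
   lem = ring

  U≡R : ∀ n w α β → U n w α β ≡ R n w α β
  U≡R zero w α β = lem (eq (α + 0) (β + 0))
   where
   lem : ∀ e → 1 * (1 * (1 * e)) ≡ 1 * e
   lem = ring
  U≡R (suc n) w α β = begin-equality
   𝔹 n (λ l → 5 * split-weight l * C (suc n) w α β (false ∷ l)) + 𝔹 n (λ l → 2 * split-weight l * C (suc n) w α β (true ∷ l))
    ≡⟨ cong₂ _+_ ((𝔹-cong n λ l → cong (5 * split-weight l *_) (C-false n w α β l) ∙ *-assoc 5 (split-weight l) _) ∙ 𝔹-*ˡ n 5 _)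
     (𝔹-cong n λ l → cong (2 * split-weight l *_) (C-true n w α β l) ∙ distr (split-weight l) (C n w' α β l) _ _) ⟩
   5 * U n w' α β + 𝔹 n (λ l → 4 * (split-weight l * C n w' α β l) + (2 * (split-weight l * C n w' (w 0 + α) β l) + 2 * (split-weight l * C n w' α (w 0 + β) l)))
    ≡⟨ cong (5 * U n w' α β +_) (𝔹-+ n _ _ ∙ cong₂ _+_ (𝔹-*ˡ n 4 _) (𝔹-+ n _ _ ∙ cong₂ _+_ (𝔹-*ˡ n 2 _) (𝔹-*ˡ n 2 _))) ⟩
   5 * U n w' α β + (4 * U n w' α β + (2 * U n w' (w 0 + α) β + 2 * U n w' α (w 0 + β)))
    ≡⟨ nine (U n w' α β) _ ⟩
   9 * U n w' α β + (2 * U n w' (w 0 + α) β + 2 * U n w' α (w 0 + β))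
    ≡⟨ cong₂ _+_ (cong (9 *_) (U≡R n w' α β)) (cong₂ _+_ (cong (2 *_) (U≡R n w' (w 0 + α) β)) (cong (2 *_) (U≡R n w' α (w 0 + β)))) ⟩
   9 * R n w' α β + (2 * R n w' (w 0 + α) β + 2 * R n w' α (w 0 + β))
    ≡⟨ cong₂ _+_ (back 9 α β (λ z → 9 * weight z * eq (α + dot⁺ w' z) (β + dot⁻ w' z)) (λ z → *-assoc 9 (weight z) _))
     (cong₂ _+_ (back 2 (w 0 + α) β (λ z → 2 * weight z * eq (α + (w 0 + dot⁺ w' z)) (β + dot⁻ w' z))
      (λ z → cong (λ s → 2 * weight z * eq s (β + dot⁻ w' z)) (+-exchange α (w 0) (dot⁺ w' z)) ∙ *-assoc 2 (weight z) _))
      (back 2 α (w 0 + β) (λ z → 2 * weight z * eq (α + dot⁺ w' z) (β + (w 0 + dot⁻ w' z)))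
       (λ z → cong (λ s → 2 * weight z * eq (α + dot⁺ w' z) s) (+-exchange β (w 0) (dot⁻ w' z)) ∙ *-assoc 2 (weight z) _))) ⟩
   R (suc n) w α β ∎
   where
   w' = shift w
   distr : ∀ s a b c → 2 * s * (2 * a + (b + c)) ≡ 4 * (s * a) + (2 * (s * b) + 2 * (s * c))
   distr = ring
   nine : ∀ u v → 5 * u + (4 * u + v) ≡ 9 * u + v
   nine = ring
   back : ∀ c α β (F : Vec Sign n → ℕ) → (∀ z → F z ≡ c * (weight z * eq (α + dot⁺ w' z) (β + dot⁻ w' z))) → c * R n w' α β ≡ 𝕋 n F
   back c α β F h = sym (𝕋-cong n h ∙ 𝕋-*ˡ n c _)

 relation-weight : ∀ n → (ℕ → ℕ) → ℕ
 relation-weight n w = 𝕋 n λ z → weight z * relation w z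

 -- Pairs of subsets are grouped by their difference. At a coordinate outside l both entries are 0,
 -- with weight 5; inside l there are four pairs of entries of weight 2, with differences 0, 0, 1
 -- and -1. So a difference 0 collects 5 + 2 · 2 = 9, and 1 and -1 collect 2 each.
 split-identity : ∀ n w → 𝔹 n (λ l → split-weight l * collisions w l) ≡ relation-weight n w
 split-identity n w = U≡R n w 0 0

-- Many distinct sums force few relations.

first : ∀ n → (Vec Bool n → Bool) → Maybe (Vec Bool n)
first zero p = if p [] then just [] else nothing
first (suc n) p with first n (λ x → p (false ∷ x))
... | just x = just (false ∷ x)
... | nothing = Maybe.map (true ∷_) (first n (λ x → p (true ∷ x)))

first-sound : ∀ n p {x} → first n p ≡ just x → p x ≡ true
first-sound zero p e with p [] in h
first-sound zero p refl | true = h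
first-sound (suc n) p e with first n (λ x → p (false ∷ x)) in h
first-sound (suc n) p refl | just x = first-sound n _ h
first-sound (suc n) p e | nothing with first n (λ x → p (true ∷ x)) in h'
first-sound (suc n) p refl | nothing | just x = first-sound n _ h'

first-complete : ∀ n p x → p x ≡ true → ∃ λ y → first n p ≡ just y
first-complete zero p [] e with p [] in h
... | true = [] , refl
first-complete zero p [] () | false
first-complete (suc n) p (b ∷ x) e with first n (λ x → p (false ∷ x)) in h
... | just y = false ∷ y , refl
first-complete (suc n) p (false ∷ x) e | nothing with () ← sym h ∙ snd (first-complete n _ x e)
first-complete (suc n) p (true ∷ x) e | nothing with first-complete n (λ x → p (true ∷ x)) x e
... | y , e' = true ∷ y , cong (Maybe.map (true ∷_)) e'

-- `A` selects the first subset for each value of f, so its total is the number of distinct values.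
module Transversal (n : ℕ) (f : Vec Bool n → ℕ) where

 canon : ℕ → Maybe (Vec Bool n)
 canon s = first n λ y → f y ≡ᵇ s

 _≟ᵐ_ : (x y : Maybe (Vec Bool n)) → Dec (x ≡ y)
 _≟ᵐ_ = Maybeₚ.≡-dec (Vecₚ.≡-dec Boolₚ._≟_)

 A : Vec Bool n → ℕ
 A a = if does (canon (f a) ≟ᵐ just a) then 1 else 0

 A-cases : ∀ a → A a ≡ 0 ⊎ (A a ≡ 1 × canon (f a) ≡ just a)
 A-cases a with canon (f a) ≟ᵐ just a
 ... | yes e = inj₂ (refl , e)
 ... | no _ = inj₁ refl

 A≤1 : ∀ a → A a ≤ 1
 A≤1 a with A-cases a
 ... | inj₁ e = e ≡⟫ z≤n
 ... | inj₂ (e , _) = ≤-reflexive e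

 A-injective : ∀ a a' → A a ≢ 0 → A a' ≢ 0 → f a ≡ f a' → a ≡ a'
 A-injective a a' h h' e with A-cases a | A-cases a'
 ... | inj₁ z | _ = ⊥-elim (h z)
 ... | _ | inj₁ z = ⊥-elim (h' z)
 ... | inj₂ (_ , c) | inj₂ (_ , c') = Maybeₚ.just-injective (sym c ∙ cong canon e ∙ c')

 represent : ∀ y → ∃ λ a → A a ≡ 1 × f a ≡ f y
 represent y with first-complete n (λ x → f x ≡ᵇ f y) y (T⇒true (≡⇒≡ᵇ (f y) (f y) refl))
  where
  T⇒true : ∀ {b} → T b → b ≡ true
  T⇒true {true} _ = refl
 ... | a , e with A-cases a
 ... | inj₂ (o , _) = a , o , ≡ᵇ⇒≡ (f a) (f y) (subst T (sym (first-sound n _ e)) _)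
 ... | inj₁ z with canon (f a) ≟ᵐ just a
 ... | no ne = ⊥-elim (ne (cong canon (≡ᵇ⇒≡ (f a) (f y) (subst T (sym (first-sound n _ e)) _)) ∙ e))

-- Overflowing coordinates of a + z, the ones equal to -1 or 2, have weight 4, the others 81.
overflow : ∀ {n} → Vec Bool n → Vec Sign n → ℕ
overflow [] [] = 1
overflow (_ ∷ a) (𝟘 ∷ z) = 81 * overflow a z
overflow (false ∷ a) (⊞ ∷ z) = 81 * overflow a z
overflow (true ∷ a) (⊞ ∷ z) = 4 * overflow a z
overflow (false ∷ a) (⊟ ∷ z) = 4 * overflow a z
overflow (true ∷ a) (⊟ ∷ z) = 81 * overflow a z

-- Where z is nonzero, exactly one of a + z and a - z overflows, and 81 · 4 = (9 · 2)²; elsewhere 81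
-- · 81 = (9 · 9)². So the geometric mean of the two weights does not depend on a.
overflow-neg : ∀ {n} (a : Vec Bool n) z → overflow a z * overflow a (neg z) ≡ (9 ^ n * weight z) * (9 ^ n * weight z)

overflow-step : ∀ {n} (a : Vec Bool n) z p q c → p * q ≡ 81 * c * c →
 p * overflow a z * (q * overflow a (neg z)) ≡ 9 * 9 ^ n * (c * weight z) * (9 * 9 ^ n * (c * weight z))
overflow-step {n} a z p q c e = *-interchange p (overflow a z) q _ ∙ cong₂ _*_ e (overflow-neg a z) ∙ lem (9 ^ n) c (weight z)
 where
 lem : ∀ k c w → 81 * c * c * (k * w * (k * w)) ≡ 9 * k * (c * w) * (9 * k * (c * w))
 lem = ring

overflow-neg [] [] = refl
overflow-neg (b ∷ a) (𝟘 ∷ z) = overflow-step a z 81 81 9 refl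
overflow-neg (false ∷ a) (⊞ ∷ z) = overflow-step a z 81 4 2 refl
overflow-neg (true ∷ a) (⊞ ∷ z) = overflow-step a z 4 81 2 refl
overflow-neg (false ∷ a) (⊟ ∷ z) = overflow-step a z 4 81 2 refl
overflow-neg (true ∷ a) (⊟ ∷ z) = overflow-step a z 81 4 2 refl

am-gm-≤ : ∀ {x y} m → x ≤ y → x * y ≡ m * m → 2 * m ≤ x + y
am-gm-≤ {x} {y} m x≤y e = ≮⇒≥ λ lt → <-irrefl refl (begin-strict
 (x + y) * (x + y) <⟨ *-mono-< lt lt ⟩
 2 * m * (2 * m) ≡⟨ lem₁ m ⟩
 4 * (m * m) ≡⟨ cong (4 *_) (sym e) ⟩
 4 * (x * y) ≤⟨ m≤m+n _ _ ⟩
 4 * (x * y) + d * d ≡⟨ cong (λ y → 4 * (x * y) + d * d) (sym (m+[n∸m] x≤y)) ∙ lem₂ x d ∙ cong (λ y → (x + y) * (x + y)) (m+[n∸m] x≤y) ⟩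
 (x + y) * (x + y) ∎)
 where
 d = y ∸ x
 lem₁ : ∀ m → 2 * m * (2 * m) ≡ 4 * (m * m)
 lem₁ = ring
 lem₂ : ∀ x d → 4 * (x * (x + d)) + d * d ≡ (x + (x + d)) * (x + (x + d))
 lem₂ = ring

am-gm : ∀ x y m → x * y ≡ m * m → 2 * m ≤ x + y
am-gm x y m e with ≤-total x y
... | inj₁ x≤y = am-gm-≤ m x≤y e
... | inj₂ y≤x = subst (2 * m ≤_) (+-comm y x) (am-gm-≤ m y≤x (*-comm y x ∙ e))

-- Negating a relation turns overflow into its complement on the support, so one of the two has at most half of it.
overflow-lower : ∀ n w (a : Vec Bool n) → 9 ^ n * relation-weight n w ≤ 𝕋 n (λ z → overflow a z * relation w z)
overflow-lower n w a = *-cancelˡ-≤ 2 (begin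
 2 * (9 ^ n * relation-weight n w)
  ≡⟨ cong (2 *_) (sym (𝕋-*ˡ n (9 ^ n) _)) ∙ sym (𝕋-*ˡ n 2 _) ⟩
 𝕋 n (λ z → 2 * (9 ^ n * (weight z * relation w z)))
  ≤⟨ 𝕋-mono n (λ z → lem (9 ^ n) (weight z) (relation w z) ≡⟫
   *-monoˡ (relation w z) (am-gm (overflow a z) (overflow a (neg z)) (9 ^ n * weight z) (overflow-neg a z))) ⟩
 𝕋 n (λ z → (overflow a z + overflow a (neg z)) * relation w z)
  ≡⟨ (𝕋-cong n λ z → *-distribʳ-+ (relation w z) (overflow a z) _ ∙ cong (λ r → overflow a z * relation w z + overflow a (neg z) * r) (sym (relation-neg w z))) ∙ 𝕋-+ n _ _ ⟩
 V + 𝕋 n (λ z → overflow a (neg z) * relation w (neg z))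
  ≡⟨ cong (V +_) (𝕋-neg n (λ z → overflow a z * relation w z) ∙ sym (n+0≡n V)) ⟩
 2 * V ∎)
 where
 V = 𝕋 n (λ z → overflow a z * relation w z)
 lem : ∀ k x r → 2 * (k * (x * r)) ≡ 2 * (k * x) * r
 lem = ring

data Quad : Set where
 m1 q0 q1 q2 : Quad

open WordSum m1 (q0 ∷ q1 ∷ q2 ∷ []) public using () renaming (Ω to ℚ4; mono to ℚ4-mono; congr to ℚ4-cong; plus to ℚ4-+; scale to ℚ4-*ˡ)

quad-weight : ∀ {n} → Vec Quad n → ℕ
quad-weight [] = 1
quad-weight (m1 ∷ b) = 4 * quad-weight b
quad-weight (q0 ∷ b) = 81 * quad-weight b
quad-weight (q1 ∷ b) = 81 * quad-weight b
quad-weight (q2 ∷ b) = 4 * quad-weight b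

-- Summation over all ways to write b as a + z with a a subset and z a sign vector; `Adds` is the
-- relation behind it.
fibre : ∀ {n} → Vec Quad n → (Vec Bool n → Vec Sign n → ℕ) → ℕ
fibre [] F = F [] []
fibre (m1 ∷ b) F = fibre b (λ a z → F (false ∷ a) (⊟ ∷ z))
fibre (q0 ∷ b) F = fibre b (λ a z → F (false ∷ a) (𝟘 ∷ z)) + fibre b (λ a z → F (true ∷ a) (⊟ ∷ z))
fibre (q1 ∷ b) F = fibre b (λ a z → F (false ∷ a) (⊞ ∷ z)) + fibre b (λ a z → F (true ∷ a) (𝟘 ∷ z))
fibre (q2 ∷ b) F = fibre b (λ a z → F (true ∷ a) (⊞ ∷ z))

data Adds : ∀ {n} → Vec Quad n → Vec Bool n → Vec Sign n → Set where
 [] : Adds [] [] []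
 am1 : ∀ {n} {b : Vec Quad n} {a z} → Adds b a z → Adds (m1 ∷ b) (false ∷ a) (⊟ ∷ z)
 a00 : ∀ {n} {b : Vec Quad n} {a z} → Adds b a z → Adds (q0 ∷ b) (false ∷ a) (𝟘 ∷ z)
 a01 : ∀ {n} {b : Vec Quad n} {a z} → Adds b a z → Adds (q0 ∷ b) (true ∷ a) (⊟ ∷ z)
 a10 : ∀ {n} {b : Vec Quad n} {a z} → Adds b a z → Adds (q1 ∷ b) (false ∷ a) (⊞ ∷ z)
 a11 : ∀ {n} {b : Vec Quad n} {a z} → Adds b a z → Adds (q1 ∷ b) (true ∷ a) (𝟘 ∷ z)
 a21 : ∀ {n} {b : Vec Quad n} {a z} → Adds b a z → Adds (q2 ∷ b) (true ∷ a) (⊞ ∷ z)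

quad-pos quad-neg : ∀ {n} → (ℕ → ℕ) → Vec Quad n → ℕ
quad-pos w [] = 0
quad-pos w (m1 ∷ b) = quad-pos (shift w) b
quad-pos w (q0 ∷ b) = quad-pos (shift w) b
quad-pos w (q1 ∷ b) = w 0 + quad-pos (shift w) b
quad-pos w (q2 ∷ b) = w 0 + w 0 + quad-pos (shift w) b
quad-neg w [] = 0
quad-neg w (m1 ∷ b) = w 0 + quad-neg (shift w) b
quad-neg w (q0 ∷ b) = quad-neg (shift w) b
quad-neg w (q1 ∷ b) = quad-neg (shift w) b
quad-neg w (q2 ∷ b) = quad-neg (shift w) b

adds-sum : ∀ {n} w {b : Vec Quad n} {a z} → Adds b a z → dot w a + dot⁺ w z + quad-neg w b ≡ dot⁻ w z + quad-pos w b

adds-step : ∀ {n} w {b : Vec Quad n} {a z} → Adds b a z → ∀ p q r t → p + q + r ≡ t →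
 p + dot w a + (q + dot⁺ w z) + (r + quad-neg w b) ≡ dot⁻ w z + (t + quad-pos w b)
adds-step w {b} {a} {z} h p q r t refl = lem p q r (dot w a) (dot⁺ w z) (quad-neg w b) ∙ cong (p + q + r +_) (adds-sum w h) ∙
 +-rotate (p + q + r) (dot⁻ w z) (quad-pos w b)
 where
 lem : ∀ p q r x y u → p + x + (q + y) + (r + u) ≡ p + q + r + (x + y + u)
 lem = ring

adds-sum w [] = refl
adds-sum w (am1 {b = b} {z = z} h) = adds-step (shift w) h 0 0 (w 0) (w 0) refl ∙ +-exchange (dot⁻ (shift w) z) (w 0) (quad-pos (shift w) b)
adds-sum w (a00 h) = adds-sum (shift w) h
adds-sum w (a01 {b = b} {z = z} h) = adds-step (shift w) h (w 0) 0 0 (w 0) (n+0≡n _ ∙ n+0≡n _) ∙ +-exchange (dot⁻ (shift w) z) (w 0) (quad-pos (shift w) b)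
adds-sum w (a10 h) = adds-step (shift w) h 0 (w 0) 0 (w 0) (n+0≡n _)
adds-sum w (a11 h) = adds-step (shift w) h (w 0) 0 0 (w 0) (n+0≡n _ ∙ n+0≡n _)
adds-sum w (a21 h) = adds-step (shift w) h (w 0) (w 0) 0 (w 0 + w 0) (n+0≡n _)

fibre-nonzero : ∀ {n} (b : Vec Quad n) F → fibre b F ≢ 0 → ∃ λ a → ∃ λ z → Adds b a z × F a z ≢ 0
fibre-nonzero [] F h = [] , [] , [] , h
fibre-nonzero (m1 ∷ b) F h with fibre-nonzero b _ h
... | a , z , ad , ne = false ∷ a , ⊟ ∷ z , am1 ad , ne
fibre-nonzero (q0 ∷ b) F h with fibre b (λ a z → F (false ∷ a) (𝟘 ∷ z)) in e
... | suc _ with fibre-nonzero b _ (λ z → 1+n≢0 (sym e ∙ z))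
... | a , z , ad , ne = false ∷ a , 𝟘 ∷ z , a00 ad , ne
fibre-nonzero (q0 ∷ b) F h | zero with fibre-nonzero b _ h
... | a , z , ad , ne = true ∷ a , ⊟ ∷ z , a01 ad , ne
fibre-nonzero (q1 ∷ b) F h with fibre b (λ a z → F (false ∷ a) (⊞ ∷ z)) in e
... | suc _ with fibre-nonzero b _ (λ z → 1+n≢0 (sym e ∙ z))
... | a , z , ad , ne = false ∷ a , ⊞ ∷ z , a10 ad , ne
fibre-nonzero (q1 ∷ b) F h | zero with fibre-nonzero b _ h
... | a , z , ad , ne = true ∷ a , 𝟘 ∷ z , a11 ad , ne
fibre-nonzero (q2 ∷ b) F h with fibre-nonzero b _ h
... | a , z , ad , ne = true ∷ a , ⊞ ∷ z , a21 ad , ne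

Unique : ∀ {n} → Vec Quad n → (Vec Bool n → Vec Sign n → ℕ) → Set
Unique b F = ∀ {a z a' z'} → Adds b a z → Adds b a' z' → F a z ≢ 0 → F a' z' ≢ 0 → a ≡ a'

tail≡ : ∀ {n} {x y : Bool} {a a' : Vec Bool n} → x ∷ a ≡ y ∷ a' → a ≡ a'
tail≡ refl = refl

≤1-sum : ∀ {x y} → x ≤ 1 → y ≤ 1 → (x ≢ 0 → y ≢ 0 → 1 ≡ 0) → x + y ≤ 1
≤1-sum {zero} x≤ y≤ h = y≤
≤1-sum {suc zero} {zero} x≤ y≤ h = z<s
≤1-sum {suc zero} {suc y} x≤ y≤ h with () ← h (λ ()) (λ ())
≤1-sum {suc (suc x)} (s≤s ()) y≤ h

differ : ∀ {n} {a a' : Vec Bool n} → false ∷ a ≡ true ∷ a' → 1 ≡ 0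
differ ()

fibre≤1 : ∀ {n} (b : Vec Quad n) F → (∀ a z → F a z ≤ 1) → Unique b F → fibre b F ≤ 1
fibre≤1 [] F le un = le [] []
fibre≤1 (m1 ∷ b) F le un = fibre≤1 b _ (λ a z → le _ _) λ p q h h' → tail≡ (un (am1 p) (am1 q) h h')
fibre≤1 (q2 ∷ b) F le un = fibre≤1 b _ (λ a z → le _ _) λ p q h h' → tail≡ (un (a21 p) (a21 q) h h')
fibre≤1 (q0 ∷ b) F le un = ≤1-sum
 (fibre≤1 b _ (λ a z → le _ _) λ p q h h' → tail≡ (un (a00 p) (a00 q) h h'))
 (fibre≤1 b _ (λ a z → le _ _) λ p q h h' → tail≡ (un (a01 p) (a01 q) h h'))
 λ h h' → let _ , _ , p , ne = fibre-nonzero b _ h ; _ , _ , q , ne' = fibre-nonzero b _ h' in differ (un (a00 p) (a01 q) ne ne')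
fibre≤1 (q1 ∷ b) F le un = ≤1-sum
 (fibre≤1 b _ (λ a z → le _ _) λ p q h h' → tail≡ (un (a10 p) (a10 q) h h'))
 (fibre≤1 b _ (λ a z → le _ _) λ p q h h' → tail≡ (un (a11 p) (a11 q) h h'))
 λ h h' → let _ , _ , p , ne = fibre-nonzero b _ h ; _ , _ , q , ne' = fibre-nonzero b _ h' in differ (un (a10 p) (a11 q) ne ne')

quad-total : ∀ n → ℚ4 n quad-weight ≡ 170 ^ n
quad-total zero = refl
quad-total (suc n) rewrite ℚ4-*ˡ n 4 quad-weight | ℚ4-*ˡ n 81 quad-weight | quad-total n = lem (170 ^ n)
 where
 lem : ∀ x → 4 * x + (81 * x + (81 * x + 4 * x)) ≡ 170 * x
 lem = ring

-- The overflow weight depends on a + z alone, so the pairs can be sorted by this sum.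
regroup : ∀ n (F : Vec Bool n → Vec Sign n → ℕ) → 𝔹 n (λ a → 𝕋 n (λ z → overflow a z * F a z)) ≡ ℚ4 n (λ b → quad-weight b * fibre b F)
regroup zero F = refl
regroup (suc n) F = cong₂ _+_ (split false) (split true) ∙ lem (Wt false 𝟘) (Wt false ⊞) (Wt false ⊟) (Wt true 𝟘) (Wt true ⊞) (Wt true ⊟) ∙
 sym (cong₂ _+_ (one 4 false ⊟) (cong₂ _+_ (two 81 false 𝟘 true ⊟) (cong₂ _+_ (two 81 false ⊞ true 𝟘) (one 4 true ⊞))))
 where
 Wt : Bool → Sign → ℕ
 Wt b s = 𝔹 n (λ a → 𝕋 n (λ z → overflow a z * F (b ∷ a) (s ∷ z)))
 assoc-out : ∀ c b s → 𝔹 n (λ a → 𝕋 n (λ z → c * overflow a z * F (b ∷ a) (s ∷ z))) ≡ c * Wt b s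
 assoc-out c b s = (𝔹-cong n λ a → (𝕋-cong n λ z → *-assoc c (overflow a z) _) ∙ 𝕋-*ˡ n c _) ∙ 𝔹-*ˡ n c _
 split : ∀ b →
  𝔹 n (λ a → 𝕋 (suc n) (λ z → overflow (b ∷ a) z * F (b ∷ a) z)) ≡ 81 * Wt b 𝟘 + ((if b then 4 else 81) * Wt b ⊞ + (if b then 81 else 4) * Wt b ⊟)
 split false = 𝔹-+ n _ _ ∙ cong₂ _+_ (assoc-out 81 false 𝟘) (𝔹-+ n _ _ ∙ cong₂ _+_ (assoc-out 81 false ⊞) (assoc-out 4 false ⊟))
 split true = 𝔹-+ n _ _ ∙ cong₂ _+_ (assoc-out 81 true 𝟘) (𝔹-+ n _ _ ∙ cong₂ _+_ (assoc-out 4 true ⊞) (assoc-out 81 true ⊟))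
 one : ∀ c b s → ℚ4 n (λ q → c * quad-weight q * fibre q (λ a z → F (b ∷ a) (s ∷ z))) ≡ c * Wt b s
 one c b s = (ℚ4-cong n λ q → *-assoc c (quad-weight q) _) ∙ ℚ4-*ˡ n c _ ∙ cong (c *_) (sym (regroup n _))
 two : ∀ c b s b' s' → ℚ4 n (λ q → c * quad-weight q * (fibre q (λ a z → F (b ∷ a) (s ∷ z)) + fibre q (λ a z → F (b' ∷ a) (s' ∷ z)))) ≡ c * Wt b s + c * Wt b' s'
 two c b s b' s' = (ℚ4-cong n λ q → *-distribˡ-+ (c * quad-weight q) (fibre q (λ a z → F (b ∷ a) (s ∷ z))) _) ∙ ℚ4-+ n _ _ ∙ cong₂ _+_ (one c b s) (one c b' s')
 lem : ∀ a b c d e f → 81 * a + (81 * b + 4 * c) + (81 * d + (4 * e + 81 * f)) ≡ 4 * c + (81 * a + 81 * f + (81 * b + 81 * d + 4 * e))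
 lem = ring

-- (a , z) ↦ a + z is injective on representatives a and relations z, because the sum of a + z is that of a.
few-relations : ∀ n w → 𝔹 n (Transversal.A n (dot w)) * (9 ^ n * relation-weight n w) ≤ 170 ^ n
few-relations n w = begin
 𝔹 n A * (9 ^ n * relation-weight n w) ≡⟨ 𝔹-*ʳ n _ A ⟨
 𝔹 n (λ a → A a * (9 ^ n * relation-weight n w)) ≤⟨ 𝔹-mono n (λ a → *-monoʳ (A a) (overflow-lower n w a)) ⟩
 𝔹 n (λ a → A a * 𝕋 n (λ z → overflow a z * relation w z)) ≡⟨ 𝔹-cong n (λ a → sym (𝕋-*ˡ n (A a) _) ∙ (𝕋-cong n λ z → *-exchange (A a) (overflow a z) (relation w z))) ⟩
 𝔹 n (λ a → 𝕋 n (λ z → overflow a z * (A a * relation w z))) ≡⟨ regroup n (λ a z → A a * relation w z) ⟩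
 ℚ4 n (λ b → quad-weight b * fibre b (λ a z → A a * relation w z)) ≤⟨ ℚ4-mono n (λ b → *-monoʳ (quad-weight b) (fibre≤1 b _ bound (unique b)) ⟫≡ n*1≡n _) ⟩
 ℚ4 n quad-weight ≡⟨ quad-total n ⟩
 170 ^ n ∎
 where
 open Transversal n (dot w)
 bound : ∀ a z → A a * relation w z ≤ 1
 bound a z = *-mono (A≤1 a) (m∸n≤m 1 ((dot⁺ w z ∸ dot⁻ w z) + (dot⁻ w z ∸ dot⁺ w z)))
 left : ∀ x {y} → x * y ≢ 0 → x ≢ 0
 left .0 h refl = h refl
 right : ∀ x {y} → x * y ≢ 0 → y ≢ 0
 right x h refl = h (*-zeroʳ x)
 related : ∀ z → relation w z ≢ 0 → dot⁺ w z ≡ dot⁻ w z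
 related z h with eq-cases (dot⁺ w z) (dot⁻ w z)
 ... | inj₁ (e , _) = e
 ... | inj₂ (_ , e) = ⊥-elim (h e)
 determined : ∀ b a z → Adds b a z → relation w z ≢ 0 → dot w a + quad-neg w b ≡ quad-pos w b
 determined b a z ad h = +-cancelˡ-≡ (dot⁻ w z) _ _ (+-exchange (dot⁻ w z) (dot w a) (quad-neg w b) ∙
  cong (λ s → dot w a + s + quad-neg w b) (sym (related z h)) ∙ adds-sum w ad)
 unique : ∀ b → Unique b (λ a z → A a * relation w z)
 unique b {a} {z} {a'} {z'} p q h h' = A-injective a a' (left (A a) h) (left (A a') h')
  (+-cancelʳ-≡ (quad-neg w b) _ _ (determined b a z p (right (A a) h) ∙ sym (determined b a' z' q (right (A a') h'))))

-- Binary numbers as subsets and as assignments of a half.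

num : Bool → ℕ
num b = if b then 1 else 0

odd : ℕ → Bool
odd x = x % 2 ≡ᵇ 1

toVec : ∀ n → ℕ → Vec Bool n
toVec zero x = []
toVec (suc n) x = odd x ∷ toVec n (x / 2)

fromVec : ∀ {n} → Vec Bool n → ℕ
fromVec [] = 0
fromVec (b ∷ x) = num b + 2 * fromVec x

[b+2x]%2 : ∀ b x → (num b + 2 * x) % 2 ≡ num b
[b+2x]%2 b x = cong (λ y → (num b + y) % 2) (*-comm 2 x) ∙ ([m+kn]%n≡m%n (num b) x 2) ∙ base b
 where
 base : ∀ b → num b % 2 ≡ num b
 base true = refl
 base false = refl

[b+2x]/2 : ∀ b x → (num b + 2 * x) / 2 ≡ x
[b+2x]/2 b x = cong (_/ 2) (cong (num b +_) (*-comm 2 x) ∙ refl) ∙ +-distrib-/ (num b) (x * 2) (rem b) ∙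
 cong₂ _+_ (base b) (m*n/n≡m x 2) ∙ refl
 where
 base : ∀ b → num b / 2 ≡ 0
 base true = refl
 base false = refl
 rem : ∀ b → num b % 2 + (x * 2) % 2 < 2
 rem b = subst (_< 2) (sym (cong (num b % 2 +_) (m*n%n≡0 x 2) ∙ n+0≡n _)) (m%n<n (num b) 2)

odd-num : ∀ x → num (odd x) ≡ x % 2
odd-num x with x % 2 | m%n<n x 2
... | zero | _ = refl
... | suc zero | _ = refl
... | suc (suc _) | s≤s (s≤s ())

odd-b : ∀ b x → odd (num b + 2 * x) ≡ b
odd-b b x = cong (_≡ᵇ 1) ([b+2x]%2 b x) ∙ lem b
 where
 lem : ∀ b → (num b ≡ᵇ 1) ≡ b
 lem true = refl
 lem false = refl

∑-toVec : ∀ n r G → ∑ (2 ^ (n + r)) (λ x → G (toVec n x)) ≡ 2 ^ r * 𝔹 n G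
∑-toVec zero r G = ∑-const (2 ^ r) (G [])
∑-toVec (suc n) r G = ∑-pairs (2 ^ (n + r)) _ ∙ cong₂ _+_ ((∑-cong' (2 ^ (n + r)) λ i → cong₂ (λ b x → G (b ∷ toVec n x)) (odd-b false i) ([b+2x]/2 false i)) ∙ ∑-toVec n r (λ x → G (false ∷ x)))
 ((∑-cong' (2 ^ (n + r)) λ i → cong₂ (λ b x → G (b ∷ toVec n x)) (odd-b true i) ([b+2x]/2 true i)) ∙ ∑-toVec n r (λ x → G (true ∷ x))) ∙
 sym (*-distribˡ-+ (2 ^ r) (𝔹 n λ x → G (false ∷ x)) _)

toVec-fromVec : ∀ {n} (x : Vec Bool n) → toVec n (fromVec x) ≡ x
toVec-fromVec [] = refl
toVec-fromVec (b ∷ x) = cong₂ _∷_ (odd-b b (fromVec x)) (cong (toVec _) ([b+2x]/2 b (fromVec x)) ∙ toVec-fromVec x)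

fromVec< : ∀ {n} (x : Vec Bool n) → fromVec x < 2 ^ n
fromVec< [] = z<s
fromVec< {suc n} (b ∷ x) = s≤s (+-monoˡ (2 * fromVec x) (num≤1 b)) ⟫ lem (fromVec x) ≡⟫ *-monoʳ 2 (fromVec< x)
 where
 num≤1 : ∀ b → num b ≤ 1
 num≤1 true = ≤-refl
 num≤1 false = z≤n
 lem : ∀ x → suc (1 + 2 * x) ≡ 2 * suc x
 lem = ring

bit-zero : ∀ x → bit x 0 ≡ x % 2
bit-zero x = cong (_% 2) (n/1≡n x)

bit-suc : ∀ x i → bit x (suc i) ≡ bit (x / 2) i
bit-suc x i = cong (_% 2) (quo-/ x (2 * 2 ^ i) {{m^n≢0 2 (suc i)}} ∙ sym (m/n/o≡m/[n*o] x 2 (2 ^ i) {{_}} {{m^n≢0 2 i}} {{m^n≢0 2 (suc i)}}) ∙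
 sym (quo-/ (x / 2) (2 ^ i) {{m^n≢0 2 i}}))

bit≤1 : ∀ x i → bit x i ≤ 1
bit≤1 x i = s≤s⁻¹ (m%n<n (x quo 2 ^ i) 2)

∑-bits : ∀ n x g → ∑ n (λ v → bit x v * g v) ≡ dot g (toVec n x)
∑-bits zero x g = refl
∑-bits (suc n) x g = ∑-head n _ ∙ cong₂ _+_ (cong (_* g 0) (bit-zero x ∙ sym (odd-num x)))
 ((∑-cong' n λ v → cong (_* g (suc v)) (bit-suc x v)) ∙ ∑-bits n (x / 2) (shift g)) ∙ lem (odd x)
 where
 lem : ∀ b → num b * g 0 + dot (shift g) (toVec n (x / 2)) ≡ dot g (b ∷ toVec n (x / 2))
 lem true = cong (_+ dot (shift g) (toVec n (x / 2))) (n+0≡n (g 0))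
 lem false = refl

dot-pow : ∀ {n} (x : Vec Bool n) → dot (2 ^_) x ≡ fromVec x
dot-pow x = go x 1 (2 ^_) (λ i → sym (n+0≡n (2 ^ i))) ∙ n+0≡n (fromVec x)
 where
 go : ∀ {n} (x : Vec Bool n) c (g : ℕ → ℕ) → (∀ i → g i ≡ c * 2 ^ i) → dot g x ≡ c * fromVec x
 go [] c g h = sym (*-zeroʳ c)
 go (b ∷ x) c g h = lem b ∙ cong (num b * g 0 +_) (go x (c * 2) (shift g) λ i → h (suc i) ∙ sym (*-assoc c 2 (2 ^ i))) ∙
  cong (λ y → num b * y + c * 2 * fromVec x) (h 0 ∙ n*1≡n c) ∙ lem' (num b) c (fromVec x)
  where
  lem : ∀ b → dot g (b ∷ x) ≡ num b * g 0 + dot (shift g) x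
  lem true = cong (_+ dot (shift g) x) (sym (n+0≡n (g 0)))
  lem false = refl
  lem' : ∀ b c f → b * c + c * 2 * f ≡ c * (b + 2 * f)
  lem' = ring

-- The bits of r are handed out to the positions in l; on subsets of l, `index` undoes this.
assign : ∀ {n} → Vec Bool n → ℕ → Vec Bool n
assign [] r = []
assign (false ∷ l) r = false ∷ assign l r
assign (true ∷ l) r = odd r ∷ assign l (r / 2)

rank-sum : ∀ n x s v → v ≤ n → ∑ n (λ u → lt u v * eq (bit x u) s) ≡ ∑ v (λ u → eq (bit x u) s)
rank-sum n x s v v≤n = cong (λ k → ∑ k (λ u → lt u v * eq (bit x u) s)) (sym (m+[n∸m] v≤n)) ∙ ∑-split v (n ∸ v) _ ∙
 cong₂ _+_ (∑-cong v λ u u< → cong (_* eq (bit x u) s) (lt-yes u<) ∙ n+0≡n _)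
  ((∑-cong' (n ∸ v) λ u → cong (_* eq (bit x (v + u)) s) (lt-no (m≤m+n v u))) ∙ ∑-zero (n ∸ v)) ∙ n+0≡n _

mask : ∀ {n} → Bool → Vec Bool n → Vec Bool n
mask true l = l
mask false l = Vec.map not l

-- The number of earlier variables on the same side is the position of the bit of r that variable v
-- receives, which turns the formula of the program into `assign`.
assign-sum : ∀ n x s r g →
 ∑ n (λ v → eq (bit x v) (num s) * bit r (∑ v (λ u → eq (bit x u) (num s))) * g v) ≡ dot g (assign (mask s (toVec n x)) r)
assign-sum zero x true r g = refl
assign-sum zero x false r g = refl
assign-sum (suc n) x s r g = ∑-head n _ ∙ cong₂ _+_ (cong (λ c → eq c (num s) * bit r 0 * g 0) (bit0 x))
 (∑-cong' n λ v → cong₂ (λ y z → eq y (num s) * bit r z * g (suc v)) (bit-suc x v)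
  (∑-head v _ ∙ cong₂ _+_ (cong (λ c → eq c (num s)) (bit0 x)) (∑-cong' v λ u → cong (λ y → eq y (num s)) (bit-suc x u)))) ∙
 go (odd x) s
 where
 bit0 : ∀ x → bit x 0 ≡ num (odd x)
 bit0 x = bit-zero x ∙ sym (odd-num x)
 x' = x / 2
 skip : ∀ s → ∑ n (λ v → eq (bit x' v) (num s) * bit r (∑ v (λ u → eq (bit x' u) (num s))) * g (suc v)) ≡ dot (shift g) (assign (mask s (toVec n x')) r)
 skip s = assign-sum n x' s r (shift g)
 take : ∀ s → bit r 0 * g 0 + ∑ n (λ v → eq (bit x' v) (num s) * bit r (1 + ∑ v (λ u → eq (bit x' u) (num s))) * g (suc v))
  ≡ dot g (odd r ∷ assign (mask s (toVec n x')) (r / 2))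
 take s = cong₂ _+_ (cong (_* g 0) (bit0 r))
  ((∑-cong' n λ v → cong (λ y → eq (bit x' v) (num s) * y * g (suc v)) (bit-suc r (∑ v (λ u → eq (bit x' u) (num s))))) ∙ assign-sum n x' s (r / 2) (shift g)) ∙ lem (odd r)
  where
  lem : ∀ b → num b * g 0 + dot (shift g) (assign (mask s (toVec n x')) (r / 2)) ≡ dot g (b ∷ assign (mask s (toVec n x')) (r / 2))
  lem true = cong (_+ dot (shift g) (assign (mask s (toVec n x')) (r / 2))) (n+0≡n (g 0))
  lem false = refl
 one : ∀ b → 1 * b * g 0 ≡ b * g 0
 one b = cong (_* g 0) (n+0≡n b)
 go : ∀ b s → eq (num b) (num s) * bit r 0 * g 0
  + ∑ n (λ v → eq (bit x' v) (num s) * bit r (eq (num b) (num s) + ∑ v (λ u → eq (bit x' u) (num s))) * g (suc v))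
  ≡ dot g (assign (mask s (b ∷ toVec n x')) r)
 go true true = cong (_+ ∑ n (λ v → eq (bit x' v) 1 * bit r (1 + ∑ v (λ u → eq (bit x' u) 1)) * g (suc v))) (one (bit r 0)) ∙ take true
 go false false = cong (_+ ∑ n (λ v → eq (bit x' v) 0 * bit r (1 + ∑ v (λ u → eq (bit x' u) 0)) * g (suc v))) (one (bit r 0)) ∙ take false
 go true false = skip false
 go false true = skip true

-- Only card l of the h bits are used, so each subset of l arises 2^e times.
∑-assign : ∀ {n} (l : Vec Bool n) h e F → card l + e ≡ h → ∑ (2 ^ h) (λ r → F (assign l r)) ≡ 2 ^ e * 𝔹 n (λ x → sub x l * F x)
∑-assign [] h e F refl = ∑-const (2 ^ e) (F []) ∙ cong (2 ^ e *_) (sym (n+0≡n (F [])))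
∑-assign {suc n} (false ∷ l) h e F eq = ∑-assign l h e (λ x → F (false ∷ x)) eq ∙
 cong (2 ^ e *_) (sym (cong (𝔹 n (λ x → sub x l * F (false ∷ x)) +_) (𝔹-const n 0 ∙ *-zeroʳ (2 ^ n)) ∙ n+0≡n _))
∑-assign {suc n} (true ∷ l) (suc h) e F eq = ∑-pairs (2 ^ h) _ ∙ cong₂ _+_
 ((∑-cong' (2 ^ h) λ i → cong₂ (λ b x → F (b ∷ assign l x)) (odd-b false i) ([b+2x]/2 false i)) ∙ ∑-assign l h e (λ x → F (false ∷ x)) (suc-injective eq))
 ((∑-cong' (2 ^ h) λ i → cong₂ (λ b x → F (b ∷ assign l x)) (odd-b true i) ([b+2x]/2 true i)) ∙ ∑-assign l h e (λ x → F (true ∷ x)) (suc-injective eq)) ∙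
 sym (*-distribˡ-+ (2 ^ e) (𝔹 n λ x → sub x l * F (false ∷ x)) _)

meet : ∀ {n} → Vec Bool n → Vec Bool n → Vec Bool n
meet [] [] = []
meet (b ∷ x) (false ∷ l) = false ∷ meet x l
meet (b ∷ x) (true ∷ l) = b ∷ meet x l

index : ∀ {n} (x l : Vec Bool n) → ℕ
index [] [] = 0
index (b ∷ x) (false ∷ l) = index x l
index (b ∷ x) (true ∷ l) = num b + 2 * index x l

assign-index : ∀ {n} (x l : Vec Bool n) → assign l (index x l) ≡ meet x l
assign-index [] [] = refl
assign-index (b ∷ x) (false ∷ l) = cong (false ∷_) (assign-index x l)
assign-index (b ∷ x) (true ∷ l) = cong₂ _∷_ (odd-b b (index x l)) (cong (assign l) ([b+2x]/2 b (index x l)) ∙ assign-index x l)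

index< : ∀ {n} (x l : Vec Bool n) {h} → card l ≤ h → index x l < 2 ^ h
index< [] [] {h} c≤ = 1≤2^ h
index< (b ∷ x) (false ∷ l) {h} c≤ = index< x l c≤
index< (b ∷ x) (true ∷ l) {suc h} (s≤s c≤) = s≤s (+-monoˡ (2 * index x l) (num≤1 b)) ⟫ lem (index x l) ≡⟫ *-monoʳ 2 (index< x l c≤)
 where
 num≤1 : ∀ b → num b ≤ 1
 num≤1 true = ≤-refl
 num≤1 false = z≤n
 lem : ∀ x → suc (1 + 2 * x) ≡ 2 * suc x
 lem = ring

dot-meet : ∀ {n} g (x l : Vec Bool n) → dot g (meet x l) + dot g (meet x (Vec.map not l)) ≡ dot g x
dot-meet g [] [] = refl
dot-meet g (false ∷ x) (false ∷ l) = dot-meet (shift g) x l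
dot-meet g (false ∷ x) (true ∷ l) = dot-meet (shift g) x l
dot-meet g (true ∷ x) (false ∷ l) = +-rotate (dot (shift g) (meet x l)) (g 0) _ ∙ cong (g 0 +_) (dot-meet (shift g) x l)
dot-meet g (true ∷ x) (true ∷ l) = +-assoc (g 0) _ _ ∙ cong (g 0 +_) (dot-meet (shift g) x l)


-- Collisions between the two halves.

eq-through : ∀ K x y → x < K → eq x y ≡ ∑ K (λ κ → eq κ x * eq κ y)
eq-through K x y x< = sym ((∑-cong' K λ κ → at κ) ∙ ∑-single K x (eq x y) x<)
 where
 at : ∀ κ → eq κ x * eq κ y ≡ eq κ x * eq x y
 at κ with eq-cases κ x
 ... | inj₁ (refl , _) = refl
 ... | inj₂ (_ , z) = cong (_* eq κ y) z ∙ sym (cong (_* eq x y) z)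

pairs-through : ∀ K m n (f g : ℕ → ℕ) → (∀ r → r < m → f r < K) →
 ∑ m (λ r → ∑ n (λ s → eq (f r) (g s))) ≡ ∑ K (λ κ → ∑ m (λ r → eq κ (f r)) * ∑ n (λ s → eq κ (g s)))
pairs-through K m n f g f< = begin-equality
 ∑ m (λ r → ∑ n (λ s → eq (f r) (g s))) ≡⟨ ∑-cong m (λ r r< → (∑-cong' n λ s → eq-through K (f r) (g s) (f< r r<)) ∙ ∑-swap n K _) ⟩
 ∑ m (λ r → ∑ K (λ κ → ∑ n (λ s → eq κ (f r) * eq κ (g s)))) ≡⟨ ∑-swap m K _ ⟩
 ∑ K (λ κ → ∑ m (λ r → ∑ n (λ s → eq κ (f r) * eq κ (g s)))) ≡⟨ ∑-cong' K (λ κ → (∑-cong' m λ r → ∑-*ˡ n (eq κ (f r)) _) ∙ ∑-*ʳ m _ _) ⟩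
 ∑ K (λ κ → ∑ m (λ r → eq κ (f r)) * ∑ n (λ s → eq κ (g s))) ∎

2ab≤ : ∀ a b → a * b + a * b ≤ a * a + b * b
2ab≤ a b with ≤-total a b
... | inj₁ a≤b = subst (λ b → a * b + a * b ≤ a * a + b * b) (m+[n∸m] a≤b) (pad (lem a (b ∸ a)))
 where
 lem : ∀ a d → a * (a + d) + a * (a + d) + d * d ≡ a * a + (a + d) * (a + d)
 lem = ring
... | inj₂ b≤a = subst (λ a → a * b + a * b ≤ a * a + b * b) (m+[n∸m] b≤a) (pad (lem b (a ∸ b)))
 where
 lem : ∀ b d → (b + d) * b + (b + d) * b + d * d ≡ (b + d) * (b + d) + b * b
 lem = ring

-- Sorted by key, the mixed pairs form a scalar product, to which 2ab ≤ a² + b² applies term by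
-- term.
cross-collisions : ∀ K m n (f g : ℕ → ℕ) → (∀ r → r < m → f r < K) → (∀ s → s < n → g s < K) →
 let LR = ∑ m (λ r → ∑ n (λ s → eq (f r) (g s))) in
 LR + LR ≤ ∑ m (λ r → ∑ m (λ s → eq (f r) (f s))) + ∑ n (λ r → ∑ n (λ s → eq (g r) (g s)))
cross-collisions K m n f g f< g< = begin
 LR + LR ≡⟨ cong₂ _+_ e e ⟩
 ∑ K (λ κ → a κ * b κ) + ∑ K (λ κ → a κ * b κ) ≡⟨ ∑-+ K _ _ ⟨
 ∑ K (λ κ → a κ * b κ + a κ * b κ) ≤⟨ ∑-mono K (λ κ _ → 2ab≤ (a κ) (b κ)) ⟩
 ∑ K (λ κ → a κ * a κ + b κ * b κ) ≡⟨ ∑-+ K _ _ ⟩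
 ∑ K (λ κ → a κ * a κ) + ∑ K (λ κ → b κ * b κ) ≡⟨ cong₂ _+_ (pairs-through K m m f f f<) (pairs-through K n n g g g<) ⟨
 ∑ m (λ r → ∑ m (λ s → eq (f r) (f s))) + ∑ n (λ r → ∑ n (λ s → eq (g r) (g s))) ∎
 where
 a b : ℕ → ℕ
 a κ = ∑ m (λ r → eq κ (f r))
 b κ = ∑ n (λ s → eq κ (g s))
 LR = ∑ m (λ r → ∑ n (λ s → eq (f r) (g s)))
 e = pairs-through K m n f g f<

eq-monus : ∀ C x y → x ≤ C → y ≤ C → eq (C ∸ x) (C ∸ y) ≡ eq x y
eq-monus C x y x≤ y≤ with eq-cases x y
... | inj₁ (refl , e) = eq-refl (C ∸ x) ∙ sym e
... | inj₂ (ne , e) = eq-no (λ h → ne (∸-cancelˡ-≡ x≤ y≤ h)) ∙ sym e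

assign-collisions : ∀ {n} (w : ℕ → ℕ) (l : Vec Bool n) h e → card l + e ≡ h →
 ∑ (2 ^ h) (λ r → ∑ (2 ^ h) (λ s → eq (dot w (assign l r)) (dot w (assign l s)))) ≡ 2 ^ e * (2 ^ e * collisions w l)
assign-collisions {n} w l h e c = ∑-assign l h e (λ x → ∑ (2 ^ h) (λ s → eq (dot w x) (dot w (assign l s)))) c ∙
 cong (2 ^ e *_) ((𝔹-cong n λ x → cong (sub x l *_) (∑-assign l h e (λ y → eq (dot w x) (dot w y)) c) ∙ *-exchange (sub x l) (2 ^ e) _) ∙ 𝔹-*ˡ n (2 ^ e) _)

∑-nonzero : ∀ n f → ∑ n f ≢ 0 → ∃ λ i → i < n × f i ≢ 0
∑-nonzero zero f h = ⊥-elim (h refl)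
∑-nonzero (suc n) f h with f n ≟ 0
... | no ne = n , ≤-refl , ne
... | yes z with ∑-nonzero n f (λ e → h (cong₂ _+_ e z ∙ refl))
... | i , i< , ne = i , <-suc i< , ne

∑-unique : ∀ n f → (∀ i → i < n → f i ≤ 1) → (∀ i j → i < n → j < n → f i ≢ 0 → f j ≢ 0 → i ≡ j) → ∑ n f ≤ 1
∑-unique zero f le un = z≤n
∑-unique (suc n) f le un with f n ≟ 0
... | yes z = cong (∑ n f +_) z ∙ n+0≡n _ ≡⟫
 ∑-unique n f (λ i i< → le i (<-suc i<)) (λ i j i< j< → un i j (<-suc i<) (<-suc j<))
... | no ne = +-monoˡ (f n) (≤-reflexive rest≡0) ⟫ le n ≤-refl
 where
 rest≡0 : ∑ n f ≡ 0
 rest≡0 with ∑ n f ≟ 0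
 ... | yes z = z
 ... | no h with ∑-nonzero n f h
 ... | i , i< , fi = ⊥-elim (<⇒≢ i< (un i n (<-suc i<) ≤-refl fi ne))

gauss : ∀ n → n * n ≤ 2 * ∑ n suc
gauss zero = z≤n
gauss (suc n) = pad (lem n) ⟫ +-monoˡ (2 * suc n) (gauss n) ⟫≡ sym (*-distribˡ-+ 2 (∑ n suc) (suc n))
 where
 lem : ∀ n → suc n * suc n + 1 ≡ n * n + 2 * suc n
 lem = ring

-- The probability that a walk finds the solution pair.

record Chase : Set where
 constructor chasing
 field
  N M q K NN Lw : ℕ
  M≡ : M ≡ q * N
  1≤M : 1 ≤ M
  1≤N : 1 ≤ N
  NN≥ : N * N ≤ NN
  1≤Lw : 1 ≤ Lw
  key : ℕ → ℕ
  key< : ∀ z → z < N → suc (key z) < K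
  0<K : 0 < K
  V : ℕ → ℕ
  V01 : ∀ s → V s ≡ 0 ⊎ V s ≡ 1
  i j : ℕ
  i< : i < N
  j< : j < N
  i≢j : i ≢ j
  key≡ : key i ≡ key j
  hit : V (i * N + j) ≡ 1
  hit' : V (j * N + i) ≡ 1

module SuccessB (ctx : Chase) where

 open Chase ctx

 -- Slot 0 is reserved for the word that chooses the start.
 slot : ℕ → ℕ
 slot z = suc (key z)

 open Walks N M q K slot M≡ 1≤M key< 1≤N
 open Pair i j i< j< (slot i) refl hiding (first; second)

 step : List ℕ → ℕ → ℕ
 step ys z = vertex ys (slot z)

 module F (ys : List ℕ) = Floyd N NN Lw 1≤N NN≥ (step ys) (λ z → vertex< ys (slot z)) slot
  (λ x y e → cong (vertex ys) e) V V01 (vertex ys 0) (vertex< ys 0)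

 success : List ℕ → ℕ
 success ys = V (F.ph2 ys)

 private
  vertex-at : ∀ ys κ k → vertex ys (at-slot ys κ k) ≡ rep (step ys) k (vertex ys κ)
  vertex-at ys κ zero = refl
  vertex-at ys κ (suc k) = vertex-at ys (slot (vertex ys κ)) k

  at-suc : ∀ ys κ k → at-slot ys κ (suc k) ≡ slot (vertex ys (at-slot ys κ k))
  at-suc ys κ zero = refl
  at-suc ys κ (suc k) = at-suc ys (slot (vertex ys κ)) k

  slot-v : ∀ ys k → slot (F.v ys k) ≡ at-slot ys 0 (suc k)
  slot-v ys k = cong slot (sym (vertex-at ys 0 k)) ∙ sym (at-suc ys 0 k)

  length-schedule : ∀ a r → length (schedule a r) ≡ 2 + (a + r)
  length-schedule a r = length-++ (replicate a free) ∙ cong₂ _+_ (length-replicate a)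
   (cong suc (length-++ (replicate r free) ∙ cong (_+ 1) (length-replicate r))) ∙ lem a r
   where
   lem : ∀ a r → a + suc (r + 1) ≡ 2 + (a + r)
   lem = ring

  exactly-≡ : ∀ i z → exactly i z ≢ 0 → z ≡ i
  exactly-≡ i z h with eq-cases z i
  ... | inj₁ (e , _) = e
  ... | inj₂ (_ , e) = ⊥-elim (h e)

  module Good (ys : List ℕ) (a r : ℕ) (ok : Φ (schedule a r) 0 [] ys ≢ 0) where

   b : ℕ
   b = suc (a + r)

   va : F.v ys a ≡ i
   va with Φ-drop (replicate a free) 0 [] ys ok
   ... | U , h = sym (vertex-at ys 0 a) ∙
    cong (λ k → vertex ys (at-slot ys 0 k)) (sym (length-replicate a {free})) ∙ exactly-≡ i _ (Φ-test (exactly i) {replicate r free ++ exactly j ∷ []} _ U ys h)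

   vb : F.v ys b ≡ j
   vb with Φ-drop (replicate a free ++ exactly i ∷ replicate r free) 0 [] ys
    (subst (λ s → Φ s 0 [] ys ≢ 0) (sym (++-assoc (replicate a free) (exactly i ∷ replicate r free) (exactly j ∷ []))) ok)
    where open import Data.List.Properties using (++-assoc)
   ... | U , h = sym (vertex-at ys 0 b) ∙ cong (λ k → vertex ys (at-slot ys 0 k)) (sym size≡) ∙ exactly-≡ j _ (Φ-test (exactly j) {[]} _ U ys h)
    where
    size≡ : length (replicate a free ++ exactly i ∷ replicate r free) ≡ b
    size≡ = length-++ (replicate a free) ∙ cong₂ _+_ (length-replicate a) (cong suc (length-replicate r)) ∙ +-suc a r

   apart : ∀ k l → k < l → l < b → slot (F.v ys k) ≢ slot (F.v ys l)
   apart k l k< l< e = Φ-distinct (schedule a r) 0 [] ys ok (suc k) (suc l) (s≤s k<)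
    (subst (suc l <_) (sym (length-schedule a r)) (s≤s l<)) (sym (slot-v ys k) ∙ e ∙ slot-v ys l)

  -- The later event demands distinct slots before its last vertex, but the earlier one has already
  -- placed i and j there, which share a slot.
  unique : ∀ ys a r a' r' → Φ (schedule a r) 0 [] ys ≢ 0 → Φ (schedule a' r') 0 [] ys ≢ 0 → ¬ (a + r < a' + r')
  unique ys a r a' r' h h' lt = G'.apart a b (s≤s (m≤m+n a r)) (s≤s lt) (cong slot (G.va ∙ sym G.va) ▸ (cong suc (cong key G.va ∙ key≡ ∙ cong key (sym G.vb))))
   where
   module G = Good ys a r h
   module G' = Good ys a' r' h'
   b = suc (a + r)
   _▸_ : ∀ {A B : Set} → A → B → B
   _ ▸ x = x

  unique' : ∀ ys a r a' r' → Φ (schedule a r) 0 [] ys ≢ 0 → Φ (schedule a' r') 0 [] ys ≢ 0 → a + r ≡ a' + r' → ¬ (a < a')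
  unique' ys a r a' r' h h' e lt = G'.apart a a' lt (s≤s (m≤m+n a' r')) (cong slot (G.va ∙ sym G'.va))
   where
   module G = Good ys a r h
   module G' = Good ys a' r' h'

  schedule≤1 : ∀ a r k T → nth (λ _ → 0) (schedule a r) k ≡ T → ∀ z → T z ≤ 1
  schedule≤1 zero r zero T refl z = m∸n≤m 1 ((z ∸ i) + (i ∸ z))
  schedule≤1 zero zero (suc zero) T refl z = m∸n≤m 1 ((z ∸ j) + (j ∸ z))
  schedule≤1 zero zero (suc (suc k)) T refl z = z≤n
  schedule≤1 zero (suc r) (suc zero) T refl z = m∸n≤m 1 (eq (slot z) (slot i))
  schedule≤1 zero (suc r) (suc (suc k)) T e z = schedule≤1 zero r (suc k) T e z
  schedule≤1 (suc a) r zero T refl z = m∸n≤m 1 (eq (slot z) (slot i))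
  schedule≤1 (suc a) r (suc k) T e z = schedule≤1 a r k T e z

  -- Index c of the outer sum stands for the position c + 1 of j, index a for the position of i.
  event : List ℕ → ℕ → ℕ → ℕ
  event ys c a = Φ (schedule a (c ∸ a)) 0 [] ys

  -- Each event says where the first repetition of a slot occurs, so at most one of them happens,
  -- and each makes Floyd's search succeed. Hence their probabilities may be added.
  events≤success : ∀ ys → ∑ Lw (λ c → ∑ (suc c) (event ys c)) ≤ success ys
  events≤success ys with ∑ Lw (λ c → ∑ (suc c) (event ys c)) ≟ 0
  ... | yes z = z ≡⟫ z≤n
  ... | no ne with ∑-nonzero Lw _ ne
  ... | c , c< , ne' with ∑-nonzero (suc c) _ ne'
  ... | a , s≤s a≤ , h = ∑-unique Lw _ inner≤ outer ⟫≡ sym won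
   where
   module G = Good ys a (c ∸ a) h
   same : ∀ {a} → a ≤ c → suc (a + (c ∸ a)) ≡ suc c
   same a≤ = cong suc (m+[n∸m] a≤)
   won : success ys ≡ 1
   won = F.floyd ys a G.b (s≤s (m≤m+n a _)) (same a≤ ≡⟫ c<)
    (λ e → i≢j (sym G.va ∙ e ∙ G.vb))
    (cong slot G.va ∙ cong suc key≡ ∙ cong slot (sym G.vb))
    G.apart
    (cong₂ (λ x y → V (x * N + y)) G.va G.vb ∙ hit) (cong₂ (λ x y → V (x * N + y)) G.vb G.va ∙ hit')
   inner≤ : ∀ c → c < Lw → ∑ (suc c) (event ys c) ≤ 1
   inner≤ c c< = ∑-unique (suc c) _ (λ a _ → Φ≤1 (schedule a (c ∸ a)) 0 [] ys (schedule≤1 a (c ∸ a))) un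
    where
    un : ∀ a a' → a < suc c → a' < suc c → event ys c a ≢ 0 → event ys c a' ≢ 0 → a ≡ a'
    un a a' (s≤s a≤) (s≤s a'≤) h h' with <-cmp a a'
    ... | tri≈ _ e _ = e
    ... | tri< lt _ _ = ⊥-elim (unique' ys a _ a' _ h h' ((m+[n∸m] a≤) ∙ sym (m+[n∸m] a'≤)) lt)
    ... | tri> _ _ gt = ⊥-elim (unique' ys a' _ a _ h' h ((m+[n∸m] a'≤) ∙ sym (m+[n∸m] a≤)) gt)
   outer : ∀ c c' → c < Lw → c' < Lw → ∑ (suc c) (event ys c) ≢ 0 → ∑ (suc c') (event ys c') ≢ 0 → c ≡ c'
   outer c c' _ _ h h' with ∑-nonzero (suc c) _ h | ∑-nonzero (suc c') _ h'
   ... | a , s≤s a≤ , e | a' , s≤s a'≤ , e' with <-cmp c c'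
   ... | tri≈ _ eq _ = eq
   ... | tri< lt _ _ = ⊥-elim (unique ys a _ a' _ e e' (subst₂ _<_ (sym (m+[n∸m] a≤)) (sym (m+[n∸m] a'≤)) lt))
   ... | tri> _ _ gt = ⊥-elim (unique ys a' _ a _ e' e (subst₂ _<_ (sym (m+[n∸m] a'≤)) (sym (m+[n∸m] a≤)) gt))

 module _ (few : 16 * ((Lw ∸ 1) * (Lw ∸ 1) * p) ≤ N * N) where

  private
   cnt* = cnt (slot i)

   -- The slot class of i alone contributes the square of its size to the pairs.
   cnt²≤p : cnt* * cnt* ≤ p
   cnt²≤p = sym (∑-*ʳ N cnt* _) ≡⟫ (∑-mono N λ z _ → at z)
    where
    at : ∀ z → eq (slot z) (slot i) * cnt* ≤ cnt (slot z)
    at z with eq-cases (slot z) (slot i)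
    ... | inj₁ (e , o) = cong (_* cnt*) o ∙ n+0≡n cnt* ≡⟫ ≤-reflexive (cong cnt (sym e))
    ... | inj₂ (_ , o) = cong (_* cnt*) o ≡⟫ z≤n

   square-cancel : ∀ {x y} → x * x ≤ y * y → x ≤ y
   square-cancel {x} {y} h = ≮⇒≥ λ lt → <⇒≱ (*-mono-< lt lt) h

   cnt0 : cnt 0 ≡ 0
   cnt0 = (∑-cong' N λ z → eq-no {slot z} {0} (λ ())) ∙ ∑-zero N

   N≢0 : ∀ k → NonZero (N ^ k)
   N≢0 k = m^n≢0 N k {{>-nonZero 1≤N}}

   -- Both error terms of `Bound` are at most 1/4: the quadratic one by `few`, the linear one
   -- because `cnt*` is at most the square root of p. So the free steps succeed with probability at
   -- least 1/2, and the two prescribed vertices cost N².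
   probable : ∀ c a → c < Lw → a ≤ c → M ^ K ≤ 4 * (N * N) * 𝕊 K M (λ ys → event ys c a)
   probable c a c< a≤ = *-cancelˡ-≤ (N ^ (2 + c)) {{N≢0 (2 + c)}} (begin
    N ^ (2 + c) * M ^ K ≤⟨ *-monoˡ (M ^ K) core ⟩
    4 * (N * N * ψ) * M ^ K ≡⟨ collect (N * N) ψ (M ^ K) ⟩
    4 * (N * N) * (ψ * M ^ K) ≡⟨ cong (4 * (N * N) *_) (sym (expectation (schedule a r) 0 [] 0<K)) ⟩
    4 * (N * N) * (N ^ length (schedule a r) * 𝕊 K M (Φ (schedule a r) 0 [])) ≡⟨ cong (λ l → 4 * (N * N) * (N ^ l * 𝕊 K M (Φ (schedule a r) 0 []))) size≡ ⟩
    4 * (N * N) * (N ^ (2 + c) * 𝕊 K M (Φ (schedule a r) 0 [])) ≡⟨ *-exchange (4 * (N * N)) (N ^ (2 + c)) _ ⟩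
    N ^ (2 + c) * (4 * (N * N) * 𝕊 K M (Φ (schedule a r) 0 [])) ∎)
    where
    r = c ∸ a
    ψ = Ψ (schedule a r) 0 []
    size≡ : length (schedule a r) ≡ 2 + c
    size≡ = length-schedule a r ∙ cong (2 +_) (m+[n∸m] a≤)
    collect : ∀ a b c → 4 * (a * b) * c ≡ 4 * a * (b * c)
    collect = ring
    c≤f : c ≤ Lw ∸ 1
    c≤f = ∸-monoˡ-≤ 1 c<
    c²p : 16 * (c * c * p) ≤ N * N
    c²p = *-monoʳ 16 (*-monoˡ p (*-mono c≤f c≤f)) ⟫ few
    linear : 4 * (c * cnt*) ≤ N
    linear = square-cancel (sq c cnt* ≡⟫ *-monoʳ 16 (*-monoʳ (c * c) cnt²≤p) ⟫ c²p)
     where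
     sq : ∀ c k → 4 * (c * k) * (4 * (c * k)) ≡ 16 * (c * c * (k * k))
     sq = ring
    bound : N ^ (2 + c) ≤ N * N * ψ + N ^ c * (c * cnt* * N + c * c * p)
    bound = subst (λ w → N ^ (2 + c) ≤ N * N * ψ + N ^ c * (c * w * N + c * c * p))
     -- No vertex has slot 0, so at the start only the class of i is charged.
     (cong (cnt* +_) (n+0≡n (cnt 0) ∙ cnt0) ∙ n+0≡n cnt*)
     (subst (λ k → Bound k (total (slot i ∷ 0 ∷ [])) ψ) (m+[n∸m] a≤)
      (first-bound a r 0 [] refl (cong (λ e → (1 ∸ e) * 1) (eq-no {slot i} {0} (λ ())))))
    slack : 4 * (N ^ c * (c * cnt* * N + c * c * p)) ≤ 2 * N ^ (2 + c)
    slack = begin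
     4 * (N ^ c * (c * cnt* * N + c * c * p)) ≡⟨ lem₁ (N ^ c) (c * cnt*) N (c * c * p) ⟩
     N ^ c * (4 * (c * cnt*) * N + 4 * (c * c * p)) ≤⟨ *-monoʳ (N ^ c) (+-mono (*-monoˡ N linear) (*-monoˡ (c * c * p) (s≤s (s≤s (s≤s (s≤s (z≤n {12}))))) ⟫ c²p)) ⟩
     N ^ c * (N * N + N * N) ≡⟨ lem₂ (N ^ c) N ⟩
     2 * N ^ (2 + c) ∎
     where
     lem₁ : ∀ x k n y → 4 * (x * (k * n + y)) ≡ x * (4 * k * n + 4 * y)
     lem₁ = ring
     lem₂ : ∀ x n → x * (n * n + n * n) ≡ 2 * (n * (n * x))
     lem₂ = ring
    core : N ^ (2 + c) ≤ 4 * (N * N * ψ)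
    core = m≤n*m (N ^ (2 + c)) 2 ⟫ +-cancelʳ-≤ (2 * N ^ (2 + c)) _ _ (begin
     2 * N ^ (2 + c) + 2 * N ^ (2 + c) ≡⟨ lem₃ (N ^ (2 + c)) ⟩
     4 * N ^ (2 + c) ≤⟨ *-monoʳ 4 bound ⟩
     4 * (N * N * ψ + N ^ c * (c * cnt* * N + c * c * p)) ≡⟨ *-distribˡ-+ 4 (N * N * ψ) _ ⟩
     4 * (N * N * ψ) + 4 * (N ^ c * (c * cnt* * N + c * c * p)) ≤⟨ +-monoʳ (4 * (N * N * ψ)) slack ⟩
     4 * (N * N * ψ) + 2 * N ^ (2 + c) ∎)
     where
     lem₃ : ∀ x → 2 * x + 2 * x ≡ 4 * x
     lem₃ = ring

  -- The gain of the birthday paradox: a walk of length Lw offers about Lw² / 2 pairs of positions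
  -- to i and j.
  success-count : M ^ K * (Lw * Lw) ≤ 8 * (N * N) * 𝕊 K M success
  success-count = begin
   M ^ K * (Lw * Lw) ≤⟨ *-monoʳ (M ^ K) (gauss Lw) ⟩
   M ^ K * (2 * ∑ Lw suc) ≡⟨ lem (M ^ K) (∑ Lw suc) ⟩
   2 * (∑ Lw suc * M ^ K) ≡⟨ cong (2 *_) (sym ((∑-cong' Lw λ c → ∑-const (suc c) (M ^ K)) ∙ ∑-*ʳ Lw (M ^ K) suc)) ⟩
   2 * ∑ Lw (λ c → ∑ (suc c) (λ _ → M ^ K)) ≤⟨ *-monoʳ 2 (∑-mono Lw λ c c< → ∑-mono (suc c) λ { a (s≤s a≤) → probable c a c< a≤ }) ⟩
   2 * ∑ Lw (λ c → ∑ (suc c) (λ a → 4 * (N * N) * 𝕊 K M (λ ys → event ys c a))) ≡⟨ cong (2 *_) ((∑-cong' Lw λ c → ∑-*ˡ (suc c) (4 * (N * N)) _) ∙ ∑-*ˡ Lw (4 * (N * N)) _) ⟩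
   2 * (4 * (N * N) * ∑ Lw (λ c → ∑ (suc c) (λ a → 𝕊 K M (λ ys → event ys c a)))) ≡⟨ cong (λ s → 2 * (4 * (N * N) * s)) (sym (𝕊-∑ K M Lw _ ∙ (∑-cong' Lw λ c → 𝕊-∑ K M (suc c) _))) ⟩
   2 * (4 * (N * N) * 𝕊 K M (λ ys → ∑ Lw (λ c → ∑ (suc c) (event ys c)))) ≤⟨ *-monoʳ 2 (*-monoʳ (4 * (N * N)) (𝕊-mono K λ ys _ → events≤success ys)) ⟩
   2 * (4 * (N * N) * 𝕊 K M success) ≡⟨ lem' (N * N) (𝕊 K M success) ⟩
   8 * (N * N) * 𝕊 K M success ∎
   where
   lem : ∀ m s → m * (2 * s) ≡ 2 * (s * m)
   lem = ring
   lem' : ∀ n s → 2 * (4 * n * s) ≡ 8 * n * s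
   lem' = ring

-- Lower bound for the number of primes.

𝟙[_] : ∀ {A : Set} → Dec A → ℕ
𝟙[ d ] = if does d then 1 else 0

[]-yes : ∀ {A : Set} (d : Dec A) → A → 𝟙[ d ] ≡ 1
[]-yes (yes _) a = refl
[]-yes (no ¬a) a = ⊥-elim (¬a a)

[]-no : ∀ {A : Set} (d : Dec A) → ¬ A → 𝟙[ d ] ≡ 0
[]-no (yes a) ¬a = ⊥-elim (¬a a)
[]-no (no _) ¬a = refl

[]≤1 : ∀ {A : Set} (d : Dec A) → 𝟙[ d ] ≤ 1
[]≤1 (yes _) = ≤-refl
[]≤1 (no _) = z≤n

prime>1 : ∀ {p} → Prime p → 1 < p
prime>1 {suc (suc p)} _ = s<s z<s
prime>1 {suc zero} h = ⊥-elim (¬prime[1] h)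
prime>1 {zero} h = ⊥-elim (¬prime[0] h)

prime-factor : ∀ k → 1 < k → ∃ λ p → Prime p × p ∣ k
prime-factor k 1<k = go k k ≤-refl 1<k
 where
 go : ∀ fuel k → k ≤ fuel → 1 < k → ∃ λ p → Prime p × p ∣ k
 go zero k k≤ 1<k = ⊥-elim (<⇒≱ 1<k (k≤ ⟫ z≤n))
 go (suc f) k k≤ 1<k with composite? k
 ... | no ¬c = k , prime {{n>1⇒nonTrivial 1<k}} ¬c , ∣-refl
 ... | yes (hasNonTrivialDivisor {divisor = d} {{nt}} d<k d∣k) with go f d (s≤s⁻¹ (d<k ⟫ k≤)) (nonTrivial⇒n>1 d {{nt}})
 ... | p , pp , p∣d = p , pp , ∣-trans p∣d d∣k

coprime-power : ∀ {p} → Prime p → ∀ a k c → ¬ p ∣ k → p ^ a ∣ k * c → p ^ a ∣ c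
coprime-power pp zero k c p∤ h = 1∣ c
coprime-power {p} pp (suc a) k c p∤ h with euclidsLemma k c pp (m*n∣⇒m∣ p (p ^ a) h)
... | inj₁ p∣k = ⊥-elim (p∤ p∣k)
... | inj₂ (divides c' refl) = subst (p ^ suc a ∣_) (*-comm p c') (*-monoʳ-∣ p
 (coprime-power pp a k c' p∤ (*-cancelˡ-∣ p {{prime⇒nonZero pp}} (subst (p ^ suc a ∣_) (lem k c' p) h))))
 where
 lem : ∀ k c p → k * (c * p) ≡ p * (k * c)
 lem = ring

divides-by-prime-powers : ∀ L k → 0 < k → (∀ p a → Prime p → p ^ a ∣ k → p ^ a ∣ L) → k ∣ L
divides-by-prime-powers L k 0<k h = go k k ≤-refl 0<k h
 where
 strip : ∀ fuel p k → Prime p → 0 < k → k ≤ fuel → ∃ λ a → ∃ λ k' → k ≡ p ^ a * k' × ¬ p ∣ k'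
 strip fuel p k pp 0<k k≤ with p ∣? k
 ... | no p∤ = 0 , k , sym (n+0≡n k) , p∤
 strip zero p k pp 0<k k≤ | yes _ = ⊥-elim (<⇒≱ 0<k k≤)
 strip (suc fuel) p .(c * p) pp 0<k k≤ | yes (divides c refl) with strip fuel p c pp 0<c (s≤s⁻¹ (c<cp ⟫ k≤))
  where
  0<c : 0 < c
  0<c = n≢0⇒n>0 λ { refl → <-irrefl refl 0<k }
  c<cp : c < c * p
  c<cp = m<m*n c p {{>-nonZero 0<c}} (prime>1 pp)
 ... | a , k' , e , p∤ = suc a , k' , cong (_* p) e ∙ lem (p ^ a) k' p , p∤
  where
  lem : ∀ x k p → x * k * p ≡ p * x * k
  lem = ring
 go : ∀ fuel k → k ≤ fuel → 0 < k → (∀ p a → Prime p → p ^ a ∣ k → p ^ a ∣ L) → k ∣ L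
 go zero k k≤ 0<k h = ⊥-elim (<⇒≱ 0<k k≤)
 go (suc f) k k≤ 0<k h with k ≟ 1
 ... | yes refl = 1∣ L
 ... | no k≢1 with prime-factor k (≤∧≢⇒< 0<k (≢-sym k≢1))
 ... | p , pp , p∣k with strip k p k pp 0<k ≤-refl
 ... | zero , k' , e , p∤ = ⊥-elim (p∤ (subst (p ∣_) (e ∙ n+0≡n k') p∣k))
 ... | suc a , k' , refl , p∤ with go f k' (s≤s⁻¹ (k'<k ⟫ k≤)) 0<k' (λ p' a' pp' d → h p' a' pp' (∣n⇒∣m*n (p ^ suc a) d))
  where
  0<k' : 0 < k'
  0<k' = n≢0⇒n>0 λ { refl → <-irrefl refl (subst (0 <_) (*-zeroʳ (p ^ suc a)) 0<k) }
  k'<k : k' < p ^ suc a * k'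
  k'<k = subst (k' <_) (*-comm k' (p ^ suc a)) (m<m*n k' (p ^ suc a) {{>-nonZero 0<k'}} (prime>1 pp ⟫ m≤m*n p (p ^ a) {{m^n≢0 p a {{prime⇒nonZero pp}}}}))
 ... | divides c refl = subst (p ^ suc a * k' ∣_) refl (*-monoˡ-∣ k' (coprime-power pp (suc a) k' c p∤
  (subst (p ^ suc a ∣_) (*-comm c k') (h p (suc a) pp (m∣m*n k')))))

-- `L` is the least common multiple of 1, ..., Y. It is a product of prime powers at most Y, hence
-- at most Y to the number of primes; an integral estimate bounds it from below.
module Nair (Y : ℕ) (1≤Y : 1 ≤ Y) where

 top : ℕ → ℕ → ℕ
 top p zero = 0
 top p (suc e) with p ^ suc e ≤? Y
 ... | yes _ = suc e
 ... | no _ = top p e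

 top≤ : ∀ p e → p ^ top p e ≤ Y
 top≤ p zero = 1≤Y
 top≤ p (suc e) with p ^ suc e ≤? Y
 ... | yes h = h
 ... | no _ = top≤ p e

 ≤top : ∀ p e a → a ≤ e → p ^ a ≤ Y → a ≤ top p e
 ≤top p zero a a≤ h = a≤
 ≤top p (suc e) a a≤ h with p ^ suc e ≤? Y
 ... | yes _ = a≤
 ... | no ¬h with m≤n⇒m<n∨m≡n a≤
 ... | inj₁ a< = ≤top p e a (s≤s⁻¹ a<) h
 ... | inj₂ refl = ⊥-elim (¬h h)

 factor : ℕ → ℕ
 factor p = if does (prime? p) then p ^ top p Y else 1

 L : ℕ
 L = ∏ (suc Y) factor

 ∏-∣ : ∀ n f i → i < n → f i ∣ ∏ n f
 ∏-∣ (suc n) f i (s≤s i≤) with m≤n⇒m<n∨m≡n i≤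
 ... | inj₁ i< = ∣m⇒∣m*n (f n) (∏-∣ n f i i<)
 ... | inj₂ refl = n∣m*n (∏ n f)

 k∣L : ∀ k → 0 < k → k ≤ Y → k ∣ L
 k∣L k 0<k k≤ = divides-by-prime-powers L k 0<k λ p a pp p^a∣k → at p a pp (∣⇒≤ {{>-nonZero 0<k}} p^a∣k ⟫ k≤)
  where
  at : ∀ p a → Prime p → p ^ a ≤ Y → p ^ a ∣ L
  at p zero pp h = 1∣ L
  at p (suc a) pp h = ∣-trans (subst (p ^ suc a ∣_) (sym fact) (pow-∣ (suc a) (top p Y) (≤top p Y (suc a) a≤ h))) (∏-∣ (suc Y) factor p (s≤s p≤))
   where
   p≤ : p ≤ Y
   p≤ = m≤m*n p (p ^ a) {{m^n≢0 p a {{prime⇒nonZero pp}}}} ⟫ h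
   a≤ : suc a ≤ Y
   a≤ = <⇒≤ (n<2^n (suc a)) ⟫ ^-monoˡ (suc a) (prime>1 pp) ⟫ h
   fact : factor p ≡ p ^ top p Y
   fact with prime? p
   ... | yes _ = refl
   ... | no ¬p = ⊥-elim (¬p pp)
   pow-∣ : ∀ a b → a ≤ b → p ^ a ∣ p ^ b
   pow-∣ a b a≤b = subst (p ^ a ∣_) (sym (^-+ p a (b ∸ a)) ∙ cong (p ^_) (m+[n∸m] a≤b)) (m∣m*n (p ^ (b ∸ a)))

 primes : ℕ
 primes = ∑ (suc Y) (λ p → 𝟙[ prime? p ])

 L≤ : L ≤ Y ^ primes
 L≤ = go (suc Y)
  where
  go : ∀ n → ∏ n factor ≤ Y ^ ∑ n (λ p → 𝟙[ prime? p ])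
  go zero = ≤-refl
  go (suc n) = *-mono (go n) (at n) ⟫≡ sym (^-+ Y (∑ n (λ p → 𝟙[ prime? p ])) 𝟙[ prime? n ])
   where
   at : ∀ p → factor p ≤ Y ^ 𝟙[ prime? p ]
   at p with prime? p
   ... | yes _ = top≤ p Y ⟫≡ sym (n*1≡n Y)
   ... | no _ = ≤-refl

 L>0 : 0 < L
 L>0 = go (suc Y)
  where
  go : ∀ n → 0 < ∏ n factor
  go zero = z<s
  go (suc n) = *-mono (go n) (at n)
   where
   at : ∀ p → 0 < factor p
   at p with prime? p
   ... | yes pp = m^n>0 p {{prime⇒nonZero pp}} (top p Y)
   ... | no _ = z<s

 -- L times the integral of x^a (1 - x)^b over [0, 1] is an integer.
 leibniz : ∀ b a → a + b < Y → ∃ λ x → x * (suc (a + b)) ! ≡ L * (a ! * b !)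
 leibniz zero a a< with k∣L (suc a) z<s (cong suc (sym (n+0≡n a)) ≡⟫ a<)
 ... | divides x e = x , cong (λ k → x * (suc k) !) (n+0≡n a) ∙ sym (*-assoc x (suc a) (a !)) ∙ cong (_* a !) (sym e) ∙ cong (L *_) (sym (n*1≡n (a !)))
 leibniz (suc b) a a< with leibniz b a (s≤s (+-monoʳ a (n≤1+n b)) ⟫ a<) | leibniz b (suc a) (cong suc (sym (+-suc a b)) ≡⟫ a<)
 ... | x₁ , e₁ | x₂ , e₂ = x₁ ∸ x₂ , (begin-equality
  (x₁ ∸ x₂) * (suc (a + suc b)) ! ≡⟨ cong (λ k → (x₁ ∸ x₂) * (suc k) !) (+-suc a b) ⟩
  (x₁ ∸ x₂) * (2 + (a + b)) ! ≡⟨ *-distribʳ-∸ ((2 + (a + b)) !) x₁ x₂ ⟩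
  x₁ * ((2 + (a + b)) * (suc (a + b)) !) ∸ x₂ * (2 + (a + b)) ! ≡⟨ cong₂ _∸_ (*-exchange x₁ (2 + (a + b)) ((suc (a + b)) !) ∙ cong ((2 + (a + b)) *_) e₁) e₂ ⟩
  (2 + (a + b)) * (L * (a ! * b !)) ∸ L * (suc a * a ! * b !) ≡⟨ cong (_∸ L * (suc a * a ! * b !)) (lem₂ a b L (a !) (b !)) ⟩
  L * (suc a * a ! * b !) + L * (a ! * (suc b * b !)) ∸ L * (suc a * a ! * b !) ≡⟨ m+n∸m≡n (L * (suc a * a ! * b !)) _ ⟩
  L * (a ! * (suc b) !) ∎)
  where
  lem₂ : ∀ a b L f g → (2 + (a + b)) * (L * (f * g)) ≡ L * (suc a * f * g) + L * (f * (suc b * g))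
  lem₂ = ring

 -- Since x (1 - x) ≤ 1/4, the integral of its m-th power over [0, 1], which is (m!)² / (2m + 1)!,
 -- is at most 4^(-m).
 central : ∀ m → 4 ^ m * (m ! * m !) ≤ (suc (m + m)) !
 central zero = ≤-refl
 central (suc m) = begin
  4 * 4 ^ m * (suc m * m ! * (suc m * m !)) ≡⟨ lem (4 ^ m) m (m !) ⟩
  4 * (suc m * suc m) * (4 ^ m * (m ! * m !)) ≤⟨ *-mono (m+n≤o⇒m≤o (4 * (suc m * suc m)) (≤-reflexive (lem' m))) (central m) ⟩
  (3 + (m + m)) * (2 + (m + m)) * (suc (m + m)) ! ≡⟨ *-assoc (3 + (m + m)) (2 + (m + m)) ((suc (m + m)) !) ⟩
  (3 + (m + m)) ! ≡⟨ cong (λ k → (2 + k) !) (sym (+-suc m m)) ⟩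
  (suc (suc m + suc m)) ! ∎
  where
  lem : ∀ x m f → 4 * x * (suc m * f * (suc m * f)) ≡ 4 * (suc m * suc m) * (x * (f * f))
  lem = ring
  lem' : ∀ m → 4 * (suc m * suc m) + (2 * m + 2) ≡ (3 + (m + m)) * (2 + (m + m))
  lem' = ring

 4^m≤L : ∀ m → m + m < Y → 4 ^ m ≤ L
 4^m≤L m m< with leibniz m m m<
 ... | zero , e = ⊥-elim (<-irrefl e (*-mono L>0 (*-mono (1≤n! m) (1≤n! m))))
 ... | suc x , e = *-cancelʳ-≤ (4 ^ m) L (m ! * m !) {{>-nonZero (*-mono (1≤n! m) (1≤n! m))}}
  (central m ⟫ m≤m+n _ _ ⟫≡ e)

-- For c ≥ 2, take Y = 2^c - 1 = 2m + 1 and let π be the number of primes up to Y. Then 2^(2m) ≤ L ≤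
-- 2^(c π), so c π ≥ 2m = 2^c - 2.
prime-count : ∀ c → 1 ≤ c → 2 ^ c ≤ 2 + c * ∑ (2 ^ c) (λ p → 𝟙[ prime? p ])
prime-count (suc zero) 1≤c = s<s z<s
prime-count c@(suc (suc c')) 1≤c = eqY ≡⟫ +-monoʳ 2 (^-cancel (m + m) (c * ∑ (2 ^ c) (λ p → 𝟙[ prime? p ])) (begin
 2 ^ (m + m) ≡⟨ cong (2 ^_) (cong (m +_) (sym (n+0≡n m))) ∙ sym (^-*-assoc 2 2 m) ⟩
 4 ^ m ≤⟨ 4^m≤L m ≤-refl ⟩
 L ≤⟨ L≤ ⟩
 Y ^ primes ≤⟨ ^-monoˡ primes (n≤1+n Y ⟫≡ eqY₁) ⟩
 (2 ^ c) ^ primes ≡⟨ ^-*-assoc 2 c primes ⟩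
 2 ^ (c * primes) ≡⟨ cong (λ n → 2 ^ (c * ∑ n (λ p → 𝟙[ prime? p ]))) eqY₁ ⟩
 2 ^ (c * ∑ (2 ^ c) (λ p → 𝟙[ prime? p ])) ∎))
 where
 m = 2 ^ suc c' ∸ 1
 Y = suc (m + m)
 open Nair Y z<s
 m+1 : 1 + m ≡ 2 ^ suc c'
 m+1 = m+[n∸m] (1≤2^ (suc c'))
 eqY₁ : suc Y ≡ 2 ^ c
 eqY₁ = lem m ∙ cong (λ x → x + (x + 0)) m+1 ∙ refl
  where
  lem : ∀ m → suc (suc (m + m)) ≡ (1 + m) + ((1 + m) + 0)
  lem = ring
 eqY : 2 ^ c ≡ 2 + (m + m)
 eqY = sym eqY₁
 ^-cancel : ∀ a b → 2 ^ a ≤ 2 ^ b → a ≤ b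
 ^-cancel a b h = ≮⇒≥ λ lt → <⇒≱ (^-monoʳ-< 2 (s<s z<s) lt) h

-- Each prime divisor accounts for a factor of at least 2.
prime-divisors : ∀ Y b C → 0 < C → C < 2 ^ b → ∑ Y (λ p → 𝟙[ prime? p ×-dec (p ∣? C) ]) ≤ b
prime-divisors Y b C 0<C C< with ∑ Y (λ p → 𝟙[ prime? p ×-dec (p ∣? C) ]) ≟ 0
... | yes z = z ≡⟫ z≤n
prime-divisors Y zero C 0<C C< | no h = ⊥-elim (<⇒≱ C< 0<C)
prime-divisors Y (suc b) C 0<C C< | no h with some Y h
 where
 some : ∀ Y → ∑ Y (λ p → 𝟙[ prime? p ×-dec (p ∣? C) ]) ≢ 0 → ∃ λ p → p < Y × Prime p × p ∣ C
 some zero h = ⊥-elim (h refl)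
 some (suc Y) h with prime? Y ×-dec (Y ∣? C)
 ... | yes (pp , d) = Y , ≤-refl , pp , d
 ... | no ¬d with some Y (λ e → h (cong₂ _+_ e ([]-no (prime? Y ×-dec (Y ∣? C)) ¬d) ∙ refl))
 ... | p , p< , r = p , <-suc p< , r
... | p , p< , pp , divides c refl = begin
 ∑ Y (λ r → 𝟙[ prime? r ×-dec (r ∣? c * p) ]) ≤⟨ ∑-mono Y (λ r _ → at r) ⟩
 ∑ Y (λ r → eq r p * 1 + 𝟙[ prime? r ×-dec (r ∣? c) ]) ≡⟨ ∑-+ Y _ _ ⟩
 ∑ Y (λ r → eq r p * 1) + ∑ Y (λ r → 𝟙[ prime? r ×-dec (r ∣? c) ]) ≤⟨ +-mono (≤-reflexive (∑-single Y p 1 p<)) (prime-divisors Y b c 0<c c<) ⟩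
 1 + b ∎
 where
 0<c : 0 < c
 0<c = n≢0⇒n>0 λ { refl → <-irrefl refl 0<C }
 c< : c < 2 ^ b
 c< = *-cancelˡ-< 2 c (2 ^ b) (≤-<-trans (*-monoˡ c (prime>1 pp) ⟫≡ *-comm p c) C<)
 at : ∀ r → 𝟙[ prime? r ×-dec (r ∣? c * p) ] ≤ eq r p * 1 + 𝟙[ prime? r ×-dec (r ∣? c) ]
 at r = lem (prime? r ×-dec (r ∣? c * p)) (prime? r ×-dec (r ∣? c)) ⟫ ≤-refl
  where
  lem : (d : Dec (Prime r × r ∣ c * p)) (d' : Dec (Prime r × r ∣ c)) → 𝟙[ d ] ≤ eq r p * 1 + 𝟙[ d' ]
  lem (no _) d' = z≤n
  lem (yes (rp , r∣)) d' with euclidsLemma c p rp r∣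
  ... | inj₁ r∣c = sym ([]-yes d' (rp , r∣c)) ≡⟫ m≤n+m _ _
  ... | inj₂ r∣p with prime⇒irreducible pp r∣p
  ... | inj₁ refl = ⊥-elim (¬prime[1] rp)
  ... | inj₂ refl = sym (n*1≡n _ ∙ eq-refl r) ≡⟫ m≤m+n _ _

-- Binomial coefficients.

choose : ℕ → ℕ → ℕ
choose n zero = 1
choose zero (suc k) = 0
choose (suc n) (suc k) = choose n k + choose n (suc k)

choose-> : ∀ n k → n < k → choose n k ≡ 0
choose-> zero (suc k) _ = refl
choose-> (suc n) (suc k) (s≤s h) = cong₂ _+_ (choose-> n k h) (choose-> n (suc k) (<-suc h))

choose-diag : ∀ n → choose n n ≡ 1
choose-diag zero = refl
choose-diag (suc n) = cong₂ _+_ (choose-diag n) (choose-> n (suc n) ≤-refl)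

choose-sub : ∀ n → choose (suc n) n ≡ suc n
choose-sub zero = refl
choose-sub (suc n) = cong₂ _+_ (choose-sub n) (choose-diag (suc n)) ∙ +-comm (suc n) 1

absorb : ∀ n k → suc k * choose (suc n) (suc k) ≡ suc n * choose n k
absorb zero zero = refl
absorb zero (suc k) = *-zeroʳ (suc (suc k))
absorb (suc n) zero = n+0≡n _ ∙ cong suc ((sym (n+0≡n _) ∙ absorb n zero) ∙ refl)
absorb (suc n) (suc k) = begin-equality
 suc (suc k) * (choose (suc n) (suc k) + choose (suc n) (suc (suc k)))
  ≡⟨ lem k (choose (suc n) (suc k)) _ ⟩
 suc k * choose (suc n) (suc k) + choose (suc n) (suc k) + suc (suc k) * choose (suc n) (suc (suc k))
  ≡⟨ cong₂ (λ x y → x + choose (suc n) (suc k) + y) (absorb n k) (absorb n (suc k)) ⟩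
 suc n * choose n k + choose (suc n) (suc k) + suc n * choose n (suc k)
  ≡⟨ lem' n (choose n k) (choose n (suc k)) ⟩
 suc (suc n) * choose (suc n) (suc k) ∎
 where
 lem : ∀ k a b → suc (suc k) * (a + b) ≡ suc k * a + a + suc (suc k) * b
 lem = ring
 lem' : ∀ n a b → suc n * a + (a + b) + suc n * b ≡ suc (suc n) * (a + b)
 lem' = ring

choose-ratio : ∀ a k → suc k * choose (a + k) (suc k) ≡ a * choose (a + k) k
choose-ratio a k = +-cancelˡ-≡ (suc k * choose (a + k) k) _ _ (sym (*-distribˡ-+ (suc k) (choose (a + k) k) _) ∙
 absorb (a + k) k ∙ lem a k (choose (a + k) k))
 where
 lem : ∀ a k c → suc (a + k) * c ≡ suc k * c + a * c
 lem = ring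

choose-middle : ∀ m → choose (suc m + m) (suc m) ≡ choose (suc m + m) m
choose-middle m = *-cancelˡ-≡ _ _ (suc m) (choose-ratio (suc m) m)

choose-double : ∀ m → suc m * choose (suc m + suc m) (suc m) ≡ 2 * suc (m + m) * choose (m + m) m
choose-double m = begin-equality
 suc m * choose (suc m + suc m) (suc m) ≡⟨ cong (λ k → suc m * choose (suc k) (suc m)) (+-suc m m) ⟩
 suc m * (choose (suc m + m) m + choose (suc m + m) (suc m)) ≡⟨ cong (λ c → suc m * (c + choose (suc m + m) (suc m))) (sym (choose-middle m)) ⟩
 suc m * (choose (suc m + m) (suc m) + choose (suc m + m) (suc m)) ≡⟨ lem m (choose (suc m + m) (suc m)) ⟩
 2 * (suc m * choose (suc (m + m)) (suc m)) ≡⟨ cong (2 *_) (absorb (m + m) m) ⟩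
 2 * (suc (m + m) * choose (m + m) m) ≡⟨ *-assoc 2 (suc (m + m)) _ ⟨
 2 * suc (m + m) * choose (m + m) m ∎
 where
 lem : ∀ m c → suc m * (c + c) ≡ 2 * (suc m * c)
 lem = ring

-- Together with `central-odd`, this shows that balanced masks are a polynomial fraction of all
-- masks.
central-even : ∀ m → 4 ^ m ≤ suc (m + m) * choose (m + m) m
central-even zero = ≤-refl
central-even (suc m) = *-cancelˡ-≤ (suc m) (begin
 suc m * (4 * 4 ^ m) ≤⟨ *-monoʳ (suc m) (*-monoʳ 4 (central-even m)) ⟩
 suc m * (4 * (suc (m + m) * choose (m + m) m)) ≡⟨ lem m (choose (m + m) m) ⟩
 (2 + (m + m)) * (2 * suc (m + m) * choose (m + m) m) ≤⟨ *-monoˡ (2 * suc (m + m) * choose (m + m) m) (n≤1+n (2 + (m + m))) ⟩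
 (3 + (m + m)) * (2 * suc (m + m) * choose (m + m) m) ≡⟨ cong ((3 + (m + m)) *_) (sym (choose-double m)) ⟩
 (3 + (m + m)) * (suc m * choose (suc m + suc m) (suc m)) ≡⟨ cong (λ k → suc k * (suc m * choose (suc m + suc m) (suc m))) (cong suc (sym (+-suc m m))) ⟩
 suc (suc m + suc m) * (suc m * choose (suc m + suc m) (suc m)) ≡⟨ *-exchange (suc (suc m + suc m)) (suc m) (choose (suc m + suc m) (suc m)) ⟩
 suc m * (suc (suc m + suc m) * choose (suc m + suc m) (suc m)) ∎)
 where
 lem : ∀ m c → suc m * (4 * (suc (m + m) * c)) ≡ (2 + (m + m)) * (2 * suc (m + m) * c)
 lem = ring

central-odd : ∀ m → 2 * 4 ^ m ≤ (3 + (m + m)) * choose (suc m + m) m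
central-odd m = *-cancelˡ-≤ 2 (begin
 2 * (2 * 4 ^ m) ≡⟨ *-assoc 2 2 (4 ^ m) ⟨
 4 ^ suc m ≤⟨ central-even (suc m) ⟩
 suc (suc m + suc m) * choose (suc m + suc m) (suc m) ≡⟨ cong₂ _*_ (cong (2 +_) (+-suc m m)) (cong (λ k → choose (suc k) (suc m)) (+-suc m m)) ⟩
 (3 + (m + m)) * (choose (suc m + m) m + choose (suc m + m) (suc m)) ≡⟨ cong (λ c → (3 + (m + m)) * (choose (suc m + m) m + c)) (choose-middle m) ⟩
 (3 + (m + m)) * (choose (suc m + m) m + choose (suc m + m) m) ≡⟨ lem (3 + (m + m)) (choose (suc m + m) m) ⟩
 2 * ((3 + (m + m)) * choose (suc m + m) m) ∎)
 where
 lem : ∀ k c → k * (c + c) ≡ 2 * (k * c)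
 lem = ring

count-card : ∀ n k → 𝔹 n (λ l → eq (card l) k) ≡ choose n k
count-card zero zero = refl
count-card zero (suc k) = eq-no {0} {suc k} λ ()
count-card (suc n) zero = cong₂ _+_ (count-card n zero) ((𝔹-cong n λ l → eq-no {suc (card l)} {0} λ ()) ∙ 𝔹-const n 0 ∙ *-zeroʳ (2 ^ n)) ∙ refl
count-card (suc n) (suc k) = cong₂ _+_ (count-card n (suc k)) (count-card n k) ∙ +-comm (choose n (suc k)) _

binomial : ∀ n x → (1 + x) ^ n ≡ ∑ (suc n) (λ i → choose n i * x ^ i)
binomial zero x = refl
binomial (suc n) x = begin-equality
 (1 + x) * (1 + x) ^ n ≡⟨ cong ((1 + x) *_) (binomial n x) ⟩
 (1 + x) * ∑ (suc n) f ≡⟨ cong (_+ x * ∑ (suc n) f) (sym (cong (λ c → ∑ (suc n) f + c * x ^ suc n) (choose-> n (suc n) ≤-refl) ∙ n+0≡n _) ∙ ∑-head (suc n) f) ⟩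
 1 + ∑ (suc n) (λ i → f (suc i)) + x * ∑ (suc n) f ≡⟨ cong (1 + ∑ (suc n) (λ i → f (suc i)) +_) (sym (∑-*ˡ (suc n) x f)) ⟩
 1 + ∑ (suc n) (λ i → f (suc i)) + ∑ (suc n) (λ i → x * f i) ≡⟨ +-assoc 1 (∑ (suc n) (λ i → f (suc i))) _ ∙ cong suc (sym (∑-+ (suc n) _ _) ∙ (∑-cong' (suc n) λ i → lem (choose n i) (choose n (suc i)) x (x ^ i))) ⟩
 1 + ∑ (suc n) (λ i → choose (suc n) (suc i) * x ^ suc i) ≡⟨ ∑-head (suc n) (λ i → choose (suc n) i * x ^ i) ⟨
 ∑ (suc (suc n)) (λ i → choose (suc n) i * x ^ i) ∎
 where
 f : ℕ → ℕ
 f i = choose n i * x ^ i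
 lem : ∀ a b x p → b * (x * p) + x * (a * p) ≡ (a + b) * (x * p)
 lem = ring

∑-∣ : ∀ {q} n f → (∀ i → i < n → q ∣ f i) → q ∣ ∑ n f
∑-∣ zero f h = _ ∣0
∑-∣ (suc n) f h = ∣m∣n⇒∣m+n (∑-∣ n f λ i i< → h i (<-suc i<)) (h n ≤-refl)

-- Power sums modulo a prime.

module Field (q : ℕ) (qp : Prime q) where

 private instance
  q≢0 : NonZero q
  q≢0 = prime⇒nonZero qp

 1<q : 1 < q
 1<q = prime>1 qp

 infix 4 _≈_
 _≈_ : ℕ → ℕ → Set
 x ≈ y = x % q ≡ y % q

 ≈-+ : ∀ {x y u v} → x ≈ y → u ≈ v → x + u ≈ y + v
 ≈-+ {x} {y} {u} {v} a b = %-distribˡ-+ x u q ∙ cong₂ (λ s t → (s + t) % q) a b ∙ sym (%-distribˡ-+ y v q)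

 ≈-* : ∀ {x y u v} → x ≈ y → u ≈ v → x * u ≈ y * v
 ≈-* {x} {y} {u} {v} a b = %-distribˡ-* x u q ∙ cong₂ (λ s t → (s * t) % q) a b ∙ sym (%-distribˡ-* y v q)

 ≈-∑ : ∀ n {f g : ℕ → ℕ} → (∀ i → i < n → f i ≈ g i) → ∑ n f ≈ ∑ n g
 ≈-∑ zero h = refl
 ≈-∑ (suc n) {f} {g} h = ≈-+ {∑ n f} {∑ n g} (≈-∑ n λ i i< → h i (<-suc i<)) (h n ≤-refl)

 ≈-∏ : ∀ n {f g : ℕ → ℕ} → (∀ i → i < n → f i ≈ g i) → ∏ n f ≈ ∏ n g
 ≈-∏ zero h = refl
 ≈-∏ (suc n) {f} {g} h = ≈-* {∏ n f} {∏ n g} (≈-∏ n λ i i< → h i (<-suc i<)) (h n ≤-refl)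

 ≈-𝔹 : ∀ n {f g : Vec Bool n → ℕ} → (∀ x → f x ≈ g x) → 𝔹 n f ≈ 𝔹 n g
 ≈-𝔹 zero h = h []
 ≈-𝔹 (suc n) {f} {g} h = ≈-+ {𝔹 n λ x → f (false ∷ x)} {𝔹 n λ x → g (false ∷ x)} (≈-𝔹 n λ x → h (false ∷ x)) (≈-𝔹 n λ x → h (true ∷ x))

 ∣⇒≈0 : ∀ {x} → q ∣ x → x ≈ 0
 ∣⇒≈0 {x} d = n∣m⇒m%n≡0 x q d ∙ sym (0%n≡0 q)
  where
  0%n≡0 : ∀ q .{{_ : NonZero q}} → 0 % q ≡ 0
  0%n≡0 (suc q) = refl

 ≈0⇒∣ : ∀ {x} → x ≈ 0 → q ∣ x
 ≈0⇒∣ {x} e = m%n≡0⇒n∣m x q (e ∙ n∣m⇒m%n≡0 0 q (q ∣0))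

 add-multiple : ∀ {x y} → q ∣ y → x + y ≈ x
 add-multiple {x} {y} d = ≈-+ {x} {x} refl (∣⇒≈0 d) ∙ cong (_% q) (n+0≡n x)

 small∤ : ∀ {k} → 0 < k → k < q → ¬ q ∣ k
 small∤ 0<k k<q d = <⇒≱ k<q (∣⇒≤ {{>-nonZero 0<k}} d)

 cancel-small : ∀ k {x} → 0 < k → k < q → q ∣ k * x → q ∣ x
 cancel-small k {x} 0<k k<q d with euclidsLemma k x qp d
 ... | inj₁ h = ⊥-elim (small∤ 0<k k<q h)
 ... | inj₂ h = h

 choose∣ : ∀ i → 0 < i → i < q → q ∣ choose q i
 choose∣ (suc i) 0<i i< = cancel-small (suc i) 0<i i< (subst (λ p → p ∣ suc i * choose p (suc i)) pq
  (subst (suc (pred q) ∣_) (sym (absorb (pred q) i)) (m∣m*n (choose (pred q) i))))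
  where
  pq : suc (pred q) ≡ q
  pq = suc-pred q

 -- By induction on x, since q divides the inner binomial coefficients of (1 + x)^q.
 fermat : ∀ x → x ^ q ≈ x
 fermat zero = cong (_% q) (zero-pow q)
  where
  zero-pow : ∀ q .{{_ : NonZero q}} → 0 ^ q ≡ 0
  zero-pow (suc q) = refl
 fermat (suc x) = cong (_% q) expand ∙ ≈-+ {1 + middle} {1} (add-multiple {1} {middle} q∣middle) (fermat x) ∙ refl
  where
  f : ℕ → ℕ
  f i = choose q i * x ^ i
  middle : ℕ
  middle = ∑ (pred q) (λ i → f (suc i))
  q∣middle : q ∣ middle
  q∣middle = ∑-∣ (pred q) _ λ i i< → ∣m⇒∣m*n (x ^ suc i) (choose∣ (suc i) z<s (subst (suc i <_) (suc-pred q) (s≤s i<)))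
  expand : (1 + x) ^ q ≡ 1 + middle + x ^ q
  expand = binomial q x ∙ cong₂ _+_ (cong (λ n → ∑ n f) (sym (suc-pred q)) ∙ ∑-head (pred q) f)
   (cong (_* x ^ q) (choose-diag q) ∙ n+0≡n _)

 powers : ℕ → ℕ
 powers k = ∑ q (λ x → x ^ k)

 -- The differences (x + 1)^(k+1) - x^(k+1), expanded by the binomial theorem and summed over x < q.
 telescope : ∀ k → ∑ k (λ i → choose (suc k) i * powers i) + suc k * powers k ≡ q ^ suc k
 telescope k = +-cancelʳ-≡ (powers (suc k)) _ _ (begin-equality
  ∑ k (λ i → choose (suc k) i * powers i) + suc k * powers k + powers (suc k)
   ≡⟨ cong₂ (λ a b → ∑ k (λ i → choose (suc k) i * powers i) + a * powers k + b) (sym (choose-sub k)) (sym (n+0≡n _) ∙ cong (_* powers (suc k)) (sym (choose-diag (suc k)))) ⟩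
  ∑ (suc (suc k)) (λ i → choose (suc k) i * powers i)
   ≡⟨ ∑-cong' (2 + k) (λ i → sym (∑-*ˡ q (choose (suc k) i) (λ x → x ^ i))) ⟩
  ∑ (suc (suc k)) (λ i → ∑ q (λ x → choose (suc k) i * x ^ i))
   ≡⟨ ∑-swap (2 + k) q _ ⟩
  ∑ q (λ x → ∑ (suc (suc k)) (λ i → choose (suc k) i * x ^ i))
   ≡⟨ ∑-cong' q (λ x → sym (binomial (suc k) x)) ⟩
  ∑ q (λ x → suc x ^ suc k)
   ≡⟨ ∑-head q (λ x → x ^ suc k) ⟨
  powers (suc k) + q ^ suc k
   ≡⟨ +-comm (powers (suc k)) _ ⟩
  q ^ suc k + powers (suc k) ∎)

 -- Modulo q, the telescoping sum expresses k + 1 times the k-th power sum through lower ones, and k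
 -- + 1 is invertible.
 powers-low : ∀ k → suc k < q → q ∣ powers k
 powers-low k = go (suc k) k ≤-refl
  where
  go : ∀ n k → k < n → suc k < q → q ∣ powers k
  go (suc n) k (s≤s k≤n) k< = cancel-small (suc k) z<s k<
   (∣m+n∣m⇒∣n (subst (q ∣_) (sym (telescope k)) (m∣m*n (q ^ k)))
    (∑-∣ k _ λ i i< → ∣n⇒∣m*n (choose (suc k) i) (go n i (i< ⟫ k≤n) (<-trans (s≤s i<) k<))))

 unit : ∀ x → 0 < x → x < q → x ^ pred q ≈ 1
 unit x 0<x x< = cong (_% q) (sym (m+[n∸m] pos)) ∙ add-multiple {1} (cancel-small x 0<x x< d)
  where
  pos : 1 ≤ x ^ pred q
  pos = m^n>0 x {{>-nonZero 0<x}} (pred q)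
  xq : x * x ^ pred q ≡ x ^ q
  xq = cong (x ^_) (suc-pred q)
  d : q ∣ x * (x ^ pred q ∸ 1)
  d = ≈0⇒∣ (cancel (cong (_% q) (cong (_+ x * (x ^ pred q ∸ 1)) (sym (n*1≡n x)) ∙
   sym (*-distribˡ-+ x 1 _) ∙ cong (x *_) (m+[n∸m] pos) ∙ xq) ∙ fermat x))
   where
   cancel : ∀ {y} → x + y ≈ x → y ≈ 0
   cancel {y} e = ∣⇒≈0 (subst (q ∣_) (cong (_∸ x) (sym refl) ∙ m+n∸m≡n x y)
    (m%n≡0⇒n∣m (x + y ∸ x) q (%-∸ (x + y) x (m≤m+n x y) e ∙ refl)))
    where
    %-∸ : ∀ a b → b ≤ a → a % q ≡ b % q → (a ∸ b) % q ≡ 0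
    %-∸ a b b≤a e = n∣m⇒m%n≡0 (a ∸ b) q (divides (a / q ∸ b / q) (cong₂ _∸_ (m≡m%n+[m/n]*n a q) (m≡m%n+[m/n]*n b q) ∙
     cong (λ r → r + a / q * q ∸ (b % q + b / q * q)) e ∙ ([m+n]∸[m+o]≡n∸o (b % q) _ _) ∙ sym (*-distribʳ-∸ q (a / q) (b / q))))

 powers-top : powers (pred q) ≈ pred q
 powers-top = cong (_% q) (cong (λ n → ∑ n (λ x → x ^ pred q)) (sym (suc-pred q)) ∙ ∑-head (pred q) _ ∙
  cong (_+ ∑ (pred q) (λ x → suc x ^ pred q)) (zero-pow (pred q) (pred-mono-≤ 1<q))) ∙
  (≈-∑ (pred q) {g = λ _ → 1} λ i i< → unit (suc i) z<s (subst (suc i <_) (suc-pred q) (s≤s i<))) ∙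
   cong (_% q) (∑-const (pred q) 1 ∙ n*1≡n _)
  where
  zero-pow : ∀ q → 1 ≤ q → 0 ^ q ≡ 0
  zero-pow (suc q) _ = refl

 -- Exponents drop by q - 1 but stay positive; exponent 0 would give a different value at x = 0.
 powers-high : ∀ e → powers (q + e) ≈ powers (suc e)
 powers-high e = ≈-∑ q λ x _ → cong (_% q) (^-+ x q e) ∙ ≈-* {x ^ q} {x} (fermat x) refl

 subset-product : ∀ v w x → ∏ v (λ u → 1 + x ^ w u) ≡ 𝔹 v (λ y → x ^ dot w y)
 subset-product zero w x = refl
 subset-product (suc v) w x = ∏-head v _ ∙ cong ((1 + x ^ w 0) *_) (subset-product v (shift w) x) ∙
  cong (𝔹 v (λ y → x ^ dot (shift w) y) +_) (sym (𝔹-*ˡ v (x ^ w 0) _) ∙ (𝔹-cong v λ y → sym (^-+ x (w 0) (dot (shift w) y))))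

 solutions : ∀ v → (ℕ → ℕ) → ℕ → ℕ
 solutions v w τ = 𝔹 v (λ y → eq (dot w y) τ)

 -- Coefficient extraction: power sums over the field vanish except at the exponent q - 1.
 extract : ∀ v w τ → suc τ < q → (∀ y → suc (dot {v} w y) < q) →
  ∑ q (λ x → x ^ (pred q ∸ τ) * ∏ v (λ u → 1 + x ^ w u)) ≈ pred q * solutions v w τ
 extract v w τ τ< d< = cong (_% q) ((∑-cong' q λ x → cong (x ^ (pred q ∸ τ) *_) (subset-product v w x) ∙
  sym (𝔹-*ˡ v (x ^ (pred q ∸ τ)) _) ∙ (𝔹-cong v λ y → sym (^-+ x (pred q ∸ τ) (dot w y)))) ∙ swap q v _) ∙
  ≈-𝔹 v at ∙ cong (_% q) (𝔹-*ˡ v (pred q) _)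
  where
  swap : ∀ m n (F : ℕ → Vec Bool n → ℕ) → ∑ m (λ x → 𝔹 n (F x)) ≡ 𝔹 n (λ y → ∑ m (λ x → F x y))
  swap zero n F = sym (𝔹-const n 0 ∙ *-zeroʳ (2 ^ n))
  swap (suc m) n F = cong (_+ 𝔹 n (F m)) (swap m n F) ∙ sym (𝔹-+ n _ (F m))
  τ≤ : suc τ ≤ pred q
  τ≤ = pred-mono-≤ τ<
  at : ∀ y → powers (pred q ∸ τ + dot w y) ≈ pred q * eq (dot w y) τ
  at y with <-cmp (dot w y) τ
  ... | tri≈ _ e _ rewrite eq-yes e | e | m∸n+n≡m (n≤1+n τ ⟫ τ≤) | n*1≡n (pred q) = powers-top
  ... | tri< lt' ne _ rewrite eq-no ne | *-zeroʳ (pred q) = ∣⇒≈0 (powers-low _ (subst (suc (pred q ∸ τ + dot w y) <_) (suc-pred q)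
   (s≤s (sym (+-suc (pred q ∸ τ) (dot w y)) ≡⟫ +-monoʳ (pred q ∸ τ) lt' ⟫≡ m∸n+n≡m (n≤1+n τ ⟫ τ≤)))))
  ... | tri> _ ne gt rewrite eq-no ne | *-zeroʳ (pred q) = cong (λ e → powers e % q) shape ∙ powers-high δ ∙ ∣⇒≈0 (powers-low (suc δ) δ<)
   where
   δ = dot w y ∸ suc τ
   shape : pred q ∸ τ + dot w y ≡ q + δ
   shape = begin-equality
    pred q ∸ τ + dot w y ≡⟨ cong (pred q ∸ τ +_) (sym (m+[n∸m] gt)) ⟩
    pred q ∸ τ + (suc τ + δ) ≡⟨ +-assoc (pred q ∸ τ) (suc τ) δ ⟨
    pred q ∸ τ + suc τ + δ ≡⟨ cong (_+ δ) (+-suc (pred q ∸ τ) τ ∙ cong suc (m∸n+n≡m (n≤1+n τ ⟫ τ≤))) ⟩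
    suc (pred q) + δ ≡⟨ cong (_+ δ) (suc-pred q) ⟩
    q + δ ∎
   δ< : suc (suc δ) < q
   δ< = ≤-<-trans (s≤s (s≤s (m≤n+m δ τ) ⟫≡ (m+[n∸m] gt))) (d< y)

 extract-zero : ∀ {X c} → X ≈ pred q * c → (X % q ≡ 0 → q ∣ c) × (c ≡ 0 → X % q ≡ 0)
 extract-zero {X} {c} e =
  (λ z → cancel-small (pred q) (pred-mono-≤ 1<q) (subst (pred q <_) (suc-pred q) ≤-refl) (m%n≡0⇒n∣m _ q (sym e ∙ z))) ,
  (λ { refl → e ∙ cong (_% q) (*-zeroʳ (pred q)) ∙ n∣m⇒m%n≡0 0 q (q ∣0) })

 module _ (W Yq : ℕ) (q≤ : q ≤ Yq) where

  power : ℕ → ℕ → ℕ → ℕ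
  power x e a = iterate↓ W (λ i a → (a * a * (bit e i * x + (1 ∸ bit e i))) mod q ⊓ Yq) a

  -- Square and multiply from the highest bit down: the accumulator is x to the part of e read so
  -- far. The cap has no effect, as residues are below q.
  power-≈ : ∀ x e → e < 2 ^ W → power x e 1 ≈ x ^ e
  power-≈ x e e< = go W 1 (cong (λ k → (x ^ k) % q) (sym (quo-/ e (2 ^ W) {{m^n≢0 2 W}} ∙ m<n⇒m/n≡0 {{m^n≢0 2 W}} e<)))
   where
   half : ∀ j → e quo 2 ^ j ≡ (e quo 2 ^ suc j) + (e quo 2 ^ suc j) + bit e j
   half j = (m≡m%n+[m/n]*n (e quo 2 ^ j) 2) ∙ +-comm (bit e j) _ ∙ cong (_+ bit e j)
    (cong (_* 2) two ∙ lem (e quo 2 ^ suc j))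
    where
    lem : ∀ y → y * 2 ≡ y + y
    lem = ring
    two : (e quo 2 ^ j) / 2 ≡ e quo 2 ^ suc j
    two = cong (_/ 2) (quo-/ e (2 ^ j) {{m^n≢0 2 j}}) ∙ (m/n/o≡m/[n*o] e (2 ^ j) 2 {{m^n≢0 2 j}} {{_}} {{m*n≢0 (2 ^ j) 2 {{m^n≢0 2 j}}}}) ∙
     /-congʳ {{m*n≢0 (2 ^ j) 2 {{m^n≢0 2 j}}}} {{m^n≢0 2 (suc j)}} (*-comm (2 ^ j) 2) ∙ sym (quo-/ e (2 ^ suc j) {{m^n≢0 2 (suc j)}})
   pick : ∀ b → b ≤ 1 → b * x + (1 ∸ b) ≡ x ^ b
   pick zero _ = refl
   pick (suc zero) _ = n+0≡n _ ∙ n+0≡n x ∙ sym (n*1≡n x)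
   pick (suc (suc b)) (s≤s ())
   go : ∀ j a → a ≈ x ^ (e quo 2 ^ j) → iterate↓ j (λ i a → (a * a * (bit e i * x + (1 ∸ bit e i))) mod q ⊓ Yq) a ≈ x ^ e
   go zero a h = h ∙ cong (λ k → (x ^ k) % q) (quo-/ e 1 ∙ n/1≡n e)
   go (suc j) a h = go j _ (cong (_% q) (m≤n⇒m⊓n≡m (mod-% y q ≡⟫ <⇒≤ (m%n<n y q) ⟫ q≤) ∙ mod-% y q) ∙
    m%n%n≡m%n y q ∙ ≈-* {a * a} {x ^ k * x ^ k} (≈-* {a} {x ^ k} h h) (cong (_% q) (pick (bit e j) (bit≤1 e j))) ∙
     cong (_% q) (cong (_* x ^ bit e j) (sym (^-+ x k k)) ∙ sym (^-+ x (k + k) (bit e j)) ∙ cong (x ^_) (sym (half j))))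
    where
    k = e quo 2 ^ suc j
    y = a * a * (bit e j * x + (1 ∸ bit e j))

-- Primes that separate the target from the other sums.

distance : ℕ → ℕ → ℕ
distance x y = (x ∸ y) + (y ∸ x)

distance>0 : ∀ {x y} → x ≢ y → 0 < distance x y
distance>0 {x} {y} ne with <-cmp x y
... | tri< l _ _ = m<n⇒0<n∸m l ⟫ m≤n+m _ _
... | tri≈ _ e _ = ⊥-elim (ne e)
... | tri> _ _ g = m<n⇒0<n∸m g ⟫ m≤m+n _ _

distance< : ∀ {x y B} → x < B → y < B → distance x y < B
distance< {x} {y} x< y< with ≤-total x y
... | inj₁ x≤y rewrite m≤n⇒m∸n≡0 x≤y = ≤-<-trans (m∸n≤m y x) y<
... | inj₂ y≤x rewrite m≤n⇒m∸n≡0 y≤x | n+0≡n (x ∸ y) = ≤-<-trans (m∸n≤m x y) x<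

≡-mod⇒∣ : ∀ p .{{_ : NonZero p}} {x y} → x % p ≡ y % p → p ∣ distance x y
≡-mod⇒∣ p {x} {y} e = ∣m∣n⇒∣m+n (half x y e) (half y x (sym e))
 where
 half : ∀ x y → x % p ≡ y % p → p ∣ x ∸ y
 half x y e = divides (x / p ∸ y / p) (cong₂ _∸_ (m≡m%n+[m/n]*n x p) (m≡m%n+[m/n]*n y p) ∙
  cong (λ r → r + x / p * p ∸ (y % p + y / p * p)) e ∙ ([m+n]∸[m+o]≡n∸o (y % p) _ _) ∙ sym (*-distribʳ-∸ p (x / p) (y / p)))

∑-𝔹-swap : ∀ m n (F : ℕ → Vec Bool n → ℕ) → ∑ m (λ x → 𝔹 n (F x)) ≡ 𝔹 n (λ y → ∑ m (λ x → F x y))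
∑-𝔹-swap zero n F = sym (𝔹-const n 0 ∙ *-zeroʳ (2 ^ n))
∑-𝔹-swap (suc m) n F = cong (_+ 𝔹 n (F m)) (∑-𝔹-swap m n F) ∙ sym (𝔹-+ n _ (F m))

module Separate (n : ℕ) (w : ℕ → ℕ) (t b : ℕ) (t< : t < 2 ^ b) (w< : ∀ y → dot {n} w y < 2 ^ b) where

 open Transversal n (dot w)

 clash : ℕ → Vec Bool n → ℕ
 clash p a = A a * ((1 ∸ eq (dot w a) t) * 𝟙[ prime? p ×-dec (p ∣? distance (dot w a) t) ])

 -- Truncated subtraction of all clashes gives an indicator of clash-free primes that is easy to sum
 -- from below.
 good : ℕ → ℕ
 good p = 𝟙[ prime? p ] ∸ 𝔹 n (clash p)

 -- A representative whose sum differs from t clashes only at the prime divisors of a nonzero number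
 -- below 2^b, of which there are at most b.
 clashes : ∀ Y → ∑ Y (λ p → 𝔹 n (clash p)) ≤ 𝔹 n A * b
 clashes Y = ∑-𝔹-swap Y n clash ≡⟫ 𝔹-mono n each ⟫≡ 𝔹-*ʳ n b A
  where
  each : ∀ a → ∑ Y (λ p → clash p a) ≤ A a * b
  each a = ∑-*ˡ Y (A a) _ ≡⟫ *-monoʳ (A a) (∑-*ˡ Y (1 ∸ eq (dot w a) t) _ ≡⟫ inner)
   where
   inner : (1 ∸ eq (dot w a) t) * ∑ Y (λ p → 𝟙[ prime? p ×-dec (p ∣? distance (dot w a) t) ]) ≤ b
   inner with eq-cases (dot w a) t
   ... | inj₁ (_ , e) = cong (λ d → (1 ∸ d) * ∑ Y (λ p → 𝟙[ prime? p ×-dec (p ∣? distance (dot w a) t) ])) e ≡⟫ z≤n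
   ... | inj₂ (ne , e) = cong (λ d → (1 ∸ d) * ∑ Y (λ p → 𝟙[ prime? p ×-dec (p ∣? distance (dot w a) t) ])) e ∙ n+0≡n _ ≡⟫
    prime-divisors Y b (distance (dot w a) t) (distance>0 ne) (distance< (w< a) t<)

 many-good : ∀ c → 1 ≤ c → 2 ^ c ≤ 2 + c * (∑ (2 ^ c) good + 𝔹 n A * b)
 many-good c 1≤c = prime-count c 1≤c ⟫ +-monoʳ 2 (*-monoʳ c ((∑-mono (2 ^ c) λ p _ → m≤n+m∸n 𝟙[ prime? p ] (𝔹 n (clash p))) ⟫
  ∑-+ (2 ^ c) _ _ ∙ +-comm (∑ (2 ^ c) (λ p → 𝔹 n (clash p))) _ ≡⟫ +-monoʳ (∑ (2 ^ c) good) (clashes (2 ^ c))))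

 good≤1 : ∀ p → good p ≤ 1
 good≤1 p = (m∸n≤m 𝟙[ prime? p ] (𝔹 n (clash p))) ⟫ ([]≤1 (prime? p))

 good-prime : ∀ p → good p ≢ 0 → Prime p
 good-prime p h = go (prime? p)
  where
  go : Dec (Prime p) → Prime p
  go (yes pp) = pp
  go (no ¬pp) = ⊥-elim (h (cong (_∸ 𝔹 n (clash p)) ([]-no (prime? p) ¬pp) ∙ 0∸n≡0 (𝔹 n (clash p))))

 -- One representative for each sum is enough, because congruence to t depends on the sum only.
 good-separates : ∀ p → good p ≢ 0 → (pp : Prime p) → ∀ y → (dot {n} w y % p) {{prime⇒nonZero pp}} ≡ (t % p) {{prime⇒nonZero pp}} → dot w y ≡ t
 good-separates p h pp y e with represent y
 ... | a , one , same with dot w a ≟ t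
 ... | yes eq = sym same ∙ eq
 ... | no ne = ⊥-elim (h (m≤n⇒m∸n≡0 (([]≤1 (prime? p)) ⟫ sym clash≡1 ≡⟫ 𝔹-term n (clash p) a)))
  where
  instance
   p≢0 : NonZero p
   p≢0 = prime⇒nonZero pp
  clash≡1 : clash p a ≡ 1
  clash≡1 = cong₂ (λ x y → x * ((1 ∸ y) * 𝟙[ prime? p ×-dec (p ∣? distance (dot w a) t) ])) one (eq-no ne) ∙
   n+0≡n _ ∙ n+0≡n _ ∙ ([]-yes (prime? p ×-dec (p ∣? distance (dot w a) t)) (pp , ≡-mod⇒∣ p (cong (_% p) same ∙ e)))

dot-∷ʳ : ∀ {n} w (y : Vec Bool n) b → dot w (y ∷ʳ b) ≡ dot w y + num b * w n
dot-∷ʳ w [] true = refl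
dot-∷ʳ w [] false = refl
dot-∷ʳ w (true ∷ y) b = cong (w 0 +_) (dot-∷ʳ (shift w) y b) ∙ sym (+-assoc (w 0) _ _)
dot-∷ʳ w (false ∷ y) b = dot-∷ʳ (shift w) y b

𝔹-nonzero : ∀ n (F : Vec Bool n → ℕ) → 𝔹 n F ≢ 0 → ∃ λ y → F y ≢ 0
𝔹-nonzero zero F h = [] , h
𝔹-nonzero (suc n) F h with 𝔹 n (λ y → F (false ∷ y)) ≟ 0
... | no ne with 𝔹-nonzero n _ ne
... | y , q = false ∷ y , q
𝔹-nonzero (suc n) F h | yes z with 𝔹-nonzero n _ (λ e → h (cong₂ _+_ z e ∙ refl))
... | y , q = true ∷ y , q

toVec-add : ∀ n v h (w : ℕ → ℕ) → v < n → dot w (toVec n (2 ^ v * (1 + 2 * h))) ≡ dot w (toVec n (2 ^ v * (2 * h))) + w v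
toVec-add (suc n) zero h w v< = begin-equality
 dot w (toVec (suc n) (1 * (1 + 2 * h))) ≡⟨ cong (λ x → dot w (toVec (suc n) x)) (n+0≡n (1 + 2 * h)) ⟩
 dot w (toVec (suc n) (1 + 2 * h)) ≡⟨ cong₂ (λ b x → dot w (b ∷ toVec n x)) (odd-b true h) ([b+2x]/2 true h) ⟩
 w 0 + dot (shift w) (toVec n h) ≡⟨ +-comm (w 0) _ ⟩
 dot (shift w) (toVec n h) + w 0 ≡⟨ cong (_+ w 0) (sym (cong₂ (λ b x → dot w (b ∷ toVec n x)) (odd-b false h) ([b+2x]/2 false h))) ⟩
 dot w (toVec (suc n) (2 * h)) + w 0 ≡⟨ cong (λ x → dot w (toVec (suc n) x) + w 0) (sym (n+0≡n (2 * h))) ⟩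
 dot w (toVec (suc n) (1 * (2 * h))) + w 0 ∎
toVec-add (suc n) (suc v) h w (s≤s v<) = even (2 ^ v) (1 + 2 * h) ∙ toVec-add n v h (shift w) v< ∙ cong (_+ w (suc v)) (sym (even (2 ^ v) (2 * h)))
 where
 even : ∀ x y → dot w (toVec (suc n) (2 * x * y)) ≡ dot (shift w) (toVec n (x * y))
 even x y = cong (λ z → dot w (toVec (suc n) z)) (*-assoc 2 x y) ∙ cong₂ (λ b z → dot w (b ∷ toVec n z)) (odd-b false (x * y)) ([b+2x]/2 false (x * y))

-- Finding a solution from counts modulo a prime.

-- Self-reduction: decide the variables from the last to the first.
module Reduce (n : ℕ) (w : ℕ → ℕ) (T NN : ℕ) (NN≥ : 2 ^ n ≤ NN) where

 chosen : ℕ → ℕ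
 chosen mask = ∑ n (λ u → bit mask u * w u)

 sols : ℕ → ℕ → ℕ
 sols v τ = 𝔹 v (λ y → eq (dot w y) τ)

 reduce : (ℕ → ℕ → ℕ) → ℕ → ℕ → ℕ
 reduce test j mask = iterate↓ j (λ v mask → (mask + 2 ^ v * (1 ∸ test v (T ∸ chosen mask))) ⊓ NN) mask

 Inv : ℕ → ℕ → Set
 Inv j mask = ∃ λ h → mask ≡ 2 ^ j * h × mask < 2 ^ n × ∃ λ (y : Vec Bool j) → dot w y + chosen mask ≡ T

 unsnoc : ∀ {j} (y : Vec Bool (suc j)) → ∃ λ y' → ∃ λ b → y ≡ y' ∷ʳ b
 unsnoc (b ∷ []) = [] , b , refl
 unsnoc (b ∷ c ∷ y) with unsnoc (c ∷ y)
 ... | y' , d , e = b ∷ y' , d , cong (b ∷_) e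

 next-mask : ℕ → ℕ → ℕ
 next-mask v mask = mask + 2 ^ v * (1 ∸ sols v (T ∸ chosen mask))

 advance : ∀ v mask → v < n → Inv (suc v) mask → Inv v (next-mask v mask)
 advance v mask v<n (h , refl , m< , y , e) with sols v (T ∸ chosen mask) ≟ 0
 ... | no ne with 𝔹-nonzero v _ ne
 ... | y' , nz = subst (Inv v) (sym same) (2 * h , shape , m< , y' ,
  cong (_+ chosen mask) (hit nz) ∙ m∸n+n≡m (m≤n+m (chosen mask) (dot w y) ⟫≡ e))
  where
  same : next-mask v mask ≡ mask
  same = cong (λ d → mask + 2 ^ v * d) (1∸suc (n≢0⇒n>0 ne)) ∙ cong (mask +_) (*-zeroʳ (2 ^ v)) ∙ n+0≡n mask
  shape : 2 * 2 ^ v * h ≡ 2 ^ v * (2 * h)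
  shape = lem (2 ^ v) h
   where
   lem : ∀ x h → 2 * x * h ≡ x * (2 * h)
   lem = ring
  hit : eq (dot w y') (T ∸ chosen mask) ≢ 0 → dot w y' ≡ T ∸ chosen mask
  hit q with eq-cases (dot w y') (T ∸ chosen mask)
  ... | inj₁ (s , _) = s
  ... | inj₂ (_ , z) = ⊥-elim (q z)
 advance v mask v<n (h , refl , m< , y , e) | yes z with unsnoc y
 ... | y' , false , refl = ⊥-elim (<-irrefl (sym z) (sym (eq-yes hit) ≡⟫ 𝔹-term v _ y'))
  where
  hit : dot w y' ≡ T ∸ chosen mask
  hit = sym (m+n∸n≡m (dot w y') (chosen mask)) ∙ cong (_∸ chosen mask) (cong (_+ chosen mask) (sym (dot-∷ʳ w y' false ∙ n+0≡n _)) ∙ e)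
 ... | y' , true , refl = subst (Inv v) (sym same) (1 + 2 * h , refl , bound , y' , total)
  where
  same : next-mask v mask ≡ 2 ^ v * (1 + 2 * h)
  same = cong (λ d → mask + 2 ^ v * (1 ∸ d)) z ∙ lem (2 ^ v) h
   where
   lem : ∀ x h → 2 * x * h + x * 1 ≡ x * (1 + 2 * h)
   lem = ring
  h< : h < 2 ^ (n ∸ suc v)
  h< = *-cancelˡ-< (2 ^ suc v) h _ (subst (mask <_) (cong (2 ^_) (sym (m+[n∸m] v<n)) ∙ ^-+ 2 (suc v) (n ∸ suc v)) m<)
  bound : 2 ^ v * (1 + 2 * h) < 2 ^ n
  bound = (lem₁ (2 ^ v) h ≡⟫ m≤m+n _ _) ⟫ lem₂ (2 ^ v) h (1≤2^ v) ≡⟫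
   *-monoʳ (2 ^ suc v) h< ⟫≡ sym (^-+ 2 (suc v) (n ∸ suc v)) ∙ cong (2 ^_) (m+[n∸m] v<n)
   where
   lem₁ : ∀ x h → suc (x * (1 + 2 * h)) ≡ 1 + x + 2 * (x * h)
   lem₁ = ring
   lem₂ : ∀ x h → 1 ≤ x → 1 + x + 2 * (x * h) + (x ∸ 1) ≡ 2 * x * suc h
   lem₂ (suc x) h _ = lem₃ x h
    where
    lem₃ : ∀ x h → 1 + suc x + 2 * (suc x * h) + x ≡ 2 * suc x * suc h
    lem₃ = ring
  grow : chosen (2 ^ v * (1 + 2 * h)) ≡ chosen mask + w v
  grow = ∑-bits n _ w ∙ toVec-add n v h w v<n ∙ cong (_+ w v) (cong (λ m → dot w (toVec n m)) (lem (2 ^ v) h) ∙ sym (∑-bits n mask w))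
   where
   lem : ∀ x h → x * (2 * h) ≡ 2 * x * h
   lem = ring
  total : dot w y' + chosen (2 ^ v * (1 + 2 * h)) ≡ T
  total = cong (dot w y' +_) grow ∙ lem (dot w y') (chosen mask) (w v) ∙ cong (_+ chosen mask) (sym (dot-∷ʳ w y' true ∙ cong (dot w y' +_) (n+0≡n (w v)))) ∙ e
   where
   lem : ∀ a b c → a + (b + c) ≡ a + c + b
   lem = ring

 -- The run with exact counts passes through a sequence of masks that does not depend on q. A prime
 -- can mislead only if it divides a nonzero count on this run; each of these counts is at most 2^n
 -- and has few prime divisors.
 bad : ℕ → ℕ → ℕ → ℕ
 bad zero mask q = 0
 bad (suc v) mask q = (1 ∸ (1 ∸ sols v (T ∸ chosen mask))) * 𝟙[ prime? q ×-dec (q ∣? sols v (T ∸ chosen mask)) ] + bad v (next-mask v mask) q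

 sols≤ : ∀ v τ → sols v τ ≤ 2 ^ v
 sols≤ v τ = (𝔹-mono v λ y → m∸n≤m 1 ((dot w y ∸ τ) + (τ ∸ dot w y))) ⟫≡ 𝔹-const v 1 ∙ n*1≡n _

 bad-total : ∀ Y j mask → j ≤ n → ∑ Y (bad j mask) ≤ j * suc n
 bad-total Y zero mask j≤ = ≤-reflexive (∑-zero Y)
 bad-total Y (suc v) mask j≤ = ∑-+ Y _ _ ≡⟫ +-mono (∑-*ˡ Y (1 ∸ (1 ∸ s)) _ ≡⟫ here) (bad-total Y v (next-mask v mask) (n≤1+n v ⟫ j≤))
  where
  s = sols v (T ∸ chosen mask)
  here : (1 ∸ (1 ∸ s)) * ∑ Y (λ q → 𝟙[ prime? q ×-dec (q ∣? s) ]) ≤ suc n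
  here with s ≟ 0
  ... | yes z = cong (λ s → (1 ∸ (1 ∸ s)) * ∑ Y (λ q → 𝟙[ prime? q ×-dec (q ∣? sols v (T ∸ chosen mask)) ])) z ≡⟫ z≤n
  ... | no ne = *-monoˡ _ (m∸n≤m 1 (1 ∸ s)) ⟫ n+0≡n _ ≡⟫
   prime-divisors Y (suc n) s (n≢0⇒n>0 ne) (≤-<-trans (sols≤ v (T ∸ chosen mask)) (^-monoʳ-< 2 (s<s z<s) (<-suc j≤)))

 -- If q is not bad, counts modulo q lead to the same decisions as exact counts.
 reduce-correct : ∀ (test : ℕ → ℕ → ℕ) q → Prime q →
  (∀ v τ → v < n → τ ≤ T → (test v τ ≡ 0 → q ∣ sols v τ) × (sols v τ ≡ 0 → test v τ ≡ 0)) →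
  ∀ j mask → j ≤ n → Inv j mask → bad j mask q ≡ 0 → dot w (toVec n (reduce test j mask)) ≡ T
 reduce-correct test q qp spec zero mask j≤ (h , _ , _ , [] , e) b = sym (∑-bits n mask w) ∙ e
 reduce-correct test q qp spec (suc v) mask j≤ I@(_ , _ , _ , y , e) b =
  cong (λ m → dot w (toVec n (reduce test v m))) same ∙
   reduce-correct test q qp spec v (next-mask v mask) (n≤1+n v ⟫ j≤) I' (m+n≡0⇒n≡0 _ b)
  where
  I' = advance v mask j≤ I
  τ = T ∸ chosen mask
  agree : 1 ∸ test v τ ≡ 1 ∸ sols v τ
  agree with sols v τ ≟ 0
  ... | yes z rewrite snd (spec v τ j≤ (m∸n≤m T (chosen mask))) z | z = refl
  ... | no ne = 1∸suc (n≢0⇒n>0 λ t0 → no-div (fst (spec v τ j≤ (m∸n≤m T (chosen mask))) t0)) ∙ sym (1∸suc (n≢0⇒n>0 ne))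
   where
   no-div : ¬ q ∣ sols v τ
   no-div d with () ← sym (m+n≡0⇒m≡0 _ b) ∙ cong₂ (λ x y → (1 ∸ x) * y) (1∸suc (n≢0⇒n>0 ne)) ([]-yes (prime? q ×-dec (q ∣? sols v τ)) (qp , d)) ∙ refl
  same : (mask + 2 ^ v * (1 ∸ test v τ)) ⊓ NN ≡ next-mask v mask
  same = cong (λ d → (mask + 2 ^ v * d) ⊓ NN) agree ∙ m≤n⇒m⊓n≡m (<⇒≤ (fst (snd (snd I'))) ⟫ NN≥)

module Extraction (n W Yq q : ℕ) (qp : Prime q) (q≤ : q ≤ Yq) (Yq≤ : Yq ≤ 2 ^ W) (w : ℕ → ℕ) (T : ℕ)
 (T< : suc T < q) (w< : ∀ u → u < n → w u < q) (d< : ∀ v → v < n → ∀ y → suc (dot {v} w y) < q) where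

 open Field q qp

 private instance
  q≢0 : NonZero q
  q≢0 = prime⇒nonZero qp

 pw : ℕ → ℕ → ℕ
 pw x e = power W Yq q≤ x e 1

 test : ℕ → ℕ → ℕ
 test v τ = ∑ Yq (λ x → lt x q * (pw x (q ∸ 1 ∸ τ) * ∏ n (λ u → 1 + lt u v * pw x (w u)))) mod q

 test-spec : ∀ v τ → v < n → τ ≤ T → (test v τ ≡ 0 → q ∣ solutions v w τ) × (solutions v w τ ≡ 0 → test v τ ≡ 0)
 test-spec v τ v< τ≤ = (λ z → fst both (sym (mod-% X q) ∙ z)) , (λ z → mod-% X q ∙ snd both z)
  where
  X = ∑ Yq (λ x → lt x q * (pw x (q ∸ 1 ∸ τ) * ∏ n (λ u → 1 + lt u v * pw x (w u))))
  g : ℕ → ℕ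
  g x = pw x (q ∸ 1 ∸ τ) * ∏ n (λ u → 1 + lt u v * pw x (w u))
  e≡ : q ∸ 1 ∸ τ ≡ pred q ∸ τ
  e≡ = cong (_∸ τ) (∸1≡pred q)
   where
   ∸1≡pred : ∀ q → q ∸ 1 ≡ pred q
   ∸1≡pred zero = refl
   ∸1≡pred (suc q) = refl
  fits : ∀ {e} → e < q → e < 2 ^ W
  fits e< = e< ⟫ q≤ ⟫ Yq≤
  cut : X ≡ ∑ q g
  cut = cong (λ k → ∑ k (λ x → lt x q * g x)) (sym (m+[n∸m] q≤)) ∙ ∑-split q (Yq ∸ q) _ ∙
   cong₂ _+_ (∑-cong q λ x x< → cong (_* g x) (lt-yes x<) ∙ n+0≡n _)
    ((∑-cong' (Yq ∸ q) λ x → cong (_* g (q + x)) (lt-no (m≤m+n q x))) ∙ ∑-zero (Yq ∸ q)) ∙ n+0≡n _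
  cut∏ : ∀ x → ∏ n (λ u → 1 + lt u v * pw x (w u)) ≡ ∏ v (λ u → 1 + pw x (w u))
  cut∏ x = cong (λ k → ∏ k (λ u → 1 + lt u v * pw x (w u))) (sym (m+[n∸m] (<⇒≤ v<))) ∙ ∏-split v (n ∸ v) _ ∙
   cong₂ _*_ (∏-cong v λ u u< → cong suc (cong (_* pw x (w u)) (lt-yes u<) ∙ n+0≡n _))
    (∏-one (n ∸ v) λ u _ → cong (λ l → suc (l * pw x (w (v + u)))) (lt-no (m≤m+n v u))) ∙ n*1≡n _
  X≈ : X ≈ pred q * solutions v w τ
  X≈ = cong (_% q) cut ∙ (≈-∑ q λ x _ → ≈-* {pw x (q ∸ 1 ∸ τ)} {x ^ (pred q ∸ τ)}
   (power-≈ W Yq q≤ x (q ∸ 1 ∸ τ) (fits (≤-<-trans (m∸n≤m (q ∸ 1) τ) q-1<)) ∙ cong (λ e → (x ^ e) % q) e≡)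
   (cong (_% q) (cut∏ x) ∙ (≈-∏ v λ u u< → ≈-+ {1} {1} refl (power-≈ W Yq q≤ x (w u) (fits (w< u (<-trans u< v<))))))) ∙
   extract v w τ (≤-<-trans (s≤s τ≤) T<) (d< v v<)
   where
   q-1< : q ∸ 1 < q
   q-1< = ≤-reflexive (m+[n∸m] (<⇒≤ (prime>1 qp)))
  both = extract-zero X≈

-- Turning the constraints into one equation.

dot-cong : ∀ {n} {f g : ℕ → ℕ} (x : Vec Bool n) → (∀ v → v < n → f v ≡ g v) → dot f x ≡ dot g x
dot-cong [] h = refl
dot-cong (false ∷ x) h = dot-cong x λ v v< → h (suc v) (s≤s v<)
dot-cong (true ∷ x) h = cong₂ _+_ (h 0 z<s) (dot-cong x λ v v< → h (suc v) (s≤s v<))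

dot-mono : ∀ {n} {f g : ℕ → ℕ} (x : Vec Bool n) → (∀ v → v < n → f v ≤ g v) → dot f x ≤ dot g x
dot-mono [] h = z≤n
dot-mono (false ∷ x) h = dot-mono x λ v v< → h (suc v) (s≤s v<)
dot-mono (true ∷ x) h = +-mono (h 0 z<s) (dot-mono x λ v v< → h (suc v) (s≤s v<))

dot-+ : ∀ {n} (f g : ℕ → ℕ) (x : Vec Bool n) → dot (λ v → f v + g v) x ≡ dot f x + dot g x
dot-+ f g [] = refl
dot-+ f g (false ∷ x) = dot-+ (shift f) (shift g) x
dot-+ f g (true ∷ x) = cong (f 0 + g 0 +_) (dot-+ (shift f) (shift g) x) ∙ +-interchange (f 0) (g 0) (dot (shift f) x) _

dot-*ʳ : ∀ {n} (f : ℕ → ℕ) c (x : Vec Bool n) → dot (λ v → f v * c) x ≡ dot f x * c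
dot-*ʳ f c [] = refl
dot-*ʳ f c (false ∷ x) = dot-*ʳ (shift f) c x
dot-*ʳ f c (true ∷ x) = cong (f 0 * c +_) (dot-*ʳ (shift f) c x) ∙ sym (*-distribʳ-+ c (f 0) _)

dot-const : ∀ {n} c (x : Vec Bool n) → dot (λ _ → c) x ≡ card x * c
dot-const c [] = refl
dot-const c (false ∷ x) = dot-const c x
dot-const c (true ∷ x) = cong (c +_) (dot-const c x)

dot-∑ : ∀ {n} k (f : ℕ → ℕ → ℕ) (x : Vec Bool n) → dot (λ v → ∑ k (λ j → f j v)) x ≡ ∑ k (λ j → dot (f j) x)
dot-∑ zero f x = dot-const 0 x ∙ *-zeroʳ (card x)
dot-∑ (suc k) f x = dot-+ (λ v → ∑ k (λ j → f j v)) (f k) x ∙ cong (_+ dot (f k) x) (dot-∑ k f x)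

dot≤ : ∀ {n} {f : ℕ → ℕ} c (x : Vec Bool n) → (∀ v → v < n → f v ≤ c) → dot f x ≤ n * c
dot≤ c x h = dot-mono x h ⟫ dot-const c x ≡⟫ *-monoˡ c (card≤ x)

polynomial< : ∀ B D (c : ℕ → ℕ) → (∀ j → j < D → c j < B) → ∑ D (λ j → c j * B ^ j) < B ^ D
polynomial< B zero c h = z<s
polynomial< B (suc D) c h = begin-strict
 ∑ D (λ j → c j * B ^ j) + c D * B ^ D <⟨ +-monoˡ-< (c D * B ^ D) (polynomial< B D c λ j j< → h j (<-suc j<)) ⟩
 suc (c D) * B ^ D ≤⟨ *-monoˡ (B ^ D) (h D ≤-refl) ⟩
 B * B ^ D ∎

split-unique : ∀ M a b c d → a < M → b < M → a + c * M ≡ b + d * M → a ≡ b × c ≡ d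
split-unique M a b c d a< b< e = a≡b , *-cancelʳ-≡ c d M (+-cancelˡ-≡ a _ _ (e ∙ cong (_+ d * M) (sym a≡b)))
 where
 instance
  M≢0 : NonZero M
  M≢0 = >-nonZero (≤-<-trans z≤n a<)
 a≡b : a ≡ b
 a≡b = sym (m<n⇒m%n≡m a<) ∙ sym ([m+kn]%n≡m%n a c M) ∙ cong (_% M) e ∙ ([m+kn]%n≡m%n b d M) ∙ m<n⇒m%n≡m b<

polynomial-unique : ∀ B D (c d : ℕ → ℕ) → (∀ j → j < D → c j < B) → (∀ j → j < D → d j < B) →
 ∑ D (λ j → c j * B ^ j) ≡ ∑ D (λ j → d j * B ^ j) → ∀ j → j < D → c j ≡ d j
polynomial-unique B (suc D) c d hc hd e j (s≤s j≤)
 with split-unique (B ^ D) _ _ (c D) (d D) (polynomial< B D c λ j j< → hc j (<-suc j<)) (polynomial< B D d λ j j< → hd j (<-suc j<)) e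
... | low , high with m≤n⇒m<n∨m≡n j≤
... | inj₁ j< = polynomial-unique B D c d (λ j j< → hc j (<-suc j<)) (λ j j< → hd j (<-suc j<)) low j j<
... | inj₂ refl = high

-- The least i that brings ε below 2^i c: either no rounding takes place, or ε is within a factor 2
-- of 2^i c.
scale : ∀ K c ε → ε < 2 ^ K * c → ∃ λ i → i ≤ K × ε < 2 ^ i * c × (i ≡ 0 ⊎ 2 ^ i * c ≤ 2 * ε)
scale zero c ε h = 0 , z≤n , h , inj₁ refl
scale (suc K) c ε h with ε <? 2 ^ K * c
... | yes h' with scale K c ε h'
... | i , i≤ , r = i , m≤n⇒m≤1+n i≤ , r
scale (suc K) c ε h | no ≮ = suc K , ≤-refl , h , inj₂ (*-assoc 2 (2 ^ K) c ≡⟫ *-monoʳ 2 (≮⇒≥ ≮))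

quo-bounds : ∀ x i → x quo 2 ^ i * 2 ^ i ≤ x × x < x quo 2 ^ i * 2 ^ i + 2 ^ i
quo-bounds x i = cong (_* 2 ^ i) (quo-/ x (2 ^ i)) ≡⟫ m/n*n≤m x (2 ^ i) ,
 (s≤s (≤-reflexive (m≡m%n+[m/n]*n x (2 ^ i))) ⟫ +-monoˡ-< (x / 2 ^ i * 2 ^ i) (m%n<n x (2 ^ i))) ⟫≡
  +-comm (2 ^ i) _ ∙ cong (λ q → q * 2 ^ i + 2 ^ i) (sym (quo-/ x (2 ^ i)))
 where
 instance
  2^≢0 : NonZero (2 ^ i)
  2^≢0 = m^n≢0 2 i

-- An inequality with nonnegative coefficients β and right hand side ρ is replaced
-- by an equation between values rounded to multiples of 2^i; e is the rounded slack.
module Rounding {n : ℕ} (β : ℕ → ℕ) (ρ : ℕ) (i : ℕ) where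

 r : ℕ → ℕ
 r v = β v quo 2 ^ i

 lower-bound : ∀ (y : Vec Bool n) → dot r y * 2 ^ i ≤ dot β y
 lower-bound y = sym (dot-*ʳ r (2 ^ i) y) ≡⟫ (dot-mono y λ v _ → fst (quo-bounds (β v) i))

 upper-bound : ∀ (y : Vec Bool n) → dot β y + card y ≤ dot r y * 2 ^ i + n * 2 ^ i
 upper-bound y = begin
  dot β y + card y ≡⟨ cong (dot β y +_) (sym (dot-const 1 y ∙ n*1≡n _)) ⟩
  dot β y + dot (λ _ → 1) y ≡⟨ dot-+ β (λ _ → 1) y ⟨
  dot (λ v → β v + 1) y ≤⟨ dot-mono y (λ v _ → +-comm (β v) 1 ≡⟫ snd (quo-bounds (β v) i)) ⟩
  dot (λ v → β v quo 2 ^ i * 2 ^ i + 2 ^ i) y ≡⟨ dot-+ (λ v → β v quo 2 ^ i * 2 ^ i) (λ _ → 2 ^ i) y ⟩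
  dot (λ v → β v quo 2 ^ i * 2 ^ i) y + dot (λ _ → 2 ^ i) y ≤⟨ +-mono (≤-reflexive (dot-*ʳ r (2 ^ i) y)) (dot≤ (2 ^ i) y λ _ _ → ≤-refl) ⟩
  dot r y * 2 ^ i + n * 2 ^ i ∎

 module _ (x : Vec Bool n) (feasible : dot β x ≤ ρ) (Δ< : ρ ∸ dot β x < 2 ^ i * (4 * suc n))
  (tight : i ≡ 0 ⊎ 2 ^ i * (4 * suc n) ≤ 2 * (ρ ∸ dot β x)) where

  e : ℕ
  e = ρ quo 2 ^ i ∸ dot r x

  instance
   2^≢0 : NonZero (2 ^ i)
   2^≢0 = m^n≢0 2 i

  ε : ℕ
  ε = ρ ∸ dot β x

  ρ≡ : dot β x + ε ≡ ρ
  ρ≡ = m+[n∸m] feasible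

  r≤ : dot r x ≤ ρ quo 2 ^ i
  r≤ = s≤s⁻¹ (*-cancelʳ-< (2 ^ i) (dot r x) _ (≤-<-trans (lower-bound x ⟫ feasible)
   (snd (quo-bounds ρ i) ⟫≡ +-comm (ρ quo 2 ^ i * 2 ^ i) (2 ^ i))))

  e-eq : dot r x + e ≡ ρ quo 2 ^ i
  e-eq = m+[n∸m] r≤

  e-mul : dot r x * 2 ^ i + e * 2 ^ i ≡ ρ quo 2 ^ i * 2 ^ i
  e-mul = sym (*-distribʳ-+ (2 ^ i) (dot r x) e) ∙ cong (_* 2 ^ i) e-eq

  -- In units of 2^i, the slack is below 4 (n + 1), and rounding the coefficients adds at most n.
  e< : e < 5 * suc n
  e< = *-cancelʳ-< (2 ^ i) e (5 * suc n) (+-cancelˡ-< (dot r x * 2 ^ i) _ _ (begin-strict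
   dot r x * 2 ^ i + e * 2 ^ i ≡⟨ e-mul ⟩
   ρ quo 2 ^ i * 2 ^ i ≤⟨ fst (quo-bounds ρ i) ⟩
   ρ ≡⟨ ρ≡ ⟨
   dot β x + ε <⟨ +-mono-≤-< (m≤m+n (dot β x) (card x) ⟫ upper-bound x) Δ< ⟩
   dot r x * 2 ^ i + n * 2 ^ i + 2 ^ i * (4 * suc n) ≤⟨ m≤m+n _ (2 ^ i) ⟩
   dot r x * 2 ^ i + n * 2 ^ i + 2 ^ i * (4 * suc n) + 2 ^ i ≡⟨ lem (dot r x * 2 ^ i) n (2 ^ i) ⟩
   dot r x * 2 ^ i + 5 * suc n * 2 ^ i ∎))
   where
   lem : ∀ a n p → a + n * p + p * (4 * suc n) + p ≡ a + 5 * suc n * p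
   lem = ring

  -- The rounded slack is zero rounding error or large enough to absorb it.
  sound : ∀ (y : Vec Bool n) → dot r y ≡ ρ quo 2 ^ i ∸ e → dot β y ≤ ρ
  sound y eq = go tight
   where
   go : _ → dot β y ≤ ρ
   go (inj₁ i≡0) = begin
    dot β y ≡⟨ dot-cong y (λ v _ → sym (exact (β v))) ⟩
    dot r y ≡⟨ eq ⟩
    ρ quo 2 ^ i ∸ e ≤⟨ m∸n≤m (ρ quo 2 ^ i) e ⟩
    ρ quo 2 ^ i ≡⟨ exact ρ ⟩
    ρ ∎
    where
    exact : ∀ z → z quo 2 ^ i ≡ z
    exact z = cong (λ k → z quo 2 ^ k) i≡0 ∙ n/1≡n z
   go (inj₂ big) = +-cancelʳ-≤ (e * 2 ^ i) (dot β y) ρ (begin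
    dot β y + e * 2 ^ i ≤⟨ +-monoˡ (e * 2 ^ i) (m≤m+n (dot β y) (card y) ⟫ upper-bound y) ⟩
    dot r y * 2 ^ i + n * 2 ^ i + e * 2 ^ i ≡⟨ +-swap (dot r y * 2 ^ i) (n * 2 ^ i) (e * 2 ^ i) ⟩
    dot r y * 2 ^ i + e * 2 ^ i + n * 2 ^ i ≡⟨ cong (_+ n * 2 ^ i) (sym (*-distribʳ-+ (2 ^ i) (dot r y) e) ∙ cong (_* 2 ^ i) (cong (_+ e) eq ∙ m∸n+n≡m (m≤n+m e (dot r x) ⟫≡ e-eq))) ⟩
    ρ quo 2 ^ i * 2 ^ i + n * 2 ^ i ≤⟨ +-mono (fst (quo-bounds ρ i)) ne≤ ⟩
    ρ + e * 2 ^ i ∎)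
    where
    half : 2 ^ i * (2 * suc n) ≤ ε
    half = *-cancelˡ-≤ 2 (lem₂ (2 ^ i) n ≡⟫ big)
     where
     lem₂ : ∀ p n → 2 * (p * (2 * suc n)) ≡ p * (4 * suc n)
     lem₂ = ring
    -- The slack is at least n + 1 units of 2^i and rounding ρ loses less than one, so the rounded
    -- slack is at least n. This covers the rounding error of any other y.
    ne≤ : n * 2 ^ i ≤ e * 2 ^ i
    ne≤ = +-cancelʳ-≤ (2 ^ i) _ _ (+-cancelˡ-≤ (dot r x * 2 ^ i) _ _ (begin
     dot r x * 2 ^ i + (n * 2 ^ i + 2 ^ i) ≤⟨ +-mono (lower-bound x) (pad (lem₃ (2 ^ i) n) ⟫ half) ⟩
     dot β x + ε ≡⟨ ρ≡ ⟩
     ρ ≤⟨ <⇒≤ (snd (quo-bounds ρ i)) ⟩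
     ρ quo 2 ^ i * 2 ^ i + 2 ^ i ≡⟨ cong (_+ 2 ^ i) (sym e-mul) ⟩
     dot r x * 2 ^ i + e * 2 ^ i + 2 ^ i ≡⟨ +-assoc (dot r x * 2 ^ i) _ _ ⟩
     dot r x * 2 ^ i + (e * 2 ^ i + 2 ^ i) ∎))
     where
     lem₃ : ∀ p n → n * p + p + (n * p + p) ≡ p * (2 * suc n)
     lem₃ = ring

record RoundedRows : Set where
 constructor roundedRows
 field
  n D O m B W Gm lb : ℕ
  P⁺ P⁻ : ℕ → ℕ → ℕ
  U⁺ U⁻ : ℕ → ℕ
  P⁺≤ : ∀ j v → j < D → v < n → P⁺ j v ≤ m
  P⁻≤ : ∀ j v → j < D → v < n → P⁻ j v ≤ m
  one-sign : ∀ j → j < D → U⁺ j ≡ 0 ⊎ U⁻ j ≡ 0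
  m≤O : m ≤ O
  B≡ : B ≡ 2 * (n + 1) * (O + 1)
  nm≤ : n * m ≤ 2 ^ lb
  ℓ<Γ : suc lb < Gm
  ℓ≤W : suc lb ≤ W
  n≤Γ : 5 * suc n ≤ Gm

module Guess (ctx : RoundedRows) where

 open RoundedRows ctx

 Feasibleᴺ : Vec Bool n → Set
 Feasibleᴺ x = ∀ j → j < D → dot (P⁺ j) x + U⁻ j ≤ dot (P⁻ j) x + U⁺ j

 β : ℕ → ℕ → ℕ
 β j v = O + P⁺ j v ∸ P⁻ j v

 -- The objective bound does not count towards m and may be huge. A left hand side is at most n m
 -- anyway, so clipping there loses no solution and keeps the slack, and with it the number of
 -- levels, in terms of n m.
 U' : ℕ → ℕ
 U' j = U⁺ j ∸ (U⁺ j ∸ n * m)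

 U'≤ : ∀ j → U' j ≤ U⁺ j
 U'≤ j = m∸n≤m (U⁺ j) (U⁺ j ∸ n * m)

 U'≤nm : ∀ j → U' j ≤ n * m
 U'≤nm j with ≤-total (U⁺ j) (n * m)
 ... | inj₁ h = U'≤ j ⟫ h
 ... | inj₂ h = ≤-reflexive (m∸[m∸n]≡n h)

 β-sum : ∀ j → j < D → (y : Vec Bool n) → dot (β j) y + dot (P⁻ j) y ≡ card y * O + dot (P⁺ j) y
 β-sum j j< y = sym (dot-+ (β j) (P⁻ j) y) ∙ (dot-cong y λ v v< → m∸n+n≡m ((P⁻≤ j v j< v< ⟫ m≤O) ⟫ m≤m+n O _)) ∙
  dot-+ (λ _ → O) (P⁺ j) y ∙ cong (_+ dot (P⁺ j) y) (dot-const O y)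

 ρ : ℕ → ℕ → ℕ
 ρ κ j = O * κ + U' j ∸ U⁻ j

 weights : (ℕ → ℕ) → ℕ → ℕ
 weights gi v = ∑ D (λ j → β j v quo 2 ^ (gi j ⊓ W) * B ^ j) + B ^ D

 target : (ℕ → ℕ) → (ℕ → ℕ) → ℕ → ℕ
 target gi ge κ = ∑ D (λ j → (ρ κ j quo 2 ^ (gi j ⊓ W) ∸ ge j) * B ^ j) + κ * B ^ D

 weights-dot : ∀ (gi : ℕ → ℕ) (y : Vec Bool n) → dot (weights gi) y ≡ ∑ D (λ j → dot (λ v → β j v quo 2 ^ (gi j ⊓ W)) y * B ^ j) + card y * B ^ D
 weights-dot gi y = dot-+ (λ v → ∑ D (λ j → β j v quo 2 ^ (gi j ⊓ W) * B ^ j)) (λ _ → B ^ D) y ∙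
  cong₂ _+_ (dot-∑ D (λ j v → β j v quo 2 ^ (gi j ⊓ W) * B ^ j) y ∙ (∑-cong' D λ j → dot-*ʳ (λ v → β j v quo 2 ^ (gi j ⊓ W)) (B ^ j) y)) (dot-const (B ^ D) y)

 -- Weights add up without carries, so an equation between sums of weights is an equation for each
 -- row.
 digit< : ∀ (gi : ℕ → ℕ) (y : Vec Bool n) j → j < D → dot (λ v → β j v quo 2 ^ (gi j ⊓ W)) y < B
 digit< gi y j j< = s≤s (dot≤ (2 * O) y λ v v< → quo≤ (β j v) (2 ^ (gi j ⊓ W)) ⟫
  m∸n≤m _ (P⁻ j v) ⟫ +-monoʳ O (P⁺≤ j v j< v< ⟫ m≤O) ⟫≡ cong (O +_) (sym (n+0≡n O))) ⟫
  pad (lem n O) ⟫≡ sym B≡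
  where
  quo≤ : ∀ (x y : ℕ) → x quo y ≤ x
  quo≤ x zero = z≤n
  quo≤ x (suc y) = m/n≤m x (suc y)
  lem : ∀ n O → suc (n * (2 * O)) + (2 * n + 2 * O + 1) ≡ 2 * (n + 1) * (O + 1)
  lem = ring

 n<B : n < B
 n<B = pad (lem n O) ⟫≡ sym B≡
  where
  lem : ∀ n O → suc n + (n + 1 + 2 * (n + 1) * O) ≡ 2 * (n + 1) * (O + 1)
  lem = ring

 weights< : ∀ (gi : ℕ → ℕ) (y : Vec Bool n) → dot (weights gi) y < B * B ^ D
 weights< gi y = s≤s (≤-reflexive (weights-dot gi y)) ⟫ +-monoˡ-< (card y * B ^ D) (polynomial< B D _ (λ j j< → digit< gi y j j<)) ⟫
  *-monoˡ (B ^ D) (s≤s (card≤ y) ⟫ n<B)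

 module _ (x : Vec Bool n) (feas : Feasibleᴺ x) where

  κ : ℕ
  κ = card x

  U⁻≤ : ∀ j → j < D → dot (β j) x + U⁻ j ≤ O * κ + U' j
  U⁻≤ j j< = +-cancelʳ-≤ (dot (P⁻ j) x) _ _ (begin
   dot (β j) x + U⁻ j + dot (P⁻ j) x ≡⟨ +-swap (dot (β j) x) (U⁻ j) _ ⟩
   dot (β j) x + dot (P⁻ j) x + U⁻ j ≡⟨ cong (_+ U⁻ j) (β-sum j j< x) ⟩
   κ * O + dot (P⁺ j) x + U⁻ j ≡⟨ +-assoc (κ * O) _ _ ⟩
   κ * O + (dot (P⁺ j) x + U⁻ j) ≤⟨ +-monoʳ (κ * O) clipped ⟩
   κ * O + (dot (P⁻ j) x + U' j) ≡⟨ lem₂ κ O (dot (P⁻ j) x) (U' j) ⟩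
   O * κ + U' j + dot (P⁻ j) x ∎)
   where
   lem₂ : ∀ k o a b → k * o + (a + b) ≡ o * k + b + a
   lem₂ = ring
   clipped : dot (P⁺ j) x + U⁻ j ≤ dot (P⁻ j) x + U' j
   clipped with ≤-total (U⁺ j) (n * m)
   ... | inj₁ h rewrite m≤n⇒m∸n≡0 h = feas j j<
   ... | inj₂ h rewrite m∸[m∸n]≡n h with one-sign j j<
   ... | inj₂ z rewrite z | n+0≡n (dot (P⁺ j) x) = (dot≤ m x λ v v< → P⁺≤ j v j< v<) ⟫ m≤n+m _ _
   ... | inj₁ z = feas j j< ⟫ +-monoʳ (dot (P⁻ j) x) (z ≡⟫ z≤n)

  β≤ρ : ∀ j → j < D → dot (β j) x ≤ ρ κ j
  β≤ρ j j< = sym (m+n∸n≡m _ (U⁻ j)) ≡⟫ ∸-monoˡ-≤ (U⁻ j) (U⁻≤ j j<)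

  -- After the shift, the right hand side is at most O κ + n m and the left one at least O κ - n m.
  slack< : ∀ j → j < D → ρ κ j ∸ dot (β j) x < 2 ^ suc lb * (4 * suc n)
  slack< j j< = ≤-<-trans (m≤n+o⇒m∸n≤o (ρ κ j) (dot (β j) x) (begin
   ρ κ j ≤⟨ m∸n≤m _ (U⁻ j) ⟩
   O * κ + U' j ≤⟨ +-monoʳ (O * κ) (U'≤nm j) ⟩
   O * κ + n * m ≤⟨ +-monoˡ (n * m) (*-comm O κ ≡⟫ m≤m+n (κ * O) (dot (P⁺ j) x)) ⟩
   κ * O + dot (P⁺ j) x + n * m ≡⟨ cong (_+ n * m) (sym (β-sum j j< x)) ⟩
   dot (β j) x + dot (P⁻ j) x + n * m ≤⟨ +-monoˡ (n * m) (+-monoʳ (dot (β j) x) (dot≤ m x λ v v< → P⁻≤ j v j< v<)) ⟩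
   dot (β j) x + n * m + n * m ≡⟨ lem (dot (β j) x) (n * m) ⟩
   dot (β j) x + 2 * (n * m) ∎))
   (s≤s (*-monoʳ 2 nm≤) ⟫ pad (lem' (2 ^ lb) n (1≤2^ lb)) ⟫ ≤-refl)
   where
   lem : ∀ a b → a + b + b ≡ a + 2 * b
   lem = ring
   lem' : ∀ p n → 1 ≤ p → suc (2 * p) + (pred p + 5 * p + 8 * (n * p)) ≡ 2 * p * (4 * suc n)
   lem' (suc p) n _ = lem″ p n
    where
    lem″ : ∀ p n → suc (2 * suc p) + (p + 5 * suc p + 8 * (n * suc p)) ≡ 2 * suc p * (4 * suc n)
    lem″ = ring

  level : ∀ j → ∃ λ i → i ≤ suc lb × (j < D → ρ κ j ∸ dot (β j) x < 2 ^ i * (4 * suc n) × (i ≡ 0 ⊎ 2 ^ i * (4 * suc n) ≤ 2 * (ρ κ j ∸ dot (β j) x)))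
  level j with j <? D
  ... | yes j< with scale (suc lb) (4 * suc n) (ρ κ j ∸ dot (β j) x) (slack< j j<)
  ... | i , i≤ , r = i , i≤ , λ _ → r
  level j | no ≮ = 0 , z≤n , λ j< → ⊥-elim (≮ j<)

  I E : ℕ → ℕ
  I j = fst (level j)
  E j = ρ κ j quo 2 ^ I j ∸ dot (λ v → β j v quo 2 ^ I j) x

  I<Γ : ∀ j → I j < Gm
  I<Γ j = ≤-<-trans (fst (snd (level j))) ℓ<Γ

  I⊓W : ∀ j → I j ⊓ W ≡ I j
  I⊓W j = m≤n⇒m⊓n≡m (fst (snd (level j)) ⟫ ℓ≤W)

  E<Γ : ∀ j → j < D → E j < Gm
  E<Γ j j< = Rounding.e< (β j) (ρ κ j) (I j) x (β≤ρ j j<) (fst (snd (snd (level j)) j<)) (snd (snd (snd (level j)) j<)) ⟫ n≤Γ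

  module _ (gi ge : ℕ → ℕ) (gi≡ : ∀ j → j < D → gi j ≡ I j) (ge≡ : ∀ j → j < D → ge j ≡ E j) where

   private
    power : ∀ j → j < D → 2 ^ (gi j ⊓ W) ≡ 2 ^ I j
    power j j< = cong (2 ^_) (cong (_⊓ W) (gi≡ j j<) ∙ I⊓W j)

    digit : ∀ j → j < D → ρ κ j quo 2 ^ (gi j ⊓ W) ∸ ge j ≡ dot (λ v → β j v quo 2 ^ (gi j ⊓ W)) x
    digit j j< rewrite power j j< | ge≡ j j< = m∸[m∸n]≡n (Rounding.r≤ (β j) (ρ κ j) (I j) x (β≤ρ j j<) (fst (snd (snd (level j)) j<)) (snd (snd (snd (level j)) j<)))

   hits-target : dot (weights gi) x ≡ target gi ge κ
   hits-target = weights-dot gi x ∙ cong (_+ κ * B ^ D) (∑-cong D λ j j< → cong (_* B ^ j) (sym (digit j j<)))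

   -- The leading digit forces `card y ≡ κ`, which cancels the shift by O; the other digits give the
   -- rounded equations, and these imply the original inequalities.
   target-feasible : ∀ y → dot (weights gi) y ≡ target gi ge κ → Feasibleᴺ y
   target-feasible y e j j< = conclude
    where
    same = split-unique (B ^ D) _ _ (card y) κ (polynomial< B D _ (λ j j< → digit< gi y j j<)) (polynomial< B D _ (λ j j< → digit< gi x j j<))
     (sym (weights-dot gi y) ∙ e ∙ sym hits-target ∙ weights-dot gi x)
    digits≡ : dot (λ v → β j v quo 2 ^ (gi j ⊓ W)) y ≡ dot (λ v → β j v quo 2 ^ (gi j ⊓ W)) x
    digits≡ = polynomial-unique B D _ _ (λ j j< → digit< gi y j j<) (λ j j< → digit< gi x j j<) (fst same) j j<
    rounded : dot (λ v → β j v quo 2 ^ I j) y ≡ ρ κ j quo 2 ^ I j ∸ E j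
    rounded = cong (λ p → dot (λ v → β j v quo p) y) (sym (power j j<)) ∙ digits≡ ∙
     sym (digit j j<) ∙ cong₂ (λ p g → ρ κ j quo p ∸ g) (power j j<) (ge≡ j j<)
    βy≤ : dot (β j) y ≤ ρ κ j
    βy≤ = Rounding.sound (β j) (ρ κ j) (I j) x (β≤ρ j j<) (fst (snd (snd (level j)) j<)) (snd (snd (snd (level j)) j<)) y rounded
    conclude : dot (P⁺ j) y + U⁻ j ≤ dot (P⁻ j) y + U⁺ j
    conclude = +-cancelˡ-≤ (κ * O) _ _ (begin
     κ * O + (dot (P⁺ j) y + U⁻ j) ≡⟨ +-assoc (κ * O) _ _ ⟨
     κ * O + dot (P⁺ j) y + U⁻ j ≡⟨ cong (λ c → c * O + dot (P⁺ j) y + U⁻ j) (sym (snd same)) ⟩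
     card y * O + dot (P⁺ j) y + U⁻ j ≡⟨ cong (_+ U⁻ j) (sym (β-sum j j< y)) ⟩
     dot (β j) y + dot (P⁻ j) y + U⁻ j ≤⟨ +-monoˡ (U⁻ j) (+-monoˡ (dot (P⁻ j) y) βy≤) ⟩
     ρ κ j + dot (P⁻ j) y + U⁻ j ≡⟨ +-swap (ρ κ j) (dot (P⁻ j) y) (U⁻ j) ⟩
     ρ κ j + U⁻ j + dot (P⁻ j) y ≡⟨ cong (_+ dot (P⁻ j) y) (m∸n+n≡m (m≤n+m (U⁻ j) (dot (β j) x) ⟫ U⁻≤ j j<)) ⟩
     O * κ + U' j + dot (P⁻ j) y ≤⟨ +-monoˡ (dot (P⁻ j) y) (+-monoʳ (O * κ) (U'≤ j)) ⟩
     O * κ + U⁺ j + dot (P⁻ j) y ≡⟨ lem₂ O κ (U⁺ j) (dot (P⁻ j) y) ⟩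
     κ * O + (dot (P⁻ j) y + U⁺ j) ∎)
     where
     lem₂ : ∀ o k a b → o * k + a + b ≡ k * o + (b + a)
     lem₂ = ring

-- Reading the encoded instance.

digits-bounds : ∀ x → x < 2 ^ digits x × (1 ≤ x → 2 ^ digits x ≤ 2 * x)
digits-bounds = <-rec _ go
 where
 go : ∀ x → (∀ {y} → y < x → y < 2 ^ digits y × (1 ≤ y → 2 ^ digits y ≤ 2 * y)) → x < 2 ^ digits x × (1 ≤ x → 2 ^ digits x ≤ 2 * x)
 go zero rec = z<s , λ ()
 go (suc x) rec = subst (λ t → suc x < 2 ^ t × (1 ≤ suc x → 2 ^ t ≤ 2 * suc x)) (sym (digits-suc x)) (below , λ _ → above)
  where
  h = suc x / 2
  h< : h < suc x
  h< = m/n<m (suc x) 2 (s<s z<s)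
  split : suc x ≡ suc x % 2 + h * 2
  split = m≡m%n+[m/n]*n (suc x) 2
  below : suc x < 2 * 2 ^ digits h
  below = s≤s (split ≡⟫ +-monoˡ (h * 2) (s≤s⁻¹ (m%n<n (suc x) 2))) ⟫
   lem h ≡⟫ *-monoʳ 2 (fst (rec h<))
   where
   lem : ∀ h → suc (1 + h * 2) ≡ 2 * suc h
   lem = ring
  above : 2 * 2 ^ digits h ≤ 2 * suc x
  above with h in e
  ... | zero = *-monoʳ 2 z<s
  ... | suc h' = *-monoʳ 2 (snd (rec (subst (_< suc x) e h<)) z<s ⟫
   *-comm 2 (suc h') ∙ cong (_* 2) (sym e) ≡⟫ m/n*n≤m (suc x) 2)

sgn pos⁺ neg⁻ : ℤ → ℕ
sgn (⁺ _) = 0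
sgn -[1+ _ ] = 1
pos⁺ (⁺ k) = k
pos⁺ -[1+ k ] = 0
neg⁻ (⁺ k) = 0
neg⁻ -[1+ k ] = suc k

encoded-sign : ∀ E k → nth 0 (List.concatMap encodeℤ E) (2 * k) ≡ sgn (nth 0ℤ E k)
encoded-abs : ∀ E k → nth 0 (List.concatMap encodeℤ E) (1 + 2 * k) ≡ abs (nth 0ℤ E k)
encoded-sign [] k = refl
encoded-sign (⁺ x ∷ E) zero = refl
encoded-sign (-[1+ x ] ∷ E) zero = refl
encoded-sign (⁺ x ∷ E) (suc k) = cong (nth 0 (0 ∷ x ∷ List.concatMap encodeℤ E)) (*-suc 2 k) ∙ encoded-sign E k
encoded-sign (-[1+ x ] ∷ E) (suc k) = cong (nth 0 (1 ∷ suc x ∷ List.concatMap encodeℤ E)) (*-suc 2 k) ∙ encoded-sign E k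
encoded-abs [] k = refl
encoded-abs (⁺ x ∷ E) zero = refl
encoded-abs (-[1+ x ] ∷ E) zero = refl
encoded-abs (⁺ x ∷ E) (suc k) = cong (λ t → nth 0 (0 ∷ x ∷ List.concatMap encodeℤ E) (1 + t)) (*-suc 2 k) ∙ encoded-abs E k
encoded-abs (-[1+ x ] ∷ E) (suc k) = cong (λ t → nth 0 (1 ∷ suc x ∷ List.concatMap encodeℤ E) (1 + t)) (*-suc 2 k) ∙ encoded-abs E k

abs-pos : ∀ z → abs z * (1 ∸ sgn z) ≡ pos⁺ z
abs-pos (⁺ k) = n*1≡n k
abs-pos -[1+ k ] = *-zeroʳ (suc k)

abs-neg : ∀ z → abs z * sgn z ≡ neg⁻ z
abs-neg (⁺ k) = *-zeroʳ k
abs-neg -[1+ k ] = n*1≡n (suc k)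

pos⁺≤ : ∀ z → pos⁺ z ≤ abs z
pos⁺≤ (⁺ k) = ≤-refl
pos⁺≤ -[1+ k ] = z≤n

neg⁻≤ : ∀ z → neg⁻ z ≤ abs z
neg⁻≤ (⁺ k) = z≤n
neg⁻≤ -[1+ k ] = ≤-refl

one-signed : ∀ z → pos⁺ z ≡ 0 ⊎ neg⁻ z ≡ 0
one-signed (⁺ k) = inj₂ refl
one-signed -[1+ k ] = inj₁ refl

signed : ∀ z → z ≡ ⁺ pos⁺ z ℤ.- ⁺ neg⁻ z
signed (⁺ k) = sym (ℤₚ.+-identityʳ (⁺ k))
signed -[1+ k ] = refl

difference-≤ : ∀ a b c d → a + d ≤ b + c → ⁺ a ℤ.- ⁺ b ℤ.≤ ⁺ c ℤ.- ⁺ d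
difference-≤ a b c d h = subst₂ ℤ._≤_ (lem₁ (⁺ a) (⁺ b) (⁺ d)) (lem₂ (⁺ b) (⁺ c) (⁺ d)) (ℤₚ.+-monoˡ-≤ (ℤ.- (⁺ b) ℤ.- ⁺ d) (ℤ.+≤+ h))
 where
 lem₁ : ∀ a b d → a ℤ.+ d ℤ.+ (ℤ.- b ℤ.- d) ≡ a ℤ.- b
 lem₁ = ℤ-Solver.solve-∀
 lem₂ : ∀ b c d → b ℤ.+ c ℤ.+ (ℤ.- b ℤ.- d) ≡ c ℤ.- d
 lem₂ = ℤ-Solver.solve-∀

difference-≤⁻¹ : ∀ a b c d → ⁺ a ℤ.- ⁺ b ℤ.≤ ⁺ c ℤ.- ⁺ d → a + d ≤ b + c
difference-≤⁻¹ a b c d h = ℤₚ.drop‿+≤+ (subst₂ ℤ._≤_ (lem₁ (⁺ a) (⁺ b) (⁺ d)) (lem₂ (⁺ b) (⁺ c) (⁺ d)) (ℤₚ.+-monoˡ-≤ (⁺ b ℤ.+ ⁺ d) h))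
 where
 lem₁ : ∀ a b d → a ℤ.- b ℤ.+ (b ℤ.+ d) ≡ a ℤ.+ d
 lem₁ = ℤ-Solver.solve-∀
 lem₂ : ∀ b c d → c ℤ.- d ℤ.+ (b ℤ.+ d) ≡ b ℤ.+ c
 lem₂ = ℤ-Solver.solve-∀

inner-product : ∀ {n} (zs : Vec ℤ n) (f g : ℕ → ℕ) → (∀ i → lookup zs i ≡ ⁺ f (toℕ i) ℤ.- ⁺ g (toℕ i)) →
 ∀ y → ⟨ zs , 0/1 y ⟩ ≡ ⁺ dot f y ℤ.- ⁺ dot g y
inner-product [] f g h [] = refl
inner-product (z ∷ zs) f g h (false ∷ y) = (cong₂ ℤ._+_ (ℤₚ.*-zeroʳ z) (inner-product zs (shift f) (shift g) (λ i → h (suc i)) y)) ∙ ℤₚ.+-identityˡ _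
inner-product (z ∷ zs) f g h (true ∷ y) = (cong₂ ℤ._+_ (ℤₚ.*-identityʳ z ∙ h zero) (inner-product zs (shift f) (shift g) (λ i → h (suc i)) y)) ∙
 lem (⁺ f 0) (⁺ g 0) (⁺ dot (shift f) y) (⁺ dot (shift g) y)
 where
 lem : ∀ a b c d → a ℤ.- b ℤ.+ (c ℤ.- d) ≡ a ℤ.+ c ℤ.- (b ℤ.+ d)
 lem = ℤ-Solver.solve-∀

nth-vecʳ : ∀ {A : Set} {m n} d (xs : Vec A m) (ys : Vec A n) zs i → nth d (Vec.toList (xs Vec.++ ys) ++ zs) (m + i) ≡ nth d (Vec.toList ys ++ zs) i
nth-vecʳ d [] ys zs i = refl
nth-vecʳ d (x ∷ xs) ys zs i = nth-vecʳ d xs ys zs i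

nth-vec : ∀ {A : Set} {m} d (xs : Vec A m) zs i → nth d (Vec.toList xs ++ zs) (toℕ i) ≡ lookup xs i
nth-vec d (x ∷ xs) zs zero = refl
nth-vec d (x ∷ xs) zs (suc i) = nth-vec d xs zs i

nth-vecˡ : ∀ {A : Set} {m n} d (xs : Vec A m) (ys : Vec A n) zs i → nth d (Vec.toList (xs Vec.++ ys) ++ zs) (toℕ i) ≡ lookup xs i
nth-vecˡ d (x ∷ xs) ys zs zero = refl
nth-vecˡ d (x ∷ xs) ys zs (suc i) = nth-vecˡ d xs ys zs i

nth-concat : ∀ {A : Set} {m n} d (R : Vec (Vec A n) m) zs j i → nth d (Vec.toList (Vec.concat R) ++ zs) (toℕ j * n + toℕ i) ≡ lookup (lookup R j) i
nth-concat d (r ∷ R) zs zero i = nth-vecˡ d r (Vec.concat R) zs i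
nth-concat {n = n} d (r ∷ R) zs (suc j) i = cong (nth d (Vec.toList (r Vec.++ Vec.concat R) ++ zs)) (+-assoc n (toℕ j * n) (toℕ i)) ∙
 nth-vecʳ d r (Vec.concat R) zs _ ∙ nth-concat d R zs j i

nth-after : ∀ {A : Set} {m} d (xs : Vec A m) zs i → nth d (Vec.toList xs ++ zs) (m + i) ≡ nth d zs i
nth-after d [] zs i = refl
nth-after d (x ∷ xs) zs i = nth-after d xs zs i

nth-before : ∀ {A : Set} (d : A) xs {ys} i → i < length xs → nth d (xs ++ ys) i ≡ nth d xs i
nth-before d (x ∷ xs) zero i< = refl
nth-before d (x ∷ xs) (suc i) (s≤s i<) = nth-before d xs i i<

abs≤max : ∀ L k → abs (nth 0ℤ L k) ≤ List.foldr _⊔_ 0 (List.map abs L)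
abs≤max [] k = z≤n
abs≤max (z ∷ L) zero = m≤m⊔n (abs z) _
abs≤max (z ∷ L) (suc k) = abs≤max L k ⟫ m≤n⊔m (abs z) _

length≤bits : ∀ L → length L ≤ bits L
length≤bits [] = z≤n
length≤bits (x ∷ L) = s≤s (length≤bits L ⟫ m≤n+m _ (digits x))

nth<2^bits : ∀ L k → nth 0 L k < 2 ^ bits L
nth<2^bits [] k = z<s
nth<2^bits (x ∷ L) zero = fst (digits-bounds x) ⟫ ^-monoʳ 2 (n≤1+n _ ⟫ m≤m+n (1 + digits x) _)
nth<2^bits (x ∷ L) (suc k) = nth<2^bits L k ⟫ ^-monoʳ 2 (m≤n+m (bits L) (1 + digits x))

length-encoded : ∀ E → length (List.concatMap encodeℤ E) ≡ 2 * length E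
length-encoded [] = refl
length-encoded (⁺ x ∷ E) = cong (2 +_) (length-encoded E) ∙ sym (*-suc 2 (length E))
length-encoded (-[1+ x ] ∷ E) = cong (2 +_) (length-encoded E) ∙ sym (*-suc 2 (length E))

module Instance {n d : ℕ} (I : BLP n d) (bound : ℤ) where

 μ : ℕ → ℕ
 μ = nth 0 (encode I bound)

 E : List ℤ
 E = entries I ++ (bound ∷ [])

 D : ℕ
 D = 1 + d

 entry : ℕ → ℤ
 entry = nth 0ℤ E

 μ-pos : ∀ k → μ (3 + 2 * k) * (1 ∸ μ (2 + 2 * k)) ≡ pos⁺ (entry k)
 μ-pos k = cong₂ (λ x y → x * (1 ∸ y)) (encoded-abs E k) (encoded-sign E k) ∙ abs-pos (entry k)

 μ-neg : ∀ k → μ (3 + 2 * k) * μ (2 + 2 * k) ≡ neg⁻ (entry k)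
 μ-neg k = cong₂ _*_ (encoded-abs E k) (encoded-sign E k) ∙ abs-neg (entry k)

 rows : Vec (Vec ℤ n) D
 rows = BLP.v I ∷ BLP.a I

 E≡ : E ≡ Vec.toList (Vec.concat rows) ++ (Vec.toList (BLP.u I) ++ (bound ∷ []))
 E≡ = ++-assoc (Vec.toList (BLP.v I)) _ (bound ∷ []) ∙ cong (Vec.toList (BLP.v I) ++_) (++-assoc (Vec.toList (Vec.concat (BLP.a I))) _ (bound ∷ [])) ∙
  sym (++-assoc (Vec.toList (BLP.v I)) _ _) ∙ cong (_++ (Vec.toList (BLP.u I) ++ (bound ∷ []))) (sym (toList-++ (BLP.v I) (Vec.concat (BLP.a I))))

 entry-row : ∀ j i → entry (toℕ j * n + toℕ i) ≡ lookup (lookup rows j) i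
 entry-row j i = cong (λ L → nth 0ℤ L (toℕ j * n + toℕ i)) E≡ ∙ nth-concat 0ℤ rows _ j i

 rhs : ℕ → ℕ
 rhs j = D * n + (j + (D ∸ 1)) mod D

 entry-rhs : ∀ r → entry (D * n + r) ≡ nth 0ℤ (Vec.toList (BLP.u I) ++ (bound ∷ [])) r
 entry-rhs r = cong (λ L → nth 0ℤ L (D * n + r)) E≡ ∙ nth-after 0ℤ (Vec.concat rows) _ r

 entry-bound : entry (rhs 0) ≡ bound
 entry-bound = entry-rhs (d mod D) ∙ cong (nth 0ℤ (Vec.toList (BLP.u I) ++ (bound ∷ [])))
  (mod-% d D ∙ m<n⇒m%n≡m (n<1+n d) ∙ sym (n+0≡n d)) ∙ nth-after 0ℤ (BLP.u I) (bound ∷ []) 0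

 entry-u : ∀ j → entry (rhs (suc (toℕ j))) ≡ lookup (BLP.u I) j
 entry-u j = entry-rhs ((suc (toℕ j) + d) mod D) ∙ cong (nth 0ℤ (Vec.toList (BLP.u I) ++ (bound ∷ [])))
  (mod-% (suc (toℕ j) + d) D ∙ cong (_% D) (sym (+-suc (toℕ j) d)) ∙ ([m+n]%n≡m%n (toℕ j) D) ∙ m<n⇒m%n≡m (<-trans (toℕ<n j) (n<1+n d))) ∙
  nth-vec 0ℤ (BLP.u I) (bound ∷ []) j

 right : Fin D → ℤ
 right zero = bound
 right (suc j) = lookup (BLP.u I) j

 entry-right : ∀ j → entry (rhs (toℕ j)) ≡ right j
 entry-right zero = entry-bound
 entry-right (suc j) = entry-u j

 P⁺ P⁻ : ℕ → ℕ → ℕ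
 P⁺ j v = pos⁺ (entry (j * n + v))
 P⁻ j v = neg⁻ (entry (j * n + v))

 U⁺ U⁻ : ℕ → ℕ
 U⁺ j = pos⁺ (entry (rhs j))
 U⁻ j = neg⁻ (entry (rhs j))

 Row : ℕ → Vec Bool n → Set
 Row j y = dot (P⁺ j) y + U⁻ j ≤ dot (P⁻ j) y + U⁺ j

 left≡ : ∀ j y → ⟨ lookup rows j , 0/1 y ⟩ ≡ ⁺ dot (P⁺ (toℕ j)) y ℤ.- ⁺ dot (P⁻ (toℕ j)) y
 left≡ j = inner-product (lookup rows j) (P⁺ (toℕ j)) (P⁻ (toℕ j)) λ i →
  sym (entry-row j i) ∙ signed _

 right≡ : ∀ j → right j ≡ ⁺ U⁺ (toℕ j) ℤ.- ⁺ U⁻ (toℕ j)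
 right≡ j = sym (entry-right j) ∙ signed _

 row⇒ : ∀ j y → Row (toℕ j) y → ⟨ lookup rows j , 0/1 y ⟩ ℤ.≤ right j
 row⇒ j y h = subst₂ ℤ._≤_ (sym (left≡ j y)) (sym (right≡ j)) (difference-≤ _ (dot (P⁻ (toℕ j)) y) (U⁺ (toℕ j)) _ h)

 row⇐ : ∀ j y → ⟨ lookup rows j , 0/1 y ⟩ ℤ.≤ right j → Row (toℕ j) y
 row⇐ j y h = difference-≤⁻¹ _ (dot (P⁻ (toℕ j)) y) (U⁺ (toℕ j)) _ (subst₂ ℤ._≤_ (left≡ j y) (right≡ j) h)

 rows⇒solution : ∀ y → (∀ j → j < D → Row j y) → HasSolution I bound
 rows⇒solution y h = y , (λ j → row⇒ (suc j) y (h (suc (toℕ j)) (s≤s (toℕ<n j)))) , row⇒ zero y (h 0 z<s)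

 solution⇒rows : HasSolution I bound → ∃ λ y → ∀ j → j < D → Row j y
 solution⇒rows (y , f , o) = y , λ j j< → subst (λ k → Row k y) (toℕ-fromℕ< j<) (row⇐ (fromℕ< j<) y (all (fromℕ< j<)))
  where
  all : ∀ j → ⟨ lookup rows j , 0/1 y ⟩ ℤ.≤ right j
  all zero = o
  all (suc j) = f j

 cnt : ℕ
 cnt = D * n + d

 length-entries : length (entries I) ≡ cnt
 length-entries = length-++ (Vec.toList (BLP.v I)) ∙ cong₂ _+_ (length-toList (BLP.v I))
  (length-++ (Vec.toList (Vec.concat (BLP.a I))) ∙ cong₂ _+_ (length-toList (Vec.concat (BLP.a I))) (length-toList (BLP.u I))) ∙
  sym (+-assoc n (d * n) d)

 μ-abs≤ : ∀ k → k < cnt → μ (3 + 2 * k) ≤ maxAbs I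
 μ-abs≤ k k< = encoded-abs E k ∙ cong abs (nth-before 0ℤ (entries I) k (subst (k <_) (sym length-entries) k<)) ≡⟫
  abs≤max (entries I) k

 abs-μ : ∀ k → abs (entry k) ≡ μ (3 + 2 * k)
 abs-μ k = sym (encoded-abs E k)

 -- Every entry takes two cells, and every cell counts at least one bit.
 size≥ : 2 + 2 * (cnt + 1) ≤ inputSize I bound
 size≥ = sym (cong (2 +_) (length-encoded E ∙ cong (2 *_) (length-++ (entries I) ∙ cong (_+ 1) length-entries))) ≡⟫
  length≤bits (encode I bound)

 row-index< : ∀ j v → j < D → v < n → j * n + v < D * n
 row-index< j v j< v< = +-monoʳ-< (j * n) v< ⟫ +-comm (j * n) n ≡⟫ *-monoˡ n j<

-- The values of the parameters.

module Parameters (μ : ℕ → ℕ) where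

 abstract
  Lw : ℕ
  Lw = 1 + 2 ^ ((14 * μ 0) / 100) quo (16 * (μ 0 + 2))

  Lw-def : Lw ≡ 1 + 2 ^ ((14 * μ 0) / 100) quo (16 * (μ 0 + 2))
  Lw-def = refl

 n D cnt O m x1 lg lam1 g5 Gam B BIG b e n' N bb lbb cp cq Yp Yq kk K2 W SL NN ne R1 R2 : ℕ
 n = μ 0
 D = 1 + μ 1
 cnt = D * n + (D ∸ 1)
 -- Entry number `cnt` is the objective bound, so O exceeds every number of the decision instance.
 O = 1 + (μ (3 + 2 * cnt) + ∑ cnt (λ k → μ (3 + 2 * k)))
 -- The maximum over all entries except the objective bound, so that it stays within the m of the
 -- time bound.
 m = iterate↓ cnt (λ k a → (a + (μ (3 + 2 * k) ∸ a)) ⊓ O) 0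
 -- For positive x, `digits (x ∸ 1)` is ⌈log₂ x⌉, matching the logarithm in the time bound.
 x1 = m * n ∸ 1
 lg = digits x1
 lam1 = lg * n ∸ 1
 -- Let Λ be the power of two with exponent `digits lam1`, at least log(mn) n when that is positive.
 -- Once Λ ≥ 2, its fifth power is at least 16 Λ, enough for all levels and for slacks below 5 (n +
 -- 1).
 g5 = 5 * digits lam1
 Gam = 2 ^ g5
 B = 2 * (n + 1) * (O + 1)
 BIG = B * B ^ D
 b = digits BIG
 -- The threshold between few and many sums is 2^(n-e), and 2^e is about the length of a walk.
 e = (14 * n) / 100
 n' = (n + 1) / 2
 N = 2 * 2 ^ n'
 -- The summand 32 serves `quartic-bound`.
 bb = b + n + 32
 lbb = digits bb
 -- Beyond the number of sums, a factor (bb + 1)³ pays for the density of primes and for the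
 -- clashing ones. A further factor (bb + 1)⁴ in Yq pays for the primes up to n p and those
 -- misleading the self-reduction.
 cp = n ∸ e + 3 * lbb
 cq = cp + 4 * lbb
 Yp = 2 ^ cp
 Yq = 2 ^ cq
 kk = digits n
 K2 = 2 ^ kk
 -- A word is long enough for 2^W to be a multiple of each modulus used: Gam, K2, Yp, Yq, N and 2^n.
 W = cq + g5 + n + n' + kk + b + 1
 -- 2 D words guess levels and slacks, up to four the other choices of a trial; the remaining ones
 -- are indexed by the keys.
 SL = 2 * D + 4 + 3 * BIG
 NN = N * N
 ne = n' + 1 ∸ e
 -- The reciprocal of the success probability of one trial: the guesses for the rows, those of κ and
 -- k, and the choice of two primes.
 R1 = (Gam * Gam) ^ D * (K2 * K2) * (4 * cp * cq)
 -- Here the last factor stands for the quotient of N² by the squared length of a walk.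
 R2 = (Gam * Gam) ^ D * K2 * (16 * 16 * 16 * ((n + 2) * (n + 2) * (n + 2)) * 4 ^ ne)

 π : Vec ℕ P#
 π = R2 ∷ R1 ∷ ne ∷ NN ∷ Lw ∷ SL ∷ W ∷ K2 ∷ kk ∷ Yq ∷ Yp ∷ cq ∷ cp ∷ lbb ∷ bb ∷ N ∷ n' ∷ e ∷ b ∷ BIG ∷ B ∷ Gam ∷ g5 ∷ lam1 ∷ lg ∷ x1 ∷ m ∷ O ∷ cnt ∷ D ∷ n ∷ []

smallᵖ : Vec Bool P#
smallᵖ = false ∷ false ∷ true ∷ false ∷ false ∷ false ∷ true ∷ false ∷ true ∷ false ∷ false ∷ true ∷ true ∷ true ∷ true ∷ false ∷
 true ∷ true ∷ true ∷ false ∷ false ∷ false ∷ true ∷ true ∷ true ∷ false ∷ false ∷ false ∷ true ∷ true ∷ true ∷ []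

only : Fin P# → Vec Bool P#
only i = Vec.replicate P# false Vec.[ i ]≔ true

module Evaluation (μ φ : ℕ → ℕ) where
 open Semantics μ φ 0

 -- Runs through the definitions of a program and lets each computed value be replaced by an equal
 -- closed form.
 data Values : ∀ {P P'} → Vec Bool P → Prog P → Vec ℕ P → Vec Bool P' → Prog P' → Vec ℕ P' → Set where
  done : ∀ {P κ p π} → Values {P} κ p π κ p π
  step : ∀ {P P' κ e p π κ' p' π'} k v → small κ e ≡ k → ⟦ e ⟧ᵉ π [] ≡ v → Values {suc P} {P'} (k ∷ κ) p (v ∷ π) κ' p' π' → Values κ (def e p) π κ' p' π'

 sweeps : Prog P#
 sweeps = sweep R1ᵖ (lower trialA) (sweep R2ᵖ (lower trialB) stop)

 open Parameters μ

 accepts-values : ∀ {P P' κ p π κ' p' π'} → Values {P} {P'} κ p π κ' p' π' → accepts μ φ p π ≡ accepts μ φ p' π'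
 accepts-values done = refl
 accepts-values (step _ _ refl refl h) = accepts-values h

 Sized : ℕ → Vec Bool P → Vec ℕ P → Set
 Sized σ κ π = Small σ κ π × Under σ π

 sized-values : ∀ {P P' κ p π κ' p' π' σ} → Values {P} {P'} κ p π κ' p' π' → Fine μ φ σ p κ π → Sized σ κ π → Sized σ κ' π'
 sized-values done f h = h
 sized-values (step _ _ refl refl r) (_ , v< , v≤ , f) (s , l) =
  sized-values r f ((λ { zero → v≤ ; (suc i) → s i }) , λ { zero → v< ; (suc i) → l i })

-- Running time.

-- Loops over a parameter of kind true take at most σ rounds, those over the
-- parameters selected by β at most H.
loopsWithin : Vec Bool P → Vec Bool P → Exp ℓ P Γ → Bool
loopsWithins : Vec Bool P → Vec Bool P → Vec (Exp ℓ P Γ) Δ → Bool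
loopsWithin κ β (op o e f) = loopsWithin κ β e ∧ loopsWithin κ β f
loopsWithin κ β (mem e) = loopsWithin κ β e
loopsWithin κ β (rnd e) = loopsWithin κ β e
loopsWithin κ β (call f es) = loopsWithin κ β f ∧ loopsWithins κ β es
loopsWithin κ β (sum i e) = (lookup κ i ∨ lookup β i) ∧ loopsWithin κ β e
loopsWithin κ β (prod i e) = (lookup κ i ∨ lookup β i) ∧ loopsWithin κ β e
loopsWithin κ β (iter i c e₀ e) = (lookup κ i ∨ lookup β i) ∧ (loopsWithin κ β e₀ ∧ loopsWithin κ β e)
loopsWithin κ β _ = true
loopsWithins κ β [] = true
loopsWithins κ β (e ∷ es) = loopsWithin κ β e ∧ loopsWithins κ β es

bigLoop : Bool → ℕ
bigLoop k = if k then 0 else 1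

-- The exponent of H in the time bound. It is 1 for both trials, that is, no exponentially long loop
-- is nested in another one.
loopDepth : Vec Bool P → Exp ℓ P Γ → ℕ
loopDepths : Vec Bool P → Vec (Exp ℓ P Γ) Δ → ℕ
loopDepth κ (op o e f) = loopDepth κ e ⊔ loopDepth κ f
loopDepth κ (mem e) = loopDepth κ e
loopDepth κ (rnd e) = loopDepth κ e
loopDepth κ (call f es) = loopDepth κ f ⊔ loopDepths κ es
loopDepth κ (sum i e) = bigLoop (lookup κ i) + loopDepth κ e
loopDepth κ (prod i e) = bigLoop (lookup κ i) + loopDepth κ e
loopDepth κ (iter i c e₀ e) = loopDepth κ e₀ ⊔ (bigLoop (lookup κ i) + loopDepth κ e)
loopDepth κ _ = 0
loopDepths κ [] = 0
loopDepths κ (e ∷ es) = loopDepth κ e ⊔ loopDepths κ es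

timeDegree : Exp ℓ P Γ → ℕ
timeDegrees : Vec (Exp ℓ P Γ) Δ → ℕ
timeDegree (par i) = 1
timeDegree (var x) = 1
timeDegree (lit c) = 1
timeDegree (op o e f) = 2 + (timeDegree e + timeDegree f)
timeDegree (mem e) = 2 + timeDegree e
timeDegree (rnd e) = 2 + timeDegree e
timeDegree blk = 1
timeDegree (len i) = 5
timeDegree (call f es) = 2 + (timeDegree f + timeDegrees es)
timeDegree (sum i e) = 5 + timeDegree e
timeDegree (prod i e) = 5 + timeDegree e
timeDegree (iter i c e₀ e) = 5 + (timeDegree e₀ + timeDegree e)
timeDegrees [] = 1
timeDegrees (e ∷ es) = 1 + (timeDegree e + timeDegrees es)

timeDegrees≥1 : (es : Vec (Exp ℓ P Γ) Δ) → 1 ≤ timeDegrees es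
timeDegrees≥1 [] = z<s
timeDegrees≥1 (_ ∷ _) = z<s

module TimeBounds (σ H : ℕ) (2≤σ : 2 ≤ σ) (1≤H : 1 ≤ H) where

 private instance
  σ≢0 : NonZero σ
  σ≢0 = >-nonZero (z<s ⟫ 2≤σ)
  H≢0 : NonZero H
  H≢0 = >-nonZero 1≤H

 abstract
  G : ℕ → ℕ → ℕ
  G x p = σ ^ x * H ^ p

  G≥1 : ∀ x p → 1 ≤ G x p
  G≥1 x p = *-mono (m^n>0 σ x) (m^n>0 H p)

  G-mono : ∀ {x y p q} → x ≤ y → p ≤ q → G x p ≤ G y q
  G-mono x≤ p≤ = *-mono (^-monoʳ σ x≤) (^-monoʳ H p≤)

  G-+ : ∀ x y p q → G x p * G y q ≡ G (x + y) (p + q)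
  G-+ x y p q = *-interchange (σ ^ x) (H ^ p) (σ ^ y) (H ^ q) ∙ sym (cong₂ _*_ (^-+ σ x y) (^-+ H p q))

  G-scale : ∀ {c} k x p → c ≤ 2 ^ k → c * G x p ≤ G (k + x) p
  G-scale k x p c≤ = *-monoˡ (G x p) (c≤ ⟫ ^-monoˡ k 2≤σ) ⟫≡
   sym (*-assoc (σ ^ k) (σ ^ x) (H ^ p)) ∙ cong (_* H ^ p) (sym (^-+ σ k x))

  two : 2 ≤ G 1 0
  two = 2≤σ ⟫≡ sym (n*1≡n _ ∙ ^-identityʳ σ)

  G-one : ∀ {x} p → x ≤ σ → x ≤ G 1 p
  G-one p h = h ⟫ sym (^-identityʳ σ) ≡⟫ m≤m*n (σ ^ 1) (H ^ p) {{m^n≢0 H p}}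

  G-big : ∀ {x} → x ≤ H → x ≤ G 1 1
  G-big h = h ⟫ sym (^-identityʳ H) ≡⟫ m≤n*m (H ^ 1) (σ ^ 1) {{m^n≢0 σ 1}}

  G-def : ∀ x p → G x p ≡ σ ^ x * H ^ p
  G-def x p = refl

 loop : ∀ {r t w} x p → r ≤ G 1 w → t ≤ G x p → 6 + r * (t + 6) ≤ G (5 + x) (w + p)
 loop {r} {t} {w} x p r≤ t≤ = begin
  6 + r * (t + 6) ≤⟨ +-monoʳ 6 (*-mono r≤ (+-monoˡ 6 t≤)) ⟩
  6 + Y * (X + 6) ≤⟨ lem X Y (G≥1 x p) (G≥1 1 w) ⟩
  16 * (Y * X) ≡⟨ cong (16 *_) (G-+ 1 x w p) ⟩
  16 * G (1 + x) (w + p) ≤⟨ G-scale 4 (1 + x) (w + p) ≤-refl ⟩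
  G (4 + (1 + x)) (w + p) ≡⟨ cong (λ y → G y (w + p)) (+-suc 4 x) ⟩
  G (5 + x) (w + p) ∎
  where
  X = G x p
  Y = G 1 w
  lem : ∀ X Y → 1 ≤ X → 1 ≤ Y → 6 + Y * (X + 6) ≤ 16 * (Y * X)
  lem (suc X) (suc Y) _ _ = pad (lem' X Y)
   where
   lem' : ∀ X Y → 6 + suc Y * (suc X + 6) + (3 + 9 * Y + 15 * X + 15 * (Y * X)) ≡ 16 * (suc Y * suc X)
   lem' = ring

 three : ∀ {a b c x p} → a ≤ G x p → b ≤ G x p → c ≤ G x p → a + (b + c) ≤ G (2 + x) p
 three {x = x} {p} a≤ b≤ c≤ = +-mono a≤ (+-mono b≤ c≤) ⟫ lem (G x p) ≡⟫ G-scale 2 x p (s≤s (s<s z<s))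
  where
  lem : ∀ g → g + (g + g) ≡ 3 * g
  lem = ring

 two' : ∀ {x} p → 1 ≤ x → 2 ≤ G x p
 two' p 1≤x = two ⟫ G-mono 1≤x z≤n

 fold-time : ∀ r t → 3 + ((r * (3 + ((t + 1) + 2)) + 1) + 2) ≡ 6 + r * (t + 6)
 fold-time = ring

 module _ {P} (κ β : Vec Bool P) (π : Vec ℕ P) (κ≤ : Small σ κ π)
  (β≤ : ∀ i → lookup β i ≡ true → lookup π i ≤ H) (π< : Under σ π) where

  rounds : ∀ i → T (lookup κ i ∨ lookup β i) → lookup π i ≤ G 1 (bigLoop (lookup κ i))
  rounds i h with lookup κ i | κ≤ i | lookup β i | β≤ i
  ... | true | k | _ | _ = G-one 0 (k refl)
  ... | false | _ | true | l = G-big (l refl)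

  time≤ : ∀ {ℓ Γ} (e : Exp ℓ P Γ) → T (loopsWithin κ β e) → time e π ≤ G (timeDegree e) (loopDepth κ e)
  times≤ : ∀ {ℓ Γ Δ} (es : Vec (Exp ℓ P Γ) Δ) → T (loopsWithins κ β es) → times es π ≤ G (timeDegrees es) (loopDepths κ es)
  time≤ (par i) ok = two
  time≤ (var x) ok = two
  time≤ (lit c) ok = z<s ⟫ two
  time≤ blk ok = two
  time≤ (len i) ok = begin
   3 + ((digits (lookup π i) * 7 + 1) + 2) ≤⟨ +-monoʳ 3 (+-monoˡ 2 (+-monoˡ 1 (*-monoˡ 7 {digits (lookup π i)} {σ} (digits-≤ {lookup π i} {σ} (π< i))))) ⟩
   3 + ((σ * 7 + 1) + 2) ≤⟨ lem σ (z<s ⟫ 2≤σ) ⟩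
   16 * σ ≤⟨ *-monoʳ 16 (G-one 0 ≤-refl) ⟩
   16 * G 1 0 ≤⟨ G-scale 4 1 0 ≤-refl ⟩
   G 5 0 ∎
   where
   lem : ∀ s → 1 ≤ s → 3 + ((s * 7 + 1) + 2) ≤ 16 * s
   lem (suc s) _ = pad (lem' s)
    where
    lem' : ∀ s → 3 + ((suc s * 7 + 1) + 2) + (3 + 9 * s) ≡ 16 * suc s
    lem' = ring
  time≤ (op o e f) ok = three
   (time≤ e (T-fst ok) ⟫ G-mono (m≤m+n _ _) (m≤m⊔n _ _))
   (time≤ f (T-snd {loopsWithin κ β e} ok) ⟫ G-mono (m≤n+m _ (timeDegree e)) (m≤n⊔m (loopDepth κ e) _))
   (G≥1 _ _)
  time≤ (mem e) ok = +-monoʳ (time e π) z<s ⟫ three {b = 0} {1} {timeDegree e} (time≤ e ok) z≤n (G≥1 (timeDegree e) (loopDepth κ e))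
  time≤ (rnd e) ok = +-monoʳ (time e π) z<s ⟫ three {b = 0} {1} {timeDegree e} (time≤ e ok) z≤n (G≥1 (timeDegree e) (loopDepth κ e))
  time≤ (call f es) ok = three
   (times≤ es (T-snd {loopsWithin κ β f} ok) ⟫ G-mono (m≤n+m _ (timeDegree f)) (m≤n⊔m (loopDepth κ f) _))
   (time≤ f (T-fst ok) ⟫ G-mono (m≤m+n _ _) (m≤m⊔n _ _))
   (two' (loopDepth κ f ⊔ loopDepths κ es) (timeDegrees≥1 es ⟫ m≤n+m _ (timeDegree f)))
  time≤ (sum i e) ok = fold-time (lookup π i) (time e π) ≡⟫ loop (timeDegree e) (loopDepth κ e) (rounds i (T-fst ok)) (time≤ e (T-snd {lookup κ i ∨ lookup β i} ok))
  time≤ (prod i e) ok = fold-time (lookup π i) (time e π) ≡⟫ loop (timeDegree e) (loopDepth κ e) (rounds i (T-fst ok)) (time≤ e (T-snd {lookup κ i ∨ lookup β i} ok))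
  time≤ (iter i c e₀ e) ok = begin
   2 + (time e₀ π + ((lookup π i * (3 + ((time e π + 2) + 2)) + 1) + 2)) ≡⟨ lem₁ (time e₀ π) (lookup π i) (time e π) ⟩
   5 + (time e₀ π + lookup π i * (time e π + 7)) ≤⟨ +-monoʳ 5 (+-mono t₀ (*-mono (rounds i (T-fst ok)) (+-monoˡ 7 t ⟫ lem₂ X (G≥1 _ _)) ⟫ lem₃ Y X ≡⟫ *-monoʳ 8 YX≤)) ⟩
   5 + (Z + 8 * Z) ≤⟨ lem₄ Z (G≥1 _ _) ⟩
   16 * Z ≤⟨ G-scale 4 (1 + D) _ ≤-refl ⟩
   G (4 + (1 + D)) q ≤⟨ G-mono (≤-reflexive (+-suc 4 D)) ≤-refl ⟩
   G (5 + D) q ∎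
   where
   w = bigLoop (lookup κ i)
   q = loopDepth κ e₀ ⊔ (w + loopDepth κ e)
   D = timeDegree e₀ + timeDegree e
   X = G (timeDegree e) (loopDepth κ e)
   Y = G 1 w
   Z = G (1 + D) q
   t = time≤ e (T-snd {loopsWithin κ β e₀} (T-snd {lookup κ i ∨ lookup β i} ok))
   t₀ : time e₀ π ≤ Z
   t₀ = time≤ e₀ (T-fst (T-snd {lookup κ i ∨ lookup β i} ok)) ⟫ G-mono (m≤m+n (timeDegree e₀) _ ⟫ n≤1+n D) (m≤m⊔n _ _)
   YX≤ : Y * X ≤ Z
   YX≤ = G-+ 1 (timeDegree e) w (loopDepth κ e) ≡⟫ G-mono (s≤s (m≤n+m _ (timeDegree e₀))) (m≤n⊔m (loopDepth κ e₀) _)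
   lem₁ : ∀ a r t → 2 + (a + ((r * (3 + ((t + 2) + 2)) + 1) + 2)) ≡ 5 + (a + r * (t + 7))
   lem₁ = ring
   lem₂ : ∀ x → 1 ≤ x → x + 7 ≤ 8 * x
   lem₂ (suc x) _ = pad (lem x)
    where
    lem : ∀ x → suc x + 7 + 7 * x ≡ 8 * suc x
    lem = ring
   lem₃ : ∀ y x → y * (8 * x) ≡ 8 * (y * x)
   lem₃ = ring
   lem₄ : ∀ z → 1 ≤ z → 5 + (z + 8 * z) ≤ 16 * z
   lem₄ (suc z) _ = pad (lem z)
    where
    lem : ∀ z → 5 + (suc z + 8 * suc z) + (2 + 7 * z) ≡ 16 * suc z
    lem = ring
  times≤ [] ok = z≤n
  times≤ (e ∷ es) ok = +-mono (time≤ e (T-fst ok)) (times≤ es (T-snd {loopsWithin κ β e} ok)) ⟫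
   +-mono (G-mono {y = timeDegree e + timeDegrees es} (m≤m+n _ _) (m≤m⊔n (loopDepth κ e) (loopDepths κ es))) (G-mono (m≤n+m _ (timeDegree e)) (m≤n⊔m (loopDepth κ e) _)) ⟫
    cong (G (timeDegree e + timeDegrees es) (loopDepth κ e ⊔ loopDepths κ es) +_) (sym (n+0≡n _)) ≡⟫ G-scale 1 (timeDegree e + timeDegrees es) _ ≤-refl

setupOk : Vec Bool P → Prog P → Bool
setupOk {P} κ (def e p) = loopsWithin κ (Vec.replicate P false) e ∧ setupOk (small κ e ∷ κ) p
setupOk κ _ = true

setupDegree : Prog P → ℕ
setupDegree (def e p) = suc (timeDegree e + setupDegree p)
setupDegree _ = 0

module _ {μ φ : ℕ → ℕ} where
 open Evaluation μ φ

 time-values : ∀ {P P' κ p π κ' p' π' σ} → 2 ≤ σ → Values {P} {P'} κ p π κ' p' π' → T (setupOk κ p) → Fine μ φ σ p κ π → Sized σ κ π →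
  timeᵖ μ φ p π ≤ σ ^ setupDegree p + timeᵖ μ φ p' π'
 time-values 2≤σ done ok f h = m≤n+m _ _
 time-values {P} {κ = κ} {π = π} {π' = π'} {σ = σ} 2≤σ (step {e = e} {p} {p' = p'} _ _ refl refl r) ok f@(_ , v< , v≤ , f') h@(s , l) = begin
  time e π + timeᵖ μ φ p _ ≤⟨ +-mono now (time-values 2≤σ r (T-snd {loopsWithin κ (Vec.replicate P false) e} ok) f'
   ((λ { zero → v≤ ; (suc i) → s i }) , λ { zero → v< ; (suc i) → l i })) ⟩
  σ ^ timeDegree e + (σ ^ setupDegree p + timeᵖ μ φ p' π') ≡⟨ +-assoc (σ ^ timeDegree e) _ _ ⟨
  σ ^ timeDegree e + σ ^ setupDegree p + timeᵖ μ φ p' π' ≤⟨ +-monoˡ _ (+-mono (^-monoʳ σ (m≤m+n (timeDegree e) _)) (^-monoʳ σ (m≤n+m (setupDegree p) (timeDegree e))) ⟫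
   cong (σ ^ (timeDegree e + setupDegree p) +_) (sym (n+0≡n _)) ≡⟫ *-monoˡ (σ ^ (timeDegree e + setupDegree p)) 2≤σ) ⟩
  σ ^ suc (timeDegree e + setupDegree p) + timeᵖ μ φ p' π' ∎
  where
  instance
   σ≢0 : NonZero σ
   σ≢0 = >-nonZero (z<s ⟫ 2≤σ)
  open TimeBounds σ 1 2≤σ ≤-refl
  now : time e π ≤ σ ^ timeDegree e
  now = time≤ κ (Vec.replicate P false) π s (λ i q → ⊥-elim (absurd (sym (lookup-replicate i false) ∙ q))) l e (T-fst ok) ⟫≡
   G-def (timeDegree e) (loopDepth κ e) ∙ cong (σ ^ timeDegree e *_) (^-zeroˡ (loopDepth κ e)) ∙ n*1≡n _
   where
   absurd : false ≢ true
   absurd ()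

module _ (μ φ : ℕ → ℕ) where
 open Evaluation μ φ
 open Parameters μ

 values : Values [] program [] smallᵖ sweeps (Parameters.π μ)
 values = step true n refl refl $ step true D refl refl $ step true cnt refl refl $ step false O refl refl $ step false m refl refl $ step false x1 refl refl $ step true lg refl refl $ step true lam1 refl refl $ step true g5 refl refl $
  step false Gam refl (∏-const g5 2) $ step false B refl refl $ step false BIG refl (cong (B *_) (∏-const D B)) $ step true b refl refl $ step true e refl refl $ step true n' refl refl $
  step false N refl (cong (2 *_) (∏-const n' 2)) $ step true bb refl refl $ step true lbb refl refl $ step true cp refl refl $ step true cq refl refl $ step false Yp refl (∏-const cp 2) $ step false Yq refl (∏-const cq 2) $ step true kk refl refl $
  step false K2 refl (∏-const kk 2) $ step true W refl refl $ step false SL refl refl $ step false Lw refl (cong (λ x → 1 + x quo (16 * (n + 2))) (∏-const e 2) ∙ sym Lw-def) $ step false NN refl refl $ step true ne refl refl $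
  step false R1 refl (cong (λ x → x * (K2 * K2) * (4 * cp * cq)) (∏-const D (Gam * Gam))) $
  step false R2 refl (cong₂ (λ x y → x * K2 * (16 * 16 * 16 * ((n + 2) * (n + 2) * (n + 2)) * y)) (∏-const D (Gam * Gam)) (∏-const ne 4)) $ done

okSetup : setupOk [] program ≡ true
okSetup = refl

okA : loopsWithin smallᵖ (only Yqᵖ) (lower trialA) ≡ true
okA = refl

okB : loopsWithin smallᵖ (only Lwᵖ) (lower trialB) ≡ true
okB = refl

depthA : loopDepth smallᵖ (lower trialA) ≡ 1
depthA = refl

depthB : loopDepth smallᵖ (lower trialB) ≡ 1
depthB = refl

module RunningTime (μ : ℕ → ℕ) (σ : ℕ) (2≤σ : 2 ≤ σ) where

 open Parameters μ

 module _ (sized : Small σ smallᵖ π × Under σ π) where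

  private instance
   σ≢0 : NonZero σ
   σ≢0 = >-nonZero (z<s ⟫ 2≤σ)

  private

   2^≤ : ∀ k → 2 ^ k ≤ σ ^ k
   2^≤ k = ^-monoˡ k 2≤σ

   σ¹ : ∀ {x} → x ≤ σ → x ≤ σ ^ 1
   σ¹ h = h ⟫≡ sym (^-identityʳ σ)

   combine : ∀ {x y} a b → x ≤ σ ^ a → y ≤ σ ^ b → x * y ≤ σ ^ (a + b)
   combine a b hx hy = *-mono hx hy ⟫≡ sym (^-+ σ a b)

   double : ∀ {x} → x ≤ σ → 2 * x ≤ σ ^ 2
   double h = combine 1 1 (2^≤ 1) (σ¹ h)

   power-digits : ∀ {x} → x ≤ σ → 2 ^ digits x ≤ σ ^ 2
   power-digits {zero} h = m^n>0 σ 2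
   power-digits {suc x} h = snd (digits-bounds (suc x)) z<s ⟫ double h

   n≤ : n ≤ σ
   n≤ = fst sized nᵖ refl
   lam1≤ : lam1 ≤ σ
   lam1≤ = fst sized lam1ᵖ refl
   bb≤ : bb ≤ σ
   bb≤ = fst sized bbᵖ refl
   cp≤ : cp ≤ σ
   cp≤ = fst sized cpᵖ refl
   cq≤ : cq ≤ σ
   cq≤ = fst sized cqᵖ refl

   U : ℕ
   U = n ∸ e

   Q : ℕ
   Q = (Gam * Gam) ^ D

   100e≤ : e * 100 ≤ 14 * n
   100e≤ = m/n*n≤m (14 * n) 100

   e≤n : e ≤ n
   e≤n = *-cancelʳ-≤ e n 100 (100e≤ ⟫ *-monoˡ n (m≤m+n 14 86) ⟫≡ *-comm 100 n)

   n≤2n' : n ≤ 2 * n'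
   n≤2n' = s≤s⁻¹ (+-comm 1 n ≡⟫ (m≡m%n+[m/n]*n (n + 1) 2) ≡⟫
    +-monoˡ (n' * 2) (s≤s⁻¹ (m%n<n (n + 1) 2)) ⟫≡ cong suc (*-comm n' 2))

   2n'≤ : 2 * n' ≤ n + 1
   2n'≤ = *-comm 2 n' ≡⟫ m/n*n≤m (n + 1) 2

   e≤n'+1 : e ≤ n' + 1
   e≤n'+1 = *-cancelʳ-≤ e (n' + 1) 100 (100e≤ ⟫ *-monoʳ 14 n≤2n' ⟫ pad (lem n') ⟫ ≤-refl)
    where
    lem : ∀ k → 14 * (2 * k) + (72 * k + 100) ≡ (k + 1) * 100
    lem = ring

   Yq≤ : Yq ≤ 2 ^ U * σ ^ 14
   Yq≤ = cong (2 ^_) (lem U lbb) ∙ ^-+ 2 U (lbb * 7) ≡⟫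
    *-monoʳ (2 ^ U) (sym (^-*-assoc 2 lbb 7) ≡⟫ ^-monoˡ 7 (power-digits bb≤) ⟫≡ ^-*-assoc σ 2 7)
    where
    lem : ∀ u l → u + 3 * l + 4 * l ≡ u + l * 7
    lem = ring

   K2≤ : K2 ≤ σ ^ 2
   K2≤ = power-digits n≤

   R1≤ : R1 ≤ Q * σ ^ 8
   R1≤ = *-assoc Q (K2 * K2) _ ≡⟫ *-monoʳ Q
    (combine 4 4 (combine 2 2 K2≤ K2≤) (combine 3 1 (combine 2 1 (refl ≡⟫ 2^≤ 2) (σ¹ cp≤)) (σ¹ cq≤)))

   n+2≤ : n + 2 ≤ σ ^ 2
   n+2≤ = +-mono n≤ 2≤σ ⟫ cong (σ +_) (sym (n+0≡n σ)) ≡⟫ double ≤-refl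

   R2≤ : R2 ≤ Q * (σ ^ 20 * 4 ^ ne)
   R2≤ = lem Q K2 (16 * 16 * 16) ((n + 2) * (n + 2) * (n + 2)) (4 ^ ne) ≡⟫ *-monoʳ Q (*-monoˡ (4 ^ ne)
    (combine 2 18 K2≤ (combine 12 6 (2^≤ 12) (combine 4 2 (combine 2 2 n+2≤ n+2≤) n+2≤))))
    where
    lem : ∀ q k c x f → q * k * (c * x * f) ≡ q * (k * (c * x) * f)
    lem = ring

   Lw≤ : Lw ≤ 2 * 2 ^ e
   Lw≤ = Lw-def ≡⟫ +-monoʳ 1 (quo≤ (2 ^ e) (16 * (n + 2))) ⟫ +-monoˡ (2 ^ e) (1≤2^ e) ⟫≡ cong (2 ^ e +_) (sym (n+0≡n _))
    where
    quo≤ : ∀ (x y : ℕ) → x quo y ≤ x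
    quo≤ x zero = z≤n
    quo≤ x (suc y) = m/n≤m x (suc y)

   -- About 2^(n-2e) repetitions of walks of length 2^e cost 2^(n-e), as much as the summation over
   -- the field in the other trial.
   split-exponent : 4 ^ ne * 2 ^ e ≤ 2 ^ U * σ ^ 3
   split-exponent = begin
    4 ^ ne * 2 ^ e ≡⟨ cong (_* 2 ^ e) (^-*-assoc 2 2 ne) ⟩
    2 ^ (2 * ne) * 2 ^ e ≡⟨ ^-+ 2 (2 * ne) e ⟨
    2 ^ (2 * ne + e) ≤⟨ ^-monoʳ 2 exponent ⟩
    2 ^ (U + 3) ≡⟨ ^-+ 2 U 3 ⟩
    2 ^ U * 2 ^ 3 ≤⟨ *-monoʳ (2 ^ U) (2^≤ 3) ⟩
    2 ^ U * σ ^ 3 ∎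
    where
    exponent : 2 * ne + e ≤ U + 3
    exponent = +-cancelʳ-≤ e _ _ (begin
     2 * ne + e + e ≡⟨ lem₁ ne e ⟩
     2 * (ne + e) ≡⟨ cong (2 *_) (m∸n+n≡m e≤n'+1) ⟩
     2 * (n' + 1) ≡⟨ *-distribˡ-+ 2 n' 1 ⟩
     2 * n' + 2 ≤⟨ +-monoˡ 2 2n'≤ ⟩
     n + 1 + 2 ≡⟨ +-assoc n 1 2 ⟩
     n + 3 ≡⟨ cong (_+ 3) (sym (m∸n+n≡m e≤n)) ⟩
     U + e + 3 ≡⟨ lem₂ U e ⟩
     U + 3 + e ∎)
     where
     lem₁ : ∀ a b → 2 * a + b + b ≡ 2 * (a + b)
     lem₁ = ring
     lem₂ : ∀ a b → a + b + 3 ≡ a + 3 + b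
     lem₂ = ring

   V : ℕ
   V = Q * 2 ^ U

   R1Yq≤ : R1 * Yq ≤ V * σ ^ 22
   R1Yq≤ = *-mono R1≤ Yq≤ ⟫≡ *-interchange Q (σ ^ 8) (2 ^ U) (σ ^ 14) ∙ cong (V *_) (sym (^-+ σ 8 14))

   R2Lw≤ : R2 * Lw ≤ V * σ ^ 24
   R2Lw≤ = begin
    R2 * Lw ≤⟨ *-mono R2≤ Lw≤ ⟩
    Q * (σ ^ 20 * 4 ^ ne) * (2 * 2 ^ e) ≡⟨ lem Q (σ ^ 20) (4 ^ ne) (2 ^ e) ⟩
    Q * (2 * σ ^ 20 * (4 ^ ne * 2 ^ e)) ≤⟨ *-monoʳ Q (*-mono (*-monoˡ (σ ^ 20) 2≤σ) split-exponent) ⟩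
    Q * (σ ^ 21 * (2 ^ U * σ ^ 3)) ≡⟨ lem' Q (σ ^ 21) (2 ^ U) (σ ^ 3) ⟩
    V * (σ ^ 21 * σ ^ 3) ≡⟨ cong (V *_) (sym (^-+ σ 21 3)) ⟩
    V * σ ^ 24 ∎
    where
    lem : ∀ q s f e → q * (s * f) * (2 * e) ≡ q * (2 * s * (f * e))
    lem = ring
    lem' : ∀ q s u t → q * (s * (u * t)) ≡ q * u * (s * t)
    lem' = ring

   1≤V : 1 ≤ V
   1≤V = *-mono (m^n>0 (Gam * Gam) {{>-nonZero (*-mono (1≤2^ g5) (1≤2^ g5))}} D) (1≤2^ U)

  bound : (x y z : ℕ) → ℕ
  bound x y z = σ ^ x + ((3 + R1 * (4 + σ ^ y * Yq)) + (3 + R2 * (4 + σ ^ z * Lw)))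

  bound≤ : ∀ x y z → bound x y z ≤ V * σ ^ (30 + (x + y + z))
  bound≤ x y z = begin
   σ ^ x + ((3 + R1 * (4 + σ ^ y * Yq)) + (3 + R2 * (4 + σ ^ z * Lw)))
    ≤⟨ +-mono setup (+-mono (+-mono 3≤ swA) (+-mono 3≤ swB)) ⟩
   X + ((X + X) + (X + X)) ≡⟨ lem X ⟩
   5 * X ≤⟨ *-monoˡ X (m≤m+n 5 3 ⟫ 2^≤ 3) ⟩
   σ ^ 3 * X ≡⟨ *-exchange (σ ^ 3) V (σ ^ (27 + k)) ∙ cong (V *_) (sym (^-+ σ 3 (27 + k))) ⟩
   V * σ ^ (30 + k) ∎
   where
   k = x + y + z
   X = V * σ ^ (27 + k)
   lem : ∀ x → x + ((x + x) + (x + x)) ≡ 5 * x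
   lem = ring
   up : ∀ {i} → i ≤ 27 + k → σ ^ i ≤ X
   up i≤ = ^-monoʳ σ i≤ ⟫ m≤n*m (σ ^ (27 + k)) V {{>-nonZero 1≤V}}
   setup : σ ^ x ≤ X
   setup = up ((m≤m+n x y ⟫ m≤m+n (x + y) z) ⟫ m≤n+m k 27)
   3≤ : 3 ≤ X
   3≤ = (m≤m+n 3 1 ⟫ 2^≤ 2) ⟫ up {2} (m≤m+n 2 (25 + k))
   scaled : ∀ R Y j w → 1 ≤ Y → R * Y ≤ V * σ ^ 24 → j ≤ k → w ≡ σ ^ j → R * (4 + w * Y) ≤ X
   scaled R Y j .(σ ^ j) 1≤Y h j≤ refl = begin
    R * (4 + σ ^ j * Y) ≤⟨ *-monoʳ R (+-monoˡ (σ ^ j * Y) (refl ≡⟫ *-monoʳ 4 (*-mono (m^n>0 σ j) 1≤Y)) ⟫≡ five (σ ^ j * Y)) ⟩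
    R * (5 * (σ ^ j * Y)) ≡⟨ lem₁ R (σ ^ j) Y ⟩
    5 * σ ^ j * (R * Y) ≤⟨ *-mono (*-mono (m≤m+n 5 3 ⟫ 2^≤ 3) (^-monoʳ σ j≤)) h ⟩
    σ ^ 3 * σ ^ k * (V * σ ^ 24) ≡⟨ lem₂ (σ ^ 3) (σ ^ k) V (σ ^ 24) ⟩
    V * (σ ^ 3 * σ ^ 24 * σ ^ k) ≡⟨ cong (V *_) (cong (_* σ ^ k) (sym (^-+ σ 3 24)) ∙ sym (^-+ σ 27 k)) ⟩
    X ∎
    where
    five : ∀ a → 4 * a + a ≡ 5 * a
    five = ring
    lem₁ : ∀ r s y → r * (5 * (s * y)) ≡ 5 * s * (r * y)
    lem₁ = ring
    lem₂ : ∀ a b v c → a * b * (v * c) ≡ v * (a * c * b)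
    lem₂ = ring
   swA : R1 * (4 + σ ^ y * Yq) ≤ X
   swA = scaled R1 Yq y (σ ^ y) (1≤2^ cq) (R1Yq≤ ⟫ *-monoʳ V (^-monoʳ σ {22} {24} (m≤m+n 22 2))) (m≤n+m y x ⟫ m≤m+n (x + y) z) refl
   swB : R2 * (4 + σ ^ z * Lw) ≤ X
   swB = scaled R2 Lw z (σ ^ z) (z<s ⟫≡ sym Lw-def) R2Lw≤ (m≤n+m z (x + y)) refl

  -- Of the D = d + 1 factors Gam², one goes into the polynomial, because only multiples of d are
  -- allowed in the exponent of λ'. The others are tenth powers of a power of two that is at most
  -- λ'², whence the exponent 20. Rounding e down costs the factor 2^100.
  bound-100 : ∀ λ' x y z → 1 + lam1 ≤ λ' → let c = 30 + (x + y + z) in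
   bound x y z ^ 100 ≤ 2 ^ (86 * n) * (σ ^ (21 + c) * λ' ^ (20 * (D ∸ 1))) ^ 100
  bound-100 λ' x y z lam< = begin
   bound x y z ^ 100 ≤⟨ ^-monoˡ 100 (bound≤ x y z) ⟩
   (Q * 2 ^ U * σ ^ c) ^ 100 ≡⟨ cong (_^ 100) (lem₁ Q (2 ^ U) (σ ^ c)) ⟩
   (2 ^ U * (Q * σ ^ c)) ^ 100 ≡⟨ ^-distribʳ-* 100 (2 ^ U) (Q * σ ^ c) ⟩
   (2 ^ U) ^ 100 * (Q * σ ^ c) ^ 100 ≤⟨ *-mono 2^U (^-monoˡ 100 (*-monoˡ (σ ^ c) Q≤)) ⟩
   2 ^ (86 * n) * 2 ^ 100 * (σ ^ 20 * L * σ ^ c) ^ 100 ≡⟨ *-assoc (2 ^ (86 * n)) (2 ^ 100) _ ∙ cong (2 ^ (86 * n) *_) (sym (^-distribʳ-* 100 2 (σ ^ 20 * L * σ ^ c))) ⟩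
   2 ^ (86 * n) * (2 * (σ ^ 20 * L * σ ^ c)) ^ 100 ≤⟨ *-monoʳ (2 ^ (86 * n)) (^-monoˡ 100 (*-monoˡ _ 2≤σ ⟫≡ lem₂ σ (σ ^ 20) L (σ ^ c) ∙ cong (_* L) (sym (^-+ σ 21 c)))) ⟩
   2 ^ (86 * n) * (σ ^ (21 + c) * L) ^ 100 ∎
   where
   c = 30 + (x + y + z)
   d = D ∸ 1
   L = λ' ^ (20 * d)
   ^-distribʳ-* : ∀ k a b → (a * b) ^ k ≡ a ^ k * b ^ k
   ^-distribʳ-* zero a b = refl
   ^-distribʳ-* (suc k) a b = cong (a * b *_) (^-distribʳ-* k a b) ∙ lem a b (a ^ k) (b ^ k)
    where
    lem : ∀ a b x y → a * b * (x * y) ≡ a * x * (b * y)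
    lem = ring
   lem₁ : ∀ q u s → q * u * s ≡ u * (q * s)
   lem₁ = ring
   lem₂ : ∀ s t l r → s * (t * l * r) ≡ s * t * r * l
   lem₂ = ring
   2^U : (2 ^ U) ^ 100 ≤ 2 ^ (86 * n) * 2 ^ 100
   2^U = ^-*-assoc 2 U 100 ≡⟫ ^-monoʳ 2 exponent ⟫≡ ^-+ 2 (86 * n) 100
    where
    exponent : U * 100 ≤ 86 * n + 100
    exponent = +-cancelʳ-≤ (e * 100) _ _ (begin
     U * 100 + e * 100 ≡⟨ *-distribʳ-+ 100 U e ⟨
     (U + e) * 100 ≡⟨ cong (_* 100) (m∸n+n≡m e≤n) ⟩
     n * 100 ≡⟨ lem n ⟩
     86 * n + 14 * n ≤⟨ +-monoʳ (86 * n) ((m≡m%n+[m/n]*n (14 * n) 100) ≡⟫ +-monoˡ (e * 100) (<⇒≤ (m%n<n (14 * n) 100))) ⟩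
     86 * n + (100 + e * 100) ≡⟨ +-assoc (86 * n) 100 _ ⟨
     86 * n + 100 + e * 100 ∎)
     where
     lem : ∀ n → n * 100 ≡ 86 * n + 14 * n
     lem = ring
   Gam≡ : Gam ≡ (2 ^ digits lam1) ^ 5
   Gam≡ = cong (2 ^_) (*-comm 5 (digits lam1)) ∙ sym (^-*-assoc 2 (digits lam1) 5)
   square : Gam * Gam ≡ (2 ^ digits lam1) ^ 10
   square = cong₂ _*_ Gam≡ Gam≡ ∙ sym (^-+ (2 ^ digits lam1) 5 5)
   below : ∀ x → 1 + x ≤ λ' → 2 ^ digits x ≤ λ' ^ 2
   below zero h = ^-monoˡ 2 h
   below (suc x) h = snd (digits-bounds (suc x)) z<s ⟫ pad (lem x) ⟫ ^-monoˡ 2 h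
    where
    lem : ∀ x → 2 * suc x + (2 + 2 * x + x * x) ≡ (2 + x) * ((2 + x) * 1)
    lem = ring
   Q≤ : Q ≤ σ ^ 20 * L
   Q≤ = *-mono {Gam * Gam} {σ ^ 20} {(Gam * Gam) ^ d} {L}
    (square ≡⟫ ^-monoˡ 10 (power-digits lam1≤) ⟫≡ ^-*-assoc σ 2 10)
    (^-monoˡ d (square ≡⟫ ^-monoˡ 10 (below lam1 lam<) ⟫≡ ^-*-assoc λ' 2 10) ⟫≡ ^-*-assoc λ' 20 d)

-- Counting the random words with correct guesses.

record GuessWords : Set where
 constructor guessWords
 field
  g Gm K₂ qΓ qK M : ℕ
  M≡Γ : M ≡ qΓ * Gm
  M≡K : M ≡ qK * K₂
  τ : ℕ → ℕ
  κ : ℕ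
  τ< : ∀ i → i < g → τ i < Gm
  κ< : κ < K₂

module Words (ctx : GuessWords) where

 open GuessWords ctx

 guesses : ∀ s F C c →
  (∀ us y → length us ≡ g → (∀ i → i < g → nth 0 us i mod Gm ≡ τ i) → y mod K₂ ≡ κ → c ≤ C * 𝕊 s M (λ zs → F (us ++ y ∷ zs))) →
  M ^ g * (M * c) ≤ Gm ^ g * K₂ * C * 𝕊 (g + suc s) M F
 guesses s F C c h = begin
  M ^ g * (M * c) ≡⟨ cong₂ (λ x y → x ^ g * (y * c)) M≡Γ M≡K ⟩
  (qΓ * Gm) ^ g * (qK * K₂ * c) ≡⟨ cong (_* (qK * K₂ * c)) (^-distribʳ-* g) ⟩
  qΓ ^ g * Gm ^ g * (qK * K₂ * c) ≡⟨ lem (qΓ ^ g) (Gm ^ g) qK K₂ c ⟩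
  Gm ^ g * K₂ * (qΓ ^ g * (qK * c)) ≤⟨ *-monoʳ (Gm ^ g * K₂) all ⟩
  Gm ^ g * K₂ * (C * 𝕊 (g + suc s) M F) ≡⟨ *-assoc (Gm ^ g * K₂) C _ ⟨
  Gm ^ g * K₂ * C * 𝕊 (g + suc s) M F ∎
  where
  ^-distribʳ-* : ∀ k → (qΓ * Gm) ^ k ≡ qΓ ^ k * Gm ^ k
  ^-distribʳ-* zero = refl
  ^-distribʳ-* (suc k) = cong (qΓ * Gm *_) (^-distribʳ-* k) ∙ *-interchange qΓ Gm (qΓ ^ k) (Gm ^ k)
  lem : ∀ a b c d e → a * b * (c * d * e) ≡ b * d * (a * (c * e))
  lem = ring
  all : qΓ ^ g * (qK * c) ≤ C * 𝕊 (g + suc s) M F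
  all = (guess g qΓ Gm M τ (λ us → C * 𝕊 (suc s) M (λ zs → F (us ++ zs))) (qK * c) M≡Γ τ< λ us size≡ good →
   (residue-hit qK K₂ M (λ y → C * 𝕊 s M (λ zs → F (us ++ y ∷ zs))) κ c M≡K κ< λ y e → h us y size≡ good e) ⟫≡
    ∑-*ˡ M C _) ⟫≡
   𝕊-*ˡ g M C _ ∙ cong (C *_) (sym (𝕊-split g (suc s) M F))

nonzero-scale : ∀ x {a b} → x ≤ 1 → (x ≢ 0 → a ≤ b) → x * a ≤ b
nonzero-scale zero x≤ h = z≤n
nonzero-scale (suc zero) x≤ h = n+0≡n _ ≡⟫ (h λ ())
nonzero-scale (suc (suc _)) (s≤s ()) h

record PrimeGuesses : Set where
 constructor primeGuesses
 field
  Yp Yq K₂ qp qq qK M cp cq : ℕ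
  M≡p : M ≡ qp * Yp
  M≡q : M ≡ qq * Yq
  M≡K : M ≡ qK * K₂
  good : ℕ → ℕ
  good' : ℕ → ℕ → ℕ
  k : ℕ → ℕ
  k< : ∀ p → k p < K₂ ⊎ good p ≡ 0
  good≤ : ∀ p → good p ≤ 1
  good'≤ : ∀ p q → good' p q ≤ 1
  many : Yp ≤ 2 * cp * ∑ Yp good
  many' : ∀ p → p < Yp → good p ≢ 0 → Yq ≤ 2 * cq * ∑ Yq (good' p)

module PrimeWords (ctx : PrimeGuesses) where

 open PrimeGuesses ctx

 -- A good p has probability at least 1 / (2 cp), then a q good for this p at least 1 / (2 cq), and
 -- the right k exactly 1 / K₂.
 primes : ∀ s F →
  (∀ x y z zs → good (x mod Yp) ≢ 0 → good' (x mod Yp) (y mod Yq) ≢ 0 → z mod K₂ ≡ k (x mod Yp) → 1 ≤ F (x ∷ y ∷ z ∷ zs)) →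
  M ^ suc (suc (suc s)) ≤ K₂ * (4 * cp * cq) * 𝕊 (3 + s) M F
 primes s F h = begin
  M * (M * (M * M ^ s)) ≡⟨ cong₂ (λ x y → x * (M * (y * M ^ s))) M≡p M≡K ⟩
  qp * Yp * (M * (qK * K₂ * M ^ s)) ≡⟨ lem₁ qp Yp M qK K₂ (M ^ s) ⟩
  Yp * (K₂ * (qp * (M * (qK * M ^ s)))) ≤⟨ *-monoˡ _ many ⟩
  2 * cp * ∑ Yp good * (K₂ * (qp * (M * (qK * M ^ s)))) ≡⟨ lem₂ cp (∑ Yp good) K₂ qp (M * (qK * M ^ s)) ⟩
  K₂ * (2 * cp) * (qp * (∑ Yp good * (M * (qK * M ^ s)))) ≤⟨ *-monoʳ (K₂ * (2 * cp)) outer ⟩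
  K₂ * (2 * cp) * (2 * cq * 𝕊 (3 + s) M F) ≡⟨ lem₃ K₂ cp cq (𝕊 (3 + s) M F) ⟩
  K₂ * (4 * cp * cq) * 𝕊 (3 + s) M F ∎
  where
  lem₁ : ∀ a y m b k z → a * y * (m * (b * k * z)) ≡ y * (k * (a * (m * (b * z))))
  lem₁ = ring
  lem₂ : ∀ c g k a z → 2 * c * g * (k * (a * z)) ≡ k * (2 * c) * (a * (g * z))
  lem₂ = ring
  lem₃ : ∀ k a b s → k * (2 * a) * (2 * b * s) ≡ k * (4 * a * b) * s
  lem₃ = ring
  lem₄ : ∀ a y b c → a * y * (b * c) ≡ y * (a * (b * c))
  lem₄ = ring
  lem₅ : ∀ c g a z → 2 * c * g * (a * z) ≡ 2 * c * (a * (g * z))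
  lem₅ = ring
  last : ∀ x y → good (x mod Yp) ≢ 0 → good' (x mod Yp) (y mod Yq) ≢ 0 → qK * M ^ s ≤ ∑ M (λ z → 𝕊 s M (λ zs → F (x ∷ y ∷ z ∷ zs)))
  last x y gp gq with k< (x mod Yp)
  ... | inj₂ e = ⊥-elim (gp e)
  ... | inj₁ kp< = residue-hit qK K₂ M _ (k (x mod Yp)) (M ^ s) M≡K kp< λ z e →
   sym (𝕊-const s M 1 ∙ n*1≡n _) ≡⟫ (𝕊-mono s λ zs _ → h x y z zs gp gq e)
  inner : ∀ x → x mod Yp < Yp → good (x mod Yp) ≢ 0 → M * (qK * M ^ s) ≤ 2 * cq * 𝕊 (2 + s) M (λ zs → F (x ∷ zs))
  inner x x< gp = begin
   M * (qK * M ^ s) ≡⟨ cong (_* (qK * M ^ s)) M≡q ⟩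
   qq * Yq * (qK * M ^ s) ≡⟨ lem₄ qq Yq qK (M ^ s) ⟩
   Yq * (qq * (qK * M ^ s)) ≤⟨ *-monoˡ _ (many' (x mod Yp) x< gp) ⟩
   2 * cq * ∑ Yq (good' (x mod Yp)) * (qq * (qK * M ^ s)) ≡⟨ lem₅ cq _ qq (qK * M ^ s) ⟩
   2 * cq * (qq * (∑ Yq (good' (x mod Yp)) * (qK * M ^ s))) ≡⟨ cong (λ z → 2 * cq * (qq * z)) (sym (∑-*ʳ Yq (qK * M ^ s) _)) ⟩
   2 * cq * (qq * ∑ Yq (λ q → good' (x mod Yp) q * (qK * M ^ s))) ≤⟨ *-monoʳ (2 * cq) (residue qq Yq M _ _ M≡q λ { y r _ refl → nonzero-scale (good' (x mod Yp) (y mod Yq)) (good'≤ (x mod Yp) (y mod Yq)) (last x y gp) }) ⟩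
   2 * cq * 𝕊 (2 + s) M (λ zs → F (x ∷ zs)) ∎
  outer : qp * (∑ Yp good * (M * (qK * M ^ s))) ≤ 2 * cq * 𝕊 (3 + s) M F
  outer = begin
   qp * (∑ Yp good * (M * (qK * M ^ s))) ≡⟨ cong (qp *_) (sym (∑-*ʳ Yp _ good)) ⟩
   qp * ∑ Yp (λ p → good p * (M * (qK * M ^ s))) ≤⟨ residue qp Yp M _ _ M≡p (λ { x r r< refl → nonzero-scale (good (x mod Yp)) (good≤ (x mod Yp)) (inner x r<) }) ⟩
   ∑ M (λ x → 2 * cq * 𝕊 (2 + s) M (λ zs → F (x ∷ zs))) ≡⟨ ∑-*ˡ M (2 * cq) _ ⟩
   2 * cq * 𝕊 (3 + s) M F ∎

∑-lt : ∀ n c → ∑ n (λ i → lt i c) ≤ c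
∑-lt zero c = z≤n
∑-lt (suc n) c with <-≤-connex n c
... | inj₁ n<c = +-mono (∑-≤-const n 1 λ i _ → m∸n≤m 1 (1 + i ∸ c)) (m∸n≤m 1 (1 + n ∸ c)) ⟫ cong (_+ 1) (n*1≡n n) ∙ +-comm n 1 ≡⟫ n<c
... | inj₂ c≤n = cong (∑ n (λ i → lt i c) +_) (lt-no c≤n) ∙ n+0≡n _ ≡⟫ ∑-lt n c

pick : ℕ → ℕ → ℕ → ℕ
pick zero a b = a
pick (suc _) a b = b

-- Words 2j and 2j + 1 guess the level and the slack of row j.
interleave : (ℕ → ℕ) → (ℕ → ℕ) → ℕ → ℕ
interleave f g i = pick (i % 2) (f (i / 2)) (g (i / 2))

interleave-even : ∀ f g j → interleave f g (2 * j) ≡ f j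
interleave-even f g j = cong₂ (λ r h → pick r (f h) (g h)) ([b+2x]%2 false j) ([b+2x]/2 false j)

interleave-odd : ∀ f g j → interleave f g (2 * j + 1) ≡ g j
interleave-odd f g j = cong (interleave f g) (+-comm (2 * j) 1) ∙ cong₂ (λ r h → pick r (f h) (g h)) ([b+2x]%2 true j) ([b+2x]/2 true j)

dot-mod : ∀ {n} (w : ℕ → ℕ) p .{{_ : NonZero p}} (y : Vec Bool n) → dot (λ v → w v mod p) y % p ≡ dot w y % p
dot-mod w p [] = refl
dot-mod w p (false ∷ y) = dot-mod (shift w) p y
dot-mod w p (true ∷ y) = %-distribˡ-+ (w 0 mod p) (dot (λ v → shift w v mod p) y) p ∙ cong₂ (λ a b → (a + b) % p) (cong (_% p) (mod-% (w 0) p) ∙ m%n%n≡m%n (w 0) p) (dot-mod (shift w) p y) ∙ sym (%-distribˡ-+ (w 0) (dot (shift w) y) p)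

dot-chosen-zero : ∀ n (w : ℕ → ℕ) → ∑ n (λ u → bit 0 u * w u) ≡ 0
dot-chosen-zero n w = (∑-cong' n λ u → cong (λ q → q % 2 * w u) (quo-/ 0 (2 ^ u) {{m^n≢0 2 u}} ∙ 0/n≡0 (2 ^ u) {{m^n≢0 2 u}})) ∙ ∑-zero n

[]-nonzero : ∀ {A : Set} (d : Dec A) → 𝟙[ d ] ≢ 0 → A
[]-nonzero (yes a) h = a
[]-nonzero (no _) h = ⊥-elim (h refl)

monus-nonzero : ∀ a b c → a ≤ 1 → a ∸ (b + c) ≢ 0 → a ≢ 0 × b ≡ 0 × c ≡ 0
monus-nonzero a zero zero a≤ h = h , refl , refl
monus-nonzero a zero (suc c) a≤ h = ⊥-elim (h (m≤n⇒m∸n≡0 (a≤ ⟫ z<s)))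
monus-nonzero a (suc b) c a≤ h = ⊥-elim (h (m≤n⇒m∸n≡0 (a≤ ⟫ z<s)))

lt-zero : ∀ i c → lt i c ≡ 0 → c ≤ i
lt-zero i c e with <-≤-connex i c
... | inj₂ c≤i = c≤i
... | inj₁ i<c with () ← sym e ∙ lt-yes i<c

digits≤ : ∀ x → digits x ≤ x
digits≤ x = digits-≤ {x} (n<2^n x)

-- Prime counting gives about Y / c candidates; if the exceptions r take at most half of this, Y /
-- (2c) good ones remain.
majority : ∀ {Y} c s r → Y ≤ 2 + c * (s + r) → 2 * (2 + c * r) ≤ Y → Y ≤ 2 * c * s
majority {Y} c s r h h' = +-cancelʳ-≤ Y Y (2 * c * s) (begin
 Y + Y ≤⟨ +-mono h h ⟩
 2 + c * (s + r) + (2 + c * (s + r)) ≡⟨ lem c s r ⟩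
 2 * c * s + 2 * (2 + c * r) ≤⟨ +-monoʳ (2 * c * s) h' ⟩
 2 * c * s + Y ∎)
 where
 lem : ∀ c s r → 2 + c * (s + r) + (2 + c * (s + r)) ≡ 2 * c * s + 2 * (2 + c * r)
 lem = ring

cube-bound : ∀ t → 9 ≤ t → 4 + 8 * (t * t) ≤ suc t ^ 3
cube-bound t 9≤ = begin
 4 + 8 * (t * t) ≤⟨ +-monoˡ (8 * (t * t)) ((m≤m+n 4 5 ⟫ 9≤) ⟫ m≤m*n t t {{>-nonZero (z<s ⟫ 9≤)}}) ⟩
 9 * (t * t) ≤⟨ *-monoˡ (t * t) 9≤ ⟩
 t * (t * t) ≡⟨ cong (λ z → t * (t * z)) (sym (n*1≡n t)) ⟩
 t ^ 3 ≤⟨ ^-monoˡ 3 (n≤1+n t) ⟩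
 suc t ^ 3 ∎

quartic-bound : ∀ t → 32 ≤ t → 4 + 16 * (t * (t * t + 2 * t + 2)) ≤ suc t ^ 4
quartic-bound t 32≤ = begin
 4 + 16 * (t * (t * t + 2 * t + 2)) ≤⟨ +-mono (m≤m+n 4 28 ⟫ m≤m*n 32 (S * S)) (*-monoʳ 16 (*-monoʳ t (m≤m+n _ (t * t + 2 * t) ⟫≡ lem₁ t))) ⟩
 32 * (S * S) + 16 * (t * (2 * (S * S))) ≡⟨ lem₂ t (S * S) ⟩
 32 * (S * (S * S)) ≤⟨ *-monoˡ (S * (S * S)) (32≤ ⟫ n≤1+n t) ⟩
 S * (S * (S * S)) ≡⟨ cong (λ z → S * (S * (S * z))) (sym (n*1≡n S)) ⟩
 S ^ 4 ∎
 where
 S = suc t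
 lem₁ : ∀ t → t * t + 2 * t + 2 + (t * t + 2 * t) ≡ 2 * (suc t * suc t)
 lem₁ = ring
 lem₂ : ∀ t s → 32 * s + 16 * (t * (2 * s)) ≡ 32 * (suc t * s)
 lem₂ = ring

-- The first trial: solutions modulo two random primes.

-- The weights modulo a prime p, where the target is reached with a multiple k* p of p.
record HiddenSum : Set where
 constructor hiddenSum
 field
  n : ℕ
  w : ℕ → ℕ
  t b : ℕ
  t< : t < 2 ^ b
  w< : ∀ y → dot {n} w y < 2 ^ b
  x : Vec Bool n
  hits : dot w x ≡ t
  NN K2 U lbb W : ℕ
  NN≥ : 2 ^ n ≤ NN
  n<K2 : n < K2
  1≤n : 1 ≤ n

module ModuloPrimes (ctx : HiddenSum) where

 open HiddenSum ctx

 open Separate n w t b t< w< public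

 bb cp cq Yp Yq : ℕ
 bb = b + n + 32
 cp = U + 3 * lbb
 cq = cp + 4 * lbb
 Yp = 2 ^ cp
 Yq = 2 ^ cq

 wp : ℕ → ℕ → ℕ
 wp p v = w v mod p

 k* Tp : ℕ → ℕ
 k* p = dot (wp p) x quo p
 Tp p = t mod p + k* p * p

 module R (p : ℕ) = Reduce n (wp p) (Tp p) NN NN≥

 -- Two reasons disqualify q: sums of residues modulo p reach up to n p and must stay below q - 1
 -- for the extraction, and q must not mislead the self-reduction.
 others good' : ℕ → ℕ → ℕ
 others p q = lt q (n * p + 2) + R.bad p n 0 q
 good' p q = 𝟙[ prime? q ] ∸ others p q

 good'≤ : ∀ p q → good' p q ≤ 1
 good'≤ p q = (m∸n≤m 𝟙[ prime? q ] (others p q)) ⟫ ([]≤1 (prime? q))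

 module _ (p : ℕ) (pp : Prime p) where

  private instance
   p≢0 : NonZero p
   p≢0 = prime⇒nonZero pp

  wp≤ : ∀ u → wp p u ≤ p
  wp≤ u = mod-% (w u) p ≡⟫ <⇒≤ (m%n<n (w u) p)

  dot-wp≤ : ∀ {v} (y : Vec Bool v) → v ≤ n → dot (wp p) y ≤ n * p
  dot-wp≤ y v≤ = (dot≤ p y λ u _ → wp≤ u) ⟫ *-monoˡ p v≤

  k*<K2 : k* p < K2
  k*<K2 = ≤-<-trans (quo-/ (dot (wp p) x) p ≡⟫ /-monoˡ-≤ p (dot-wp≤ x ≤-refl) ⟫≡ m*n/n≡m n p) n<K2

  Tp≡ : dot (wp p) x ≡ Tp p
  Tp≡ = (m≡m%n+[m/n]*n (dot (wp p) x) p) ∙ cong₂ (λ a b → a + b * p)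
   (dot-mod w p x ∙ cong (_% p) hits ∙ sym (mod-% t p)) (sym (quo-/ (dot (wp p) x) p))

  Tp≤ : Tp p ≤ n * p
  Tp≤ = sym Tp≡ ≡⟫ dot-wp≤ x ≤-refl

  start : R.Inv p n 0
  start = 0 , sym (*-zeroʳ (2 ^ n)) , 1≤2^ n , x , cong (dot (wp p) x +_) (dot-chosen-zero n (wp p)) ∙ n+0≡n _ ∙ Tp≡

  residue-target : ∀ y → dot (wp p) y ≡ Tp p → dot {n} w y % p ≡ t % p
  residue-target y h = sym (dot-mod w p y) ∙ cong (_% p) h ∙ ([m+kn]%n≡m%n (t mod p) (k* p) p) ∙
   cong (_% p) (mod-% t p) ∙ m%n%n≡m%n t p

 k< : ∀ p → k* p < K2 ⊎ good p ≡ 0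
 k< p with good p ≟ 0
 ... | yes e = inj₂ e
 ... | no ne = inj₁ (k*<K2 p (good-prime p ne))

 pw : ℕ → ℕ → ℕ → ℕ
 pw x e q = iterate↓ W (λ i a → (a * a * (bit e i * x + (1 ∸ bit e i))) mod q ⊓ Yq) 1

 ext : ℕ → (ℕ → ℕ) → ℕ → ℕ → ℕ
 ext q w v τ = ∑ Yq (λ x → lt x q * (pw x (q ∸ 1 ∸ τ) q * ∏ n (λ u → 1 + lt u v * pw x (w u) q))) mod q

 ext-cong : ∀ {q q'} {w w' : ℕ → ℕ} v {τ τ'} → q ≡ q' → (∀ u → w u ≡ w' u) → τ ≡ τ' → ext q w v τ ≡ ext q' w' v τ'
 ext-cong {q} v {τ} refl h refl = cong (_mod q) (∑-cong' Yq λ x → cong (λ P → lt x q * (pw x (q ∸ 1 ∸ τ) q * P))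
  (∏-cong n λ u _ → cong (λ e → 1 + lt u v * pw x e q) (h u)))

 solve : (q : ℕ) → (ℕ → ℕ) → ℕ → ℕ
 solve q w T = iterate↓ n (λ v mask → (mask + 2 ^ v * (1 ∸ ext q w v (T ∸ ∑ n (λ u → bit mask u * w u)))) ⊓ NN) 0

 solve-cong : ∀ {q q'} {w w' : ℕ → ℕ} {T T'} → q ≡ q' → (∀ u → w u ≡ w' u) → T ≡ T' → solve q w T ≡ solve q' w' T'
 solve-cong q≡ w≡ refl = iterate↓-cong n 0 λ v mask v< → cong (λ d → (mask + 2 ^ v * (1 ∸ d)) ⊓ NN)
  (ext-cong v q≡ w≡ (cong (_ ∸_) (∑-cong' n λ u → cong (bit mask u *_) (w≡ u))))

 module _ (cq≤W : cq ≤ W) (p q : ℕ) (gp : good p ≢ 0) (gq : good' p q ≢ 0) (q≤ : q ≤ Yq) where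

  private
   pp : Prime p
   pp = good-prime p gp

   parts : 𝟙[ prime? q ] ≢ 0 × lt q (n * p + 2) ≡ 0 × R.bad p n 0 q ≡ 0
   parts = monus-nonzero 𝟙[ prime? q ] (lt q (n * p + 2)) (R.bad p n 0 q) ([]≤1 (prime? q)) gq

   qp : Prime q
   qp = []-nonzero (prime? q) (fst parts)

   below : ∀ {z} → z ≤ n * p → suc z < q
   below {z} h = s≤s (s≤s h) ⟫ +-comm 2 (n * p) ≡⟫ lt-zero q (n * p + 2) (fst (snd parts))

   module X = Extraction n W Yq q qp q≤ (^-monoʳ 2 cq≤W) (wp p) (Tp p) (below (Tp≤ p pp))
    (λ u u< → <-trans (n<1+n (wp p u)) (below (wp≤ p pp u ⟫ m≤n*m p n {{>-nonZero 1≤n}})))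
    (λ v v< y → below (dot-wp≤ p pp y (<⇒≤ v<)))

   found : dot (wp p) (toVec n (solve q (wp p) (Tp p))) ≡ Tp p
   found = R.reduce-correct p X.test q qp X.test-spec n 0 ≤-refl (start p pp) (snd (snd parts))

  solved : dot w (toVec n (solve q (wp p) (Tp p))) ≡ t
  solved = good-separates p gp pp (toVec n (solve q (wp p) (Tp p))) (residue-target p pp (toVec n (solve q (wp p) (Tp p))) found)

 module _ (few : 𝔹 n (Transversal.A n (dot w)) ≤ 2 ^ U) (bb<Λ : suc bb ≤ 2 ^ lbb) (lbb≤ : lbb ≤ bb) (U≤n : U ≤ n) where

  private
   32≤bb : 32 ≤ bb
   32≤bb = m≤n+m 32 (b + n)

   9≤bb : 9 ≤ bb
   9≤bb = m≤m+n 9 23 ⟫ 32≤bb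

   b≤bb : b ≤ bb
   b≤bb = m≤m+n b n ⟫ m≤m+n (b + n) 32

   n≤bb : n ≤ bb
   n≤bb = m≤n+m n b ⟫ m≤m+n (b + n) 32

   cp≤ : cp ≤ 4 * bb
   cp≤ = +-mono (U≤n ⟫ n≤bb) (*-monoʳ 3 lbb≤)

   cq≤ : cq ≤ 8 * bb
   cq≤ = +-mono cp≤ (*-monoʳ 4 lbb≤) ⟫≡ lem bb
    where
    lem : ∀ t → 4 * t + 4 * t ≡ 8 * t
    lem = ring

   power-lbb : ∀ k → suc bb ^ k ≤ 2 ^ (k * lbb)
   power-lbb k = ^-monoˡ k bb<Λ ⟫≡ ^-*-assoc 2 lbb k ∙ cong (2 ^_) (*-comm lbb k)

   lbb≥1 : 1 ≤ lbb
   lbb≥1 = go lbb bb<Λ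
    where
    go : ∀ l → suc bb ≤ 2 ^ l → 1 ≤ l
    go zero h = ⊥-elim (<⇒≱ (s≤s (z<s ⟫ m≤n+m 32 (b + n))) h)
    go (suc _) _ = z<s

   1≤cp : 1 ≤ cp
   1≤cp = lbb≥1 ⟫ m≤n*m lbb 3 ⟫ m≤n+m (3 * lbb) U

   1≤cq : 1 ≤ cq
   1≤cq = 1≤cp ⟫ m≤m+n cp _

  many : Yp ≤ 2 * cp * ∑ Yp good
  many = majority cp (∑ Yp good) (𝔹 n (Transversal.A n (dot w)) * b) (many-good cp 1≤cp) (begin
   2 * (2 + cp * (𝔹 n (Transversal.A n (dot w)) * b)) ≤⟨ *-monoʳ 2 (+-mono (*-monoʳ 2 (1≤2^ U)) (*-mono cp≤ (*-mono few b≤bb))) ⟩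
   2 * (2 * 2 ^ U + 4 * bb * (2 ^ U * bb)) ≡⟨ lem₁ (2 ^ U) bb ⟩
   2 ^ U * (4 + 8 * (bb * bb)) ≤⟨ *-monoʳ (2 ^ U) (cube-bound bb 9≤bb) ⟩
   2 ^ U * suc bb ^ 3 ≤⟨ *-monoʳ (2 ^ U) (power-lbb 3) ⟩
   2 ^ U * 2 ^ (3 * lbb) ≡⟨ ^-+ 2 U (3 * lbb) ⟨
   Yp ∎)
   where
   lem₁ : ∀ u t → 2 * (2 * u + 4 * t * (u * t)) ≡ u * (4 + 8 * (t * t))
   lem₁ = ring

  many' : ∀ p → p < Yp → good p ≢ 0 → Yq ≤ 2 * cq * ∑ Yq (good' p)
  many' p p< gp = majority cq (∑ Yq (good' p)) ((n * Yp + 2) + n * suc n) (prime-count cq 1≤cq ⟫ +-monoʳ 2 (*-monoʳ cq primes≤)) (begin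
   2 * (2 + cq * ((n * Yp + 2) + n * suc n)) ≤⟨ *-monoʳ 2 (+-mono (*-monoʳ 2 (1≤2^ cp)) (*-mono cq≤ (+-mono (+-mono (*-monoˡ Yp n≤bb) (*-monoʳ 2 (1≤2^ cp))) n²≤))) ⟩
   2 * (2 * Yp + 8 * bb * ((bb * Yp + 2 * Yp) + bb * suc bb * Yp)) ≡⟨ lem₁ Yp bb ⟩
   Yp * (4 + 16 * (bb * (bb * bb + 2 * bb + 2))) ≤⟨ *-monoʳ Yp (quartic-bound bb 32≤bb) ⟩
   Yp * suc bb ^ 4 ≤⟨ *-monoʳ Yp (power-lbb 4) ⟩
   Yp * 2 ^ (4 * lbb) ≡⟨ ^-+ 2 cp (4 * lbb) ⟨
   Yq ∎)
   where
   lem₁ : ∀ y t → 2 * (2 * y + 8 * t * ((t * y + 2 * y) + t * suc t * y)) ≡ y * (4 + 16 * (t * (t * t + 2 * t + 2)))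
   lem₁ = ring
   n²≤ : n * suc n ≤ bb * suc bb * Yp
   n²≤ = *-mono n≤bb (s≤s n≤bb) ⟫ m≤m*n (bb * suc bb) Yp {{>-nonZero (1≤2^ cp)}}
   primes≤ : ∑ Yq (λ q → 𝟙[ prime? q ]) ≤ ∑ Yq (good' p) + ((n * Yp + 2) + n * suc n)
   primes≤ = (∑-mono Yq λ q _ → (m≤n+m∸n 𝟙[ prime? q ] (others p q)) ⟫≡ +-comm (others p q) (good' p q)) ⟫
    ∑-+ Yq (good' p) (others p) ≡⟫ +-monoʳ (∑ Yq (good' p)) (∑-+ Yq (λ q → lt q (n * p + 2)) (R.bad p n 0) ≡⟫
     +-mono (∑-lt Yq (n * p + 2) ⟫ +-monoˡ 2 (*-monoʳ n (<⇒≤ p<))) (R.bad-total p Yq n 0 ≤-refl))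

-- Balanced splittings with few collisions.

halves : ∀ n → ∃ λ h → (n ≡ h + h × (n + 1) / 2 ≡ h) ⊎ (n ≡ suc h + h × (n + 1) / 2 ≡ suc h)
halves zero = 0 , inj₁ (refl , refl)
halves (suc n) with halves n
... | h , inj₁ (e , q) = h , inj₂ (cong suc e , cong (_/ 2) {suc n + 1} {2 * suc h} (cong (λ k → suc (k + 1)) e ∙ lem h) ∙ ([b+2x]/2 false (suc h)))
 where
 lem : ∀ h → suc (h + h + 1) ≡ 2 * suc h
 lem = ring
... | h , inj₂ (e , q) = suc h , inj₁ (cong suc e ∙ cong suc (sym (+-suc h h)) , cong (_/ 2) {suc n + 1} {1 + 2 * suc h} (cong (λ k → suc k + 1) e ∙ lem h) ∙ ([b+2x]/2 true (suc h)))
 where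
 lem : ∀ h → suc (suc h + h) + 1 ≡ 1 + 2 * suc h
 lem = ring

^-distrib : ∀ k a b → (a * b) ^ k ≡ a ^ k * b ^ k
^-distrib zero a b = refl
^-distrib (suc k) a b = cong (a * b *_) (^-distrib k a b) ∙ *-interchange a b (a ^ k) (b ^ k)

^-exchange : ∀ a m n → (a ^ m) ^ n ≡ (a ^ n) ^ m
^-exchange a m n = ^-*-assoc a m n ∙ cong (a ^_) (*-comm m n) ∙ sym (^-*-assoc a n m)

root : ∀ k {x y} → x ^ suc k ≤ y ^ suc k → x ≤ y
root k h = ≮⇒≥ λ lt → <⇒≱ (^-monoˡ-< (suc k) lt) h

-- Here the constant 0.86 = 1 - 0.14 enters.
constant : 8 ^ 14 * 170 ^ 100 ≤ 36 ^ 100 * 40 ^ 50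
constant = ≤ᵇ⇒≤ (8 ^ 14 * 170 ^ 100) (36 ^ 100 * 40 ^ 50) tt

-- Taking 100th powers removes the fractional exponents, and h ≤ h' makes 8^h' 5^h at least
-- 40^(n/2).
balance : ∀ n e h h' → e * 100 ≤ 14 * n → h + h' ≡ n → h ≤ h' → 8 ^ e * 170 ^ n ≤ 36 ^ n * (8 ^ h' * 5 ^ h)
balance n e h h' e≤ h+h' h≤h' = root 99 (begin
 (8 ^ e * 170 ^ n) ^ 100 ≡⟨ ^-distrib 100 (8 ^ e) (170 ^ n) ⟩
 (8 ^ e) ^ 100 * (170 ^ n) ^ 100 ≤⟨ *-mono (^-*-assoc 8 e 100 ≡⟫ ^-monoʳ 8 e≤) (≤-reflexive (^-exchange 170 n 100)) ⟩
 8 ^ (14 * n) * (170 ^ 100) ^ n ≡⟨ cong (_* (170 ^ 100) ^ n) (sym (^-*-assoc 8 14 n)) ⟩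
 (8 ^ 14) ^ n * (170 ^ 100) ^ n ≡⟨ ^-distrib n (8 ^ 14) (170 ^ 100) ⟨
 (8 ^ 14 * 170 ^ 100) ^ n ≤⟨ ^-monoˡ n constant ⟩
 (36 ^ 100 * 40 ^ 50) ^ n ≡⟨ ^-distrib n (36 ^ 100) (40 ^ 50) ⟩
 (36 ^ 100) ^ n * (40 ^ 50) ^ n ≡⟨ cong₂ _*_ (^-exchange 36 100 n) (^-exchange 40 50 n) ⟩
 (36 ^ n) ^ 100 * (40 ^ n) ^ 50 ≤⟨ *-monoʳ ((36 ^ n) ^ 100) (^-monoˡ 50 forty) ⟩
 (36 ^ n) ^ 100 * (Y ^ 2) ^ 50 ≡⟨ cong ((36 ^ n) ^ 100 *_) (^-*-assoc Y 2 50) ⟩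
 (36 ^ n) ^ 100 * Y ^ 100 ≡⟨ ^-distrib 100 (36 ^ n) Y ⟨
 (36 ^ n * Y) ^ 100 ∎)
 where
 Y = 8 ^ h' * 5 ^ h
 forty : 40 ^ n ≤ Y ^ 2
 forty = begin
  40 ^ n ≡⟨ ^-distrib n 8 5 ⟩
  8 ^ n * 5 ^ n ≡⟨ cong (λ k → 8 ^ k * 5 ^ k) (sym h+h') ⟩
  8 ^ (h + h') * 5 ^ (h + h') ≡⟨ cong₂ _*_ (^-+ 8 h h') (^-+ 5 h h') ⟩
  8 ^ h * 8 ^ h' * (5 ^ h * 5 ^ h') ≡⟨ cong (λ k → 8 ^ h * 8 ^ h' * (5 ^ h * 5 ^ k)) (sym (m+[n∸m] h≤h')) ⟩
  8 ^ h * 8 ^ h' * (5 ^ h * 5 ^ (h + δ)) ≡⟨ cong (λ k → 8 ^ h * 8 ^ h' * (5 ^ h * k)) (^-+ 5 h δ) ⟩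
  8 ^ h * 8 ^ h' * (5 ^ h * (5 ^ h * 5 ^ δ)) ≤⟨ *-monoʳ (8 ^ h * 8 ^ h') (*-monoʳ (5 ^ h) (*-monoʳ (5 ^ h) (^-monoˡ δ (m≤m+n 5 3)))) ⟩
  8 ^ h * 8 ^ h' * (5 ^ h * (5 ^ h * 8 ^ δ)) ≡⟨ lem (8 ^ h) (8 ^ h') (5 ^ h) (8 ^ δ) ⟩
  8 ^ h * 8 ^ δ * 8 ^ h' * (5 ^ h * 5 ^ h) ≡⟨ cong (λ k → k * 8 ^ h' * (5 ^ h * 5 ^ h)) (sym (^-+ 8 h δ) ∙ cong (8 ^_) (m+[n∸m] h≤h')) ⟩
  8 ^ h' * 8 ^ h' * (5 ^ h * 5 ^ h) ≡⟨ lem' (8 ^ h') (5 ^ h) ⟩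
  Y ^ 2 ∎
  where
  δ = h' ∸ h
  lem : ∀ a b c d → a * b * (c * (c * d)) ≡ a * d * b * (c * c)
  lem = ring
  lem' : ∀ a c → a * a * (c * c) ≡ a * c * (a * c * 1)
  lem' = ring

module Splittings (n : ℕ) (w : ℕ → ℕ) (e f : ℕ) (e≤ : e * 100 ≤ 14 * n) (f≤ : f * (16 * (n + 2)) ≤ 2 ^ e)
 (many : 2 ^ (n ∸ e) ≤ 𝔹 n (Transversal.A n (dot w))) where

 h' h : ℕ
 h' = (n + 1) / 2
 h = n ∸ h'

 private
  shape : h + h' ≡ n × h ≤ h' × h' ≤ suc h × 2 ^ n ≤ (n + 2) * choose n h
  shape with halves n
  ... | k , inj₁ (refl , q) rewrite q | m+n∸n≡m k k = refl , ≤-refl , n≤1+n k ,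
   cong (2 ^_) (cong (k +_) (sym (n+0≡n k))) ∙ sym (^-*-assoc 2 2 k) ≡⟫
    central-even k ⟫ *-monoˡ (choose (k + k) k) (n≤1+n _ ⟫≡ +-comm 2 (k + k))
  ... | k , inj₂ (refl , q) rewrite q | m+n∸m≡n k k = +-suc k k , n≤1+n k , ≤-refl ,
   cong (2 *_) (cong (2 ^_) (cong (k +_) (sym (n+0≡n k))) ∙ sym (^-*-assoc 2 2 k)) ≡⟫
    central-odd k ⟫ *-monoˡ (choose (suc k + k) k) (≤-reflexive (+-comm 2 (suc k + k)))

 h+h' : h + h' ≡ n
 h+h' = fst shape
 h≤h' : h ≤ h'
 h≤h' = fst (snd shape)
 h'≤ : h' ≤ suc h
 h'≤ = fst (snd (snd shape))

 X : Vec Bool n → ℕ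
 X l = collisions w l + collisions w (Vec.map not l)

 -- The threshold is the number of collisions that a walk of f steps survives.
 calm? : ∀ l → Dec (32 * (f * f * X l) ≤ 4 ^ h')
 calm? l = 32 * (f * f * X l) ≤? 4 ^ h'

 good : Vec Bool n → ℕ
 good l = eq (card l) h * 𝟙[ calm? l ]

 private
  e≤n : e ≤ n
  e≤n = *-cancelʳ-≤ e n 100 (e≤ ⟫ *-monoˡ n (m≤m+n 14 86) ⟫≡ *-comm 100 n)

  Wt Xh Cn : ℕ
  Wt = relation-weight n w
  Xh = 𝔹 n (λ l → eq (card l) h * X l)
  Cn = choose n h

  -- On a balanced l, both l and its complement have split weight at least 5^h 2^h', so collisions
  -- on both sides are covered by terms of `split-identity`.
  weighted : ∀ l → eq (card l) h * X l * (5 ^ h * 2 ^ h') ≤ split-weight l * collisions w l + split-weight (Vec.map not l) * collisions w (Vec.map not l)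
  weighted l with eq-cases (card l) h
  ... | inj₂ (_ , z) = cong (λ k → k * X l * (5 ^ h * 2 ^ h')) z ≡⟫ z≤n
  ... | inj₁ (c , o) = cong (λ k → k * X l * (5 ^ h * 2 ^ h')) o ∙ lem (collisions w l) (collisions w (Vec.map not l)) (5 ^ h * 2 ^ h') ≡⟫
   +-mono (*-monoˡ (collisions w l) (heavier ⟫≡ sym (split-weight-≡ l ∙ cong₂ (λ a b → 5 ^ a * 2 ^ b) (cong (n ∸_) c ∙ n∸h) c)))
    (*-monoˡ (collisions w (Vec.map not l)) (≤-reflexive (sym (split-weight-≡ (Vec.map not l) ∙ cong₂ (λ a b → 5 ^ a * 2 ^ b) (cong (n ∸_) c' ∙ refl) c'))))
   where
   lem : ∀ a b w → (a + b + 0) * w ≡ w * a + w * b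
   lem = ring
   n∸h : n ∸ h ≡ h'
   n∸h = cong (_∸ h) (sym h+h') ∙ m+n∸m≡n h h'
   c' : card (Vec.map not l) ≡ h'
   c' = +-cancelʳ-≡ (card l) _ _ (card-not l ∙ sym h+h' ∙ +-comm h h' ∙ cong (h' +_) (sym c))
   heavier : 5 ^ h * 2 ^ h' ≤ 5 ^ h' * 2 ^ h
   heavier = begin
    5 ^ h * 2 ^ h' ≡⟨ cong (λ k → 5 ^ h * 2 ^ k) (sym (m+[n∸m] h≤h')) ⟩
    5 ^ h * 2 ^ (h + (h' ∸ h)) ≡⟨ cong (5 ^ h *_) (^-+ 2 h (h' ∸ h) ∙ *-comm (2 ^ h) _) ⟩
    5 ^ h * (2 ^ (h' ∸ h) * 2 ^ h) ≤⟨ *-monoʳ (5 ^ h) (*-monoˡ (2 ^ h) (^-monoˡ (h' ∸ h) (m≤m+n 2 3))) ⟩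
    5 ^ h * (5 ^ (h' ∸ h) * 2 ^ h) ≡⟨ *-assoc (5 ^ h) _ _ ⟨
    5 ^ h * 5 ^ (h' ∸ h) * 2 ^ h ≡⟨ cong (_* 2 ^ h) (sym (^-+ 5 h (h' ∸ h)) ∙ cong (5 ^_) (m+[n∸m] h≤h')) ⟩
    5 ^ h' * 2 ^ h ∎

  Xh≤ : Xh * (5 ^ h * 2 ^ h') ≤ 2 * Wt
  Xh≤ = begin
   Xh * (5 ^ h * 2 ^ h') ≡⟨ 𝔹-*ʳ n _ _ ⟨
   𝔹 n (λ l → eq (card l) h * X l * (5 ^ h * 2 ^ h')) ≤⟨ 𝔹-mono n weighted ⟩
   𝔹 n (λ l → g l + g (Vec.map not l)) ≡⟨ 𝔹-+ n g (λ l → g (Vec.map not l)) ⟩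
   𝔹 n g + 𝔹 n (λ l → g (Vec.map not l)) ≡⟨ cong₂ _+_ (split-identity n w) (𝔹-not n g ∙ split-identity n w ∙ sym (n+0≡n _)) ⟩
   2 * Wt ∎
   where
   g : Vec Bool n → ℕ
   g l = split-weight l * collisions w l

  Wt≤ : 2 ^ (n ∸ e) * (9 ^ n * Wt) ≤ 170 ^ n
  Wt≤ = *-monoˡ (9 ^ n * Wt) many ⟫ few-relations n w

  -- Averaged over balanced masks, the quantity tested by `calm?` is at most half its threshold.
  -- This joins the bound on relations with `balance`; `Z` is a common denominator.
  few-collisions : 2 * (32 * (f * f) * Xh) ≤ 4 ^ h' * Cn
  few-collisions = *-cancelʳ-≤ _ _ Z {{Z≢0}} (begin
   2 * (32 * (f * f) * Xh) * Z ≡⟨ lem₁ f Xh n p₅ p₂ U 9ⁿ E ⟩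
   F * F * (Xh * (p₅ * p₂)) * (U * 9ⁿ * E) ≤⟨ *-monoˡ (U * 9ⁿ * E) (*-mono (*-mono f≤ f≤) Xh≤) ⟩
   E * E * (2 * Wt) * (U * 9ⁿ * E) ≡⟨ lem₂ E Wt U 9ⁿ ⟩
   2 * (E * E * E) * (U * (9ⁿ * Wt)) ≤⟨ *-monoʳ (2 * (E * E * E)) Wt≤ ⟩
   2 * (E * E * E) * 170 ^ n ≡⟨ *-assoc 2 (E * E * E) _ ∙ cong (λ x → 2 * (x * 170 ^ n)) (sym (cube e)) ⟩
   2 * (8 ^ e * 170 ^ n) ≤⟨ *-mono (m≤m+n 2 2 ⟫ m≤m*n 4 (n + 2) {{>-nonZero (z<s ⟫ m≤n+m 2 n)}}) (balance n e h h' e≤ h+h' h≤h') ⟩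
   4 * (n + 2) * (36 ^ n * (8 ^ h' * p₅)) ≡⟨ cong₂ (λ x y → 4 * (n + 2) * (x * (y * p₅))) thirty-six eight ⟩
   4 * (n + 2) * (2 ^ n * (U * E) * 9ⁿ * (4 ^ h' * p₂ * p₅)) ≤⟨ *-monoʳ (4 * (n + 2)) (*-monoˡ (4 ^ h' * p₂ * p₅) (*-monoˡ 9ⁿ (*-monoˡ (U * E) (snd (snd (snd shape)))))) ⟩
   4 * (n + 2) * ((n + 2) * Cn * (U * E) * 9ⁿ * (4 ^ h' * p₂ * p₅)) ≡⟨ lem₃ n Cn U E 9ⁿ (4 ^ h') p₂ p₅ ⟩
   4 ^ h' * Cn * Z ∎)
   where
   E = 2 ^ e
   U = 2 ^ (n ∸ e)
   9ⁿ = 9 ^ n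
   p₅ = 5 ^ h
   p₂ = 2 ^ h'
   F = f * (16 * (n + 2))
   Z = 4 * ((n + 2) * (n + 2)) * (p₅ * p₂) * (U * 9ⁿ * E)
   Z≢0 : NonZero Z
   Z≢0 = >-nonZero (*-mono (*-mono (*-mono {1} {4} z<s (*-mono {1} {n + 2} {1} {n + 2} n2 n2)) (*-mono (m^n>0 5 h) (1≤2^ h'))) (*-mono (*-mono (1≤2^ (n ∸ e)) (m^n>0 9 n)) (1≤2^ e)))
    where
    n2 : 1 ≤ n + 2
    n2 = z<s ⟫ m≤n+m 2 n
   cube : ∀ e → 8 ^ e ≡ 2 ^ e * 2 ^ e * 2 ^ e
   cube e = ^-distrib e 4 2 ∙ cong (_* 2 ^ e) (^-distrib e 2 2)
   UE : U * E ≡ 2 ^ n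
   UE = sym (^-+ 2 (n ∸ e) e) ∙ cong (2 ^_) (m∸n+n≡m e≤n)
   thirty-six : 36 ^ n ≡ 2 ^ n * (U * E) * 9ⁿ
   thirty-six = ^-distrib n 4 9 ∙ cong (_* 9ⁿ) (^-distrib n 2 2 ∙ cong (2 ^ n *_) (sym UE))
   eight : 8 ^ h' ≡ 4 ^ h' * p₂
   eight = ^-distrib h' 4 2
   lem₁ : ∀ f x n a b u v e → 2 * (32 * (f * f) * x) * (4 * ((n + 2) * (n + 2)) * (a * b) * (u * v * e)) ≡ f * (16 * (n + 2)) * (f * (16 * (n + 2))) * (x * (a * b)) * (u * v * e)
   lem₁ = ring
   lem₂ : ∀ e w u v → e * e * (2 * w) * (u * v * e) ≡ 2 * (e * e * e) * (u * (v * w))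
   lem₂ = ring
   lem₃ : ∀ n c u e v k a b → 4 * (n + 2) * ((n + 2) * c * (u * e) * v * (k * a * b)) ≡ k * c * (4 * ((n + 2) * (n + 2)) * (b * a) * (u * v * e))
   lem₃ = ring

  -- Markov's inequality before averaging: a mask that is not calm pays for itself by its
  -- collisions.
  markov : ∀ l → eq (card l) h * 4 ^ h' ≤ good l * 4 ^ h' + 32 * (f * f) * (eq (card l) h * X l)
  markov l = go (calm? l)
   where
   c = eq (card l) h
   lem : ∀ c f x → c * (32 * (f * x)) ≡ 32 * f * (c * x)
   lem = ring
   go : (d : Dec (32 * (f * f * X l) ≤ 4 ^ h')) → c * 4 ^ h' ≤ c * 𝟙[ d ] * 4 ^ h' + 32 * (f * f) * (c * X l)
   go (yes _) = cong (_* 4 ^ h') (sym (n*1≡n c)) ≡⟫ m≤m+n _ _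
   go (no big) = (*-monoʳ c (<⇒≤ (≰⇒> big)) ⟫≡ lem c (f * f) (X l)) ⟫ m≤n+m _ _

 many-good : 2 ^ n ≤ 2 * (n + 2) * 𝔹 n good
 many-good = snd (snd (snd shape)) ⟫ *-monoʳ (n + 2) (*-cancelʳ-≤ Cn (2 * Gm) (4 ^ h') {{m^n≢0 4 h'}} twice) ⟫≡ lem (n + 2) Gm
  where
  Gm = 𝔹 n good
  lem : ∀ n g → n * (2 * g) ≡ 2 * n * g
  lem = ring
  total : Cn * 4 ^ h' ≤ Gm * 4 ^ h' + 32 * (f * f) * Xh
  total = begin
   Cn * 4 ^ h' ≡⟨ cong (_* 4 ^ h') (sym (count-card n h)) ⟩
   𝔹 n (λ l → eq (card l) h) * 4 ^ h' ≡⟨ 𝔹-*ʳ n (4 ^ h') _ ⟨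
   𝔹 n (λ l → eq (card l) h * 4 ^ h') ≤⟨ 𝔹-mono n markov ⟩
   𝔹 n (λ l → good l * 4 ^ h' + 32 * (f * f) * (eq (card l) h * X l)) ≡⟨ 𝔹-+ n _ _ ⟩
   𝔹 n (λ l → good l * 4 ^ h') + 𝔹 n (λ l → 32 * (f * f) * (eq (card l) h * X l)) ≡⟨ cong₂ _+_ (𝔹-*ʳ n (4 ^ h') good) (𝔹-*ˡ n (32 * (f * f)) _) ⟩
   Gm * 4 ^ h' + 32 * (f * f) * Xh ∎
  twice : Cn * 4 ^ h' ≤ 2 * Gm * 4 ^ h'
  twice = +-cancelʳ-≤ (Cn * 4 ^ h') _ _ (begin
   Cn * 4 ^ h' + Cn * 4 ^ h' ≡⟨ cong (Cn * 4 ^ h' +_) (sym (n+0≡n _)) ⟩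
   2 * (Cn * 4 ^ h') ≤⟨ *-monoʳ 2 total ⟩
   2 * (Gm * 4 ^ h' + 32 * (f * f) * Xh) ≡⟨ lem' Gm (4 ^ h') (32 * (f * f) * Xh) ⟩
   2 * Gm * 4 ^ h' + 2 * (32 * (f * f) * Xh) ≤⟨ +-monoʳ (2 * Gm * 4 ^ h') (few-collisions ⟫≡ *-comm (4 ^ h') Cn) ⟩
   2 * Gm * 4 ^ h' + Cn * 4 ^ h' ∎)
   where
   lem' : ∀ g k x → 2 * (g * k + x) ≡ 2 * g * k + 2 * x
   lem' = ring

-- The second trial: a walk through the partial sums of both halves.

-- Even vertices lie on one side and odd ones on the other; mixed collisions are at most as many as
-- pure ones.
all-pairs : ∀ m (k a c : ℕ → ℕ) → (∀ r → k (2 * r) ≡ a r) → (∀ r → k (1 + 2 * r) ≡ c r) →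
 ∀ K → (∀ r → r < m → a r < K) → (∀ r → r < m → c r < K) →
 ∑ (2 * m) (λ z → ∑ (2 * m) (λ z' → eq (k z') (k z))) ≤ 2 * (∑ m (λ r → ∑ m (λ s → eq (a r) (a s))) + ∑ m (λ r → ∑ m (λ s → eq (c r) (c s))))
all-pairs m k a c k0 k1 K a< c< = begin
 ∑ (2 * m) (λ z → ∑ (2 * m) (λ z' → eq (k z') (k z))) ≡⟨ ∑-pairs m _ ∙ cong₂ _+_ (∑-cong' m λ r → half r (k0 r)) (∑-cong' m λ r → half r (k1 r)) ⟩
 ∑ m (λ r → row a (a r) + row c (a r)) + ∑ m (λ r → row a (c r) + row c (c r)) ≡⟨ cong₂ _+_ (∑-+ m _ _) (∑-+ m _ _) ⟩
 ∑ m (λ r → row a (a r)) + ∑ m (λ r → row c (a r)) + (∑ m (λ r → row a (c r)) + ∑ m (λ r → row c (c r)))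
  ≡⟨ cong₂ _+_ (cong₂ _+_ (∑-swap m m _) (∑-cong' m λ r → ∑-cong' m λ s → eq-sym (c s) (a r))) (cong₂ _+_ (∑-swap m m _) (∑-swap m m _)) ⟩
 AA + AC + (AC + CC) ≡⟨ lem AA AC CC ⟩
 AA + CC + (AC + AC) ≤⟨ +-monoʳ (AA + CC) (cross-collisions K m m a c a< c<) ⟩
 AA + CC + (AA + CC) ≡⟨ cong (AA + CC +_) (sym (n+0≡n _)) ⟩
 2 * (AA + CC) ∎
 where
 row : (ℕ → ℕ) → ℕ → ℕ
 row f x = ∑ m (λ s → eq (f s) x)
 AA = ∑ m (λ r → ∑ m (λ s → eq (a r) (a s)))
 AC = ∑ m (λ r → ∑ m (λ s → eq (a r) (c s)))
 CC = ∑ m (λ r → ∑ m (λ s → eq (c r) (c s)))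
 lem : ∀ a b c → a + b + (b + c) ≡ a + c + (b + b)
 lem = ring
 half : ∀ r {z x} → k z ≡ x → ∑ (2 * m) (λ z' → eq (k z') (k z)) ≡ row a x + row c x
 half r {z} refl = ∑-pairs m _ ∙ cong₂ _+_ (∑-cong' m λ s → cong (λ y → eq y (k z)) (k0 s)) (∑-cong' m λ s → cong (λ y → eq y (k z)) (k1 s))

-- Meet in the middle: the variables are split by a mask l, partial sums of the two
-- sides that fit together have equal keys, and a random walk looks for a collision.
record SplitSum : Set where
 constructor splitSum
 field
  n : ℕ
  w : ℕ → ℕ
  e Lw BIG t : ℕ
  1≤Lw : 1 ≤ Lw
  w< : ∀ y → dot {n} w y < BIG
  t< : t < BIG
  x : Vec Bool n
  hits : dot w x ≡ t
  V : ℕ → ℕ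
  V01 : ∀ s → V s ≡ 0 ⊎ V s ≡ 1
  V-x : V (fromVec x) ≡ 1

module Birthday (ctx : SplitSum) where

 open SplitSum ctx

 K N NN f : ℕ
 K = 2 + 3 * BIG
 N = 2 * 2 ^ ((n + 1) / 2)
 NN = N * N
 f = Lw ∸ 1

 1≤N : 1 ≤ N
 1≤N = *-mono {1} {2} z<s (1≤2^ ((n + 1) / 2))

 instance
  N≢0 : NonZero N
  N≢0 = >-nonZero 1≤N

 sideKey : Bool → Vec Bool n → ℕ → ℕ
 sideKey false l r = BIG + dot w (assign (mask false l) r)
 sideKey true l r = BIG + t ∸ dot w (assign (mask true l) r)

 keyOf maskOf : Vec Bool n → ℕ → ℕ
 keyOf l z = sideKey (odd z) l (z / 2)
 maskOf l z = fromVec (assign (mask (odd z) l) (z / 2))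

 joinOf : Vec Bool n → ℕ → ℕ
 joinOf l s = V (maskOf l (s quo N) + maskOf l (s mod N))

 step : Vec Bool n → List ℕ → ℕ → ℕ
 step l zs z = nth 0 zs (suc (keyOf l z)) mod N

 won : Vec Bool n → List ℕ → ℕ
 won l zs = race N NN Lw (step l zs) (joinOf l) (nth 0 zs 0 mod N)

 sideKey< : ∀ s l r → sideKey s l r < 2 * BIG
 sideKey< false l r = +-monoʳ-< BIG (w< (assign (mask false l) r)) ⟫≡ cong (BIG +_) (sym (n+0≡n BIG))
 sideKey< true l r = ≤-<-trans (m∸n≤m (BIG + t) (dot w (assign (mask true l) r))) (+-monoʳ-< BIG t< ⟫≡ cong (BIG +_) (sym (n+0≡n BIG)))

 key<K : ∀ l z → suc (keyOf l z) < K
 key<K l z = s≤s (sideKey< (odd z) l (z / 2) ⟫ *-monoˡ BIG (m≤m+n 2 1) ⟫ n≤1+n _)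

record Odds : Set where
 constructor odds
 field
  S : SplitSum
 open SplitSum S public
 field
  M qN rest : ℕ
  M≡N : M ≡ qN * (2 * 2 ^ ((n + 1) / 2))
  1≤M : 1 ≤ M
  M≡ : M ≡ 2 ^ (n + rest)
  100e≤ : e * 100 ≤ 14 * n
  f≤ : (Lw ∸ 1) * (16 * (n + 2)) ≤ 2 ^ e
  many : 2 ^ (n ∸ e) ≤ 𝔹 n (Transversal.A n (dot w))

module BirthdayCount (ctx : Odds) where

 open Odds ctx

 open Birthday S

 open Splittings n w e f 100e≤ f≤ many

 record CalmMask : Set where
  constructor calmMask
  field
   l : Vec Bool n
   card-l : card l ≡ h
   calm : 32 * (f * f * X l) ≤ 4 ^ h'

 module Calm (c : CalmMask) where

  open CalmMask c

  card-not-l : card (Vec.map not l) ≡ h'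
  card-not-l = +-cancelʳ-≡ (card l) _ _ (card-not l ∙ sym h+h' ∙ +-comm h h' ∙ cong (h' +_) (sym card-l))

  -- Half indices have h' bits on both sides. The side with h variables ignores at most one of them,
  -- which multiplies its collisions by at most 4.
  collisions-bound : ∑ N (λ z → ∑ N (λ z' → eq (keyOf l z') (keyOf l z))) ≤ 8 * X l
  collisions-bound = begin
   ∑ N (λ z → ∑ N (λ z' → eq (keyOf l z') (keyOf l z))) ≤⟨ all-pairs (2 ^ h') (keyOf l) (sideKey false l) (sideKey true l)
    (λ r → cong₂ (λ s q → sideKey s l q) (odd-b false r) ([b+2x]/2 false r))
    (λ r → cong₂ (λ s q → sideKey s l q) (odd-b true r) ([b+2x]/2 true r))
    (2 * BIG) (λ r _ → sideKey< false l r) (λ r _ → sideKey< true l r) ⟩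
   2 * (∑ (2 ^ h') (λ r → ∑ (2 ^ h') (λ s → eq (sideKey false l r) (sideKey false l s))) + ∑ (2 ^ h') (λ r → ∑ (2 ^ h') (λ s → eq (sideKey true l r) (sideKey true l s))))
    ≡⟨ cong (2 *_) (cong₂ _+_
     ((∑-cong' (2 ^ h') λ r → ∑-cong' (2 ^ h') λ s → eq-shift BIG (dot w (assign (mask false l) r)) (dot w (assign (mask false l) s))) ∙
      assign-collisions w (Vec.map not l) h' 0 (n+0≡n _ ∙ card-not-l))
     ((∑-cong' (2 ^ h') λ r → ∑-cong' (2 ^ h') λ s → eq-monus (BIG + t) (dot w (assign (mask true l) r)) (dot w (assign (mask true l) s)) (fits r) (fits s)) ∙
      assign-collisions w l h' δ (cong (_+ δ) card-l ∙ (m+[n∸m] h≤h')))) ⟩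
   2 * (1 * (1 * collisions w (Vec.map not l)) + 2 ^ δ * (2 ^ δ * collisions w l))
    ≤⟨ *-monoʳ 2 (+-mono (*-mono {1} {2} z<s (*-monoˡ (collisions w (Vec.map not l)) {1} {2} z<s)) (*-mono 2^δ≤2 (*-monoˡ (collisions w l) 2^δ≤2))) ⟩
   2 * (2 * (2 * collisions w (Vec.map not l)) + 2 * (2 * collisions w l)) ≡⟨ lem (collisions w l) (collisions w (Vec.map not l)) ⟩
   8 * X l ∎
   where
   δ = h' ∸ h
   lem : ∀ a c → 2 * (2 * (2 * c) + 2 * (2 * a)) ≡ 8 * (a + c)
   lem = ring
   fits : ∀ r → dot w (assign (mask true l) r) ≤ BIG + t
   fits r = <⇒≤ (w< (assign (mask true l) r)) ⟫ m≤m+n BIG t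
   2^δ≤2 : 2 ^ δ ≤ 2
   2^δ≤2 = ^-monoʳ 2 {δ} {1} (∸-monoˡ-≤ h h'≤ ⟫≡ m+n∸n≡m 1 h)

  few : 16 * (f * f * ∑ N (λ z → ∑ N (λ z' → eq (keyOf l z') (keyOf l z)))) ≤ N * N
  few = begin
   16 * (f * f * ∑ N (λ z → ∑ N (λ z' → eq (keyOf l z') (keyOf l z)))) ≤⟨ *-monoʳ 16 (*-monoʳ (f * f) collisions-bound) ⟩
   16 * (f * f * (8 * X l)) ≡⟨ lem (f * f) (X l) ⟩
   4 * (32 * (f * f * X l)) ≤⟨ *-monoʳ 4 calm ⟩
   4 * 4 ^ h' ≡⟨ cong (4 *_) (^-distrib h' 2 2) ⟩
   4 * (2 ^ h' * 2 ^ h') ≡⟨ lem' (2 ^ h') ⟩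
   N * N ∎
   where
   lem : ∀ f x → 16 * (f * (8 * x)) ≡ 4 * (32 * (f * x))
   lem = ring
   lem' : ∀ x → 4 * (x * x) ≡ 2 * x * (2 * x)
   lem' = ring

  -- The vertices of the two halves of the solution x.
  r₀ r₁ i₀ j₀ : ℕ
  r₀ = index x (Vec.map not l)
  r₁ = index x l
  i₀ = 0 + 2 * r₀
  j₀ = 1 + 2 * r₁

  i₀< : i₀ < N
  i₀< = *-monoʳ-< 2 (index< x (Vec.map not l) (≤-reflexive card-not-l))

  j₀< : j₀ < N
  j₀< = sym (*-suc 2 r₁) ≡⟫ *-monoʳ 2 (index< x l (card-l ≡⟫ h≤h'))

  i₀≢j₀ : i₀ ≢ j₀
  i₀≢j₀ h with () ← sym (odd-b false r₀) ∙ cong odd h ∙ odd-b true r₁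

  keys≡ : keyOf l i₀ ≡ keyOf l j₀
  keys≡ = begin-equality
   keyOf l i₀ ≡⟨ cong₂ (λ s q → sideKey s l q) (odd-b false r₀) ([b+2x]/2 false r₀) ⟩
   BIG + dot w (assign (Vec.map not l) r₀) ≡⟨ cong (λ z → BIG + dot w z) (assign-index x (Vec.map not l)) ⟩
   BIG + right ≡⟨ m+n∸n≡m (BIG + right) left ⟨
   BIG + right + left ∸ left ≡⟨ cong (_∸ left) (+-assoc BIG right left ∙ cong (BIG +_) (+-comm right left ∙ dot-meet w x l ∙ hits)) ⟩
   BIG + t ∸ left ≡⟨ cong (λ z → BIG + t ∸ dot w z) (sym (assign-index x l)) ⟩
   sideKey true l r₁ ≡⟨ cong₂ (λ s q → sideKey s l q) (odd-b true r₁) ([b+2x]/2 true r₁) ⟨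
   keyOf l j₀ ∎
   where
   left = dot w (meet x l)
   right = dot w (meet x (Vec.map not l))

  mask-i : maskOf l i₀ ≡ fromVec (meet x (Vec.map not l))
  mask-i = cong₂ (λ s q → fromVec (assign (mask s l) q)) (odd-b false r₀) ([b+2x]/2 false r₀) ∙ cong fromVec (assign-index x (Vec.map not l))

  mask-j : maskOf l j₀ ≡ fromVec (meet x l)
  mask-j = cong₂ (λ s q → fromVec (assign (mask s l) q)) (odd-b true r₁) ([b+2x]/2 true r₁) ∙ cong fromVec (assign-index x l)

  masks : maskOf l i₀ + maskOf l j₀ ≡ fromVec x
  masks = cong₂ _+_ mask-i mask-j ∙ +-comm (fromVec (meet x (Vec.map not l))) _ ∙
   cong₂ _+_ (sym (dot-pow (meet x l))) (sym (dot-pow (meet x (Vec.map not l)))) ∙ dot-meet (2 ^_) x l ∙ dot-pow x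

  joined : ∀ a c → c < N → joinOf l (a * N + c) ≡ V (maskOf l a + maskOf l c)
  joined a c c< = cong₂ (λ y z → V (maskOf l y + maskOf l z)) (pairing-quo N a c c<) (pairing-mod N a c c<)

  hit : joinOf l (i₀ * N + j₀) ≡ 1
  hit = joined i₀ j₀ j₀< ∙ cong V masks ∙ V-x

  hit' : joinOf l (j₀ * N + i₀) ≡ 1
  hit' = joined j₀ i₀ i₀< ∙ cong V (+-comm (maskOf l j₀) _ ∙ masks) ∙ V-x

  chase : Chase
  chase = chasing N M qN K NN Lw M≡N 1≤M 1≤N ≤-refl 1≤Lw (keyOf l) (λ z _ → key<K l z) z<s
   (joinOf l) (λ s → V01 _) i₀ j₀ i₀< j₀< i₀≢j₀ keys≡ hit hit'

  probable : M ^ K * (Lw * Lw) ≤ 8 * (N * N) * 𝕊 K M (won l)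
  probable = SuccessB.success-count chase (subst (λ p → 16 * (f * f * p) ≤ N * N) (∑-cong' N λ z → ∑-cong' N λ z' → sym (eq-shift 1 (keyOf l z') (keyOf l z))) few) ⟫≡
   cong (8 * (N * N) *_) (𝕊-cong K {M} λ zs _ → sym (race-def N NN Lw (step l zs) (joinOf l) (nth 0 zs 0 mod N)))

 success-count : M * M ^ K * (Lw * Lw) ≤ 16 * (n + 2) * (N * N) * ∑ M (λ y → 𝕊 K M (won (toVec n y)))
 success-count = begin
  M * M ^ K * (Lw * Lw) ≡⟨ cong (λ m → m * M ^ K * (Lw * Lw)) (M≡ ∙ ^-+ 2 n rest) ⟩
  2 ^ n * 2 ^ rest * M ^ K * (Lw * Lw) ≡⟨ lem₁ (2 ^ n) (2 ^ rest) (M ^ K) (Lw * Lw) ⟩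
  2 ^ n * (2 ^ rest * Y) ≤⟨ *-monoˡ (2 ^ rest * Y) many-good ⟩
  2 * (n + 2) * 𝔹 n good * (2 ^ rest * Y) ≡⟨ lem₂ (n + 2) (𝔹 n good) (2 ^ rest) Y ⟩
  2 * (n + 2) * (2 ^ rest * (𝔹 n good * Y)) ≤⟨ *-monoʳ (2 * (n + 2)) (*-monoʳ (2 ^ rest) (sym (𝔹-*ʳ n Y good) ≡⟫ 𝔹-mono n each)) ⟩
  2 * (n + 2) * (2 ^ rest * 𝔹 n (λ l → 8 * (N * N) * 𝕊 K M (won l))) ≡⟨ cong (2 * (n + 2) *_) (cong (2 ^ rest *_) (𝔹-*ˡ n (8 * (N * N)) _)) ⟩
  2 * (n + 2) * (2 ^ rest * (8 * (N * N) * 𝔹 n (λ l → 𝕊 K M (won l)))) ≡⟨ lem₃ (n + 2) (2 ^ rest) (N * N) _ ⟩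
  16 * (n + 2) * (N * N) * (2 ^ rest * 𝔹 n (λ l → 𝕊 K M (won l))) ≡⟨ cong (16 * (n + 2) * (N * N) *_) (sym (cong (λ m → ∑ m (λ y → 𝕊 K M (won (toVec n y)))) M≡ ∙ ∑-toVec n rest (λ l → 𝕊 K M (won l)))) ⟩
  16 * (n + 2) * (N * N) * ∑ M (λ y → 𝕊 K M (won (toVec n y))) ∎
  where
  Y = M ^ K * (Lw * Lw)
  lem₁ : ∀ a b c d → a * b * c * d ≡ a * (b * (c * d))
  lem₁ = ring
  lem₂ : ∀ n g r y → 2 * n * g * (r * y) ≡ 2 * n * (r * (g * y))
  lem₂ = ring
  lem₃ : ∀ n r k s → 2 * n * (r * (8 * k * s)) ≡ 16 * n * k * (r * s)
  lem₃ = ring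
  each : ∀ l → good l * Y ≤ 8 * (N * N) * 𝕊 K M (won l)
  each l = go (calm? l) (eq-cases (card l) h)
   where
   go : (d : Dec (32 * (f * f * X l) ≤ 4 ^ h')) → (card l ≡ h × eq (card l) h ≡ 1) ⊎ (card l ≢ h × eq (card l) h ≡ 0) →
    eq (card l) h * 𝟙[ d ] * Y ≤ 8 * (N * N) * 𝕊 K M (won l)
   go d (inj₂ (_ , z)) = cong (λ k → k * 𝟙[ d ] * Y) z ≡⟫ z≤n
   go (yes calm) (inj₁ (c , o)) = cong (λ k → k * 1 * Y) o ∙ n+0≡n Y ≡⟫ Calm.probable (calmMask l c calm)
   go (no _) (inj₁ _) = cong (_* Y) (*-zeroʳ (eq (card l) h)) ≡⟫ z≤n

spread : ∀ n x i g → ∑ n (λ v → eq (bit x v) (i mod 2) * bit (i / 2) (∑ n (λ u → lt u v * eq (bit x u) (i mod 2))) * g v)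
 ≡ dot g (assign (mask (odd i) (toVec n x)) (i / 2))
spread n x i g = (∑-cong n λ v v< → cong₂ (λ s r → eq (bit x v) s * bit (i / 2) r * g v) side
 (cong (λ s → ∑ n (λ u → lt u v * eq (bit x u) s)) side ∙ rank-sum n x (num (odd i)) v (<⇒≤ v<))) ∙
 assign-sum n x (odd i) (i / 2) g
 where
 side : i mod 2 ≡ num (odd i)
 side = mod-% i 2 ∙ sym (odd-num i)

-- The actual length of a walk is replaced by its lower bound 2^e / (16 (n + 2)), so that the number
-- of repetitions becomes a closed formula.
trial-constant : ∀ e n n' Lw X S → 2 ^ e ≤ Lw * (16 * (n + 2)) → X * (Lw * Lw) ≤ 16 * (n + 2) * (2 * 2 ^ n' * (2 * 2 ^ n')) * S →
 X ≤ 16 * 16 * 16 * ((n + 2) * (n + 2) * (n + 2)) * 4 ^ (n' + 1 ∸ e) * S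
trial-constant e n n' Lw X S big h = *-cancelʳ-≤ _ _ (4 ^ e) {{m^n≢0 4 e}} (begin
 X * 4 ^ e ≡⟨ cong (X *_) (^-distrib e 2 2) ⟩
 X * (2 ^ e * 2 ^ e) ≤⟨ *-monoʳ X (*-mono big big) ⟩
 X * (Lw * (16 * (n + 2)) * (Lw * (16 * (n + 2)))) ≡⟨ lem₁ X Lw n ⟩
 X * (Lw * Lw) * (16 * 16 * ((n + 2) * (n + 2))) ≤⟨ *-monoˡ (16 * 16 * ((n + 2) * (n + 2))) h ⟩
 16 * (n + 2) * (N * N) * S * (16 * 16 * ((n + 2) * (n + 2))) ≤⟨ *-monoˡ _ (*-monoˡ S (*-monoʳ (16 * (n + 2)) N²≤)) ⟩
 16 * (n + 2) * (4 ^ (n' + 1 ∸ e) * 4 ^ e) * S * (16 * 16 * ((n + 2) * (n + 2))) ≡⟨ lem₂ n (4 ^ (n' + 1 ∸ e)) (4 ^ e) S ⟩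
 16 * 16 * 16 * ((n + 2) * (n + 2) * (n + 2)) * 4 ^ (n' + 1 ∸ e) * S * 4 ^ e ∎)
 where
 N = 2 * 2 ^ n'
 lem₁ : ∀ x l n → x * (l * (16 * (n + 2)) * (l * (16 * (n + 2)))) ≡ x * (l * l) * (16 * 16 * ((n + 2) * (n + 2)))
 lem₁ = ring
 lem₂ : ∀ n f e s → 16 * (n + 2) * (f * e) * s * (16 * 16 * ((n + 2) * (n + 2))) ≡ 16 * 16 * 16 * ((n + 2) * (n + 2) * (n + 2)) * f * s * e
 lem₂ = ring
 N²≤ : N * N ≤ 4 ^ (n' + 1 ∸ e) * 4 ^ e
 N²≤ = sym (^-distrib (suc n') 2 2) ≡⟫ ^-monoʳ 4 (+-comm 1 n' ≡⟫ m≤n+m∸n (n' + 1) e ⟫≡ +-comm e _) ⟫≡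
  ^-+ 4 (n' + 1 ∸ e) e

-- Both trials on the encoded instance.

module Setting (μ : ℕ → ℕ) where

 open Parameters μ public

 ψ : List ℕ → ℕ → ℕ
 ψ ys s = nth 0 ys (s mod SL)

 V₀ : Sizes
 V₀ = sizes-of n D cnt O m x1 lg lam1 g5 Gam B BIG b e n' N bb lbb cp cq Yp Yq kk K2 W SL Lw NN ne R1 R2

 module T (ys : List ℕ) = Trial V₀ μ (ψ ys)

 open Verifier n D μ public using (violation; verify; verify-def; rhs) renaming (pos to posᵉ; neg to negᵉ)

 P⁺ P⁻ : ℕ → ℕ → ℕ
 P⁺ j v = posᵉ (j * n + v)
 P⁻ j v = negᵉ (j * n + v)

 U⁺ U⁻ : ℕ → ℕ
 U⁺ j = posᵉ (rhs j)
 U⁻ j = negᵉ (rhs j)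

 Solution : Vec Bool n → Set
 Solution y = ∀ j → j < D → dot (P⁺ j) y + U⁻ j ≤ dot (P⁻ j) y + U⁺ j

 verify-complete : ∀ x → Solution (toVec n x) → verify x ≡ 1
 verify-complete x h = verify-def x ∙ cong (1 ∸_) ((∑-cong D λ j j< → m≤n⇒m∸n≡0 (subst₂ _≤_
  (cong (_+ U⁻ j) (sym (∑-bits n x (P⁺ j)))) (cong (_+ U⁺ j) (sym (∑-bits n x (P⁻ j)))) (h j j<))) ∙ ∑-zero D)

 verify-sound : ∀ x → verify x ≢ 0 → Solution (toVec n x)
 verify-sound x h j j< = subst₂ _≤_ (cong (_+ U⁻ j) (∑-bits n x (P⁺ j))) (cong (_+ U⁺ j) (∑-bits n x (P⁻ j)))
  (m∸n≡0⇒m≤n (∑≡0⇒≡0 _ j j< (zero-sum (violation x) (λ e → h (verify-def x ∙ e)))))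
  where
  zero-sum : ∀ s → 1 ∸ s ≢ 0 → s ≡ 0
  zero-sum zero h = refl
  zero-sum (suc s) h = ⊥-elim (h (0∸n≡0 s))

 verify01 : ∀ x → verify x ≡ 0 ⊎ verify x ≡ 1
 verify01 x = subst (λ s → s ≡ 0 ⊎ s ≡ 1) (sym (verify-def x)) (cases (violation x))
  where
  cases : ∀ s → 1 ∸ s ≡ 0 ⊎ 1 ∸ s ≡ 1
  cases zero = inj₂ refl
  cases (suc s) = inj₁ (0∸n≡0 s)

 ψ-nth : ∀ ys s → s < SL → ψ ys s ≡ nth 0 ys s
 ψ-nth ys s s< = cong (nth 0 ys) (mod-% s SL ∙ m<n⇒m%n≡m s<)

 record Hypotheses : Set where
  constructor hypotheses
  field
   2≤n : 2 ≤ n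
   1≤m : 1 ≤ m
   m≤O : m ≤ O
   pos≤ : ∀ j v → j < D → v < n → P⁺ j v ≤ m
   neg≤ : ∀ j v → j < D → v < n → P⁻ j v ≤ m
   one-sign : ∀ k → posᵉ k ≡ 0 ⊎ negᵉ k ≡ 0
   x : Vec Bool n
   solution : Solution x

 module Hidden (ctx : Hypotheses) where

  open Hypotheses ctx

  private
   Λ : ℕ
   Λ = 2 ^ digits lam1

   nm≤ : m * n ≤ 2 ^ lg
   nm≤ = sym (m+[n∸m] {1} {m * n} (*-mono 1≤m (z<s ⟫ 2≤n))) ≡⟫ fst (digits-bounds x1)

   lg≥1 : 1 ≤ lg
   lg≥1 with lg | nm≤
   ... | zero | h = ⊥-elim (<⇒≱ (*-mono 1≤m 2≤n) h)
   ... | suc _ | h = z<s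

   lgn≤Λ : lg * n ≤ Λ
   lgn≤Λ = sym (m+[n∸m] {1} {lg * n} (*-mono lg≥1 (z<s ⟫ 2≤n))) ≡⟫ fst (digits-bounds lam1)

   n≤Λ : n ≤ Λ
   n≤Λ = m≤n*m n lg {{>-nonZero lg≥1}} ⟫ lgn≤Λ

   Λ≥2 : 2 ≤ Λ
   Λ≥2 = 2≤n ⟫ n≤Λ

   16Λ≤ : 16 * Λ ≤ Gam
   16Λ≤ = *-monoˡ Λ (^-monoˡ 4 Λ≥2) ⟫≡ *-comm (Λ ^ 4) Λ ∙ ^-*-assoc 2 (digits lam1) 5 ∙ cong (2 ^_) (*-comm (digits lam1) 5)

   suc-lg≤Λ : suc lg ≤ Λ
   suc-lg≤Λ = ((+-monoˡ lg lg≥1 ⟫≡ cong (lg +_) (sym (n+0≡n lg)) ∙ *-comm 2 lg) ⟫ *-monoʳ lg 2≤n) ⟫ lgn≤Λ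

   BIG≥ : m * n ≤ BIG
   BIG≥ = ((*-comm m n ≡⟫ *-mono {n} {2 * (n + 1)} (m≤m+n n 1 ⟫ m≤n*m (n + 1) 2) (m≤O ⟫ m≤m+n O 1)) ⟫≡ sym (n*1≡n B)) ⟫
    *-monoʳ B (m^n>0 B {{>-nonZero (*-mono (*-mono {1} {2} z<s (m≤n+m 1 n)) (m≤n+m 1 O))}} D)

  BIG<2^b : BIG < 2 ^ b
  BIG<2^b = fst (digits-bounds BIG)

  private
   lg≤b : lg ≤ b
   lg≤b = digits-≤ {x1} (≤-<-trans (m∸n≤m (m * n) 1 ⟫ BIG≥) BIG<2^b)

   suc-lg≤W : suc lg ≤ W
   suc-lg≤W = (s≤s lg≤b ⟫≡ +-comm 1 b) ⟫ +-monoˡ 1 (m≤n+m b (cq + g5 + n + n' + kk))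

   suc-lg<Γ : suc lg < Gam
   suc-lg<Γ = s≤s suc-lg≤Λ ⟫ +-monoˡ Λ (z<s ⟫ Λ≥2) ⟫ pad (lem Λ) ⟫ ≤-refl ⟫ 16Λ≤
    where
    lem : ∀ l → l + l + 14 * l ≡ 16 * l
    lem = ring

   5n≤Γ : 5 * suc n ≤ Gam
   5n≤Γ = (*-suc 5 n ≡⟫ +-monoˡ (5 * n) (m≤n+m 5 5 ⟫ *-monoʳ 5 2≤n) ⟫
    pad (lem n) ⟫ *-monoʳ 16 n≤Λ) ⟫ 16Λ≤
    where
    lem : ∀ n → 5 * n + 5 * n + 6 * n ≡ 16 * n
    lem = ring

  G₀ : RoundedRows
  G₀ = roundedRows n D O m B W Gam lg P⁺ P⁻ U⁺ U⁻ pos≤ neg≤ (λ j _ → one-sign (rhs j)) m≤O refl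
   (*-comm n m ≡⟫ nm≤) suc-lg<Γ suc-lg≤W 5n≤Γ

  module G = Guess G₀

  κ* : ℕ
  κ* = card x

  κ*< : κ* < K2
  κ*< = ≤-<-trans (card≤ x) (fst (digits-bounds n))

  I* E* : ℕ → ℕ
  I* = G.I x solution
  E* = G.E x solution

  -- The weights under the guesses that belong to the solution x. They involve no randomness, so the
  -- distinction of few or many sums can be made for them beforehand.
  w* : ℕ → ℕ
  w* = G.weights I*

  t* : ℕ
  t* = G.target I* E* κ*

  τ* : ℕ → ℕ
  τ* = interleave I* E*

  τ*< : ∀ i → i < 2 * D → τ* i < Gam
  τ*< i i< = choice (i % 2)
   where
   choice : ∀ r → pick r (I* (i / 2)) (E* (i / 2)) < Gam
   choice zero = G.I<Γ x solution (i / 2)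
   choice (suc _) = G.E<Γ x solution (i / 2) (m<n*o⇒m/o<n (i< ⟫≡ *-comm 2 D))

  hit* : dot w* x ≡ t*
  hit* = G.hits-target x solution I* E* (λ _ _ → refl) (λ _ _ → refl)

  sound* : ∀ y → dot w* y ≡ t* → Solution y
  sound* = G.target-feasible x solution I* E* (λ _ _ → refl) (λ _ _ → refl)

  w*< : ∀ y → dot {n} w* y < BIG
  w*< = G.weights< I*

  t*< : t* < BIG
  t*< = subst (_< BIG) hit* (w*< x)

  Lucky-words : List ℕ → ℕ → Set
  Lucky-words us kw = length us ≡ 2 * D × (∀ i → i < 2 * D → nth 0 us i mod Gam ≡ τ* i) × kw mod K2 ≡ κ*

  module Lucky (us : List ℕ) (kw : ℕ) (zs : List ℕ) (lucky : Lucky-words us kw) where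

   private
    size≡ = fst lucky

   ys : List ℕ
   ys = us ++ kw ∷ zs

   2D+≤ : 2 * D + 4 ≤ SL
   2D+≤ = m≤m+n (2 * D + 4) (3 * BIG)

   ψ-prefix : ∀ i → i < 2 * D → ψ ys i mod Gam ≡ τ* i
   ψ-prefix i i< = cong (_mod Gam) (ψ-nth ys i (i< ⟫ m≤m+n (2 * D) 4 ⟫ 2D+≤) ∙ nth-before 0 us i (subst (i <_) (sym size≡) i<)) ∙ fst (snd lucky) i i<

   ψ-rest : ∀ i → 2 * D + i < SL → ψ ys (2 * D + i) ≡ nth 0 (kw ∷ zs) i
   ψ-rest i i< = ψ-nth ys (2 * D + i) i< ∙ cong (λ k → nth 0 ys (k + i)) (sym size≡) ∙ nth-++ʳ 0 us i

   gi≡ : ∀ j → j < D → T.gi ys j ≡ I* j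
   gi≡ j j< = ψ-prefix (2 * j) (*-monoʳ-< 2 j<) ∙ interleave-even I* E* j

   ge≡ : ∀ j → j < D → T.ge ys j ≡ E* j
   ge≡ j j< = ψ-prefix (2 * j + 1) (cong suc (+-comm (2 * j) 1) ∙ sym (*-suc 2 j) ≡⟫ *-monoʳ 2 j<) ∙ interleave-odd I* E* j

   κ≡ : T.κ ys ≡ κ*
   κ≡ = cong (_mod K2) (cong (ψ ys) (sym (n+0≡n (2 * D))) ∙ ψ-rest 0 (+-monoʳ-< (2 * D) z<s ⟫ 2D+≤)) ∙ snd (snd lucky)

   wt≡ : ∀ v → T.wt ys v ≡ w* v
   wt≡ v = cong (_+ B ^ D) (∑-cong D λ j j< → cong (λ g → G.β j v quo 2 ^ (g ⊓ W) * B ^ j) (gi≡ j j<))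

   tg≡ : T.tg ys ≡ t*
   tg≡ = cong (λ k → ∑ D (λ j → (G.ρ k j quo 2 ^ (T.gi ys j ⊓ W) ∸ T.ge ys j) * B ^ j) + k * B ^ D) κ≡ ∙
    cong (_+ κ* * B ^ D) (∑-cong D λ j j< → cong₂ (λ g h → (G.ρ κ* j quo 2 ^ (g ⊓ W) ∸ h) * B ^ j) (gi≡ j j<) (ge≡ j j<))

  private
   M : ℕ
   M = 2 ^ W

   factor : ∀ i rest → W ≡ rest + i → M ≡ 2 ^ rest * 2 ^ i
   factor i rest e = cong (2 ^_) e ∙ ^-+ 2 rest i

   W-g5 : ∀ c g n m k b → c + g + n + m + k + b + 1 ≡ c + n + m + k + b + 1 + g
   W-g5 = ring

   W-kk : ∀ c g n m k b → c + g + n + m + k + b + 1 ≡ c + g + n + m + b + 1 + k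
   W-kk = ring

   Wd₀ : GuessWords
   Wd₀ = guessWords (2 * D) Gam K2 (2 ^ (cq + n + n' + kk + b + 1)) (2 ^ (cq + g5 + n + n' + b + 1)) M
    (factor g5 (cq + n + n' + kk + b + 1) (W-g5 cq g5 n n' kk b)) (factor kk (cq + g5 + n + n' + b + 1) (W-kk cq g5 n n' kk b)) τ* κ* τ*< κ*<

   module Wd = Words Wd₀

  NN≥ : 2 ^ n ≤ NN
  NN≥ = begin
   2 ^ n ≤⟨ ^-monoʳ 2 n≤ ⟩
   2 ^ (suc n' + suc n') ≡⟨ ^-+ 2 (suc n') (suc n') ⟩
   NN ∎
   where
   n≤ : n ≤ suc n' + suc n'
   n≤ = m≤m+n n 1 ⟫ (m≡m%n+[m/n]*n (n + 1) 2) ≡⟫ +-monoˡ (n' * 2) (s≤s⁻¹ (m%n<n (n + 1) 2)) ⟫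
    m≤m+n _ 1 ⟫≡ lem n'
    where
    lem : ∀ a → 1 + a * 2 + 1 ≡ suc a + suc a
    lem = ring

  P₀ : HiddenSum
  P₀ = hiddenSum n w* t* b (<-trans t*< BIG<2^b) (λ y → <-trans (w*< y) BIG<2^b) x hit* NN K2 (n ∸ e) lbb W NN≥
   (fst (digits-bounds n)) (z<s ⟫ 2≤n)

  module P = ModuloPrimes P₀

  cq≤W : cq ≤ W
  cq≤W = (m≤m+n cq g5 ⟫ m≤m+n _ n ⟫ m≤m+n _ n' ⟫ m≤m+n _ kk ⟫ m≤m+n _ b) ⟫ m≤m+n _ 1

  module Trialᴬ (us : List ℕ) (kw pw qw zw : ℕ) (zs : List ℕ) (lucky : Lucky-words us kw)
   (gp : P.good (pw mod Yp) ≢ 0) (gq : P.good' (pw mod Yp) (qw mod Yq) ≢ 0) (gk : zw mod K2 ≡ P.k* (pw mod Yp)) where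

   open Lucky us kw (pw ∷ qw ∷ zw ∷ zs) lucky

   private
    p q : ℕ
    p = pw mod Yp
    q = qw mod Yq

    instance
     Yq≢0 : NonZero Yq
     Yq≢0 = >-nonZero (1≤2^ cq)

    q≤ : q ≤ Yq
    q≤ = mod-% qw Yq ≡⟫ <⇒≤ (m%n<n qw Yq)

    at : ∀ i → 2 * D + i < 2 * D + 4 → ψ ys (2 * D + i) ≡ nth 0 (kw ∷ pw ∷ qw ∷ zw ∷ zs) i
    at i i< = ψ-rest i (i< ⟫ 2D+≤)

    p≡ : T.p ys ≡ p
    p≡ = cong (_mod Yp) (at 1 (+-monoʳ-< (2 * D) (s<s z<s)))

    q≡ : T.q ys ≡ q
    q≡ = cong (_mod Yq) (at 2 (+-monoʳ-< (2 * D) (s≤s (s<s z<s))))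

    k≡ : T.k ys ≡ P.k* p
    k≡ = cong (_mod K2) (at 3 (+-monoʳ-< (2 * D) (s≤s (s≤s (s<s z<s))))) ∙ gk

    wp≡ : ∀ u → T.wp ys u ≡ P.wp p u
    wp≡ u = cong₂ _mod_ (wt≡ u) p≡

    T≡ : T.τ₀ ys ≡ P.Tp p
    T≡ = cong₂ (λ a b → a + b) (cong₂ _mod_ tg≡ p≡) (cong₂ _*_ k≡ p≡)

    sol≡ : T.sol ys ≡ P.solve q (P.wp p) (P.Tp p)
    sol≡ = P.solve-cong q≡ wp≡ T≡

   succeeds : verify (T.sol ys) ≡ 1
   succeeds = cong verify sol≡ ∙ verify-complete z (sound* (toVec n z) (P.solved cq≤W p q gp gq q≤))
    where z = P.solve q (P.wp p) (P.Tp p)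

  module _ (few : 𝔹 n (Transversal.A n (dot w*)) ≤ 2 ^ (n ∸ e)) where

   private
    W-cp : ∀ p l g n m k b → p + l + g + n + m + k + b + 1 ≡ l + g + n + m + k + b + 1 + p
    W-cp = ring

    W-cq : ∀ c g n m k b → c + g + n + m + k + b + 1 ≡ g + n + m + k + b + 1 + c
    W-cq = ring

    bb<Λ : suc bb ≤ 2 ^ lbb
    bb<Λ = fst (digits-bounds bb)

    Pw₀ : PrimeGuesses
    Pw₀ = primeGuesses Yp Yq K2 (2 ^ (4 * lbb + g5 + n + n' + kk + b + 1)) (2 ^ (g5 + n + n' + kk + b + 1)) (2 ^ (cq + g5 + n + n' + b + 1)) M cp cq
     (factor cp (4 * lbb + g5 + n + n' + kk + b + 1) (W-cp cp (4 * lbb) g5 n n' kk b)) (factor cq (g5 + n + n' + kk + b + 1) (W-cq cq g5 n n' kk b))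
     (factor kk (cq + g5 + n + n' + b + 1) (W-kk cq g5 n n' kk b))
     P.good P.good' P.k* P.k< P.good≤1 P.good'≤ (P.many few bb<Λ (digits≤ bb) (m∸n≤m n e)) (P.many' few bb<Λ (digits≤ bb) (m∸n≤m n e))

    module Pw = PrimeWords Pw₀

   success-countᴬ : M ^ SL ≤ R1 * 𝕊 SL M (λ ys → verify (T.sol ys))
   success-countᴬ = begin
    M ^ SL ≡⟨ cong (M ^_) (+-assoc (2 * D) 4 (3 * BIG)) ∙ ^-+ M (2 * D) (4 + 3 * BIG) ⟩
    M ^ (2 * D) * (M * M ^ (3 + 3 * BIG)) ≤⟨ Wd.guesses (3 + 3 * BIG) F (K2 * (4 * cp * cq)) (M ^ (3 + 3 * BIG)) (λ us y size≡ lucky e →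
     Pw.primes (3 * BIG) (λ zs → F (us ++ y ∷ zs)) λ px qx zx zs gp gq gk →
      ≤-reflexive (sym (Trialᴬ.succeeds us y px qx zx zs (size≡ , lucky , e) gp gq gk))) ⟩
    Gam ^ (2 * D) * K2 * (K2 * (4 * cp * cq)) * 𝕊 (2 * D + (4 + 3 * BIG)) M F ≡⟨ cong₂ _*_ R1≡ (cong (λ s → 𝕊 s M F) (sym (+-assoc (2 * D) 4 (3 * BIG)))) ⟩
    R1 * 𝕊 SL M F ∎
    where
    F : List ℕ → ℕ
    F ys = verify (T.sol ys)
    R1≡ : Gam ^ (2 * D) * K2 * (K2 * (4 * cp * cq)) ≡ R1
    R1≡ = lem (Gam ^ (2 * D)) K2 (4 * cp * cq) ∙ cong (λ g → g * (K2 * K2) * (4 * cp * cq))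
     (sym (^-*-assoc Gam 2 D) ∙ cong (λ g → (Gam * g) ^ D) (n*1≡n Gam))
     where
     lem : ∀ g k c → g * k * (k * c) ≡ g * (k * k) * c
     lem = ring

  private
   d : ℕ
   d = 16 * (n + 2)

   instance
    d≢0 : NonZero d
    d≢0 = >-nonZero (*-mono {1} {16} z<s (z<s ⟫ m≤n+m 2 n))

   1≤Lw : 1 ≤ Lw
   1≤Lw = z<s ⟫≡ sym Lw-def

   f≤ : (Lw ∸ 1) * d ≤ 2 ^ e
   f≤ = cong (λ l → (l ∸ 1) * d) Lw-def ≡⟫ cong (_* d) (quo-/ (2 ^ e) d) ≡⟫ m/n*n≤m (2 ^ e) d

   big : 2 ^ e ≤ Lw * d
   big = ((m≡m%n+[m/n]*n (2 ^ e) d) ≡⟫ +-monoˡ (2 ^ e / d * d) (<⇒≤ (m%n<n (2 ^ e) d))) ⟫≡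
    cong (_* d) (cong suc (sym (quo-/ (2 ^ e) d)) ∙ sym Lw-def)

   V-x : verify (fromVec x) ≡ 1
   V-x = verify-complete (fromVec x) (subst Solution (sym (toVec-fromVec x)) solution)

  B₀ : SplitSum
  B₀ = splitSum n w* e Lw BIG t* 1≤Lw w*< t*< x hit* verify verify01 V-x

  module B = Birthday B₀

  module Trialᴮ (us : List ℕ) (kw lw : ℕ) (zs : List ℕ) (lucky : Lucky-words us kw) where

   open Lucky us kw (lw ∷ zs) lucky

   private
    l : Vec Bool n
    l = toVec n lw

    L≡ : T.L ys ≡ lw
    L≡ = ψ-rest 1 (+-monoʳ-< (2 * D) (s<s z<s) ⟫ 2D+≤)

    start≡ : T.start ys ≡ nth 0 zs 0 mod N
    start≡ = cong (_mod N) (ψ-rest 2 (+-monoʳ-< (2 * D) (s≤s (s<s z<s)) ⟫ 2D+≤))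

    chosen : ∀ i g → ∑ n (λ v → T.xb ys i v * g v) ≡ dot g (assign (mask (odd i) l) (i / 2))
    chosen i g = spread n (T.L ys) i g ∙ cong (λ y → dot g (assign (mask (odd i) (toVec n y)) (i / 2))) L≡

    msk≡ : ∀ i → T.msk ys i ≡ B.maskOf l i
    msk≡ i = chosen i (2 ^_) ∙ dot-pow (assign (mask (odd i) l) (i / 2))

    form : ∀ s {r} → BIG + num s * t* + (1 ∸ num s) * dot w* (assign (mask s l) r) ∸ num s * dot w* (assign (mask s l) r) ≡ B.sideKey s l r
    form false {r} = cong₂ _+_ (n+0≡n BIG) (n+0≡n _)
    form true {r} = cong₂ _∸_ (n+0≡n _ ∙ cong (BIG +_) (n+0≡n t*)) (n+0≡n (dot w* (assign l r)))

    key≡ : ∀ i → T.key ys i ≡ B.keyOf l i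
    key≡ i = keyOf-cong (mod-% i 2 ∙ sym (odd-num i)) tg≡ ((∑-cong' n λ v → cong (T.xb ys i v *_) (wt≡ v)) ∙ chosen i w*) ∙ form (odd i)
     where
     keyOf-cong : ∀ {s s' t t' d d'} → s ≡ s' → t ≡ t' → d ≡ d' → BIG + s * t + (1 ∸ s) * d ∸ s * d ≡ BIG + s' * t' + (1 ∸ s') * d' ∸ s' * d'
     keyOf-cong refl refl refl = refl

    walk≡ : ∀ i → T.walk ys i ≡ B.step l zs i
    walk≡ i = cong (λ k → ψ ys (2 * D + 3 + k) mod N) (key≡ i) ∙ cong (_mod N) (cong (ψ ys) (+-assoc (2 * D) 3 _) ∙
     ψ-rest (3 + B.keyOf l i) (+-monoʳ-< (2 * D) (s≤s (s≤s (B.key<K l i))) ⟫≡ sym (+-assoc (2 * D) 4 (3 * BIG))))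

   outcome≡ : T.outcome ys ≡ B.won l zs
   outcome≡ = race-cong refl refl walk≡ (λ s → cong₂ (λ y z → verify (y + z)) (msk≡ (s quo N)) (msk≡ (s mod N))) start≡

  module _ (many : 2 ^ (n ∸ e) ≤ 𝔹 n (Transversal.A n (dot w*))) where

   private
    qN rest : ℕ
    qN = 2 ^ (cq + g5 + n + kk + b)
    rest = cq + g5 + n' + kk + b + 1

    W-n' : ∀ c g n m k b → c + g + n + m + k + b + 1 ≡ c + g + n + k + b + suc m
    W-n' = ring

    W-n : ∀ c g n m k b → c + g + n + m + k + b + 1 ≡ n + (c + g + m + k + b + 1)
    W-n = ring

    C₀ : Odds
    C₀ = odds B₀ M qN rest
     (factor (suc n') (cq + g5 + n + kk + b) (W-n' cq g5 n n' kk b)) (1≤2^ W) (cong (2 ^_) (W-n cq g5 n n' kk b)) (m/n*n≤m (14 * n) 100) f≤ many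

    module C = BirthdayCount C₀

    C* : ℕ
    C* = 16 * 16 * 16 * ((n + 2) * (n + 2) * (n + 2)) * 4 ^ ne

    F : List ℕ → ℕ
    F ys = T.outcome ys

    walks : ∀ us y → length us ≡ 2 * D → (∀ i → i < 2 * D → nth 0 us i mod Gam ≡ τ* i) → y mod K2 ≡ κ* →
     M ^ (3 + 3 * BIG) ≤ C* * 𝕊 (3 + 3 * BIG) M (λ zs → F (us ++ y ∷ zs))
    walks us y size≡ lucky lucky-κ = trial-constant e n n' Lw _ _ big (C.success-count ⟫≡ cong (16 * (n + 2) * (N * N) *_)
     (∑-cong' M λ lw → 𝕊-cong (2 + 3 * BIG) {M} λ zs _ → sym (Trialᴮ.outcome≡ us y lw zs (size≡ , lucky , lucky-κ))))

   success-countᴮ : M ^ SL ≤ R2 * 𝕊 SL M (λ ys → T.outcome ys)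
   success-countᴮ = begin
    M ^ SL ≡⟨ cong (M ^_) (+-assoc (2 * D) 4 (3 * BIG)) ∙ ^-+ M (2 * D) (4 + 3 * BIG) ⟩
    M ^ (2 * D) * (M * M ^ (3 + 3 * BIG)) ≤⟨ Wd.guesses (3 + 3 * BIG) F C* (M ^ (3 + 3 * BIG)) walks ⟩
    Gam ^ (2 * D) * K2 * C* * 𝕊 (2 * D + (4 + 3 * BIG)) M F ≡⟨ cong₂ _*_ R2≡ (cong (λ s → 𝕊 s M F) (sym (+-assoc (2 * D) 4 (3 * BIG)))) ⟩
    R2 * 𝕊 SL M F ∎
    where
    R2≡ : Gam ^ (2 * D) * K2 * C* ≡ R2
    R2≡ = cong (λ g → g * K2 * C*) (sym (^-*-assoc Gam 2 D) ∙ cong (λ g → (Gam * g) ^ D) (n*1≡n Gam))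

-- Repetition and one-sided error.

sumL-mono : ∀ n {F G : List Bool → ℕ} → (∀ l → length l ≡ n → F l ≤ G l) → sumL n F ≤ sumL n G
sumL-mono zero h = h [] refl
sumL-mono (suc n) h = +-mono (sumL-mono n λ l e → h (false ∷ l) (cong suc e)) (sumL-mono n λ l e → h (true ∷ l) (cong suc e))

count-cong : ∀ {L} {E E' : Vec Bool L → Bool} → (∀ ω → E ω ≡ E' ω) → count E ≡ count E'
count-cong {zero} h = cong (if_then 1 else 0) (h [])
count-cong {suc L} h = cong₂ _+_ (count-cong λ ω → h (false ∷ ω)) (count-cong λ ω → h (true ∷ ω))

nth-take : ∀ {A : Set} (d : A) k l i → i < k → nth d (List.take k l) i ≡ nth d l i
nth-take d (suc k) [] i i< = refl
nth-take d (suc k) (x ∷ l) zero i< = refl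
nth-take d (suc k) (x ∷ l) (suc i) (s≤s i<) = nth-take d k l i i<

word-block : ∀ W S R l b s → 1 ≤ S → b < R →
 ∑ W (λ i → bitval l ((b * S + s mod S) * W + i) * 2 ^ i) ≡ nth 0 (block S b (words W (R * S) l)) (s mod S)
word-block W S R l b s 1≤S b< = sym (nth-take 0 S _ (s mod S) s< ∙ nth-drop 0 (b * S) _ (s mod S) ∙
 nth-words W (R * S) l (b * S + s mod S) (+-monoʳ-< (b * S) s< ⟫ +-comm (b * S) S ≡⟫ *-monoˡ S b<))
 where
 instance
  S≢0 : NonZero S
  S≢0 = >-nonZero 1≤S
 s< : s mod S < S
 s< = ≤-<-trans (≤-reflexive (mod-% s S)) (m%n<n s S)

any-sound : ∀ n f → any n f ≡ true → ∃ λ b → b < n × f b ≢ 0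
any-sound (suc n) f h with f n in e
... | suc _ = n , ≤-refl , λ z → 1+n≢0 (sym e ∙ z)
... | zero with any-sound n f h
... | b , b< , ne = b , <-suc b< , ne

any-complete : ∀ n f → any n f ≡ false → ∀ b → b < n → f b ≡ 0
any-complete (suc n) f h b (s≤s b≤) with f n in e | m≤n⇒m<n∨m≡n b≤
... | zero | inj₁ b< = any-complete n f h b b<
... | zero | inj₂ refl = e

-- R independent blocks that each succeed with probability at least 1/R fail together with
-- probability at most 1/2; the bits behind the blocks are only a common factor.
few-failures : ∀ W SL R r (F : List ℕ → ℕ) → (∀ ys → F ys ≤ 1) → (2 ^ W) ^ SL ≤ R * 𝕊 SL (2 ^ W) F → (failed : List Bool → Bool) →
 (∀ l → failed l ≡ true → ∀ b → b < R → F (block SL b (words W (R * SL) l)) ≡ 0) →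
 let L = R * SL * W + r in 2 * sumL L (λ l → if failed l then 1 else 0) ≤ 2 ^ L
few-failures W SL R r F F≤1 likely failed h = begin
 2 * sumL L (λ l → if failed l then 1 else 0) ≤⟨ *-monoʳ 2 (sumL-mono L λ l _ → all-fail l (failed l) refl) ⟩
 2 * sumL L (λ l → G (words W (R * SL) l)) ≡⟨ cong (2 *_) (sumL-words W (R * SL) r G ∙ cong (2 ^ r *_) (𝕊-blocks R SL M F')) ⟩
 2 * (2 ^ r * 𝕊 SL M F' ^ R) ≡⟨ lem (2 ^ r) _ ⟩
 2 ^ r * (2 * 𝕊 SL M F' ^ R) ≤⟨ *-monoʳ (2 ^ r) (amplify (𝕊 SL M F') (𝕊 SL M F) (M ^ SL) R (m^n>0 M {{m^n≢0 2 W}} SL) total likely) ⟩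
 2 ^ r * (M ^ SL) ^ R ≡⟨ *-comm (2 ^ r) _ ∙ cong (_* 2 ^ r) (^-*-assoc M SL R ∙ ^-*-assoc 2 W (SL * R) ∙ cong (2 ^_) (lem' W SL R)) ⟩
 2 ^ (R * SL * W) * 2 ^ r ≡⟨ ^-+ 2 (R * SL * W) r ⟨
 2 ^ L ∎
 where
 M = 2 ^ W
 L = R * SL * W + r
 F' G : List ℕ → ℕ
 F' ys = 1 ∸ F ys
 G xs = ∏ R (λ b → F' (block SL b xs))
 all-fail : ∀ l c → failed l ≡ c → (if c then 1 else 0) ≤ G (words W (R * SL) l)
 all-fail l false e = z≤n
 all-fail l true e = ≤-reflexive (sym (∏-one R λ b b< → cong (1 ∸_) (h l e b b<)))
 total : 𝕊 SL M F' + 𝕊 SL M F ≤ M ^ SL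
 total = ≤-reflexive (sym (𝕊-+ SL M F' F) ∙ (𝕊-cong SL {M} λ ys _ → m∸n+n≡m (F≤1 ys)) ∙ 𝕊-const SL M 1 ∙ n*1≡n _)
 lem : ∀ a b → 2 * (a * b) ≡ a * (2 * b)
 lem = ring
 lem' : ∀ w s r → w * (s * r) ≡ r * s * w
 lem' = ring

either-sound : ∀ r₁ r₂ {f g} → any r₁ f ∨ (any r₂ g ∨ false) ≡ true → (∃ λ b → b < r₁ × f b ≢ 0) ⊎ (∃ λ b → b < r₂ × g b ≢ 0)
either-sound r₁ r₂ {f} {g} h with any r₁ f in e | any r₂ g in e'
... | true | _ = inj₁ (any-sound r₁ f e)
... | false | true = inj₂ (any-sound r₂ g e')

either-complete : ∀ r₁ r₂ {f g} → any r₁ f ∨ (any r₂ g ∨ false) ≡ false → any r₁ f ≡ false × any r₂ g ≡ false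
either-complete r₁ r₂ {f} {g} h with any r₁ f | any r₂ g
... | false | false = refl , refl

module Correctness (μ : ℕ → ℕ) where

 open Setting μ

 private
  1≤B : 1 ≤ B
  1≤B = *-mono (*-mono {1} {2} z<s (m≤n+m 1 n)) (m≤n+m 1 O)

  n≤W : n ≤ W
  n≤W = m≤n+m n (cq + g5) ⟫ m≤m+n _ n' ⟫ m≤m+n _ kk ⟫ m≤m+n _ b ⟫ m≤m+n _ 1

  1≤SL : 1 ≤ SL
  1≤SL = (z<s ⟫ m≤n+m 4 (2 * D)) ⟫ m≤m+n (2 * D + 4) (3 * BIG)

  1≤R1 : 1 ≤ R1
  1≤R1 = *-mono (*-mono (m^n>0 (Gam * Gam) {{>-nonZero (*-mono (1≤2^ g5) (1≤2^ g5))}} D) (*-mono (1≤2^ kk) (1≤2^ kk)))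
   (*-mono (*-mono {1} {4} z<s 1≤cp) (1≤cp ⟫ m≤m+n cp (4 * lbb)))
   where
   positive : ∀ x → 32 ≤ x → 1 ≤ digits x
   positive (suc x) _ = z<s ⟫≡ sym (digits-suc x)
   1≤cp : 1 ≤ cp
   1≤cp = positive bb (m≤n+m 32 (b + n)) ⟫ m≤n*m lbb 3 ⟫ m≤n+m (3 * lbb) (n ∸ e)

 module Run (l : List Bool) where

  blocks : ℕ → ℕ → List ℕ
  blocks R b = block SL b (words W (R * SL) l)

  valueA valueB : ℕ → ℕ
  valueA b = evalˡ μ (bitval l) b (lower trialA) π
  valueB b = evalˡ μ (bitval l) b (lower trialB) π

  valueA≡ : ∀ b → b < R1 → valueA b ≡ verify (T.sol (blocks R1 b)) + (verify 0 + verify 1)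
  valueA≡ b b< = lower-eval μ (bitval l) π b (ψ (blocks R1 b))
   (λ s → Blocks.word-sem μ (bitval l) π b s ∙ word-block W SL R1 l b s 1≤SL b<) trialA ∙
   T.trialA-value (blocks R1 b) n≤W 1≤B

  valueB≡ : ∀ b → b < R2 → valueB b ≡ T.outcome (blocks R2 b)
  valueB≡ b b< = lower-eval μ (bitval l) π b (ψ (blocks R2 b))
   (λ s → Blocks.word-sem μ (bitval l) π b s ∙ word-block W SL R2 l b s 1≤SL b<) trialB ∙
   T.trialB-value (blocks R2 b) n≤W 1≤B

  accepted : Bool
  accepted = any R1 valueA ∨ (any R2 valueB ∨ false)

  sound : accepted ≡ true → ∃ λ z → verify z ≢ 0
  sound h = [ (λ { (b , b< , ne) → T.found-A (blocks R1 b) (valueA≡ b b<) ne }) , (λ { (b , b< , ne) → T.found-B (blocks R2 b) (valueB≡ b b<) ne }) ]′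
   (either-sound R1 R2 h)

  rejectedA : accepted ≡ false → ∀ b → b < R1 → verify (T.sol (blocks R1 b)) ≡ 0 × verify 0 + verify 1 ≡ 0
  rejectedA h b b< = m+n≡0⇒m≡0 _ zero-sum , m+n≡0⇒n≡0 (verify (T.sol (blocks R1 b))) zero-sum
   where
   zero-sum : verify (T.sol (blocks R1 b)) + (verify 0 + verify 1) ≡ 0
   zero-sum = sym (valueA≡ b b<) ∙ any-complete R1 valueA (fst (either-complete R1 R2 h)) b b<

  rejectedB : accepted ≡ false → ∀ b → b < R2 → T.outcome (blocks R2 b) ≡ 0
  rejectedB h b b< = sym (valueB≡ b b<) ∙ any-complete R2 valueB (snd (either-complete R1 R2 h)) b b<

 verify≤1 : ∀ x → verify x ≤ 1
 verify≤1 x = verify-def x ≡⟫ m∸n≤m 1 (violation x)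

 outcome≤1 : ∀ ys → T.outcome ys ≤ 1
 outcome≤1 ys = race-def N NN Lw (T.walk ys) (T.join ys) (T.start ys) ≡⟫ verify≤1 _

 -- Both sweeps read the same random bits. A rejection means that both have failed, in particular
 -- the one that suits the number of sums, and the failure of that one is estimated.
 module Complete (m≤O : m ≤ O)
  (pos≤ : ∀ j v → j < D → v < n → P⁺ j v ≤ m) (neg≤ : ∀ j v → j < D → v < n → P⁻ j v ≤ m)
  (one-sign : ∀ k → posᵉ k ≡ 0 ⊎ negᵉ k ≡ 0) (x : Vec Bool n) (solution : Solution x)
  (L r₁ r₂ : ℕ) (L≡₁ : R1 * SL * W + r₁ ≡ L) (L≡₂ : R2 * SL * W + r₂ ≡ L) where

  Failing : ℕ
  Failing = sumL L λ l → if not (Run.accepted l) then 1 else 0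

  private
   not⇒ : ∀ {c} → not c ≡ true → c ≡ false
   not⇒ {false} _ = refl

   trivial : verify 0 + verify 1 ≢ 0 → 2 * Failing ≤ 2 ^ L
   trivial ne = cong (2 *_) ((sumL-cong L λ l _ → go l (Run.accepted l) refl) ∙ sumL-const L 0 ∙ *-zeroʳ (2 ^ L)) ≡⟫ z≤n
    where
    go : ∀ l c → Run.accepted l ≡ c → (if not c then 1 else 0) ≡ 0
    go l true e = refl
    go l false e = ⊥-elim (ne (snd (Run.rejectedA l e 0 1≤R1)))

   one≢0 : ∀ {y z} → y ≡ 1 ⊎ z ≡ 1 → y + z ≢ 0
   one≢0 (inj₁ refl) ()
   one≢0 {y} (inj₂ refl) e with () ← +-comm 1 y ∙ e

   tiny : ∀ k → k ≤ 1 → (y : Vec Bool k) → toVec k 0 ≡ y ⊎ toVec k 1 ≡ y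
   tiny zero _ [] = inj₁ refl
   tiny (suc zero) _ (false ∷ []) = inj₁ refl
   tiny (suc zero) _ (true ∷ []) = inj₂ refl
   tiny (suc (suc k)) (s≤s ()) y

   few-variables : n ≤ 1 → verify 0 + verify 1 ≢ 0
   few-variables n≤1 = one≢0 ([ (λ e → inj₁ (verify-complete 0 (subst Solution (sym e) solution))) ,
    (λ e → inj₂ (verify-complete 1 (subst Solution (sym e) solution))) ]′ (tiny n n≤1 x))

   -- If m = 0, all left hand sides vanish, so the empty choice satisfies the rows as soon as x
   -- does.
   no-weights : m ≡ 0 → verify 0 + verify 1 ≢ 0
   no-weights m≡0 = one≢0 {z = verify 1} (inj₁ (verify-complete 0 λ j j< → subst₂ (λ p q → p + U⁻ j ≤ q + U⁺ j)
    (vanish (P⁺ j) (λ v → pos≤ j v j<) x (toVec n 0)) (vanish (P⁻ j) (λ v → neg≤ j v j<) x (toVec n 0)) (solution j j<)))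
    where
    vanish : ∀ (g : ℕ → ℕ) → (∀ v → v < n → g v ≤ m) → ∀ y z → dot g y ≡ dot {n} g z
    vanish g h y z = zero-dot y ∙ sym (zero-dot z)
     where
     zero-dot : ∀ y → dot {n} g y ≡ 0
     zero-dot y = n≤0⇒n≡0 ((dot≤ 0 y λ v v< → h v v< ⟫≡ m≡0) ⟫≡ *-zeroʳ n)

   module Big (2≤n : 2 ≤ n) (1≤m : 1 ≤ m) where

    module H = Hidden (hypotheses 2≤n 1≤m m≤O pos≤ neg≤ one-sign x solution)

    few : 𝔹 n (Transversal.A n (dot H.w*)) ≤ 2 ^ (n ∸ e) → 2 * Failing ≤ 2 ^ L
    few h = subst (λ L → 2 * sumL L (λ l → if not (Run.accepted l) then 1 else 0) ≤ 2 ^ L) L≡₁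
     (few-failures W SL R1 r₁ (λ ys → verify (T.sol ys)) (λ ys → verify≤1 _)
      (H.success-countᴬ h) (λ l → not (Run.accepted l))
      λ l q b b< → fst (Run.rejectedA l (not⇒ q) b b<))

    many : 2 ^ (n ∸ e) ≤ 𝔹 n (Transversal.A n (dot H.w*)) → 2 * Failing ≤ 2 ^ L
    many h = subst (λ L → 2 * sumL L (λ l → if not (Run.accepted l) then 1 else 0) ≤ 2 ^ L) L≡₂
     (few-failures W SL R2 r₂ (λ ys → T.outcome ys) outcome≤1
      (H.success-countᴮ h) (λ l → not (Run.accepted l))
      λ l q b b< → Run.rejectedB l (not⇒ q) b b<)

    either : 2 * Failing ≤ 2 ^ L
    either = [ few , many ]′ (≤-total (𝔹 n (Transversal.A n (dot H.w*))) (2 ^ (n ∸ e)))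

  failing : 2 * Failing ≤ 2 ^ L
  failing = [ (λ 2≤n → [ (λ 1≤m → Big.either 2≤n 1≤m) , (λ m≤0 → trivial (no-weights (n≤0⇒n≡0 m≤0))) ]′ (<-≤-connex 0 m)) ,
   (λ n≤1 → trivial (few-variables n≤1)) ]′ (<-≤-connex 1 n)

-- The machine with its time, space and error bounds.

half≤ : ∀ c N .{{_ : NonZero N}} → 2 * c ≤ N → ℚ._/_ (⁺ c) N ℚ.≤ ½
half≤ c (suc N) h = ℚₚ.toℚᵘ-cancel-≤ (ℚᵘₚ.≤-respˡ-≃ (ℚᵘₚ.≃-sym (ℚₚ.toℚᵘ-fromℚᵘ (mkℚᵘ (⁺ c) N)))
 (ℚᵘ.*≤* (subst₂ ℤ._≤_ (ℤₚ.pos-* c 2) (ℤₚ.pos-* 1 (suc N)) (ℤ.+≤+ (*-comm c 2 ≡⟫ h ⟫≡ sym (*-identityˡ (suc N)))))))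

iterate-max : ∀ n (f : ℕ → ℕ) O a → a ≤ O → let r = iterate↓ n (λ k a → (a + (f k ∸ a)) ⊓ O) a in
 a ≤ r × r ≤ O × (∀ k → k < n → f k ≤ O → f k ≤ r) × (∀ M → a ≤ M → (∀ k → k < n → f k ≤ M) → r ≤ M)
iterate-max zero f O a a≤ = ≤-refl , a≤ , (λ k ()) , λ M h _ → h
iterate-max (suc n) f O a a≤ with iterate-max n f O ((a + (f n ∸ a)) ⊓ O) (m⊓n≤n (a + (f n ∸ a)) O)
... | h₁ , h₂ , h₃ , h₄ = ⊓-glb (m≤m+n a _) a≤ ⟫ h₁ , h₂ ,
 (λ k k< k≤ → [ (λ lt → h₃ k lt k≤) , (λ { refl → ⊓-glb (m≤n+m∸n (f n) a) k≤ ⟫ h₁ }) ]′ (m≤n⇒m<n∨m≡n (s≤s⁻¹ k<))) ,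
 λ M a≤M h → h₄ M (m⊓n≤m _ O ⟫ ([ (λ le → (m+[n∸m] le) ≡⟫ h n ≤-refl) ,
  (λ ge → cong (a +_) (m≤n⇒m∸n≡0 ge) ∙ n+0≡n a ≡⟫ a≤M) ]′ (≤-total a (f n)))) λ k k< → h k (<-suc k<)

only-spec : ∀ i j → lookup (only i) j ≡ true → j ≡ i
only-spec i j h with j Fin.≟ i
... | yes e = e
... | no ne with () ← sym (lookup∘update′ ne (Vec.replicate P# false) true ∙ lookup-replicate j false) ∙ h

trial-time : ∀ {σ H} → 2 ≤ σ → 1 ≤ H → (π : Vec ℕ P#) → Small σ smallᵖ π × Under σ π → ∀ k → lookup π k ≤ H →
 (e : Exp lo P# 0) → loopsWithin smallᵖ (only k) e ≡ true → loopDepth smallᵖ e ≡ 1 → time e π ≤ σ ^ timeDegree e * H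
trial-time {σ} {H} 2≤σ 1≤H π (small≤ , π<) k k≤ e ok depth =
 time≤ smallᵖ (only k) π small≤ (λ i h → subst (λ i → lookup π i ≤ H) (sym (only-spec k i h)) k≤) π< e (subst T (sym ok) tt) ⟫≡
  G-def (timeDegree e) (loopDepth smallᵖ e) ∙ cong (σ ^ timeDegree e *_) (cong (H ^_) depth ∙ n*1≡n H)
 where open TimeBounds σ H 2≤σ 1≤H

any-cong : ∀ n {f g : ℕ → ℕ} → (∀ i → f i ≡ g i) → any n f ≡ any n g
any-cong zero h = refl
any-cong (suc n) {f} {g} h rewrite h n with g n
... | zero = any-cong n h
... | suc _ = refl

accepts-sweeps : ∀ μ β e₁ e₂ π → accepts μ β (sweep R1ᵖ e₁ (sweep R2ᵖ e₂ stop)) π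
 ≡ any (lookup π R1ᵖ) (λ b → evalˡ μ β b e₁ π) ∨ (any (lookup π R2ᵖ) (λ b → evalˡ μ β b e₂ π) ∨ false)
accepts-sweeps μ β e₁ e₂ π = cong₂ (λ x y → x ∨ (y ∨ false)) (any-cong (lookup π R1ᵖ) λ b → sym (evalˡ-def μ β b e₁ π))
 (any-cong (lookup π R2ᵖ) λ b → sym (evalˡ-def μ β b e₂ π))

time-sweeps : ∀ μ β e₁ e₂ π {t₁ t₂} → time e₁ π ≤ t₁ → time e₂ π ≤ t₂ → timeᵖ μ β (sweep R1ᵖ e₁ (sweep R2ᵖ e₂ stop)) π
 ≤ (3 + lookup π R1ᵖ * (4 + t₁)) + (3 + lookup π R2ᵖ * (4 + t₂))
time-sweeps μ β e₁ e₂ π h₁ h₂ = +-mono (+-monoʳ 3 (*-monoʳ (lookup π R1ᵖ) (+-monoʳ 4 h₁)))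
 (n+0≡n _ ≡⟫ +-monoʳ 3 (*-monoʳ (lookup π R2ᵖ) (+-monoʳ 4 h₂)))

log-pred : ∀ x y → x ≤ y → digits (x ∸ 1) ≤ ⌈log₂ y ⌉
log-pred zero y h = z≤n
log-pred (suc x) y h = ⌈log₂⌉-mono-≤ h

suc-pred≤ : ∀ x y → x ≤ y → 1 + (x ∸ 1) ≤ 1 ⊔ y
suc-pred≤ zero y h = m≤m⊔n 1 y
suc-pred≤ (suc x) y h = h ⟫ m≤n⊔m 1 y

module Setup {n d : ℕ} (I : BLP n d) (bound : ℤ) where

 module N = Instance I bound
 module S = Setting N.μ

 s : ℕ
 s = inputSize I bound

 2≤s : 2 ≤ s
 2≤s = m≤m+n 2 _ ⟫ N.size≥

 n≤s : n ≤ s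
 n≤s = ((m≤m+n n (d * n + d) ⟫≡ sym (+-assoc n (d * n) d)) ⟫ cnt≤) ⟫ N.size≥
  where
  cnt≤ : N.cnt ≤ 2 + 2 * (N.cnt + 1)
  cnt≤ = pad (lem N.cnt)
   where
   lem : ∀ c → c + (4 + c) ≡ 2 + 2 * (c + 1)
   lem = ring

 d≤s : d ≤ s
 d≤s = (m≤n+m d (N.D * n) ⟫ pad (lem N.cnt)) ⟫ N.size≥
  where
  lem : ∀ c → c + (4 + c) ≡ 2 + 2 * (c + 1)
  lem = ring

 private
  mag : ℕ → ℕ
  mag k = N.μ (3 + 2 * k)

  max : 0 ≤ S.m × S.m ≤ S.O × (∀ k → k < N.cnt → mag k ≤ S.O → mag k ≤ S.m) × (∀ M → 0 ≤ M → (∀ k → k < N.cnt → mag k ≤ M) → S.m ≤ M)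
  max = iterate-max N.cnt mag S.O 0 z≤n

  mag≤m : ∀ j v → j < N.D → v < n → mag (j * n + v) ≤ S.m
  mag≤m j v j< v< = fst (snd (snd max)) (j * n + v) k< (∑-term (j * n + v) mag k< ⟫ m≤n+m _ (mag N.cnt) ⟫ n≤1+n _)
   where
   k< : j * n + v < N.cnt
   k< = N.row-index< j v j< v< ⟫ m≤m+n (N.D * n) d

 m≤O : S.m ≤ S.O
 m≤O = fst (snd max)

 m≤max : S.m ≤ maxAbs I
 m≤max = snd (snd (snd max)) (maxAbs I) z≤n N.μ-abs≤

 pos≤ : ∀ j v → j < N.D → v < n → S.P⁺ j v ≤ S.m
 pos≤ j v j< v< = (N.μ-pos (j * n + v) ≡⟫ pos⁺≤ (N.entry (j * n + v)) ⟫≡ N.abs-μ (j * n + v)) ⟫ mag≤m j v j< v<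

 neg≤ : ∀ j v → j < N.D → v < n → S.P⁻ j v ≤ S.m
 neg≤ j v j< v< = (N.μ-neg (j * n + v) ≡⟫ neg⁻≤ (N.entry (j * n + v)) ⟫≡ N.abs-μ (j * n + v)) ⟫ mag≤m j v j< v<

 one-sign : ∀ k → S.posᵉ k ≡ 0 ⊎ S.negᵉ k ≡ 0
 one-sign k = subst₂ (λ x y → x ≡ 0 ⊎ y ≡ 0) (sym (N.μ-pos k)) (sym (N.μ-neg k)) (one-signed (N.entry k))

 lam≤ : 1 + S.lam1 ≤ logBase I
 lam≤ = suc-pred≤ (S.lg * n) (⌈log₂ (maxAbs I * n) ⌉ * n) (*-monoˡ n (log-pred (S.m * n) (maxAbs I * n) (*-monoˡ n m≤max)))

 private
  left : ∀ j y → dot (S.P⁺ j) y + S.U⁻ j ≡ dot {n} (N.P⁺ j) y + N.U⁻ j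
  left j y = cong₂ _+_ (dot-cong y λ v _ → N.μ-pos (j * n + v)) (N.μ-neg (N.rhs j))

  right : ∀ j y → dot (S.P⁻ j) y + S.U⁺ j ≡ dot {n} (N.P⁻ j) y + N.U⁺ j
  right j y = cong₂ _+_ (dot-cong y λ v _ → N.μ-neg (j * n + v)) (N.μ-pos (N.rhs j))

 solved : ∀ z → S.verify z ≢ 0 → HasSolution I bound
 solved z h = N.rows⇒solution (toVec n z) λ j j< → subst₂ _≤_ (left j (toVec n z)) (right j (toVec n z)) (S.verify-sound z h j j<)

 solvable : HasSolution I bound → ∃ λ x → S.Solution x
 solvable h with N.solution⇒rows h
 ... | x , rows = x , λ j j< → subst₂ _≤_ (sym (left j x)) (sym (right j x)) (rows j j<)

-- The program is a variable here, so that type checking never unfolds it.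
module Solver (p : Prog 0) (values≡ : ∀ μ φ → Evaluation.Values μ φ [] p [] smallᵖ (Evaluation.sweeps μ φ) (Parameters.π μ))
 (okp : okProducts [] p ≡ true) (oks : setupOk [] p ≡ true) where

 open Top p

 abstract
  yA yB : ℕ
  yA = timeDegree (lower trialA)
  yB = timeDegree (lower trialB)

  trialA-time : ∀ {σ H} → 2 ≤ σ → 1 ≤ H → (π : Vec ℕ P#) → Small σ smallᵖ π × Under σ π →
   lookup π Yqᵖ ≤ H → time (lower trialA) π ≤ σ ^ yA * H
  trialA-time 2≤σ 1≤H π sized k≤ = trial-time 2≤σ 1≤H π sized Yqᵖ k≤ (lower trialA) okA depthA

  trialB-time : ∀ {σ H} → 2 ≤ σ → 1 ≤ H → (π : Vec ℕ P#) → Small σ smallᵖ π × Under σ π →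
   lookup π Lwᵖ ≤ H → time (lower trialB) π ≤ σ ^ yB * H
  trialB-time 2≤σ 1≤H π sized k≤ = trial-time 2≤σ 1≤H π sized Lwᵖ k≤ (lower trialB) okB depthB

 g x t q cT cS cR : ℕ
 g = growth p
 x = setupDegree p
 t = g * (21 + (30 + (x + yA + yB)))
 q = g * degreeᵖ p
 cT = 1 + t
 cS = suc (suc K * 3) + suc q
 cR = 3 + g

 module _ {n d : ℕ} (I : BLP n d) (bound : ℤ) where

  open Setup I bound

  σ L τ : ℕ
  σ = s ^ g
  L = 2 ^ poly cR s
  τ = σ ^ x + ((3 + S.R1 * (4 + σ ^ yA * S.Yq)) + (3 + S.R2 * (4 + σ ^ yB * S.Lw)))

  private
   instance
    s≢0 : NonZero s
    s≢0 = >-nonZero (z<s ⟫ 2≤s)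

   s≤σ : s ≤ σ
   s≤σ = sym (^-identityʳ s) ≡⟫ ^-monoʳ s (growth≥1 p)

   2≤σ : 2 ≤ σ
   2≤σ = 2≤s ⟫ s≤σ

   module _ (β : ℕ → ℕ) (β≤ : ∀ i → β i ≤ 1) where

    fine-p : Fine N.μ β σ p [] []
    fine-p = fine s σ 2≤s p [] [] N.μ β ≤-refl (subst T (sym okp) tt) (λ ()) (λ ()) (nth<2^bits (encode I bound)) β≤ n≤s d≤s

    sized : Small σ smallᵖ S.π × Under σ S.π
    sized = Evaluation.sized-values N.μ β (values≡ N.μ β) fine-p ((λ ()) , λ ())

    time-p : timeᵖ N.μ β p [] ≤ τ
    time-p = time-values 2≤σ (values≡ N.μ β) (subst T (sym oks) tt) fine-p ((λ ()) , λ ()) ⟫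
     +-monoʳ (σ ^ x) (time-sweeps N.μ β (lower trialA) (lower trialB) S.π
      (trialA-time 2≤σ (1≤2^ S.cq) S.π sized ≤-refl) (trialB-time 2≤σ (z<s ⟫≡ sym S.Lw-def) S.π sized ≤-refl))

   sized₀ : Small σ smallᵖ S.π × Under σ S.π
   sized₀ = sized (λ _ → 0) λ _ → z≤n

  time-bound : TimeBound cT 20 I bound τ
  time-bound = RunningTime.bound-100 N.μ σ 2≤σ sized₀ (logBase I) x yA yB lam≤ ⟫
   *-monoʳ (2 ^ (86 * n)) (^-monoˡ 100 (*-monoˡ (logBase I ^ (20 * d)) (^-*-assoc s g _ ≡⟫
    ^-monoʳ s (n≤1+n t) ⟫ m≤n*m (s ^ cT) cT)))

  private
   bits≤ : ∀ (ω : Vec Bool L) i → bitval (Vec.toList ω) i ≤ 1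
   bits≤ ω i = le (nth false (Vec.toList ω) i)
    where
    le : ∀ b → (if b then 1 else 0) ≤ 1
    le true = ≤-refl
    le false = z≤n

   accepted : Vec Bool L → Bool
   accepted ω = Correctness.Run.accepted N.μ (Vec.toList ω)

  given-input : Vec Bool L → Given
  given-input ω = given ω (encode I bound) s 2≤s (nth<2^bits (encode I bound)) n≤s d≤s (subst T (sym okp) tt)

  output≡ : ∀ (ω : Vec Bool L) → output Pg ω (encode I bound) τ ≡ just (accepted ω)
  output≡ ω = prog-output (given-input ω) (time-p (bitval (Vec.toList ω)) (bits≤ ω)) ∙
   cong just (Evaluation.accepts-values N.μ (bitval (Vec.toList ω)) (values≡ N.μ (bitval (Vec.toList ω))) ∙
    accepts-sweeps N.μ (bitval (Vec.toList ω)) (lower trialA) (lower trialB) S.π)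

  space-bound : ∀ (ω : Vec Bool L) u → space (run Pg ω (encode I bound) u) ≤ poly cS s
  space-bound ω u = begin
   space (run Pg ω (encode I bound) u) ≤⟨ prog-space (given-input ω) u ⟩
   suc K * (2 + (s ^ g) ^ degreeᵖ p) + s ≡⟨ cong (λ y → suc K * (2 + y) + s) (^-*-assoc s g (degreeᵖ p)) ⟩
   suc K * (2 + s ^ q) + s ≤⟨ +-mono (*-monoʳ (suc K) (+-mono (2≤s ⟫ s≤Y) (^-monoʳ s (n≤1+n q)))) s≤Y ⟩
   suc K * (Y + Y) + Y ≤⟨ pad (lem (suc K) Y) ⟩
   suc (suc K * 3) * Y ≤⟨ *-mono (m≤m+n (suc (suc K * 3)) (suc q)) (^-monoʳ s (m≤n+m (suc q) (suc (suc K * 3)))) ⟩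
   poly cS s ∎
   where
   Y = s ^ suc q
   s≤Y : s ≤ Y
   s≤Y = m≤m*n s (s ^ q) {{m^n≢0 s q}}
   lem : ∀ k y → k * (y + y) + y + k * y ≡ suc (k * 3) * y
   lem = ring

  sound : ∀ (ω : Vec Bool L) → output Pg ω (encode I bound) τ ≡ just true → HasSolution I bound
  sound ω h = solved (fst found) (snd found)
   where
   found : ∃ λ z → S.verify z ≢ 0
   found = Correctness.Run.sound N.μ (Vec.toList ω) (Maybeₚ.just-injective (sym (output≡ ω) ∙ h))

  private
   -- Three factors below 2^σ need at most 2^(3σ) random bits, whence the 3 in `cR`.
   enough : ∀ R → R < 2 ^ σ → R * S.SL * S.W ≤ L
   enough R R< = *-mono (*-mono (<⇒≤ R<) (<⇒≤ (snd sized₀ SLᵖ))) (<⇒≤ (snd sized₀ Wᵖ)) ⟫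
    cong (_* 2 ^ σ) (sym (^-+ 2 σ σ)) ∙ sym (^-+ 2 (σ + σ) σ) ≡⟫
     ^-monoʳ 2 (lem σ ≡⟫ *-mono (m≤m+n 3 g) (^-monoʳ s (m≤n+m g 3)))
    where
    lem : ∀ y → y + y + y ≡ 3 * y
    lem = ring

  failure : HasSolution I bound → Pr (λ (ω : Vec Bool L) → rejects (output Pg ω (encode I bound) τ)) ℚ.≤ ½
  failure h = half≤ (count {L} (λ ω → rejects (output Pg ω (encode I bound) τ))) (2 ^ L) {{m^n≢0 2 L}}
   (cong (2 *_) ((count-cong λ ω → cong rejects (output≡ ω) ∙ rejects-just (accepted ω)) ∙
    (count-toList L λ l → not (Correctness.Run.accepted N.μ l))) ≡⟫
    Correctness.Complete.failing N.μ m≤O pos≤ neg≤ one-sign (fst (solvable h)) (snd (solvable h)) L _ _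
     (m+[n∸m] (enough S.R1 (snd sized₀ R1ᵖ))) (m+[n∸m] (enough S.R2 (snd sized₀ R2ᵖ))))
   where
   rejects-just : ∀ b → rejects (just b) ≡ not b
   rejects-just true = refl
   rejects-just false = refl

 solves :
   ∃ λ (k : ℕ) → Σ (Program k) λ P →
   ∃ λ (ε : ℚ) → (ε ℚ.< 1ℚ) ×
   (∃ λ (cT : ℕ) → ∃ λ (cS : ℕ) → ∃ λ (cR : ℕ) → ∃ λ (C : ℕ) →
     ∀ (n d : ℕ) (I : BLP n d) (bound : ℤ) →
     let input = encode I bound
         s     = inputSize I bound
         Ω     = Vec Bool (2 ^ poly cR s)
     in
     ∃ λ (T : ℕ) → TimeBound cT C I bound T
       × (∀ (ω : Ω) → ∃ λ (b : Bool) → output P ω input T ≡ just b)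
       × (∀ (ω : Ω) (t : ℕ) → space (run P ω input t) ≤ poly cS s)
       × (∀ (ω : Ω) → output P ω input T ≡ just true → HasSolution I bound)
       × (HasSolution I bound → Pr (λ (ω : Ω) → rejects (output P ω input T)) ℚ.≤ ε))
 solves = suc K , Pg , ½ , ℚ.*<* (ℤ.+<+ (s<s z<s)) , cT , cS , cR , 20 ,
   λ n d I bound → τ I bound , time-bound I bound , (λ ω → _ , output≡ I bound ω) , space-bound I bound , sound I bound , failure I bound

corollary2 :
  ∃ λ (k : ℕ) → Σ (Program k) λ P →
  ∃ λ (ε : ℚ) → (ε ℚ.< 1ℚ) ×
  (∃ λ (cT : ℕ) → ∃ λ (cS : ℕ) → ∃ λ (cR : ℕ) → ∃ λ (C : ℕ) →
    ∀ (n d : ℕ) (I : BLP n d) (bound : ℤ) →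
    let input = encode I bound
        s     = inputSize I bound
        Ω     = Vec Bool (2 ^ poly cR s)
    in
    ∃ λ (T : ℕ) → TimeBound cT C I bound T
      × (∀ (ω : Ω) → ∃ λ (b : Bool) → output P ω input T ≡ just b)
      × (∀ (ω : Ω) (t : ℕ) → space (run P ω input t) ≤ poly cS s)
      × (∀ (ω : Ω) → output P ω input T ≡ just true → HasSolution I bound)
      × (HasSolution I bound → Pr (λ (ω : Ω) → rejects (output P ω input T)) ℚ.≤ ε))
corollary2 = Solver.solves program values okProgram okSetup
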